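{- For each $c\in\mathbb{N}$, both EF-GC (envy-free graph cutting) and EF-VDGC (envy-free vertex-disjoint graph cutting), restricted to instances $(A,G,(u_a)_{a\in A})$ with at most $c$ agents ($|A|\le c$) in which $G$ is a cycle, are solvable in polynomial time.
   Context: An instance consists of a finite set $A$ of agents, a finite simple undirected connected graph $G=(V,E)$, and for every agent $a\in A$ a utility function $u_a:E\to\mathbb{Q}^+$, where $\mathbb{Q}^+$ is the set of non-negative rationals (encoded in binary). Utilities are assumed normalized: $\sum_{e\in E}u_a(e)=1$ for all $a\in A$. Fix an arbitrary linear order on $V$. Each edge is identified with $[0,1]$, with $0$ at the endpoint that is smaller in the order and $1$ at the larger one. A piece of an edge $e$ is a pair $(e,I)$ with $I\subseteq[0,1]$ a possibly empty interval (with rational endpoints; open, closed or half-open); $|I|$ denotes its length. Pieces $(e,I)$, $(e',I')$ of two different edges are adjacent if $e=uv$ and $e'=vu'$ share a vertex $v$, the coordinate of $v$ on $e$ (that is, $1$ if $u$ precedes $v$ in the order, and $0$ otherwise) lies in $I$, and the coordinate of $v$ on $e'$ lies in $I'$. A piece of $G$ is a collection $P$ of pieces of edges of $G$ such that any two members of $P$ are linked by a finite sequence of members of $P$ in which consecutive members are adjacent. The utility of agent $a$ for $P$ is $u_a(P)=\sum_{(e,I)\in P}|I|\cdot u_a(e)$. A partition of $G$ into pieces is a set $\Pi$ of pieces of $G$ such that for every $e\in E$ and every real $\alpha\in[0,1]$ there is precisely one $P\in\Pi$ and precisely one $(e,I)\in P$ with $\alpha\in I$. (Different edges incident to the same vertex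 may belong to different pieces at that vertex.) A partition is vertex-disjoint if for every vertex $v$, all pieces of edges containing $v$ (i.e. pieces $(e,I)$ with $e$ incident to $v$ and the coordinate of $v$ on $e$ in $I$) belong to the same piece $P\in\Pi$. EF-GC: given an instance, decide whether there exist a partition $\Pi$ of $G$ into pieces and a bijection $\pi:A\to\Pi$ that is envy-free, i.e. $u_a(\pi(a))\ge u_a(\pi(a'))$ for all $a,a'\in A$, and, if so, construct them. EF-VDGC: the same problem with $\Pi$ additionally required to be vertex-disjoint. Polynomial time is measured in the encoding length of the instance. -}

module Defs where

open import Data.Bool.Base using (Bool; true; false; T)
open import Data.Empty using (⊥)
open import Data.Fin.Base using (Fin; toℕ) renaming (_<_ to _<ᶠ_)
open import Data.Fin.Permutation using (Permutation′; _⟨$⟩ʳ_)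
open import Data.Integer.Base using (ℤ; +_; -[1+_])
open import Data.List.Base using (List; []; _∷_; map; foldr; tabulate)
open import Data.List.Membership.Propositional using (_∈_)
open import Data.List.Relation.Binary.BagAndSetEquality using (_∼[_]_; set)
open import Data.List.Relation.Unary.Unique.Propositional using (Unique)
open import Data.Nat.Base as ℕ using (ℕ; zero; suc)
open import Data.Nat.Binary.Base using (ℕᵇ; 2[1+_]; 1+[2_]) renaming (zero to 0ᵇ; fromℕ to toBinary)
open import Data.Product using (Σ; Σ-syntax; ∃; ∃₂; ∃!; _×_; _,_; proj₁)
open import Data.Rational.Base using (ℚ; 0ℚ; 1ℚ; _+_; _-_; _*_; -_; _≤_; _≥_; _<_; fromℚᵘ)
open import Data.Rational.Unnormalised.Base using (ℚᵘ; mkℚᵘ)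
open import Data.Rational.Properties using (_<?_; <-dense; <-trans; <-asym; <-cmp; +-monoʳ-<; +-identityʳ; +-0-commutativeMonoid; positive⁻¹; negative⁻¹)
open import Algebra.Properties.CommutativeMonoid.Sum +-0-commutativeMonoid using (sum)
open import Data.Sum.Base using (_⊎_; inj₁; inj₂)
open import Function.Base using (_∘_)
open import Function.Bundles using (_⇔_; mk⇔; _⤖_; Bijection)
open import Relation.Binary.Construct.Closure.ReflexiveTransitive using (Star)
open import Relation.Binary.Definitions using (tri<; tri≈; tri>)
open import Relation.Binary.PropositionalEquality using (_≡_; _≢_; refl; subst)
open import Relation.Nullary.Decidable using (⌊_⌋; toWitness; fromWitness)
open import Relation.Nullary.Negation using (¬_)

------------------------------------------------------------------------
-- Real numbers

-- Two-sided Dedekind cuts whose halves are given by characteristic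
-- functions.  Classically every real number is of this form;
-- constructively, these are the reals that can be compared with each
-- rational.  `below q` means q < α and `above q` means α < q.

record ℝ : Set where
  field
    below above     : ℚ → Bool
    below-inhabited : ∃ λ q → T (below q)
    above-inhabited : ∃ λ q → T (above q)
    below-rounded   : ∀ q → T (below q) ⇔ (∃ λ r → q < r × T (below r))
    above-rounded   : ∀ q → T (above q) ⇔ (∃ λ r → r < q × T (above r))
    disjoint        : ∀ q → ¬ (T (below q) × T (above q))
    located         : ∀ {q r} → q < r → T (below q) ⊎ T (above r)

open ℝ

private
  q-1<q : ∀ q → q - 1ℚ < q
  q-1<q q = subst (q - 1ℚ <_) (+-identityʳ q) (+-monoʳ-< q (negative⁻¹ (- 1ℚ)))

  q<q+1 : ∀ q → q < q + 1ℚ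
  q<q+1 q = subst (_< q + 1ℚ) (+-identityʳ q) (+-monoʳ-< q (positive⁻¹ 1ℚ))

fromℚ : ℚ → ℝ
fromℚ p = record
  { below           = λ q → ⌊ q <? p ⌋
  ; above           = λ q → ⌊ p <? q ⌋
  ; below-inhabited = p - 1ℚ , fromWitness (q-1<q p)
  ; above-inhabited = p + 1ℚ , fromWitness (q<q+1 p)
  ; below-rounded   = λ q → mk⇔
      (λ q<p → let r , q<r , r<p = <-dense (toWitness q<p) in r , q<r , fromWitness r<p)
      (λ (r , q<r , r<p) → fromWitness (<-trans q<r (toWitness r<p)))
  ; above-rounded   = λ q → mk⇔
      (λ p<q → let r , p<r , r<q = <-dense (toWitness p<q) in r , r<q , fromWitness p<r)
      (λ (r , r<q , p<r) → fromWitness (<-trans (toWitness p<r) r<q))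
  ; disjoint        = λ q (q<p , p<q) → <-asym (toWitness q<p) (toWitness p<q)
  ; located         = located-p
  }
  where
  located-p : ∀ {q r} → q < r → T ⌊ q <? p ⌋ ⊎ T ⌊ p <? r ⌋
  located-p {q} {r} q<r with <-cmp q p
  ... | tri< q<p _ _    = inj₁ (fromWitness q<p)
  ... | tri≈ _ refl _   = inj₂ (fromWitness q<r)
  ... | tri> _ _ p<q    = inj₂ (fromWitness (<-trans p<q q<r))

------------------------------------------------------------------------
-- Intervals

-- Subintervals of [0,1] with rational endpoints.  The flags of a
-- segment say whether its left and its right endpoint belong to it.
-- Every such set has exactly one representation, so propositional
-- equality is equality of sets.

data Interval : Set where
  empty   : Interval
  point   : (q : ℚ) → .(0ℚ ≤ q) → .(q ≤ 1ℚ) → Interval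
  segment : (l r : ℚ) (lClosed rClosed : Bool) →
            .(0ℚ ≤ l) → .(l < r) → .(r ≤ 1ℚ) → Interval

∣_∣ᴵ : Interval → ℚ
∣ empty ∣ᴵ                 = 0ℚ
∣ point _ _ _ ∣ᴵ           = 0ℚ
∣ segment l r _ _ _ _ _ ∣ᴵ = r - l

RightOf : Bool → ℚ → ℝ → Set
RightOf true  l α = ¬ T (above α l)
RightOf false l α = T (below α l)

LeftOf : Bool → ℚ → ℝ → Set
LeftOf true  r α = ¬ T (below α r)
LeftOf false r α = T (above α r)

Between : ℚ → ℚ → Bool → Bool → ℝ → Set
Between l r lClosed rClosed α = RightOf lClosed l α × LeftOf rClosed r α

infix 4 _∈ᴵ_

_∈ᴵ_ : ℝ → Interval → Set
α ∈ᴵ empty                   = ⊥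
α ∈ᴵ point q _ _             = Between q q true true α
α ∈ᴵ segment l r lc rc _ _ _ = Between l r lc rc α

InUnitInterval : ℝ → Set
InUnitInterval = Between 0ℚ 1ℚ true true

------------------------------------------------------------------------
-- Graphs

-- The left endpoint of an edge is the one that is smaller in the order
-- on the vertices.

data Side : Set where
  left right : Side

coordinate : Side → ℚ
coordinate left  = 0ℚ
coordinate right = 1ℚ

-- Finite simple undirected connected graphs.

record Graph : Set where
  field
    #V #E : ℕ

  V : Set
  V = Fin #V

  E : Set
  E = Fin #E

  field
    endpoint : E → Side → V
    ordered  : ∀ e → endpoint e left <ᶠ endpoint e right
    simple   : ∀ {e e′} → (∀ s → endpoint e s ≡ endpoint e′ s) → e ≡ e′

  Neighbours : V → V → Set
  Neighbours u v = ∃ λ e → (endpoint e left ≡ u × endpoint e right ≡ v)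
                         ⊎ (endpoint e left ≡ v × endpoint e right ≡ u)

  field
    connected : ∀ u v → Star Neighbours u v

-- j comes directly after i in the cyclic order 0, 1, …, n - 1, 0.

Next : ∀ {n} → Fin n → Fin n → Set
Next {n} i j = toℕ j ≡ suc (toℕ i) ⊎ (suc (toℕ i) ≡ n × toℕ j ≡ 0)

IsCycle : Graph → Set
IsCycle G = 3 ℕ.≤ #V ×
  Σ[ σ ∈ Permutation′ #V ]
    (∀ i j → Neighbours (σ ⟨$⟩ʳ i) (σ ⟨$⟩ʳ j) ⇔ (Next i j ⊎ Next j i))
  where open Graph G

------------------------------------------------------------------------
-- Instances

record Instance : Set where
  field
    #agents : ℕ
    graph   : Graph

  open Graph graph public

  Agent : Set
  Agent = Fin #agents

  field
    utility     : Agent → E → ℚ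
    nonNegative : ∀ a e → 0ℚ ≤ utility a e
    normalized  : ∀ a → sum (utility a) ≡ 1ℚ

------------------------------------------------------------------------
-- Pieces and partitions

module _ (G : Graph) where
  open Graph G

  EdgePiece : Set
  EdgePiece = E × Interval

  -- The edge piece contains the endpoint of its edge on the given side.

  ContainsEnd : EdgePiece → Side → Set
  ContainsEnd (e , I) s = fromℚ (coordinate s) ∈ᴵ I

  Contains : EdgePiece → V → Set
  Contains x@(e , _) v = ∃ λ s → endpoint e s ≡ v × ContainsEnd x s

  Adjacent : EdgePiece → EdgePiece → Set
  Adjacent x y = proj₁ x ≢ proj₁ y × ∃ λ v → Contains x v × Contains y v

  -- Sets of edge pieces are duplicate-free lists.  Finiteness loses no
  -- generality: every member of a linked set with two or more elements
  -- contains an end of its edge, so in a partition at most two members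
  -- lie on the same edge.

  record Piece : Set where
    field
      members : List EdgePiece
      unique  : Unique members
      linked  : ∀ {x y} → x ∈ members → y ∈ members →
                Star (λ z w → z ∈ members × w ∈ members × Adjacent z w) x y

  open Piece

  record Partition : Set where
    field
      #pieces  : ℕ
      piece    : Fin #pieces → Piece
      distinct : ∀ {i j} → members (piece i) ∼[ set ] members (piece j) → i ≡ j
      covers   : ∀ e α → InUnitInterval α →
                 ∃! _≡_ λ ((i , I) : Fin #pieces × Interval) →
                   (e , I) ∈ members (piece i) × α ∈ᴵ I

  open Partition

  VertexDisjoint : Partition → Set
  VertexDisjoint Π = ∀ v {i j x y} →
    x ∈ members (piece Π i) → Contains x v →
    y ∈ members (piece Π j) → Contains y v → i ≡ j

module _ (X : Instance) where
  open Instance X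
  open Piece
  open Partition

  value : Agent → Piece graph → ℚ
  value a P = foldr _+_ 0ℚ (map (λ (e , I) → ∣ I ∣ᴵ * utility a e) (members P))

  EnvyFree : (Π : Partition graph) → (Agent → Fin (#pieces Π)) → Set
  EnvyFree Π π = ∀ a a′ → value a (piece Π (π a)) ≥ value a (piece Π (π a′))

  record EnvyFreeCutting : Set where
    field
      partition  : Partition graph
      assignment : Agent ⤖ Fin (#pieces partition)
      envyFree   : EnvyFree partition (Bijection.to assignment)

  EnvyFreeVertexDisjointCutting : Set
  EnvyFreeVertexDisjointCutting =
    Σ[ C ∈ EnvyFreeCutting ] VertexDisjoint graph (EnvyFreeCutting.partition C)

------------------------------------------------------------------------
-- Model of computation

-- A While language over binary trees, in the style of Jones's
-- "Computability and Complexity from a Programming Perspective".  Every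
-- elementary step, test and duplication is charged the size of the tree
-- it acts on (rather than 1), so a run of cost t can be simulated by a
-- multi-tape Turing machine in time polynomial in t, and conversely.

data Tree : Set where
  nil  : Tree
  cons : Tree → Tree → Tree

size : Tree → ℕ
size nil        = 1
size (cons x y) = suc (size x ℕ.+ size y)

infixr 5 _⨾_

data Program : Set where
  skip erase head tail : Program
  pair                 : Program → Program → Program
  _⨾_                  : Program → Program → Program
  branch               : (test yes no : Program) → Program
  while                : (test body : Program) → Program

infix 3 _⊢_⇓_⟨_⟩

-- p ⊢ x ⇓ y ⟨ t ⟩ : started on x, the program p halts with y at cost t.
-- In a test, nil counts as false and every other tree as true.

data _⊢_⇓_⟨_⟩ : Program → Tree → Tree → ℕ → Set where
  skip       : ∀ {x} → skip ⊢ x ⇓ x ⟨ size x ⟩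
  erase      : ∀ {x} → erase ⊢ x ⇓ nil ⟨ size x ⟩
  head-nil   : head ⊢ nil ⇓ nil ⟨ 1 ⟩
  head-cons  : ∀ {x y} → head ⊢ cons x y ⇓ x ⟨ size (cons x y) ⟩
  tail-nil   : tail ⊢ nil ⇓ nil ⟨ 1 ⟩
  tail-cons  : ∀ {x y} → tail ⊢ cons x y ⇓ y ⟨ size (cons x y) ⟩
  pair       : ∀ {p q x y z s t} →
               p ⊢ x ⇓ y ⟨ s ⟩ → q ⊢ x ⇓ z ⟨ t ⟩ →
               pair p q ⊢ x ⇓ cons y z ⟨ size x ℕ.+ s ℕ.+ t ⟩
  seq        : ∀ {p q x y z s t} →
               p ⊢ x ⇓ y ⟨ s ⟩ → q ⊢ y ⇓ z ⟨ t ⟩ →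
               p ⨾ q ⊢ x ⇓ z ⟨ s ℕ.+ t ⟩
  branch-yes : ∀ {p q r x b₁ b₂ y s t} →
               p ⊢ x ⇓ cons b₁ b₂ ⟨ s ⟩ → q ⊢ x ⇓ y ⟨ t ⟩ →
               branch p q r ⊢ x ⇓ y ⟨ size x ℕ.+ s ℕ.+ t ⟩
  branch-no  : ∀ {p q r x y s t} →
               p ⊢ x ⇓ nil ⟨ s ⟩ → r ⊢ x ⇓ y ⟨ t ⟩ →
               branch p q r ⊢ x ⇓ y ⟨ size x ℕ.+ s ℕ.+ t ⟩
  while-stop : ∀ {p q x s} →
               p ⊢ x ⇓ nil ⟨ s ⟩ →
               while p q ⊢ x ⇓ x ⟨ size x ℕ.+ s ⟩
  while-loop : ∀ {p q x b₁ b₂ y z s t u} →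
               p ⊢ x ⇓ cons b₁ b₂ ⟨ s ⟩ → q ⊢ x ⇓ y ⟨ t ⟩ →
               while p q ⊢ y ⇓ z ⟨ u ⟩ →
               while p q ⊢ x ⇓ z ⟨ size x ℕ.+ s ℕ.+ t ℕ.+ u ⟩

deterministic : ∀ {p x y y′ t t′} →
                p ⊢ x ⇓ y ⟨ t ⟩ → p ⊢ x ⇓ y′ ⟨ t′ ⟩ → y ≡ y′ × t ≡ t′
deterministic skip skip = refl , refl
deterministic erase erase = refl , refl
deterministic head-nil head-nil = refl , refl
deterministic head-cons head-cons = refl , refl
deterministic tail-nil tail-nil = refl , refl
deterministic tail-cons tail-cons = refl , refl
deterministic (pair d e) (pair d′ e′)
  with refl , refl ← deterministic d d′ | refl , refl ← deterministic e e′ = refl , refl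
deterministic (seq d e) (seq d′ e′)
  with refl , refl ← deterministic d d′
  with refl , refl ← deterministic e e′ = refl , refl
deterministic (branch-yes d e) (branch-yes d′ e′)
  with refl , refl ← deterministic d d′ | refl , refl ← deterministic e e′ = refl , refl
deterministic (branch-yes d _) (branch-no d′ _) with () , _ ← deterministic d d′
deterministic (branch-no d _) (branch-yes d′ _) with () , _ ← deterministic d d′
deterministic (branch-no d e) (branch-no d′ e′)
  with refl , refl ← deterministic d d′ | refl , refl ← deterministic e e′ = refl , refl
deterministic (while-stop d) (while-stop d′) with refl , refl ← deterministic d d′ = refl , refl
deterministic (while-stop d) (while-loop d′ _ _) with () , _ ← deterministic d d′
deterministic (while-loop d _ _) (while-stop d′) with () , _ ← deterministic d d′
deterministic (while-loop d e f) (while-loop d′ e′ f′)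
  with refl , refl ← deterministic d d′ | refl , refl ← deterministic e e′
  with refl , refl ← deterministic f f′ = refl , refl

------------------------------------------------------------------------
-- Polynomial-time solvability of search problems

-- A relation, since a rational number may be encoded by any fraction
-- representing it, in lowest terms or not.

Encoding : Set → Set₁
Encoding A = A → Tree → Set

record SearchProblem : Set₁ where
  field
    Input            : Set
    inputEncoding    : Encoding Input
    Solution         : Input → Set
    solutionEncoding : ∀ x → Encoding (Solution x)

restrict : (P : SearchProblem) → (SearchProblem.Input P → Set) → SearchProblem
restrict P Q = record
  { Input            = Σ Input Q
  ; inputEncoding    = inputEncoding ∘ proj₁
  ; Solution         = Solution ∘ proj₁
  ; solutionEncoding = solutionEncoding ∘ proj₁
  }
  where open SearchProblem P

data Answers {S : Set} (enc : Encoding S) : Tree → Set where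
  no  : ¬ S → Answers enc nil
  yes : ∀ (s : S) {t} → enc s t → Answers enc (cons nil t)

-- The polynomial with the given coefficients, constant term first.

polynomial : List ℕ → ℕ → ℕ
polynomial cs n = foldr (λ c v → c ℕ.+ n ℕ.* v) 0 cs

PolynomialTimeSolvable : SearchProblem → Set
PolynomialTimeSolvable P =
  Σ[ p ∈ Program ] Σ[ cs ∈ List ℕ ]
    ∀ x {i} → inputEncoding x i →
    ∃₂ λ o t → (p ⊢ i ⇓ o ⟨ t ⟩)
             × t ℕ.≤ polynomial cs (size i)
             × Answers (solutionEncoding x) o
  where open SearchProblem P

------------------------------------------------------------------------
-- Encodings

bit : Bool → Tree
bit false = nil
bit true  = cons nil nil

-- Bijective base 2, least significant digit first: digit 2 is encoded as
-- false and digit 1 as true.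

binary : ℕᵇ → Tree
binary 0ᵇ       = nil
binary 2[1+ n ] = cons (bit false) (binary n)
binary 1+[2 n ] = cons (bit true) (binary n)

natural : ℕ → Tree
natural n = binary (toBinary n)

integer : ℤ → Tree
integer (+ n)    = cons (bit false) (natural n)
integer -[1+ n ] = cons (bit true) (natural (suc n))

fraction : ℚᵘ → Tree
fraction (mkℚᵘ n d-1) = cons (integer n) (natural (suc d-1))

naturalᴱ : Encoding ℕ
naturalᴱ n t = t ≡ natural n

finᴱ : ∀ {n} → Encoding (Fin n)
finᴱ i = naturalᴱ (toℕ i)

rationalᴱ : Encoding ℚ
rationalᴱ q t = ∃ λ p → fromℚᵘ p ≡ q × t ≡ fraction p

data pairᴱ {A B : Set} (R : Encoding A) (S : Encoding B) : Encoding (A × B) where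
  cons : ∀ {a b s t} → R a s → S b t → pairᴱ R S (a , b) (cons s t)

data listᴱ {A : Set} (R : Encoding A) : Encoding (List A) where
  []  : listᴱ R [] nil
  _∷_ : ∀ {a as s t} → R a s → listᴱ R as t → listᴱ R (a ∷ as) (cons s t)

familyᴱ : ∀ {n} {A : Set} → Encoding A → Encoding (Fin n → A)
familyᴱ R f = listᴱ R (tabulate f)

data intervalᴱ : Encoding Interval where
  empty   : intervalᴱ empty nil
  point   : ∀ {q 0≤q q≤1 t} → rationalᴱ q t →
            intervalᴱ (point q 0≤q q≤1) (cons nil t)
  segment : ∀ {l r lc rc 0≤l l<r r≤1 s t} → rationalᴱ l s → rationalᴱ r t →
            intervalᴱ (segment l r lc rc 0≤l l<r r≤1)
                      (cons (cons (bit lc) (bit rc)) (cons s t))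

graphᴱ : Encoding Graph
graphᴱ G = pairᴱ naturalᴱ (familyᴱ (pairᴱ finᴱ finᴱ))
  (#V , λ e → endpoint e left , endpoint e right)
  where open Graph G

instanceᴱ : Encoding Instance
instanceᴱ X = pairᴱ graphᴱ (familyᴱ (familyᴱ rationalᴱ)) (graph , utility)
  where open Instance X

module _ {G : Graph} where
  pieceᴱ : Encoding (Piece G)
  pieceᴱ P = listᴱ (pairᴱ finᴱ intervalᴱ) (Piece.members P)

  partitionᴱ : Encoding (Partition G)
  partitionᴱ Π = familyᴱ pieceᴱ (Partition.piece Π)

cuttingᴱ : ∀ {X} → Encoding (EnvyFreeCutting X)
cuttingᴱ C = pairᴱ partitionᴱ (familyᴱ finᴱ) (partition , Bijection.to assignment)
  where open EnvyFreeCutting C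

------------------------------------------------------------------------
-- The problems

EF-GC : SearchProblem
EF-GC = record
  { Input            = Instance
  ; inputEncoding    = instanceᴱ
  ; Solution         = EnvyFreeCutting
  ; solutionEncoding = λ _ → cuttingᴱ
  }

EF-VDGC : SearchProblem
EF-VDGC = record
  { Input            = Instance
  ; inputEncoding    = instanceᴱ
  ; Solution         = EnvyFreeVertexDisjointCutting
  ; solutionEncoding = λ _ (C , _) → cuttingᴱ C
  }

CycleWithAtMost : ℕ → Instance → Set
CycleWithAtMost c X = #agents ℕ.≤ c × IsCycle graph
  where open Instance X

{-# OPTIONS --safe #-}
module Submission where

-- Cut the cycle at a vertex and let n be the number of agents.  If
-- n = 0 there is no solution.  Otherwise Sperner's lemma, applied to a fine
-- grid of cuts whose points are labelled by a favourite piece of an agent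
-- depending on the sum of the coordinates modulo n, gives divisions of the
-- path that are envy-free up to an arbitrarily small error.  Once the edges
-- containing the n - 1 cuts and the assignment of the pieces are fixed,
-- envy-freeness is a system of linear inequalities in the positions of the
-- cuts.  Its vertices are enumerated by choosing an inequality to be tight
-- and eliminating a variable, n - 1 times.  A system that is satisfied up to
-- a sufficiently small error is satisfied exactly by one of them, so that
-- trying all edges, assignments and vertices always succeeds; the number of
-- trials is polynomial since n is bounded.  Each cut belongs to the piece
-- that starts there, on both edges if the cut is at a vertex, so the partition
-- is vertex-disjoint and solves both problems.

-- The grid appears only in the proof that the search succeeds and is never computed, so it may be
-- as fine as the argument asks. The vertices of a cell of the Kuhn triangulation have n consecutive
-- coordinate sums; modulo n, each agent therefore owns exactly one of them, and a cell whose labels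
-- are all different hands out n different favourite pieces. Sperner's lemma is proved by parity:
-- functions modulo 2 on lists of vertices, a prism operator, and induction on the dimension. Edges
-- may be worthless to an agent, but every total is positive, so a favourite piece always has
-- positive value; this yields the boundary conditions of the labelling. The passage to an exact
-- division needs no limit: the coefficients are integers, so after all eliminations a violated
-- inequality fails by a definite amount, and the tolerable error is traced back through the
-- eliminations. To stay within the integers the system is made homogeneous, with the length z of an
-- edge as a further unknown. A bounded n keeps both the number of trials and the sizes of the
-- numbers polynomial, as only n - 1 eliminations are nested.

-- Sperner's lemma for the Kuhn triangulation of a cube, by parity.

module Sperner where

  open import Data.Nat.Base using (ℕ; zero; suc; _+_; _≤_; _<_; z≤n; s≤s; s≤s⁻¹; _≡ᵇ_)
  open import Relation.Binary.PropositionalEquality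
  open import Data.Bool.Base using (Bool; true; false; _∧_; _xor_)
  open import Data.Bool.Properties using (xor-assoc; xor-comm; xor-same; xor-identityʳ; ∧-zeroʳ; ∧-distribʳ-xor; T-≡)
  open import Data.Fin.Base using (Fin; zero; suc; toℕ)
  open import Data.List.Base as List using (List; []; _∷_; map; length; downFrom)
  open import Data.List.Properties using (map-∘; length-map)
  open import Data.List.Relation.Binary.Permutation.Propositional using (_↭_; ↭-refl; ↭-trans; prep; swap; ↭-sym; ↭⇒↭ₛ)
  open import Data.List.Relation.Binary.Permutation.Setoid.Properties (setoid ℕ) using (Unique-resp-↭)
  open import Data.List.Relation.Binary.Permutation.Propositional.Properties using (All-resp-↭)
  open import Data.List.Relation.Unary.All as All using (All; []; _∷_)
  import Data.List.Relation.Unary.All.Properties as All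
  open import Data.List.Relation.Unary.AllPairs using ([]; _∷_)
  open import Data.List.Relation.Unary.Unique.Propositional using (Unique)
  open import Data.List.Relation.Unary.Unique.Propositional.Properties using (downFrom⁺)
  open import Data.Nat.Properties
  open import Data.Product using (Σ; ∃; _×_; _,_; proj₁; proj₂)
  open import Data.Vec.Base as Vec using (Vec; []; _∷_; lookup)
  open import Data.Vec.Relation.Unary.All using ([]; _∷_) renaming (All to VAll)
  open import Data.Vec.Relation.Binary.Pointwise.Inductive using (Pointwise; []; _∷_)
  open import Data.List.Membership.Propositional.Properties using (∈-lookup; ∈-downFrom⁺)
  open import Data.Unit.Base using (tt) renaming (⊤ to Unit)
  open import Function.Base using (_∘_; flip)
  open import Function.Bundles using (Equivalence)
  open import Relation.Nullary using (contradiction; yes; no)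
  open import Data.Bool.Solver using (module xor-∧-Solver)
  open xor-∧-Solver using (solve; _:+_; _:*_; _:=_)

  private variable
    X Y : Set

  medial : ∀ a b c d → (a xor b) xor (c xor d) ≡ (a xor c) xor (b xor d)
  medial = solve 4 (λ a b c d → (a :+ b) :+ (c :+ d) := (a :+ c) :+ (b :+ d)) refl

  xorSum : (ℕ → Bool) → ℕ → Bool
  xorSum g zero    = false
  xorSum g (suc n) = g n xor xorSum g n

  xorSum-cong : ∀ {g h} n → (∀ {t} → t < n → g t ≡ h t) → xorSum g n ≡ xorSum h n
  xorSum-cong zero    eq = refl
  xorSum-cong (suc n) eq = cong₂ _xor_ (eq ≤-refl) (xorSum-cong n (eq ∘ m<n⇒m<1+n))

  xorSum-false : ∀ {g} n → (∀ {t} → t < n → g t ≡ false) → xorSum g n ≡ false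
  xorSum-false zero    eq = refl
  xorSum-false (suc n) eq = cong₂ _xor_ (eq ≤-refl) (xorSum-false n (eq ∘ m<n⇒m<1+n))

  xorSum-xor : ∀ (g h : ℕ → Bool) n → xorSum (λ t → g t xor h t) n ≡ xorSum g n xor xorSum h n
  xorSum-xor g h zero    = refl
  xorSum-xor g h (suc n) = trans (cong ((g n xor h n) xor_) (xorSum-xor g h n)) (medial (g n) (h n) _ _)

  xorSum-telescope : ∀ (g : ℕ → Bool) n → xorSum (λ t → g (suc t) xor g t) n ≡ g n xor g 0
  xorSum-telescope g zero    = sym (xor-same (g 0))
  xorSum-telescope g (suc n) = begin
    (g (suc n) xor g n) xor xorSum _ n  ≡⟨ cong ((g (suc n) xor g n) xor_) (xorSum-telescope g n) ⟩
    (g (suc n) xor g n) xor (g n xor g 0) ≡⟨ xor-assoc (g (suc n)) (g n) _ ⟩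
    g (suc n) xor (g n xor (g n xor g 0)) ≡⟨ cong (g (suc n) xor_) (sym (xor-assoc (g n) (g n) _)) ⟩
    g (suc n) xor ((g n xor g n) xor g 0) ≡⟨ cong (λ b → g (suc n) xor (b xor g 0)) (xor-same (g n)) ⟩
    g (suc n) xor g 0 ∎
    where open ≡-Reasoning

  xorSum-true : ∀ (g : ℕ → Bool) n → xorSum g n ≡ true → ∃ λ t → t < n × g t ≡ true
  xorSum-true g (suc n) eq with g n in eqₙ
  ... | true  = n , ≤-refl , eqₙ
  ... | false = let t , t<n , eqₜ = xorSum-true g n eq in t , m<n⇒m<1+n t<n , eqₜ

  -- The sum, modulo 2, of h x r over all ways of splitting one element x
  -- off the list, leaving r.

  pickSum : (X → List X → Bool) → List X → Bool
  pickSum h []      = false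
  pickSum h (x ∷ l) = h x l xor pickSum (λ y r → h y (x ∷ r)) l

  pickSum-cong : ∀ {g h : X → List X → Bool} l → (∀ x r → g x r ≡ h x r) → pickSum g l ≡ pickSum h l
  pickSum-cong []      eq = refl
  pickSum-cong (x ∷ l) eq = cong₂ _xor_ (eq x l) (pickSum-cong l (λ y r → eq y (x ∷ r)))

  pickSum-false : ∀ {h : X → List X → Bool} l → (∀ x r → h x r ≡ false) → pickSum h l ≡ false
  pickSum-false []      eq = refl
  pickSum-false (x ∷ l) eq = cong₂ _xor_ (eq x l) (pickSum-false l (λ y r → eq y (x ∷ r)))

  pickSum-xor : ∀ (g h : X → List X → Bool) l →
                pickSum (λ x r → g x r xor h x r) l ≡ pickSum g l xor pickSum h l
  pickSum-xor g h []      = refl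
  pickSum-xor g h (x ∷ l) = trans (cong ((g x l xor h x l) xor_) (pickSum-xor (λ y r → g y (x ∷ r)) _ l)) (medial (g x l) (h x l) _ _)

  pickSum-∧ : ∀ b (h : X → List X → Bool) l → pickSum (λ x r → b ∧ h x r) l ≡ b ∧ pickSum h l
  pickSum-∧ true  h l = refl
  pickSum-∧ false h l = pickSum-false l (λ _ _ → refl)

  pickSum-pickSum : ∀ (g : X → X → List X → Bool) x l →
    pickSum (λ y r → pickSum (g y) r) (x ∷ l) ≡
    (pickSum (g x) l xor pickSum (λ y → g y x) l) xor pickSum (λ y r → pickSum (λ z s → g y z (x ∷ s)) r) l
  pickSum-pickSum g x l =
    trans (cong (pickSum (g x) l xor_) (pickSum-xor (λ y r → g y x r) _ l)) (sym (xor-assoc (pickSum (g x) l) _ _))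

  -- Both sides run over the ordered pairs of positions, and what remains of the list does not
  -- depend on the order of the two picks.
  pickSum-flip : ∀ (g : X → X → List X → Bool) l →
                 pickSum (λ x r → pickSum (g x) r) l ≡ pickSum (λ x r → pickSum (λ y → g y x) r) l
  pickSum-flip g []      = refl
  pickSum-flip g (x ∷ l) = begin
    _ ≡⟨ pickSum-pickSum g x l ⟩
    _ ≡⟨ cong₂ _xor_ (xor-comm (pickSum (g x) l) _) (pickSum-flip (λ y z s → g y z (x ∷ s)) l) ⟩
    _ ≡⟨ sym (pickSum-pickSum (flip g) x l) ⟩
    _ ∎
    where open ≡-Reasoning

  -- Every pair of positions is picked in both orders, and the two equal terms cancel modulo 2.
  pickSum-symmetric : ∀ (g : X → X → List X → Bool) → (∀ x y r → g x y r ≡ g y x r) →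
                      ∀ l → pickSum (λ x r → pickSum (g x) r) l ≡ false
  pickSum-symmetric g sym-g []      = refl
  pickSum-symmetric g sym-g (x ∷ l) = begin
    _ ≡⟨ pickSum-pickSum g x l ⟩
    _ ≡⟨ cong₂ _xor_ (cong (pickSum (g x) l xor_) (pickSum-cong l (λ y r → sym-g y x r)))
                     (pickSum-symmetric (λ y z s → g y z (x ∷ s)) (λ y z s → sym-g y z (x ∷ s)) l) ⟩
    _ ≡⟨ xor-identityʳ (pickSum (g x) l xor pickSum (g x) l) ⟩
    _ ≡⟨ xor-same (pickSum (g x) l) ⟩
    _ ∎
    where open ≡-Reasoning

  pickSum-true : ∀ (h : X → List X → Bool) l → pickSum h l ≡ true →
                 ∃ λ x → ∃ λ r → l ↭ x ∷ r × h x r ≡ true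
  pickSum-true h (x ∷ l) eq with h x l in eqₓ
  ... | true  = x , l , ↭-refl , eqₓ
  ... | false = let y , r , l↭ , eq′ = pickSum-true (λ y r → h y (x ∷ r)) l eq
                in y , x ∷ r , ↭-trans (prep x l↭) (swap x y ↭-refl) , eq′

  -- The simplicial coboundary modulo 2: a list of vertices is a simplex, and forgetting the picked
  -- vertex leaves a facet.
  δ : (List X → Bool) → List X → Bool
  δ G = pickSum (λ _ → G)

  -- A list of pairs (bᵢ , tᵢ) stands for a prism with bottom b and top t.
  -- The sum is over its standard triangulation.

  prism : (List X → Bool) → List (X × X) → Bool
  prism G []             = false
  prism G ((b , t) ∷ ps) = G (b ∷ t ∷ map proj₂ ps) xor prism (λ l → G (b ∷ l)) ps

  prism-cong : ∀ {G H : List X → Bool} {Q : X → Set} ps → All (λ (b , t) → Q b × Q t) ps →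
               (∀ l → All Q l → G l ≡ H l) → prism G ps ≡ prism H ps
  prism-cong []             []              eq = refl
  prism-cong ((b , t) ∷ ps) ((qb , qt) ∷ q) eq =
    cong₂ _xor_ (eq _ (qb ∷ qt ∷ All.map⁺ (All.map proj₂ q)))
                (prism-cong ps q (λ l ql → eq (b ∷ l) (qb ∷ ql)))

  prism-false : ∀ (ps : List (X × X)) → prism (λ _ → false) ps ≡ false
  prism-false []       = refl
  prism-false (_ ∷ ps) = prism-false ps

  prism-xor : ∀ (G H : List X → Bool) ps → prism (λ l → G l xor H l) ps ≡ prism G ps xor prism H ps
  prism-xor G H []             = refl
  prism-xor G H ((b , t) ∷ ps) = 
    trans (cong ((G (b ∷ t ∷ map proj₂ ps) xor H (b ∷ t ∷ map proj₂ ps)) xor_) (prism-xor (λ l → G (b ∷ l)) _ ps))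
          (medial (G (b ∷ t ∷ map proj₂ ps)) _ _ _)

  prism-map : ∀ (g : X → Y) (G : List Y → Bool) ps →
              prism (G ∘ map g) ps ≡ prism G (map (λ (b , t) → g b , g t) ps)
  prism-map g G []             = refl
  prism-map g G ((b , t) ∷ ps) =
    cong₂ _xor_ (cong (λ l → G (g b ∷ g t ∷ l)) (trans (sym (map-∘ ps)) (map-∘ ps)))
                (prism-map g (λ l → G (g b ∷ l)) ps)

  -- The homotopy formula of the prism operator modulo 2: the boundary of a triangulated prism is
  -- its top, its bottom and the prisms over the facets of the base.
  prism-δ : ∀ (G : List X → Bool) ps →
    prism (δ G) ps ≡ (G (map proj₂ ps) xor G (map proj₁ ps)) xor δ (prism G) ps
  prism-δ G []             = sym (trans (xor-identityʳ (G [] xor G [])) (xor-same (G [])))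
  prism-δ G ((b , t) ∷ ps) = begin
    (G (t ∷ T) xor (G (b ∷ T) xor C)) xor prism (λ l → G l xor δ (λ r → G (b ∷ r)) l) ps
      ≡⟨ cong ((G (t ∷ T) xor (G (b ∷ T) xor C)) xor_) (prism-xor G (δ (λ r → G (b ∷ r))) ps) ⟩
    (G (t ∷ T) xor (G (b ∷ T) xor C)) xor (prism G ps xor prism (δ (λ r → G (b ∷ r))) ps)
      ≡⟨ cong (λ z → (G (t ∷ T) xor (G (b ∷ T) xor C)) xor (prism G ps xor z)) (prism-δ (λ r → G (b ∷ r)) ps) ⟩
    (G (t ∷ T) xor (G (b ∷ T) xor C)) xor (prism G ps xor ((G (b ∷ T) xor G (b ∷ B)) xor D))
      -- `G (b ∷ T)` belongs to the interior face between the first simplex and the rest of the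
      -- prism; it occurs twice and cancels.
      ≡⟨ rearrange (G (t ∷ T)) (G (b ∷ T)) C (prism G ps) (G (b ∷ B)) D ⟩
    (G (t ∷ T) xor G (b ∷ B)) xor (prism G ps xor (C xor D))
      ≡⟨ cong (λ z → (G (t ∷ T) xor G (b ∷ B)) xor (prism G ps xor z)) (sym split) ⟩
    (G (t ∷ T) xor G (b ∷ B)) xor δ (prism G) ((b , t) ∷ ps) ∎
    where
    open ≡-Reasoning
    T = map proj₂ ps
    B = map proj₁ ps
    C = δ (λ r → G (b ∷ t ∷ r)) T
    D = δ (prism (λ r → G (b ∷ r))) ps
    δ-map : ∀ (H : List X → Bool) (qs : List (X × X)) → δ H (map proj₂ qs) ≡ δ (λ qs → H (map proj₂ qs)) qs
    δ-map H []       = refl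
    δ-map H (q ∷ qs) = cong (H (map proj₂ qs) xor_) (δ-map (λ r → H (proj₂ q ∷ r)) qs)
    split : δ (λ qs → prism G ((b , t) ∷ qs)) ps ≡ C xor D
    split = trans (pickSum-xor (λ _ qs → G (b ∷ t ∷ map proj₂ qs)) _ ps)
                  (cong (_xor D) (sym (δ-map (λ r → G (b ∷ t ∷ r)) ps)))
    rearrange : ∀ u v c p w d → (u xor (v xor c)) xor (p xor ((v xor w) xor d)) ≡ (u xor w) xor (p xor (c xor d))
    rearrange = solve 6 (λ u v c p w d → (u :+ (v :+ c)) :+ (p :+ ((v :+ w) :+ d)) := (u :+ w) :+ (p :+ (c :+ d))) refl

  -- The sum, modulo 2, of G over the simplices of the Kuhn triangulation of
  -- the cube [0,M]^d, where f is applied to the vertices of each simplex.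

  cells : ∀ M d → (Vec ℕ d → X) → (List X → Bool) → Bool
  cells M zero    f G = G (f [] ∷ [])
  cells M (suc d) f G = xorSum (λ t → cells M d (λ v → f (t ∷ v) , f (suc t ∷ v)) (prism G)) M

  Box : ∀ {d} → ℕ → Vec ℕ d → Set
  Box M = VAll (_≤ M)

  cells-cong : ∀ M d (f : Vec ℕ d → X) {G H} {Q : X → Set} → (∀ v → Box M v → Q (f v)) →
               (∀ l → All Q l → G l ≡ H l) → cells M d f G ≡ cells M d f H
  cells-cong M zero    f q eq = eq _ (q [] [] ∷ [])
  cells-cong M (suc d) f q eq = xorSum-cong M λ t<M →
    cells-cong M d _ (λ v v≤M → q _ (<⇒≤ t<M ∷ v≤M) , q _ (t<M ∷ v≤M)) (λ ps qs → prism-cong ps qs eq)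

  cells-false : ∀ M d (f : Vec ℕ d → X) → cells M d f (λ _ → false) ≡ false
  cells-false M zero    f = refl
  cells-false M (suc d) f = xorSum-false M λ _ →
    trans (cells-cong M d _ {Q = λ _ → Unit} (λ _ _ → tt) (λ ps _ → prism-false ps)) (cells-false M d _)

  cells-xor : ∀ M d (f : Vec ℕ d → X) G H → cells M d f (λ l → G l xor H l) ≡ cells M d f G xor cells M d f H
  cells-xor M zero    f G H = refl
  cells-xor M (suc d) f G H = trans
    (xorSum-cong M λ _ → trans (cells-cong M d _ {Q = λ _ → Unit} (λ _ _ → tt) (λ ps _ → prism-xor G H ps))
                               (cells-xor M d _ (prism G) (prism H)))
    (xorSum-xor _ _ M)

  cells-map : ∀ M d (f : Vec ℕ d → X) (g : X → Y) G → cells M d f (G ∘ map g) ≡ cells M d (g ∘ f) G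
  cells-map M zero    f g G = refl
  cells-map M (suc d) f g G = xorSum-cong M λ _ →
    trans (cells-cong M d _ {Q = λ _ → Unit} (λ _ _ → tt) (λ ps _ → prism-map g G ps)) (cells-map M d _ _ (prism G))

  -- The part of Stokes' theorem for the first coordinate.

  cells-δ : ∀ M d (f : Vec ℕ (suc d) → X) G →
    cells M (suc d) f (δ G) ≡
    (cells M d (f ∘ (M ∷_)) G xor cells M d (f ∘ (0 ∷_)) G) xor
    xorSum (λ t → cells M d (λ v → f (t ∷ v) , f (suc t ∷ v)) (δ (prism G))) M
  cells-δ M d f G = begin
    xorSum (λ t → cells M d (pairs t) (prism (δ G))) M
      ≡⟨ (xorSum-cong M λ {t} _ → trans
           (cells-cong M d (pairs t) {Q = λ _ → Unit} (λ _ _ → tt) (λ ps _ → prism-δ G ps))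
           (trans (cells-xor M d (pairs t) _ (δ (prism G)))
                  (cong (λ z → z xor cells M d (pairs t) (δ (prism G)))
                    (trans (cells-xor M d (pairs t) _ _)
                           (cong₂ _xor_ (cells-map M d (pairs t) proj₂ G) (cells-map M d (pairs t) proj₁ G)))))) ⟩
    xorSum (λ t → (face (suc t) xor face t) xor cells M d (pairs t) (δ (prism G))) M
      ≡⟨ xorSum-xor _ _ M ⟩
    xorSum (λ t → face (suc t) xor face t) M xor xorSum (λ t → cells M d (pairs t) (δ (prism G))) M
      ≡⟨ cong (_xor xorSum (λ t → cells M d (pairs t) (δ (prism G))) M) (xorSum-telescope face M) ⟩
    _ ∎
    where
    open ≡-Reasoning
    pairs = λ t v → f (t ∷ v) , f (suc t ∷ v)
    face  = λ t → cells M d (f ∘ (t ∷_)) G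

  end : ℕ → Bool → ℕ
  end M false = 0
  end M true  = M

  end≤ : ∀ M b → end M b ≤ M
  end≤ M false = z≤n
  end≤ M true  = ≤-refl

  -- A facet in the interior is shared by two cells and cancels, so only facets in the faces of the
  -- cube count, and there `G` vanishes. The value at `[]` covers dimension 0, where the one facet
  -- of a point is the empty simplex.
  cells-δ-false : ∀ M d (f : Vec ℕ d → X) G →
    (∀ i b l → All (λ x → ∃ λ v → Box M v × lookup v i ≡ end M b × x ≡ f v) l → G l ≡ false) →
    G [] ≡ false →
    cells M d f (δ G) ≡ false
  cells-δ-false M zero    f G faces nil = trans (xor-identityʳ (G [])) nil
  cells-δ-false M (suc d) f G faces nil = trans (cells-δ M d f G) (cong₂ _xor_
    (cong₂ _xor_ (face true) (face false))
    (xorSum-false M λ {t} t<M → cells-δ-false M d _ (prism G) (λ i b ps onFace →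
      trans (prism-cong ps (All.map (λ { (v , v≤M , eq , refl) →
                                       (_ , <⇒≤ t<M ∷ v≤M , eq , refl) , (_ , t<M ∷ v≤M , eq , refl) }) onFace)
                           (faces (suc i) b))
            (prism-false ps)) refl))
    where
    face : ∀ b → cells M d (f ∘ (end M b ∷_)) G ≡ false
    face b = trans (cells-cong M d _ (λ v v≤M → _ , end≤ M b ∷ v≤M , refl , refl) (faces zero b)) (cells-false M d _)

  -- The number, modulo 2, of ways to order `l` as n - 1, ..., 0. It is 1 exactly for the
  -- permutations of `downFrom n`; as a nested sum it obeys the laws of `pickSum`.
  rainbow : ℕ → List ℕ → Bool
  rainbow zero    []      = true
  rainbow zero    (_ ∷ _) = false
  rainbow (suc n) l       = pickSum (λ x r → (x ≡ᵇ n) ∧ rainbow n r) l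

  ≡ᵇ-true : ∀ {m n} → (m ≡ᵇ n) ≡ true → m ≡ n
  ≡ᵇ-true {m} {n} eq = ≡ᵇ⇒≡ m n (Equivalence.from T-≡ eq)

  ≡ᵇ-false : ∀ {m n} → m ≢ n → (m ≡ᵇ n) ≡ false
  ≡ᵇ-false {m} {n} m≢n with m ≡ᵇ n in eq
  ... | true  = contradiction (≡ᵇ-true eq) m≢n
  ... | false = refl

  ≡ᵇ-refl : ∀ n → (n ≡ᵇ n) ≡ true
  ≡ᵇ-refl zero    = refl
  ≡ᵇ-refl (suc n) = ≡ᵇ-refl n

  rainbow⇒↭ : ∀ n l → rainbow n l ≡ true → l ↭ downFrom n
  rainbow⇒↭ zero    []  eq = ↭-refl
  rainbow⇒↭ (suc n) l   eq with x , r , l↭ , eqₓ ← pickSum-true _ l eq with x ≡ᵇ n in x≡n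
  ... | true rewrite ≡ᵇ-true {x} x≡n = ↭-trans l↭ (prep n (rainbow⇒↭ n r eqₓ))

  rainbow-missing : ∀ {n j} l → j < n → All (_≢ j) l → rainbow n l ≡ false
  rainbow-missing {n} {j} l j<n all with rainbow n l in eq
  ... | false = refl
  ... | true  = contradiction refl (All.lookup (All-resp-↭ (rainbow⇒↭ n l eq) all) (∈-downFrom⁺ j<n))

  swap-∧ : ∀ a b c → a ∧ (b ∧ c) ≡ b ∧ (a ∧ c)
  swap-∧ = solve 3 (λ a b c → a :* (b :* c) := b :* (a :* c)) refl

  -- In every term that counts, the removed label j occurs once more in the rest. The two copies can
  -- be exchanged, so these terms come in pairs.
  pickSum-repeated : ∀ n {j} → j < n → ∀ l → pickSum (λ x r → (x ≡ᵇ j) ∧ rainbow n r) l ≡ false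
  pickSum-repeated (suc n) {j} j<1+n l with j ≟ n
  ... | yes refl = trans (pickSum-cong l λ x r → sym (pickSum-∧ (x ≡ᵇ n) _ r))
                         (pickSum-symmetric _ (λ x y r → swap-∧ (x ≡ᵇ n) (y ≡ᵇ n) (rainbow n r)) l)
  ... | no  j≢n  = begin
    pickSum (λ x r → (x ≡ᵇ j) ∧ rainbow (suc n) r) l
      ≡⟨ (pickSum-cong l λ x r → sym (pickSum-∧ (x ≡ᵇ j) _ r)) ⟩
    pickSum (λ x r → pickSum (λ y s → (x ≡ᵇ j) ∧ ((y ≡ᵇ n) ∧ rainbow n s)) r) l
      ≡⟨ pickSum-flip _ l ⟩
    pickSum (λ y r → pickSum (λ x s → (x ≡ᵇ j) ∧ ((y ≡ᵇ n) ∧ rainbow n s)) r) l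
      ≡⟨ (pickSum-false l λ y r → trans
           (pickSum-cong r λ x s → swap-∧ (x ≡ᵇ j) (y ≡ᵇ n) (rainbow n s))
           (trans (pickSum-∧ (y ≡ᵇ n) _ r)
                  (trans (cong ((y ≡ᵇ n) ∧_) (pickSum-repeated n (≤∧≢⇒< (s≤s⁻¹ j<1+n) j≢n) r)) (∧-zeroʳ (y ≡ᵇ n))))) ⟩
    false ∎
    where
    open ≡-Reasoning

  xorSum-≡ᵇ : ∀ {x n} → x < n → xorSum (x ≡ᵇ_) n ≡ true
  xorSum-≡ᵇ {x} {suc n} x<1+n with x ≟ n
  ... | yes refl = cong₂ _xor_ (≡ᵇ-refl n) (xorSum-false n λ t<n → ≡ᵇ-false (≢-sym (<⇒≢ t<n)))
  ... | no  x≢n  = cong₂ _xor_ (≡ᵇ-false x≢n) (xorSum-≡ᵇ (≤∧≢⇒< (s≤s⁻¹ x<1+n) x≢n))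

  -- The counting of doors in Sperner's lemma: a simplex with n + 1 vertices and labels up to n has
  -- one facet carrying 0, ..., n - 1 if it carries all labels, and otherwise none or two.
  δ-rainbow : ∀ n l → All (_≤ n) l → δ (rainbow n) l ≡ rainbow (suc n) l
  δ-rainbow n l l≤n = begin
    pickSum (λ _ r → rainbow n r) l
      -- A factor 1 is written as a sum over the possible labels of the removed vertex. The label n
      -- gives the result, and the labels below n contribute nothing.
      ≡⟨ pickSum-cong-All l l≤n (λ x r x≤n → sym (cong (_∧ rainbow n r) (xorSum-≡ᵇ (s≤s x≤n)))) ⟩
    pickSum (λ x r → ((x ≡ᵇ n) xor xorSum (x ≡ᵇ_) n) ∧ rainbow n r) l
      ≡⟨ (pickSum-cong l λ x r → ∧-distribʳ-xor (rainbow n r) (x ≡ᵇ n) _) ⟩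
    pickSum (λ x r → ((x ≡ᵇ n) ∧ rainbow n r) xor (xorSum (x ≡ᵇ_) n ∧ rainbow n r)) l
      ≡⟨ pickSum-xor _ _ l ⟩
    rainbow (suc n) l xor pickSum (λ x r → xorSum (x ≡ᵇ_) n ∧ rainbow n r) l
      ≡⟨ cong (rainbow (suc n) l xor_) (others n ≤-refl) ⟩
    rainbow (suc n) l xor false
      ≡⟨ xor-identityʳ _ ⟩
    rainbow (suc n) l ∎
    where
    open ≡-Reasoning
    pickSum-cong-All : ∀ {g h : ℕ → List ℕ → Bool} l → All (_≤ n) l → (∀ x r → x ≤ n → g x r ≡ h x r) →
                       pickSum g l ≡ pickSum h l
    pickSum-cong-All []      []        eq = refl
    pickSum-cong-All (x ∷ l) (x≤n ∷ q) eq =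
      cong₂ _xor_ (eq x l x≤n) (pickSum-cong-All l q (λ y r → eq y (x ∷ r)))
    others : ∀ k → k ≤ n → pickSum (λ x r → xorSum (x ≡ᵇ_) k ∧ rainbow n r) l ≡ false
    others zero    k≤n = pickSum-false l λ _ _ → refl
    others (suc k) k<n = begin
      pickSum (λ x r → ((x ≡ᵇ k) xor xorSum (x ≡ᵇ_) k) ∧ rainbow n r) l
        ≡⟨ (pickSum-cong l λ x r → ∧-distribʳ-xor (rainbow n r) (x ≡ᵇ k) _) ⟩
      _ ≡⟨ pickSum-xor _ _ l ⟩
      _ ≡⟨ cong₂ _xor_ (pickSum-repeated n k<n l) (others k (<⇒≤ k<n)) ⟩
      false ∎

  -- Coordinates are numbered from the last one.

  rank : ∀ {d} → Fin d → ℕ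
  rank {suc d} zero    = d
  rank         (suc i) = rank i

  rank< : ∀ {d} (i : Fin d) → rank i < d
  rank< zero    = ≤-refl
  rank< (suc i) = m<n⇒m<1+n (rank< i)

  -- The conditions are made to survive the induction: on the face where the first coordinate is M
  -- they restrict to a labelling in one dimension less, and every other face of the cube misses one
  -- of the labels below `d`.
  record Labelling (M d : ℕ) (label : Vec ℕ d → ℕ) : Set where
    field
      label≤ : ∀ v → Box M v → label v ≤ d
      lower  : ∀ v → Box M v → ∀ i → lookup v i ≡ 0 → label v ≢ rank i
      upper  : ∀ v → Box M v → ∀ i → lookup v i ≡ M → label v ≤ rank i

  -- By `δ-rainbow` the rainbow cells are counted through their facets with all labels but the
  -- largest. These cancel in the interior, and on the boundary they occur only where the first
  -- coordinate is M.
  rainbow-odd : ∀ M d {label} → Labelling M d label → cells M d label (rainbow (suc d)) ≡ true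
  rainbow-odd M zero    {label} L = trans
    (cong (λ x → ((x ≡ᵇ 0) ∧ true) xor false) (n≤0⇒n≡0 (label≤ [] []))) refl
    where open Labelling L
  rainbow-odd M (suc d) {label} L = begin
    cells M (suc d) label (rainbow (2 + d))
      ≡⟨ cells-cong M (suc d) label label≤ (λ l l≤ → sym (δ-rainbow (suc d) l l≤)) ⟩
    cells M (suc d) label (δ (rainbow (suc d)))
      ≡⟨ cells-δ M d label _ ⟩
    (cells M d (label ∘ (M ∷_)) (rainbow (suc d)) xor cells M d (label ∘ (0 ∷_)) (rainbow (suc d))) xor
    xorSum (λ t → cells M d (pairs t) (δ (prism (rainbow (suc d))))) M
      ≡⟨ cong₂ _xor_ (cong₂ _xor_ (rainbow-odd M d top) bottom) (xorSum-false M sides) ⟩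
    true ∎
    where
    open ≡-Reasoning
    open Labelling L
    pairs = λ t v → label (t ∷ v) , label (suc t ∷ v)
    top : Labelling M d (label ∘ (M ∷_))
    top = record
      { label≤ = λ v v≤M → upper _ (≤-refl ∷ v≤M) zero refl
      ; lower  = λ v v≤M i → lower _ (≤-refl ∷ v≤M) (suc i)
      ; upper  = λ v v≤M i → upper _ (≤-refl ∷ v≤M) (suc i)
      }
    bottom : cells M d (label ∘ (0 ∷_)) (rainbow (suc d)) ≡ false
    bottom = trans (cells-cong M d _ (λ v v≤M → lower _ (z≤n ∷ v≤M) zero refl) (λ l → rainbow-missing l ≤-refl))
                   (cells-false M d _)
    sides : ∀ {t} → t < M → cells M d (pairs t) (δ (prism (rainbow (suc d)))) ≡ false
    sides {t} t<M = cells-δ-false M d _ (prism (rainbow (suc d))) side refl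
      where
      side : ∀ i b ps → All (λ x → ∃ λ v → Box M v × lookup v i ≡ end M b × x ≡ pairs t v) ps →
             prism (rainbow (suc d)) ps ≡ false
      side i false ps onFace = trans
        (prism-cong ps (All.map (λ { (v , v≤M , eq , refl) → lower _ (<⇒≤ t<M ∷ v≤M) (suc i) eq
                                                           , lower _ (t<M ∷ v≤M) (suc i) eq }) onFace)
                    (λ l → rainbow-missing l (m<n⇒m<1+n (rank< i))))
        (prism-false ps)
      side i true ps onFace = trans
        (prism-cong ps (All.map (λ { (v , v≤M , eq , refl) → avoids (upper _ (<⇒≤ t<M ∷ v≤M) (suc i) eq)
                                                           , avoids (upper _ (t<M ∷ v≤M) (suc i) eq) }) onFace)
                    (λ l → rainbow-missing l ≤-refl))
        (prism-false ps)
        where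
        avoids : ∀ {x} → x ≤ rank i → x ≢ d
        avoids x≤ refl = <⇒≱ (rank< i) x≤

  Near : ∀ {d} → ℕ → Vec ℕ d → Vec ℕ d → Set
  Near M base v = Box M v × Pointwise (λ b x → b ≤ x × x ≤ suc b) base v

  -- Each step along a cell raises one coordinate by one. Hence the coordinate sums are consecutive,
  -- and all different modulo the number of vertices.
  data Chain {d} : ℕ → List (Vec ℕ d) → Set where
    []  : ∀ {s} → Chain s []
    _∷_ : ∀ {s v vs} → Vec.sum v ≡ s → Chain (suc s) vs → Chain s (v ∷ vs)

  restart : ∀ {d s s′} {vs : List (Vec ℕ d)} → s ≡ s′ → Chain s vs → Chain s′ vs
  restart refl ch = ch

  Chain-map : ∀ {d s t} {vs : List (Vec ℕ d)} → Chain s vs → Chain (t + s) (map (t ∷_) vs)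
  Chain-map         []          = []
  Chain-map {t = t} (refl ∷ ch) = refl ∷ restart (+-suc t _) (Chain-map ch)

  record Cell {d} (M : ℕ) (vs : List (Vec ℕ d)) : Set where
    constructor cell
    field
      base start : _
      size       : length vs ≡ suc d
      chain      : Chain start vs
      near       : All (Near M base) vs

  near-low : ∀ {d M t} {b v : Vec ℕ d} → t < M → Near M b v → Near M (t ∷ b) (t ∷ v)
  near-low t<M (v≤M , pw) = (<⇒≤ t<M ∷ v≤M) , ((≤-refl , n≤1+n _) ∷ pw)

  near-high : ∀ {d M t} {b v : Vec ℕ d} → t < M → Near M b v → Near M (t ∷ b) (suc t ∷ v)
  near-high t<M (v≤M , pw) = (t<M ∷ v≤M) , ((n≤1+n _ , ≤-refl) ∷ pw)

  -- A simplex of the prism follows the bottom up to some vertex, rises there, and goes on along the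
  -- top; the rise is the additional step of the chain.
  prism-true : ∀ {M d t s b} {f : Vec ℕ (suc d) → X} G qs → t < M → Chain s qs → All (Near M b) qs →
    prism G (map (λ v → f (t ∷ v) , f (suc t ∷ v)) qs) ≡ true →
    ∃ λ vs → G (map f vs) ≡ true × length vs ≡ suc (length qs) × Chain (t + s) vs × All (Near M (t ∷ b)) vs
  prism-true {t = t} {f = f} G (q ∷ qs) t<M (refl ∷ ch) (nr ∷ nrs) eq
    with G (f (t ∷ q) ∷ f (suc t ∷ q) ∷ map proj₂ (map (λ v → f (t ∷ v) , f (suc t ∷ v)) qs)) in eq₁
  ... | true  = (t ∷ q) ∷ (suc t ∷ q) ∷ map (suc t ∷_) qs ,
                trans (cong (λ l → G (f (t ∷ q) ∷ f (suc t ∷ q) ∷ l)) (trans (sym (map-∘ qs)) (map-∘ qs))) eq₁ ,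
                cong (2 +_) (length-map _ qs) ,
                refl ∷ refl ∷ restart (cong suc (+-suc t _)) (Chain-map ch) ,
                near-low t<M nr ∷ near-high t<M nr ∷ All.map⁺ (All.map (near-high t<M) nrs)
  ... | false with vs , eqG , len , chv , nrv ← prism-true {f = f} (λ l → G (f (t ∷ q) ∷ l)) qs t<M ch nrs eq
              = (t ∷ q) ∷ vs , eqG , cong suc len , refl ∷ restart (+-suc t _) chv , near-low t<M nr ∷ nrv

  cells-true : ∀ M d (f : Vec ℕ d → X) G → cells M d f G ≡ true → ∃ λ vs → G (map f vs) ≡ true × Cell M vs
  cells-true M zero    f G eq = [] ∷ [] , eq , cell [] 0 refl (refl ∷ []) (([] , []) ∷ [])
  cells-true M (suc d) f G eq
    with t , t<M , eqₜ ← xorSum-true _ M eq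
    with qs , eqq , cell b s size ch nr ← cells-true M d (λ v → f (t ∷ v) , f (suc t ∷ v)) (prism G) eqₜ
    with vs , eqv , len , chv , nrv ← prism-true {f = f} G qs t<M ch nr eqq
    = vs , eqv , cell (t ∷ b) (t + s) (trans len (cong suc size)) chv nrv

  Chain-lookup : ∀ {d s} {vs : List (Vec ℕ d)} → Chain s vs → ∀ i → Vec.sum (List.lookup vs i) ≡ s + toℕ i
  Chain-lookup         (eq ∷ ch) zero    = trans eq (sym (+-identityʳ _))
  Chain-lookup {s = s} (eq ∷ ch) (suc i) = trans (Chain-lookup ch i) (sym (+-suc s (toℕ i)))

  Unique-lookup : ∀ (l : List X) (f : X → Y) → Unique (map f l) →
                  ∀ i j → f (List.lookup l i) ≡ f (List.lookup l j) → i ≡ j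
  Unique-lookup (x ∷ l) f (x∉ ∷ u) zero    zero    eq = refl
  Unique-lookup (x ∷ l) f (x∉ ∷ u) zero    (suc j) eq = contradiction eq (All.lookup (All.map⁻ x∉) (∈-lookup j))
  Unique-lookup (x ∷ l) f (x∉ ∷ u) (suc i) zero    eq = contradiction (sym eq) (All.lookup (All.map⁻ x∉) (∈-lookup i))
  Unique-lookup (x ∷ l) f (x∉ ∷ u) (suc i) (suc j) eq = cong suc (Unique-lookup l f u i j eq)

  vertices : ∀ {M d s b n} (vs : List (Vec ℕ d)) (label : Vec ℕ d → ℕ) → length vs ≡ n →
    Chain s vs → All (Near M b) vs → Unique (map label vs) →
    Σ (Fin n → Vec ℕ d) λ vertex →
      (∀ i → Vec.sum (vertex i) ≡ s + toℕ i) × (∀ i → Near M b (vertex i)) ×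
      (∀ i j → label (vertex i) ≡ label (vertex j) → i ≡ j)
  vertices vs label refl chain near unique =
    List.lookup vs , Chain-lookup chain , (λ i → All.lookup near (∈-lookup i)) , Unique-lookup vs label unique

  -- An odd number of cells is not zero, so a rainbow cell can be extracted from the sum.
  sperner : ∀ M d {label} → Labelling M d label →
    ∃ λ base → ∃ λ start → Σ (Fin (suc d) → Vec ℕ d) λ vertex →
      (∀ i → Vec.sum (vertex i) ≡ start + toℕ i) × (∀ i → Near M base (vertex i)) ×
      (∀ i j → label (vertex i) ≡ label (vertex j) → i ≡ j)
  sperner M d {label} L with vs , eq , cell base start size chain near ← cells-true M d label _ (rainbow-odd M d L)
    = base , start , vertices vs label size chain near
        (Unique-resp-↭ (↭⇒↭ₛ (↭-sym (rainbow⇒↭ (suc d) _ eq))) (downFrom⁺ (suc d)))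

-- Polynomial-time functions on encoded data.

module Complexity where

  open import Defs
  open import Data.Bool.Base using (Bool; true; false; if_then_else_; _∧_; not)
  open import Data.Integer.Base using (ℤ)
  open import Data.List.Base using (List; []; _∷_; _++_; foldl; foldr; length; reverse; concatMap; map; filterᵇ; _ʳ++_)
  open import Data.List.Properties using (ʳ++-defn; reverse-involutive; ++-identityʳ; ++-assoc)
  open import Data.Nat.Base using (ℕ; zero; suc; _+_; _*_; _≤_; z≤n; s≤s)
  open import Data.Nat.Properties
  open import Data.Nat.Tactic.RingSolver using (solve-∀)
  open import Data.Product using (∃; _×_; _,_; proj₁; proj₂; uncurry)
  open import Data.Vec.Base as Vec using (Vec; []; _∷_)
  open import Function.Base using (_∘_; flip; id; const)
  open import Relation.Binary.PropositionalEquality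

  infixr 6 _⊗_

  -- The length of a `vec` belongs to the type, and its encoding is that of a list. Loops over a
  -- vector are unrolled in the program, whereas loops over a list are executed.
  data Ty : Set where
    tree bool num int : Ty
    _⊗_               : Ty → Ty → Ty
    list              : Ty → Ty
    vec               : Ty → ℕ → Ty

  El : Ty → Set
  El tree      = Tree
  El bool      = Bool
  El num       = ℕ
  El int       = ℤ
  El (σ ⊗ τ)   = El σ × El τ
  El (list τ)  = List (El τ)
  El (vec τ n) = Vec (El τ) n

  enc : ∀ τ → El τ → Tree
  enc tree      t       = t
  enc bool      b       = bit b
  enc num       n       = natural n
  enc int       i       = integer i
  enc (σ ⊗ τ)   (x , y) = cons (enc σ x) (enc τ y)
  enc (list τ)  xs      = foldr (λ x → cons (enc τ x)) nil xs
  enc (vec τ n) xs      = Vec.foldr′ (λ x → cons (enc τ x)) nil xs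

  -- Expressions with natural coefficients are monotone and closed under substitution, as the cost
  -- of a composition requires. They are turned into lists of coefficients only at the very end.
  data Poly : Set where
    var         : Poly
    con         : ℕ → Poly
    _⊕_ _⊛_     : Poly → Poly → Poly

  infixl 6 _⊕_
  infixl 7 _⊛_

  ⟦_⟧ : Poly → ℕ → ℕ
  ⟦ var ⟧   n = n
  ⟦ con c ⟧ n = c
  ⟦ p ⊕ q ⟧ n = ⟦ p ⟧ n + ⟦ q ⟧ n
  ⟦ p ⊛ q ⟧ n = ⟦ p ⟧ n * ⟦ q ⟧ n

  ⟦⟧-mono : ∀ p {m n} → m ≤ n → ⟦ p ⟧ m ≤ ⟦ p ⟧ n
  ⟦⟧-mono var     m≤n = m≤n
  ⟦⟧-mono (con c) m≤n = ≤-refl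
  ⟦⟧-mono (p ⊕ q) m≤n = +-mono-≤ (⟦⟧-mono p m≤n) (⟦⟧-mono q m≤n)
  ⟦⟧-mono (p ⊛ q) m≤n = *-mono-≤ (⟦⟧-mono p m≤n) (⟦⟧-mono q m≤n)

  _⟪_⟫ : Poly → Poly → Poly
  var     ⟪ r ⟫ = r
  con c   ⟪ r ⟫ = con c
  (p ⊕ q) ⟪ r ⟫ = (p ⟪ r ⟫) ⊕ (q ⟪ r ⟫)
  (p ⊛ q) ⟪ r ⟫ = (p ⟪ r ⟫) ⊛ (q ⟪ r ⟫)

  ⟦⟧-⟪⟫ : ∀ p r n → ⟦ p ⟪ r ⟫ ⟧ n ≡ ⟦ p ⟧ (⟦ r ⟧ n)
  ⟦⟧-⟪⟫ var     r n = refl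
  ⟦⟧-⟪⟫ (con c) r n = refl
  ⟦⟧-⟪⟫ (p ⊕ q) r n = cong₂ _+_ (⟦⟧-⟪⟫ p r n) (⟦⟧-⟪⟫ q r n)
  ⟦⟧-⟪⟫ (p ⊛ q) r n = cong₂ _*_ (⟦⟧-⟪⟫ p r n) (⟦⟧-⟪⟫ q r n)

  addᶜ : List ℕ → List ℕ → List ℕ
  addᶜ []       ds       = ds
  addᶜ (c ∷ cs) []       = c ∷ cs
  addᶜ (c ∷ cs) (d ∷ ds) = c + d ∷ addᶜ cs ds

  addᶜ-correct : ∀ cs ds n → polynomial (addᶜ cs ds) n ≡ polynomial cs n + polynomial ds n
  addᶜ-correct []       ds       n = refl
  addᶜ-correct (c ∷ cs) []       n = sym (+-identityʳ _)
  addᶜ-correct (c ∷ cs) (d ∷ ds) n rewrite addᶜ-correct cs ds n = lemma c d n (polynomial cs n) (polynomial ds n)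
    where
    lemma : ∀ c d n x y → c + d + n * (x + y) ≡ (c + n * x) + (d + n * y)
    lemma = solve-∀

  scale-correct : ∀ c ds n → polynomial (map (c *_) ds) n ≡ c * polynomial ds n
  scale-correct c []       n = sym (*-zeroʳ c)
  scale-correct c (d ∷ ds) n rewrite scale-correct c ds n = lemma c d n (polynomial ds n)
    where
    lemma : ∀ c d n x → c * d + n * (c * x) ≡ c * (d + n * x)
    lemma = solve-∀

  mulᶜ : List ℕ → List ℕ → List ℕ
  mulᶜ []       ds = []
  mulᶜ (c ∷ cs) ds = addᶜ (map (c *_) ds) (0 ∷ mulᶜ cs ds)

  mulᶜ-correct : ∀ cs ds n → polynomial (mulᶜ cs ds) n ≡ polynomial cs n * polynomial ds n
  mulᶜ-correct []       ds n = refl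
  mulᶜ-correct (c ∷ cs) ds n
    rewrite addᶜ-correct (map (c *_) ds) (0 ∷ mulᶜ cs ds) n | mulᶜ-correct cs ds n | scale-correct c ds n
    = lemma c n (polynomial cs n) (polynomial ds n)
    where
    lemma : ∀ c n x y → c * y + (0 + n * (x * y)) ≡ (c + n * x) * y
    lemma = solve-∀

  coefficients : Poly → List ℕ
  coefficients var     = 0 ∷ 1 ∷ []
  coefficients (con c) = c ∷ []
  coefficients (p ⊕ q) = addᶜ (coefficients p) (coefficients q)
  coefficients (p ⊛ q) = mulᶜ (coefficients p) (coefficients q)

  coefficients-correct : ∀ p n → polynomial (coefficients p) n ≡ ⟦ p ⟧ n
  coefficients-correct var     n = lemma n
    where
    lemma : ∀ n → n * (1 + n * 0) ≡ n
    lemma = solve-∀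
  coefficients-correct (con c) n = trans (cong (c +_) (*-zeroʳ n)) (+-identityʳ c)
  coefficients-correct (p ⊕ q) n = trans (addᶜ-correct (coefficients p) _ n)
    (cong₂ _+_ (coefficients-correct p n) (coefficients-correct q n))
  coefficients-correct (p ⊛ q) n = trans (mulᶜ-correct (coefficients p) _ n)
    (cong₂ _*_ (coefficients-correct p n) (coefficients-correct q n))

  -- The bound on the cost also limits the size of the result, by `output≤`; this is what makes such
  -- functions compose.
  record PolyTime (σ τ : Ty) (f : El σ → El τ) : Set where
    field
      program : Program
      bound   : Poly
      run     : ∀ x → ∃ λ t → (program ⊢ enc σ x ⇓ enc τ (f x) ⟨ t ⟩) × t ≤ ⟦ bound ⟧ (size (enc σ x))

  open PolyTime public

  private variable
    σ τ ρ Γ α : Ty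

  size≥1 : ∀ t → 1 ≤ size t
  size≥1 nil        = s≤s z≤n
  size≥1 (cons _ _) = s≤s z≤n

  -- Every step is charged at least for the part of the output that it creates.
  output≤cost : ∀ {p x y t} → p ⊢ x ⇓ y ⟨ t ⟩ → size y ≤ t
  output≤cost skip                       = ≤-refl
  output≤cost (erase {x})                = size≥1 x
  output≤cost head-nil                   = ≤-refl
  output≤cost (head-cons {x} {y})        = m≤n⇒m≤1+n (m≤m+n (size x) (size y))
  output≤cost tail-nil                   = ≤-refl
  output≤cost (tail-cons {x} {y})        = m≤n⇒m≤1+n (m≤n+m (size y) (size x))
  output≤cost (pair {x = x} d e)         = +-mono-≤ (+-mono-≤ (size≥1 x) (output≤cost d)) (output≤cost e)
  output≤cost (seq {s = s} d e)          = ≤-trans (output≤cost e) (m≤n+m _ s)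
  output≤cost (branch-yes d e)           = ≤-trans (output≤cost e) (m≤n+m _ _)
  output≤cost (branch-no d e)            = ≤-trans (output≤cost e) (m≤n+m _ _)
  output≤cost (while-stop d)             = m≤m+n _ _
  output≤cost (while-loop d e f)         = ≤-trans (output≤cost f) (m≤n+m _ _)

  output≤ : ∀ {f} (F : PolyTime σ τ f) x → size (enc τ (f x)) ≤ ⟦ bound F ⟧ (size (enc σ x))
  output≤ F x = let t , d , t≤ = run F x in ≤-trans (output≤cost d) t≤

  ext : ∀ {f g} → PolyTime σ τ f → (∀ x → f x ≡ g x) → PolyTime σ τ g
  ext {τ = τ} F eq = record
    { program = program F
    ; bound   = bound F
    ; run     = λ x → let t , d , t≤ = run F x in t , subst (λ y → program F ⊢ _ ⇓ enc τ y ⟨ t ⟩) (eq x) d , t≤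
    }

  coerce : ∀ {f} → (∀ x → enc σ x ≡ enc τ (f x)) → PolyTime σ τ f
  coerce eq = record
    { program = skip
    ; bound   = var
    ; run     = λ x → _ , subst (λ y → skip ⊢ _ ⇓ y ⟨ _ ⟩) (eq x) skip , ≤-refl
    }

  identity : PolyTime σ σ id
  identity = coerce (λ _ → refl)

  toTree : PolyTime σ tree (enc σ)
  toTree = coerce (λ _ → refl)

  fromTree : ∀ {f} → PolyTime σ tree (enc τ ∘ f) → PolyTime σ τ f
  fromTree F = record { program = program F ; bound = bound F ; run = run F }

  infixl 5 _▷_

  _▷_ : ∀ {f g} → PolyTime σ τ f → PolyTime τ ρ g → PolyTime σ ρ (g ∘ f)
  F ▷ G = record
    { program = program F ⨾ program G
    ; bound   = bound F ⊕ (bound G ⟪ bound F ⟫)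
    ; run     = λ x →
        let s , d , s≤ = run F x
            t , e , t≤ = run G _
        in s + t , seq d e ,
           +-mono-≤ s≤ (≤-trans t≤ (≤-trans (⟦⟧-mono (bound G) (output≤ F x)) (≤-reflexive (sym (⟦⟧-⟪⟫ (bound G) (bound F) _)))))
    }

  ⟨_,_⟩ : ∀ {f g} → PolyTime σ τ f → PolyTime σ ρ g → PolyTime σ (τ ⊗ ρ) (λ x → f x , g x)
  ⟨ F , G ⟩ = record
    { program = pair (program F) (program G)
    ; bound   = var ⊕ bound F ⊕ bound G
    ; run     = λ x →
        let s , d , s≤ = run F x
            t , e , t≤ = run G x
        in _ , pair d e , +-mono-≤ (+-mono-≤ ≤-refl s≤) t≤
    }

  fst : PolyTime (σ ⊗ τ) σ proj₁
  fst = record { program = head ; bound = var ; run = λ _ → _ , head-cons , ≤-refl }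

  snd : PolyTime (σ ⊗ τ) τ proj₂
  snd = record { program = tail ; bound = var ; run = λ _ → _ , tail-cons , ≤-refl }

  write : Tree → Program
  write nil        = erase
  write (cons x y) = pair (write x) (write y)

  write-run : ∀ t x → ∃ λ c → (write t ⊢ x ⇓ t ⟨ c ⟩) × c ≤ size t * size x
  write-run nil        x = _ , erase , ≤-reflexive (sym (*-identityˡ _))
  write-run (cons y z) x =
    let c , d , c≤ = write-run y x
        e , f , e≤ = write-run z x
    in _ , pair d f , ≤-trans (+-mono-≤ (+-monoʳ-≤ (size x) c≤) e≤) (≤-reflexive (lemma (size x) (size y) (size z)))
    where
    lemma : ∀ x y z → x + y * x + z * x ≡ suc (y + z) * x
    lemma = solve-∀

  constant : ∀ y → PolyTime σ τ (const y)
  constant {τ = τ} y = record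
    { program = write (enc τ y)
    ; bound   = con (size (enc τ y)) ⊛ var
    ; run     = λ x → write-run (enc τ y) _
    }

  cond : ∀ {b f g} → PolyTime σ bool b → PolyTime σ τ f → PolyTime σ τ g →
         PolyTime σ τ (λ x → if b x then f x else g x)
  cond {b = b} {f} {g} B F G = record
    { program = branch (program B) (program F) (program G)
    ; bound   = var ⊕ bound B ⊕ (bound F ⊕ bound G)
    ; run     = runs
    }
    where
    runs : ∀ x → ∃ λ t → (branch (program B) (program F) (program G) ⊢ _ ⇓ enc _ (if b x then f x else g x) ⟨ t ⟩) × _
    runs x with b x | run B x
    ... | true  | s , d , s≤ = let t , e , t≤ = run F x in
                               _ , branch-yes d e , +-mono-≤ (+-monoʳ-≤ _ s≤) (m≤n⇒m≤n+o _ t≤)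
    ... | false | s , d , s≤ = let t , e , t≤ = run G x in
                               _ , branch-no d e , +-mono-≤ (+-monoʳ-≤ _ s≤) (m≤n⇒m≤o+n _ t≤)

  caseList : ∀ {A : Set} → List A → {B : Set} → B → (A × List A → B) → B
  caseList []       n c = n
  caseList (x ∷ xs) n c = c (x , xs)

  match : ∀ {l f g} → PolyTime σ (list τ) l → PolyTime σ ρ f → PolyTime (σ ⊗ (τ ⊗ list τ)) ρ g →
          PolyTime σ ρ (λ x → caseList (l x) (f x) (λ p → g (x , p)))
  match {σ = σ} {τ} {ρ} {l} {f} {g} L F G = record
    { program = branch (program L) (pair skip (program L) ⨾ program G) (program F)
    ; bound   = var ⊕ bound L ⊕ (bound F ⊕ (cost ⊕ (bound G ⟪ cost ⟫)))
    ; run     = runs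
    }
    where
    cost = var ⊕ var ⊕ bound L
    runs : ∀ x → ∃ λ t → (branch (program L) (pair skip (program L) ⨾ program G) (program F) ⊢ enc σ x ⇓
                          enc ρ (caseList (l x) (f x) (λ p → g (x , p))) ⟨ t ⟩) × _
    runs x with l x | run L x
    ... | []    | s , d , s≤ = let t , e , t≤ = run F x in
                               _ , branch-no d e , +-mono-≤ (+-monoʳ-≤ _ s≤) (m≤n⇒m≤n+o _ t≤)
    ... | y ∷ ys | s , d , s≤ =
      let pd = pair (skip {x = enc σ x}) d
          p≤ = +-monoʳ-≤ (size (enc σ x) + size (enc σ x)) s≤
          t , e , t≤ = run G (x , (y , ys))
      in _ , branch-yes d (seq pd e) ,
         +-mono-≤ (+-monoʳ-≤ (size (enc σ x)) s≤) (m≤n⇒m≤o+n (⟦ bound F ⟧ (size (enc σ x))) (+-mono-≤ p≤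
           (≤-trans t≤ (≤-trans (⟦⟧-mono (bound G) (≤-trans (output≤cost pd) p≤))
                                (≤-reflexive (sym (⟦⟧-⟪⟫ (bound G) cost _)))))))

  size-++ : ∀ τ (xs ys : List (El τ)) → suc (size (enc (list τ) (xs ++ ys))) ≡ size (enc (list τ) xs) + size (enc (list τ) ys)
  size-++ τ []       ys = refl
  size-++ τ (x ∷ xs) ys = cong suc (begin
    suc (size (enc τ x) + size (enc (list τ) (xs ++ ys)))          ≡⟨ sym (+-suc _ _) ⟩
    size (enc τ x) + suc (size (enc (list τ) (xs ++ ys)))          ≡⟨ cong (size (enc τ x) +_) (size-++ τ xs ys) ⟩
    size (enc τ x) + (size (enc (list τ) xs) + size (enc (list τ) ys)) ≡⟨ sym (+-assoc (size (enc τ x)) _ _) ⟩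
    size (enc τ x) + size (enc (list τ) xs) + size (enc (list τ) ys) ∎)
    where open ≡-Reasoning

  prefix≤ : ∀ τ (xs ys : List (El τ)) → size (enc (list τ) xs) ≤ size (enc (list τ) (xs ++ ys))
  prefix≤ τ []       ys = size≥1 (enc (list τ) ys)
  prefix≤ τ (x ∷ xs) ys = s≤s (+-monoʳ-≤ (size (enc τ x)) (prefix≤ τ xs ys))

  suffix≤ : ∀ τ (xs ys : List (El τ)) → size (enc (list τ) ys) ≤ size (enc (list τ) (xs ++ ys))
  suffix≤ τ []       ys = ≤-refl
  suffix≤ τ (x ∷ xs) ys = m≤n⇒m≤1+n (m≤n⇒m≤o+n (size (enc τ x)) (suffix≤ τ xs ys))

  length≤ : ∀ τ (xs : List (El τ)) → suc (length xs) ≤ size (enc (list τ) xs)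
  length≤ τ []       = ≤-refl
  length≤ τ (x ∷ xs) = s≤s (m≤n⇒m≤o+n (size (enc τ x)) (length≤ τ xs))

  -- Iterating a polynomial-time step may blow up the state exponentially, hence the bound `B`.
  -- Stating it for results of whole folds suffices, because the state after any number of rounds is
  -- the result of folding a prefix.
  module Fold {Γ τ α : Ty} (g : El Γ → El α → El τ → El α)
    (step : PolyTime ((Γ ⊗ τ) ⊗ α) α (λ ((γ , x) , a) → g γ a x))
    (B : Poly)
    (result≤ : ∀ γ xs a → size (enc α (foldl (g γ) a xs)) ≤ ⟦ B ⟧ (size (enc ((Γ ⊗ list τ) ⊗ α) ((γ , xs) , a))))
    where

    State = Γ ⊗ (list τ ⊗ α)

    test : PolyTime State (list τ) (proj₁ ∘ proj₂)
    test = snd ▷ fst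

    body : PolyTime (Γ ⊗ ((τ ⊗ list τ) ⊗ α)) State (λ (γ , (x , xs) , a) → γ , xs , g γ a x)
    body = ⟨ fst , ⟨ snd ▷ fst ▷ snd , ⟨ ⟨ fst , snd ▷ fst ▷ fst ⟩ , snd ▷ snd ⟩ ▷ step ⟩ ⟩

    iteration : Poly
    iteration = var ⊕ bound test ⊕ bound body

    loop : Program
    loop = while (program test) (program body)

    loop-run : ∀ C γ xs a →
      (∀ ys zs → xs ≡ ys ++ zs → ⟦ iteration ⟧ (size (enc State (γ , zs , foldl (g γ) a ys))) ≤ C) →
      ∃ λ t → (loop ⊢ enc State (γ , xs , a) ⇓ enc State (γ , [] , foldl (g γ) a xs) ⟨ t ⟩) × t ≤ suc (length xs) * C
    loop-run C γ [] a small =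
      let s , d , s≤ = run test (γ , [] , a)
      in _ , while-stop d , ≤-trans (≤-trans (≤-trans (+-monoʳ-≤ (size (enc State (γ , [] , a))) s≤) (m≤m+n _ _)) (small [] [] refl)) (m≤m+n C 0)
    loop-run C γ (x ∷ xs) a small =
      let s , d , s≤ = run test (γ , x ∷ xs , a)
          t , e , t≤ = run body (γ , (x , xs) , a)
          u , f , u≤ = loop-run C γ xs (g γ a x) (λ ys zs eq → small (x ∷ ys) zs (cong (x ∷_) eq))
      in _ , while-loop d e f , +-mono-≤ (≤-trans (+-mono-≤ (+-monoʳ-≤ (size (enc State (γ , x ∷ xs , a))) s≤) t≤) (small [] (x ∷ xs) refl)) u≤

    prepare : PolyTime ((Γ ⊗ list τ) ⊗ α) State (λ ((γ , xs) , a) → γ , xs , a)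
    prepare = ⟨ fst ▷ fst , ⟨ fst ▷ snd , snd ⟩ ⟩

    finish : PolyTime State α (proj₂ ∘ proj₂)
    finish = snd ▷ snd

    widest : Poly
    widest = var ⊕ B

    total : Poly
    total = var ⊛ (iteration ⟪ widest ⟫)

    fold : PolyTime ((Γ ⊗ list τ) ⊗ α) α (λ ((γ , xs) , a) → foldl (g γ) a xs)
    fold = record
      { program = program prepare ⨾ (loop ⨾ program finish)
      ; bound   = bound prepare ⊕ (total ⊕ (bound finish ⟪ total ⟫))
      ; run     = runs
      }
      where
      runs : ∀ x → _
      runs ((γ , xs) , a) =
        let s , d , s≤ = run prepare ((γ , xs) , a)
            t , e , t≤ = loop-run C γ xs a small
            u , f , u≤ = run finish (γ , [] , foldl (g γ) a xs)
            t≤′ : t ≤ ⟦ total ⟧ n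
            t≤′ = ≤-trans t≤ (*-mono-≤ length≤n (≤-reflexive (sym (⟦⟧-⟪⟫ iteration widest n))))
        in _ , seq d (seq e f) ,
           +-mono-≤ s≤ (+-mono-≤ t≤′
             (≤-trans u≤ (≤-trans (⟦⟧-mono (bound finish) (≤-trans (output≤cost e) t≤′))
                                  (≤-reflexive (sym (⟦⟧-⟪⟫ (bound finish) total n))))))
        where
        n = size (enc ((Γ ⊗ list τ) ⊗ α) ((γ , xs) , a))
        C = ⟦ iteration ⟧ (⟦ widest ⟧ n)
        xs≤n : size (enc (list τ) xs) ≤ n
        xs≤n = m≤n⇒m≤1+n (m≤n⇒m≤n+o (size (enc α a)) (m≤n⇒m≤1+n (m≤n⇒m≤o+n (size (enc Γ γ)) ≤-refl)))
        length≤n : suc (length xs) ≤ n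
        length≤n = ≤-trans (length≤ τ xs) xs≤n
        small : ∀ ys zs → xs ≡ ys ++ zs → ⟦ iteration ⟧ (size (enc State (γ , zs , foldl (g γ) a ys))) ≤ C
        small ys zs refl = ⟦⟧-mono iteration (begin
          suc (size (enc Γ γ) + suc (size (enc (list τ) zs) + size (enc α (foldl (g γ) a ys))))
            ≤⟨ s≤s (+-monoʳ-≤ (size (enc Γ γ)) (s≤s (+-mono-≤ (suffix≤ τ ys zs) (result≤ γ ys a)))) ⟩
          suc (size (enc Γ γ) + suc (size (enc (list τ) (ys ++ zs)) + ⟦ B ⟧ _))
            ≤⟨ s≤s (+-monoʳ-≤ (size (enc Γ γ)) (s≤s (+-monoʳ-≤ _ (⟦⟧-mono B
                 (s≤s (+-monoˡ-≤ (size (enc α a)) (s≤s (+-monoʳ-≤ (size (enc Γ γ)) (prefix≤ τ ys zs))))))))) ⟩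
          suc (size (enc Γ γ) + suc (size (enc (list τ) (ys ++ zs)) + ⟦ B ⟧ n))
            ≤⟨ m≤m+n _ (size (enc α a)) ⟩
          suc (size (enc Γ γ) + suc (size (enc (list τ) (ys ++ zs)) + ⟦ B ⟧ n)) + size (enc α a)
            ≡⟨ lemma (size (enc Γ γ)) (size (enc (list τ) (ys ++ zs))) (⟦ B ⟧ n) (size (enc α a)) ⟩
          n + ⟦ B ⟧ n ∎)
          where
          open ≤-Reasoning
          lemma : ∀ γ x b a → suc (γ + suc (x + b)) + a ≡ suc (suc (γ + x) + a) + b
          lemma = solve-∀

  open Fold public using (fold)

  -- Each step adds an amount that does not depend on the state, so the total growth is at most this
  -- amount times the length of the list.
  foldGrowing : ∀ {Γ τ α} (g : El Γ → El α → El τ → El α) →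
    PolyTime ((Γ ⊗ τ) ⊗ α) α (λ ((γ , x) , a) → g γ a x) →
    ∀ p → (∀ γ a x → size (enc α (g γ a x)) ≤ size (enc α a) + ⟦ p ⟧ (size (enc Γ γ) + size (enc τ x))) →
    PolyTime ((Γ ⊗ list τ) ⊗ α) α (λ ((γ , xs) , a) → foldl (g γ) a xs)
  foldGrowing {Γ} {τ} {α} g step p grow = fold g step (var ⊕ var ⊛ p) λ γ xs a →
    ≤-trans (bounded γ xs a) (+-mono-≤
      (m≤n⇒m≤1+n (m≤n+m (size (enc α a)) (suc (size (enc Γ γ) + size (enc (list τ) xs)))))
      (*-mono-≤ {length xs} (≤-trans (n≤1+n _) (≤-trans (length≤ τ xs) (xs≤ γ xs a)))
                (⟦⟧-mono p (m≤n⇒m≤1+n (m≤n⇒m≤n+o (size (enc α a)) (n≤1+n _))))))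
    where
    xs≤ : ∀ γ xs a → size (enc (list τ) xs) ≤ size (enc ((Γ ⊗ list τ) ⊗ α) ((γ , xs) , a))
    xs≤ γ xs a = m≤n⇒m≤1+n (m≤n⇒m≤n+o (size (enc α a)) (m≤n⇒m≤1+n (m≤n⇒m≤o+n (size (enc Γ γ)) ≤-refl)))
    bounded : ∀ γ xs a → size (enc α (foldl (g γ) a xs)) ≤
              size (enc α a) + length xs * ⟦ p ⟧ (size (enc Γ γ) + size (enc (list τ) xs))
    bounded γ []       a = m≤m+n _ 0
    bounded γ (x ∷ xs) a = begin
      size (enc α (foldl (g γ) (g γ a x) xs))
        ≤⟨ bounded γ xs (g γ a x) ⟩
      size (enc α (g γ a x)) + length xs * ⟦ p ⟧ (size (enc Γ γ) + size (enc (list τ) xs))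
        ≤⟨ +-mono-≤ (grow γ a x) (*-monoʳ-≤ (length xs) (⟦⟧-mono p (+-monoʳ-≤ (size (enc Γ γ)) (m≤n⇒m≤1+n (m≤n+m _ _))))) ⟩
      (size (enc α a) + ⟦ p ⟧ (size (enc Γ γ) + size (enc τ x))) + length xs * P
        ≤⟨ +-monoˡ-≤ _ (+-monoʳ-≤ (size (enc α a)) (⟦⟧-mono p (+-monoʳ-≤ (size (enc Γ γ)) (m≤n⇒m≤1+n (m≤m+n _ _))))) ⟩
      (size (enc α a) + P) + length xs * P
        ≡⟨ +-assoc (size (enc α a)) P _ ⟩
      size (enc α a) + suc (length xs) * P ∎
      where
      open ≤-Reasoning
      P = ⟦ p ⟧ (size (enc Γ γ) + size (enc (list τ) (x ∷ xs)))

  nilP : PolyTime σ (list τ) (const [])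
  nilP = constant []

  consP : PolyTime (τ ⊗ list τ) (list τ) (uncurry _∷_)
  consP = coerce (λ _ → refl)

  singleton : PolyTime τ (list τ) (_∷ [])
  singleton = ⟨ identity , nilP ⟩ ▷ consP

  reverseAppend : PolyTime (list τ ⊗ list τ) (list τ) (uncurry _ʳ++_)
  reverseAppend {τ} = ⟨ ⟨ constant {τ = tree} nil , fst ⟩ , snd ⟩ ▷
    foldGrowing (λ _ → flip _∷_) (⟨ fst ▷ snd , snd ⟩ ▷ consP) (con 1 ⊕ var) λ _ a x →
      ≤-trans (≤-reflexive (cong suc (+-comm (size (enc τ x)) _)))
              (≤-trans (≤-reflexive (sym (+-suc _ _))) (+-monoʳ-≤ _ (s≤s (m≤n+m (size (enc τ x)) _))))

  reverseP : PolyTime (list τ) (list τ) reverse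
  reverseP = ⟨ identity , nilP ⟩ ▷ reverseAppend

  -- Lists can be built only at the front, so the first one is reversed and then pushed onto the
  -- second.
  appendP : PolyTime (list τ ⊗ list τ) (list τ) (uncurry _++_)
  appendP = ext (⟨ fst ▷ reverseP , snd ⟩ ▷ reverseAppend) λ (xs , ys) →
    trans (ʳ++-defn (reverse xs)) (cong (_++ ys) (reverse-involutive xs))

  concatMapP : ∀ {f} → PolyTime (Γ ⊗ τ) (list ρ) f →
               PolyTime (Γ ⊗ list τ) (list ρ) (λ (γ , xs) → concatMap (λ x → f (γ , x)) xs)
  concatMapP {Γ} {τ} {ρ} {f} F = ext
    (⟨ identity , nilP ⟩ ▷
     foldGrowing (λ γ ys x → ys ++ f (γ , x)) (⟨ snd , fst ▷ F ⟩ ▷ appendP) (bound F ⟪ con 1 ⊕ var ⟫)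
       λ γ ys x → ≤-trans (n≤1+n _) (≤-trans (≤-reflexive (size-++ ρ ys (f (γ , x))))
         (+-monoʳ-≤ _ (≤-trans (output≤ F (γ , x)) (≤-reflexive (sym (⟦⟧-⟪⟫ (bound F) (con 1 ⊕ var) _)))))))
    λ (γ , xs) → collect γ xs []
    where
    collect : ∀ γ xs ys → foldl (λ ys x → ys ++ f (γ , x)) ys xs ≡ ys ++ concatMap (λ x → f (γ , x)) xs
    collect γ []       ys = sym (++-identityʳ ys)
    collect γ (x ∷ xs) ys = trans (collect γ xs _) (++-assoc ys (f (γ , x)) _)

  mapP : ∀ {f} → PolyTime (Γ ⊗ τ) ρ f → PolyTime (Γ ⊗ list τ) (list ρ) (λ (γ , xs) → map (λ x → f (γ , x)) xs)
  mapP {f = f} F = ext (concatMapP (F ▷ singleton)) λ (γ , xs) → eq γ xs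
    where
    eq : ∀ γ xs → concatMap (λ x → f (γ , x) ∷ []) xs ≡ map (λ x → f (γ , x)) xs
    eq γ []       = refl
    eq γ (x ∷ xs) = cong (f (γ , x) ∷_) (eq γ xs)

  filterP : ∀ {f} → PolyTime (Γ ⊗ τ) bool f →
            PolyTime (Γ ⊗ list τ) (list τ) (λ (γ , xs) → filterᵇ (λ x → f (γ , x)) xs)
  filterP {f = f} F = ext (concatMapP (cond F (snd ▷ singleton) nilP)) λ (γ , xs) → eq γ xs
    where
    eq : ∀ γ xs → concatMap (λ x → if f (γ , x) then x ∷ [] else []) xs ≡ filterᵇ (λ x → f (γ , x)) xs
    eq γ []       = refl
    eq γ (x ∷ xs) with f (γ , x)
    ... | true  = cong (x ∷_) (eq γ xs)
    ... | false = eq γ xs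

  notP : PolyTime bool bool not
  notP = ext (cond identity (constant false) (constant true)) λ { true → refl ; false → refl }

  andP : PolyTime (bool ⊗ bool) bool (uncurry _∧_)
  andP = ext (cond fst snd (constant false)) λ { (true , _) → refl ; (false , _) → refl }

  bit≤3 : ∀ b → size (bit b) ≤ 3
  bit≤3 true  = ≤-refl
  bit≤3 false = s≤s z≤n

  allP : ∀ {f} → PolyTime (Γ ⊗ τ) bool f →
         PolyTime (Γ ⊗ list τ) bool (λ (γ , xs) → foldl (λ b x → b ∧ f (γ , x)) true xs)
  allP {f = f} F = ⟨ identity , constant true ⟩ ▷
    fold (λ γ b x → b ∧ f (γ , x)) (⟨ snd , fst ▷ F ⟩ ▷ andP) (con 3) (λ γ xs b → bit≤3 (foldl _ b xs))

  vhead : ∀ {n} → PolyTime (vec τ (suc n)) τ Vec.head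
  vhead = record { program = head ; bound = var ; run = λ { (_ ∷ _) → _ , head-cons , ≤-refl } }

  vtail : ∀ {n} → PolyTime (vec τ (suc n)) (vec τ n) Vec.tail
  vtail = record { program = tail ; bound = var ; run = λ { (_ ∷ _) → _ , tail-cons , ≤-refl } }

  vnil : PolyTime σ (vec τ 0) (const [])
  vnil = constant []

  vcons : ∀ {n} → PolyTime (τ ⊗ vec τ n) (vec τ (suc n)) (uncurry _∷_)
  vcons = coerce (λ _ → refl)

  vmapP : ∀ {f} n → PolyTime (Γ ⊗ τ) ρ f → PolyTime (Γ ⊗ vec τ n) (vec ρ n) (λ (γ , v) → Vec.map (λ x → f (γ , x)) v)
  vmapP zero    F = ext vnil λ { (_ , []) → refl }
  vmapP (suc n) F = ext (⟨ ⟨ fst , snd ▷ vhead ⟩ ▷ F , ⟨ fst , snd ▷ vtail ⟩ ▷ vmapP n F ⟩ ▷ vcons)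
                        λ { (_ , _ ∷ _) → refl }

  vzipWithP : ∀ {α β} {f : El α × El β → El ρ} n → PolyTime (α ⊗ β) ρ f →
              PolyTime (vec α n ⊗ vec β n) (vec ρ n) (λ (u , v) → Vec.zipWith (λ x y → f (x , y)) u v)
  vzipWithP zero    F = ext vnil λ { ([] , []) → refl }
  vzipWithP (suc n) F =
    ext (⟨ ⟨ fst ▷ vhead , snd ▷ vhead ⟩ ▷ F , ⟨ fst ▷ vtail , snd ▷ vtail ⟩ ▷ vzipWithP n F ⟩ ▷ vcons)
        λ { (_ ∷ _ , _ ∷ _) → refl }

-- Binary arithmetic in polynomial time.

module Arithmetic where

  open import Defs hiding (yes; no)
  open Complexity
  open import Data.Bool.Base using (Bool; true; false; if_then_else_; _∧_; not; _xor_; T)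
  open import Data.Bool.Properties using (T-≡)
  open import Data.Integer.Base as ℤ using (ℤ; +_; -[1+_]; _⊖_; ∣_∣)
  import Data.Integer.Properties as ℤ
  import Data.Integer.Tactic.RingSolver as ℤSolver
  open import Data.List.Base using (List; []; _∷_; foldl; foldr; length; _ʳ++_; map)
  open import Data.Nat.ListAction using (sum; product)
  open import Data.List.Properties using (reverse-foldl)
  open import Data.Nat.Base using (ℕ; zero; suc; _+_; _*_; _∸_; _^_; _≤_; _<_; z≤n; s≤s; _≤ᵇ_; _≡ᵇ_; _<ᵇ_)
  open import Data.Nat.Binary.Base as ℕᵇ using (ℕᵇ; 2[1+_]; 1+[2_])
  import Data.Nat.Binary.Properties as ℕᵇ
  open import Data.Nat.Properties
  open import Data.Nat.Tactic.RingSolver using (solve-∀)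
  open import Data.Product using (_×_; _,_; proj₁; proj₂; uncurry)
  open import Function.Bundles using (Equivalence)
  open import Relation.Binary.PropositionalEquality
  open import Relation.Nullary using (¬_; contradiction; yes; no)

  private variable
    σ τ ρ Γ : Ty

  -- Bijective binary digits, least significant first: true stands for 1 and
  -- false for 2.

  toℕᵇ : List Bool → ℕᵇ
  toℕᵇ []          = ℕᵇ.zero
  toℕᵇ (false ∷ l) = 2[1+ toℕᵇ l ]
  toℕᵇ (true  ∷ l) = 1+[2 toℕᵇ l ]

  fromℕᵇ : ℕᵇ → List Bool
  fromℕᵇ ℕᵇ.zero  = []
  fromℕᵇ 2[1+ b ] = false ∷ fromℕᵇ b
  fromℕᵇ 1+[2 b ] = true ∷ fromℕᵇ b

  fromDigits : List Bool → ℕ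
  fromDigits l = ℕᵇ.toℕ (toℕᵇ l)

  digits : ℕ → List Bool
  digits n = fromℕᵇ (ℕᵇ.fromℕ n)

  binary-toℕᵇ : ∀ l → binary (toℕᵇ l) ≡ enc (list bool) l
  binary-toℕᵇ []          = refl
  binary-toℕᵇ (false ∷ l) = cong (cons nil) (binary-toℕᵇ l)
  binary-toℕᵇ (true  ∷ l) = cong (cons (cons nil nil)) (binary-toℕᵇ l)

  toℕᵇ-fromℕᵇ : ∀ b → toℕᵇ (fromℕᵇ b) ≡ b
  toℕᵇ-fromℕᵇ ℕᵇ.zero  = refl
  toℕᵇ-fromℕᵇ 2[1+ b ] = cong 2[1+_] (toℕᵇ-fromℕᵇ b)
  toℕᵇ-fromℕᵇ 1+[2 b ] = cong 1+[2_] (toℕᵇ-fromℕᵇ b)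

  fromDigits-digits : ∀ n → fromDigits (digits n) ≡ n
  fromDigits-digits n = trans (cong ℕᵇ.toℕ (toℕᵇ-fromℕᵇ (ℕᵇ.fromℕ n))) (ℕᵇ.toℕ-fromℕ n)

  natural-fromDigits : ∀ l → natural (fromDigits l) ≡ enc (list bool) l
  natural-fromDigits l = trans (cong binary (ℕᵇ.fromℕ-toℕ (toℕᵇ l))) (binary-toℕᵇ l)

  natural-digits : ∀ n → natural n ≡ enc (list bool) (digits n)
  natural-digits n = trans (cong natural (sym (fromDigits-digits n))) (natural-fromDigits (digits n))

  -- The tree of a number is that of its list of digits, so the conversions leave the data
  -- unchanged.
  fromDigitsP : PolyTime (list bool) num fromDigits
  fromDigitsP = coerce (λ l → sym (natural-fromDigits l))

  digitsP : PolyTime num (list bool) digits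
  digitsP = coerce natural-digits

  digit : Bool → ℕ
  digit false = 2
  digit true  = 1

  digit≤2 : ∀ d → digit d ≤ 2
  digit≤2 false = ≤-refl
  digit≤2 true  = s≤s z≤n

  1≤digit : ∀ d → 1 ≤ digit d
  1≤digit false = s≤s z≤n
  1≤digit true  = ≤-refl

  fromDigits-∷ : ∀ d l → fromDigits (d ∷ l) ≡ digit d + 2 * fromDigits l
  fromDigits-∷ false l = *-suc 2 (fromDigits l)
  fromDigits-∷ true  l = refl

  -- A digit costs 1 for the `cons` and at most 3 for its bit; the final `nil` costs 1.
  size-digits : ∀ l → size (enc (list bool) l) ≤ 4 * length l + 1
  size-digits []      = ≤-refl
  size-digits (d ∷ l) = ≤-trans (s≤s (+-mono-≤ (bit≤3 d) (size-digits l))) (≤-reflexive (lemma (length l)))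
    where
    lemma : ∀ n → suc (3 + (4 * n + 1)) ≡ 4 * suc n + 1
    lemma = solve-∀

  -- In bijective base 2 the largest number with k digits consists of twos and is 2^(k+1) - 2; the
  -- smallest one consists of ones and is 2^k - 1.
  fromDigits-upper : ∀ l → 2 + fromDigits l ≤ 2 ^ suc (length l)
  fromDigits-upper []      = ≤-refl
  fromDigits-upper (d ∷ l) = begin
    2 + fromDigits (d ∷ l)         ≡⟨ cong (λ z → 2 + z) (fromDigits-∷ d l) ⟩
    2 + (digit d + 2 * fromDigits l) ≤⟨ +-monoʳ-≤ 2 (+-monoˡ-≤ _ (digit≤2 d)) ⟩
    2 + (2 + 2 * fromDigits l)     ≡⟨ lemma (fromDigits l) ⟩
    2 * (2 + fromDigits l)         ≤⟨ *-monoʳ-≤ 2 (fromDigits-upper l) ⟩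
    2 ^ suc (suc (length l))  ∎
    where
    open ≤-Reasoning
    lemma : ∀ v → 2 + (2 + 2 * v) ≡ 2 * (2 + v)
    lemma = solve-∀

  fromDigits-lower : ∀ l → 2 ^ length l ≤ suc (fromDigits l)
  fromDigits-lower []      = ≤-refl
  fromDigits-lower (d ∷ l) = begin
    2 ^ suc (length l)            ≤⟨ *-monoʳ-≤ 2 (fromDigits-lower l) ⟩
    2 * suc (fromDigits l)             ≡⟨ lemma (fromDigits l) ⟩
    suc (1 + 2 * fromDigits l)         ≤⟨ s≤s (+-monoˡ-≤ _ (1≤digit d)) ⟩
    suc (digit d + 2 * fromDigits l)   ≡⟨ cong suc (sym (fromDigits-∷ d l)) ⟩
    suc (fromDigits (d ∷ l))           ∎
    where
    open ≤-Reasoning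
    lemma : ∀ v → 2 * suc v ≡ suc (1 + 2 * v)
    lemma = solve-∀

  natural-upper : ∀ n → n < 2 ^ size (natural n)
  natural-upper n = begin-strict
    n                              ≡⟨ sym (fromDigits-digits n) ⟩
    fromDigits (digits n)               <⟨ ≤-trans (n≤1+n _) (fromDigits-upper (digits n)) ⟩
    2 ^ suc (length (digits n))    ≤⟨ ^-monoʳ-≤ 2 (length≤ bool (digits n)) ⟩
    2 ^ size (enc (list bool) (digits n)) ≡⟨ cong (λ t → 2 ^ size t) (sym (natural-digits n)) ⟩
    2 ^ size (natural n)           ∎
    where open ≤-Reasoning

  natural-size : ∀ {n} k → n < 2 ^ k → size (natural n) ≤ 4 * k + 1
  natural-size {n} k n<2^k = begin
    size (natural n)                  ≡⟨ cong size (natural-digits n) ⟩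
    size (enc (list bool) (digits n)) ≤⟨ size-digits (digits n) ⟩
    4 * length (digits n) + 1         ≤⟨ +-monoˡ-≤ 1 (*-monoʳ-≤ 4 (≮⇒≥ long)) ⟩
    4 * k + 1                         ∎
    where
    open ≤-Reasoning
    long : ¬ k < length (digits n)
    long k<len = <⇒≱ (^-monoʳ-< 2 (s≤s (s≤s z≤n)) k<len)
      (≤-trans (fromDigits-lower (digits n)) (subst (λ m → suc m ≤ 2 ^ k) (sym (fromDigits-digits n)) n<2^k))

  2^+2^ : ∀ {a b} → 1 ≤ a → 1 ≤ b → 2 ^ a + 2 ^ b ≤ 2 ^ (a + b)
  2^+2^ {suc a} {suc b} _ _ = begin
    2 ^ suc a + 2 ^ suc b     ≤⟨ +-mono-≤ (^-monoʳ-≤ 2 (s≤s (m≤m+n a b))) (^-monoʳ-≤ 2 (s≤s (m≤n+m b a))) ⟩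
    2 ^ suc (a + b) + 2 ^ suc (a + b) ≡⟨ cong (λ z → 2 ^ suc (a + b) + z) (sym (+-identityʳ _)) ⟩
    2 ^ suc (suc (a + b))     ≡⟨ cong (λ n → 2 ^ suc n) (sym (+-suc a b)) ⟩
    2 ^ (suc a + suc b)       ∎
    where open ≤-Reasoning

  sum<2^ : ∀ {x y a b} → 1 ≤ a → 1 ≤ b → x < 2 ^ a → y < 2 ^ b → x + y < 2 ^ (a + b)
  sum<2^ 1≤a 1≤b x< y< = ≤-trans (+-mono-<-≤ x< (<⇒≤ y<)) (2^+2^ 1≤a 1≤b)

  product<2^ : ∀ {x y a b} → x < 2 ^ a → y < 2 ^ b → x * y < 2 ^ (a + b)
  product<2^ {x} {y} {a} {b} x< y< = ≤-trans (*-mono-< x< y<) (≤-reflexive (sym (^-distribˡ-+-* 2 a b)))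

  -- The state is bounded by a power of 2 instead of by its size: passing from an exponent to a size
  -- costs a factor 4, which would compound if it were paid in every round. It is paid once, at the
  -- end.
  foldNum : ∀ {Γ τ} (g : El Γ → ℕ → El τ → ℕ) →
    PolyTime ((Γ ⊗ τ) ⊗ num) num (λ ((γ , x) , a) → g γ a x) →
    ∀ p → (∀ γ a x k → 1 ≤ k → a < 2 ^ k → g γ a x < 2 ^ (k + ⟦ p ⟧ (size (enc Γ γ) + size (enc τ x)))) →
    PolyTime ((Γ ⊗ list τ) ⊗ num) num (λ ((γ , xs) , a) → foldl (g γ) a xs)
  foldNum {Γ} {τ} g step p grow = fold g step (con 4 ⊛ (var ⊕ var ⊛ p) ⊕ con 1) λ γ xs a →
    let n = size (enc ((Γ ⊗ list τ) ⊗ num) ((γ , xs) , a)) in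
    ≤-trans (natural-size (size (natural a) + length xs * P γ xs) (bounded γ xs a _ (size≥1 (natural a)) (natural-upper a)))
    (+-monoˡ-≤ 1 (*-monoʳ-≤ 4 (+-mono-≤ {y = n}
      (m≤n⇒m≤1+n (m≤n+m (size (natural a)) (suc (size (enc Γ γ) + size (enc (list τ) xs)))))
      (*-mono-≤ {length xs} {n} (≤-trans (n≤1+n _) (≤-trans (length≤ τ xs)
                  (m≤n⇒m≤1+n (m≤n⇒m≤n+o (size (natural a)) (m≤n⇒m≤1+n (m≤n⇒m≤o+n (size (enc Γ γ)) ≤-refl))))))
                (⟦⟧-mono p (m≤n⇒m≤1+n (m≤n⇒m≤n+o (size (natural a)) (n≤1+n _))))))))
    where
    P : El Γ → List (El τ) → ℕ
    P γ xs = ⟦ p ⟧ (size (enc Γ γ) + size (enc (list τ) xs))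
    bounded : ∀ γ xs a k → 1 ≤ k → a < 2 ^ k → foldl (g γ) a xs < 2 ^ (k + length xs * P γ xs)
    bounded γ []       a k 1≤k a< = subst (λ e → a < 2 ^ e) (sym (+-identityʳ k)) a<
    bounded γ (x ∷ xs) a k 1≤k a< = ≤-trans
      (bounded γ xs (g γ a x) _ (m≤n⇒m≤n+o _ 1≤k) (grow γ a x k 1≤k a<))
      (^-monoʳ-≤ 2 (≤-trans
        (+-mono-≤ (+-monoʳ-≤ k (⟦⟧-mono p (+-monoʳ-≤ (size (enc Γ γ)) (m≤n⇒m≤1+n (m≤m+n _ _)))))
                  (*-monoʳ-≤ (length xs) (⟦⟧-mono p (+-monoʳ-≤ (size (enc Γ γ)) (m≤n⇒m≤1+n (m≤n+m _ (size (enc τ x))))))))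
        (≤-reflexive (+-assoc k (P γ (x ∷ xs)) _))))

  isZeroP : PolyTime num bool (_≡ᵇ 0)
  isZeroP = ext (match digitsP (constant true) (constant false)) λ n →
    trans (eq (digits n)) (cong (_≡ᵇ 0) (fromDigits-digits n))
    where
    eq : ∀ l → caseList l true (λ _ → false) ≡ (fromDigits l ≡ᵇ 0)
    eq []          = refl
    eq (false ∷ l) = refl
    eq (true  ∷ l) = refl

  -- The number obtained by prefixing to n the digits of out, last digit first.

  unroll : List Bool → ℕ → ℕ
  unroll out n = foldl (λ n d → digit d + 2 * n) n out

  fromDigits-ʳ++ : ∀ out l → fromDigits (out ʳ++ l) ≡ unroll out (fromDigits l)
  fromDigits-ʳ++ []        l = refl
  fromDigits-ʳ++ (d ∷ out) l = trans (fromDigits-ʳ++ out (d ∷ l)) (cong (unroll out) (fromDigits-∷ d l))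

  length-ʳ++ : ∀ (out l : List Bool) → length (out ʳ++ l) ≡ length out + length l
  length-ʳ++ []        l = refl
  length-ʳ++ (d ∷ out) l = trans (length-ʳ++ out (d ∷ l)) (+-suc (length out) (length l))

  size-∷-digit : ∀ d (out : List Bool) → size (enc (list bool) (d ∷ out)) ≤ size (enc (list bool) out) + 4
  size-∷-digit d out = ≤-trans (s≤s (+-monoˡ-≤ (size (enc (list bool) out)) (bit≤3 d)))
                               (≤-reflexive (+-comm 4 (size (enc (list bool) out))))

  -- A carry turns the digit 1 into 2 without a new carry, and 2 into 1 with a new carry. Hence
  -- `not d` is both the new carry and the new digit.
  sucStep : Bool × List Bool → Bool → Bool × List Bool
  sucStep (c , out) d = if c then (not d , not d ∷ out) else (false , d ∷ out)

  sucStepP : PolyTime (bool ⊗ (bool ⊗ list bool)) (bool ⊗ list bool) (λ (d , s) → sucStep s d)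
  sucStepP = cond (snd ▷ fst)
    ⟨ fst ▷ notP , ⟨ fst ▷ notP , snd ▷ snd ⟩ ▷ consP ⟩
    ⟨ constant false , ⟨ fst , snd ▷ snd ⟩ ▷ consP ⟩

  sucFinish : Bool × List Bool → List Bool
  sucFinish (c , out) = if c then out ʳ++ (true ∷ []) else out ʳ++ []

  sucDigits : List Bool → List Bool
  sucDigits l = sucFinish (foldl sucStep (true , []) l)

  sucDigitsP : PolyTime (list bool) (list bool) sucDigits
  sucDigitsP =
    ⟨ ⟨ constant {τ = tree} nil , identity ⟩ , constant (true , []) ⟩ ▷
    foldGrowing (λ _ → sucStep) (⟨ fst ▷ snd , snd ⟩ ▷ sucStepP) (con 10) (λ _ (c , out) d → grow c out d) ▷
    cond fst (⟨ snd , constant (true ∷ []) ⟩ ▷ reverseAppend) (⟨ snd , nilP ⟩ ▷ reverseAppend)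
    where
    grow′ : ∀ c c′ d out → size (enc (bool ⊗ list bool) (c′ , d ∷ out)) ≤ size (enc (bool ⊗ list bool) (c , out)) + 10
    grow′ c c′ d out = ≤-trans (s≤s (+-mono-≤ (bit≤3 c′) (size-∷-digit d out)))
      (≤-trans (≤-reflexive (lemma (size (enc (list bool) out)))) (+-mono-≤ (s≤s (m≤n+m _ (size (bit c)))) (m≤n+m 7 3)))
      where
      lemma : ∀ s → suc (3 + (s + 4)) ≡ suc s + 7
      lemma = solve-∀
    grow : ∀ c out d → size (enc (bool ⊗ list bool) (sucStep (c , out) d)) ≤ size (enc (bool ⊗ list bool) (c , out)) + 10
    grow true  out d = grow′ true (not d) (not d) out
    grow false out d = grow′ false false d out

  fromDigits-sucDigits : ∀ l → fromDigits (sucDigits l) ≡ suc (fromDigits l)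
  fromDigits-sucDigits l = go l true []
    where
    open ≡-Reasoning
    carry : Bool → ℕ
    carry true  = 1
    carry false = 0
    go : ∀ l c out → fromDigits (sucFinish (foldl sucStep (c , out) l)) ≡ unroll out (carry c + fromDigits l)
    go []          true  out = fromDigits-ʳ++ out (true ∷ [])
    go []          false out = fromDigits-ʳ++ out []
    go (true  ∷ l) true  out = trans (go l false (false ∷ out)) (cong (unroll out) (lemma (fromDigits l)))
      where
      lemma : ∀ v → 2 + 2 * v ≡ 1 + suc (2 * v)
      lemma = solve-∀
    go (false ∷ l) true  out = trans (go l true (true ∷ out)) (cong (unroll out) (lemma (fromDigits l)))
      where
      lemma : ∀ v → 1 + 2 * (1 + v) ≡ 1 + 2 * suc v
      lemma = solve-∀
    go (d ∷ l) false out = trans (go l false (d ∷ out)) (cong (unroll out) (sym (fromDigits-∷ d l)))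

  length-sucDigits : ∀ l → length (sucDigits l) ≤ suc (length l)
  length-sucDigits l = go l true []
    where
    go : ∀ l c out → length (sucFinish (foldl sucStep (c , out) l)) ≤ suc (length out + length l)
    go []      true  out = ≤-reflexive (trans (length-ʳ++ out _) (trans (+-suc _ 0) refl))
    go []      false out = ≤-trans (≤-reflexive (length-ʳ++ out _)) (n≤1+n _)
    go (d ∷ l) true  out = ≤-trans (go l (not d) (not d ∷ out)) (≤-reflexive (cong suc (sym (+-suc _ _))))
    go (d ∷ l) false out = ≤-trans (go l false (d ∷ out)) (≤-reflexive (cong suc (sym (+-suc _ _))))

  sucP : PolyTime num num suc
  sucP = ext (digitsP ▷ sucDigitsP ▷ fromDigitsP) λ n → trans (fromDigits-sucDigits (digits n)) (cong suc (fromDigits-digits n))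

  -- A pass over the digits of the first operand; the state consists of the
  -- remaining digits of the second one, incremented or decremented by the
  -- carry, and of the digits computed so far.

  module Pass (combine : Bool → Bool → Bool × Bool) where

    -- combine d e is the digit to be written and whether there is a carry.

    passStep : List Bool × List Bool → Bool → List Bool × List Bool
    passStep (l , out) d = caseList l ([] , d ∷ out) λ (e , l) →
      (if proj₁ (combine d e) then sucDigits l else l) , proj₂ (combine d e) ∷ out

    pass : List Bool × List Bool → List Bool → List Bool × List Bool
    pass = foldl passStep

    module _ (combineP : PolyTime (bool ⊗ bool) (bool ⊗ bool) (uncurry combine)) where

      passStepP : PolyTime (bool ⊗ (list bool ⊗ list bool)) (list bool ⊗ list bool) (λ (d , s) → passStep s d)
      passStepP = match (snd ▷ fst)
        ⟨ nilP , ⟨ fst , snd ▷ snd ⟩ ▷ consP ⟩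
        ⟨ cond (⟨ fst ▷ fst , snd ▷ fst ⟩ ▷ combineP ▷ fst) (snd ▷ snd ▷ sucDigitsP) (snd ▷ snd)
        , ⟨ ⟨ fst ▷ fst , snd ▷ fst ⟩ ▷ combineP ▷ snd , fst ▷ snd ▷ snd ⟩ ▷ consP ⟩

      pass-lengths : ∀ ds l out → length (proj₁ (pass (l , out) ds)) ≤ length l ×
                                  length (proj₂ (pass (l , out) ds)) ≤ length ds + length out
      pass-lengths []       l       out = ≤-refl , ≤-refl
      pass-lengths (d ∷ ds) []      out =
        let p , q = pass-lengths ds [] (d ∷ out) in p , ≤-trans q (≤-reflexive (+-suc (length ds) _))
      pass-lengths (d ∷ ds) (e ∷ l) out =
        let p , q = pass-lengths ds _ (proj₂ (combine d e) ∷ out)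
        in ≤-trans p (shorter (proj₁ (combine d e))) , ≤-trans q (≤-reflexive (+-suc (length ds) _))
        where
        shorter : ∀ c → length (if c then sucDigits l else l) ≤ suc (length l)
        shorter true  = length-sucDigits l
        shorter false = n≤1+n _

      passP : PolyTime (list bool ⊗ list bool) (list bool ⊗ list bool) (λ (ds , l) → pass (l , []) ds)
      passP = ⟨ ⟨ constant {τ = tree} nil , fst ⟩ , ⟨ snd , nilP ⟩ ⟩ ▷
        fold (λ _ → passStep) (⟨ fst ▷ snd , snd ⟩ ▷ passStepP) (con 8 ⊛ var ⊕ con 3) λ γ ds (l , out) →
          let p , q = pass-lengths ds l out
              n = size (enc ((tree ⊗ list bool) ⊗ (list bool ⊗ list bool)) ((γ , ds) , (l , out)))
              D = size (enc (list bool) ds) ; L = size (enc (list bool) l) ; O = size (enc (list bool) out)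
              l≤ = ≤-trans p (≤-trans (n≤1+n _) (length≤ bool l))
              o≤ = ≤-trans q (+-mono-≤ (≤-trans (n≤1+n _) (length≤ bool ds)) (≤-trans (n≤1+n _) (length≤ bool out)))
          in ≤-trans (s≤s (+-mono-≤ (≤-trans (size-digits (proj₁ (pass (l , out) ds))) (+-monoˡ-≤ 1 (*-monoʳ-≤ 4 l≤)))
                                    (≤-trans (size-digits (proj₂ (pass (l , out) ds))) (+-monoˡ-≤ 1 (*-monoʳ-≤ 4 o≤)))))
             (≤-trans (≤-reflexive (lemma L D O)) (+-monoˡ-≤ 3 (≤-trans (*-monoʳ-≤ 4 (rough (size γ) D L O)) (*-monoˡ-≤ n (m≤m+n 4 4)))))
        where
        lemma : ∀ l d o → suc ((4 * l + 1) + (4 * (d + o) + 1)) ≡ 4 * (l + (d + o)) + 3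
        lemma = solve-∀
        rearrange : ∀ g d l o → suc (suc (g + d) + suc (l + o)) ≡ (l + (d + o)) + (3 + g)
        rearrange = solve-∀
        rough : ∀ g d l o → l + (d + o) ≤ suc (suc (g + d) + suc (l + o))
        rough g d l o = ≤-trans (m≤m+n _ (3 + g)) (≤-reflexive (sym (rearrange g d l o)))

  -- d + e = out + 2 · carry.

  addCombine : Bool → Bool → Bool × Bool
  addCombine true  true  = false , false
  addCombine true  false = true  , true
  addCombine false true  = true  , true
  addCombine false false = true  , false

  module Add = Pass addCombine

  addCombineP : PolyTime (bool ⊗ bool) (bool ⊗ bool) (uncurry addCombine)
  addCombineP = ext (cond fst (cond snd (constant (false , false)) (constant (true , true)))
                              (cond snd (constant (true , true)) (constant (true , false))))
    λ { (true , true) → refl ; (true , false) → refl ; (false , true) → refl ; (false , false) → refl }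

  -- An invariant of the pass: the digits written so far, continued by the sum of what remains of
  -- both operands, represent the total.
  fromDigits-add : ∀ ds l out → let (r , out′) = Add.pass (l , out) ds in
              unroll out′ (fromDigits r) ≡ unroll out (fromDigits ds + fromDigits l)
  fromDigits-add []       l       out = refl
  fromDigits-add (d ∷ ds) []      out = trans (fromDigits-add ds [] (d ∷ out))
    (cong (unroll out) (trans (cong (λ v → digit d + 2 * v) (+-identityʳ (fromDigits ds)))
                              (trans (sym (fromDigits-∷ d ds)) (sym (+-identityʳ _)))))
  fromDigits-add (d ∷ ds) (e ∷ l) out = trans (fromDigits-add ds _ _) (cong (unroll out)
    (trans (lemma d e) (sym (cong₂ _+_ (fromDigits-∷ d ds) (fromDigits-∷ e l)))))
    where
    v = fromDigits ds
    w = fromDigits l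
    lemma : ∀ d e → let (c , o) = addCombine d e in
            digit o + 2 * (v + fromDigits (if c then sucDigits l else l)) ≡ (digit d + 2 * v) + (digit e + 2 * w)
    lemma true  true  = eq v w
      where eq : ∀ v w → 2 + 2 * (v + w) ≡ (1 + 2 * v) + (1 + 2 * w)
            eq = solve-∀
    lemma true  false rewrite fromDigits-sucDigits l = eq v w
      where eq : ∀ v w → 1 + 2 * (v + suc w) ≡ (1 + 2 * v) + (2 + 2 * w)
            eq = solve-∀
    lemma false true  rewrite fromDigits-sucDigits l = eq v w
      where eq : ∀ v w → 1 + 2 * (v + suc w) ≡ (2 + 2 * v) + (1 + 2 * w)
            eq = solve-∀
    lemma false false rewrite fromDigits-sucDigits l = eq v w
      where eq : ∀ v w → 2 + 2 * (v + suc w) ≡ (2 + 2 * v) + (2 + 2 * w)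
            eq = solve-∀

  addP : PolyTime (num ⊗ num) num (uncurry _+_)
  addP = ext (⟨ fst ▷ digitsP , snd ▷ digitsP ⟩ ▷ Add.passP addCombineP ▷ ⟨ snd , fst ⟩ ▷ reverseAppend ▷ fromDigitsP)
    λ (m , n) → let (r , out) = Add.pass (digits n , []) (digits m) in
      trans (fromDigits-ʳ++ out r) (trans (fromDigits-add (digits m) (digits n) []) (cong₂ _+_ (fromDigits-digits m) (fromDigits-digits n)))

  -- d - e = out - 2 · borrow.

  subCombine : Bool → Bool → Bool × Bool
  subCombine true  true  = true  , false
  subCombine true  false = true  , true
  subCombine false true  = false , true
  subCombine false false = true  , false

  module Sub = Pass subCombine

  subCombineP : PolyTime (bool ⊗ bool) (bool ⊗ bool) (uncurry subCombine)
  subCombineP = ext (cond fst (cond snd (constant (true , false)) (constant (true , true)))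
                              (cond snd (constant (false , true)) (constant (true , false))))
    λ { (true , true) → refl ; (true , false) → refl ; (false , true) → refl ; (false , false) → refl }

  unrollℤ : List Bool → ℤ → ℤ
  unrollℤ out i = foldl (λ i d → + digit d ℤ.+ + 2 ℤ.* i) i out

  fromDigits-∷ℤ : ∀ d l → + fromDigits (d ∷ l) ≡ + digit d ℤ.+ + 2 ℤ.* + fromDigits l
  fromDigits-∷ℤ d l = trans (cong +_ (fromDigits-∷ d l)) (cong (λ z → + digit d ℤ.+ z) (ℤ.pos-* 2 (fromDigits l)))

  fromDigits-sub : ∀ ds l out → let (r , out′) = Sub.pass (l , out) ds in
              unrollℤ out′ (ℤ.- + fromDigits r) ≡ unrollℤ out (+ fromDigits ds ℤ.- + fromDigits l)
  fromDigits-sub []       l       out = cong (unrollℤ out) (sym (ℤ.+-identityˡ _))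
  fromDigits-sub (d ∷ ds) []      out = trans (fromDigits-sub ds [] (d ∷ out))
    (cong (unrollℤ out) (trans (cong (λ v → + digit d ℤ.+ + 2 ℤ.* v) (ℤ.+-identityʳ (+ fromDigits ds)))
                               (trans (sym (fromDigits-∷ℤ d ds)) (sym (ℤ.+-identityʳ _)))))
  fromDigits-sub (d ∷ ds) (e ∷ l) out = trans (fromDigits-sub ds _ _) (cong (unrollℤ out)
    (trans (lemma d e) (sym (cong₂ ℤ._-_ (fromDigits-∷ℤ d ds) (fromDigits-∷ℤ e l)))))
    where
    v = + fromDigits ds
    w = + fromDigits l
    lemma : ∀ d e → let (c , o) = subCombine d e in
            + digit o ℤ.+ + 2 ℤ.* (v ℤ.- + fromDigits (if c then sucDigits l else l)) ≡
            (+ digit d ℤ.+ + 2 ℤ.* v) ℤ.- (+ digit e ℤ.+ + 2 ℤ.* w)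
    lemma true  true  rewrite fromDigits-sucDigits l = eq v w
      where eq : ∀ v w → + 2 ℤ.+ + 2 ℤ.* (v ℤ.- (+ 1 ℤ.+ w)) ≡ (+ 1 ℤ.+ + 2 ℤ.* v) ℤ.- (+ 1 ℤ.+ + 2 ℤ.* w)
            eq = ℤSolver.solve-∀
    lemma true  false rewrite fromDigits-sucDigits l = eq v w
      where eq : ∀ v w → + 1 ℤ.+ + 2 ℤ.* (v ℤ.- (+ 1 ℤ.+ w)) ≡ (+ 1 ℤ.+ + 2 ℤ.* v) ℤ.- (+ 2 ℤ.+ + 2 ℤ.* w)
            eq = ℤSolver.solve-∀
    lemma false true  = eq v w
      where eq : ∀ v w → + 1 ℤ.+ + 2 ℤ.* (v ℤ.- w) ≡ (+ 2 ℤ.+ + 2 ℤ.* v) ℤ.- (+ 1 ℤ.+ + 2 ℤ.* w)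
            eq = ℤSolver.solve-∀
    lemma false false rewrite fromDigits-sucDigits l = eq v w
      where eq : ∀ v w → + 2 ℤ.+ + 2 ℤ.* (v ℤ.- (+ 1 ℤ.+ w)) ≡ (+ 2 ℤ.+ + 2 ℤ.* v) ℤ.- (+ 2 ℤ.+ + 2 ℤ.* w)
            eq = ℤSolver.solve-∀

  -- The digits of the difference may have to be prefixed to -1; the value of
  -- a state is -1 if its flag is set.

  signed : Bool × List Bool → ℤ
  signed (true  , _) = -[1+ 0 ]
  signed (false , l) = + fromDigits l

  -- Prefixing a digit to -1 gives 1 + 2 (-1) = -1 or 2 + 2 (-1) = 0, so the new flag is `d` itself
  -- and the list of digits stays empty.
  pushStep : Bool × List Bool → Bool → Bool × List Bool
  pushStep (m , l) d = if m then (d , []) else (false , d ∷ l)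

  signed-push : ∀ out s → signed (foldl pushStep s out) ≡ unrollℤ out (signed s)
  signed-push []          s           = refl
  signed-push (true  ∷ out) (true  , l) = signed-push out (true , [])
  signed-push (false ∷ out) (true  , l) = signed-push out (false , [])
  signed-push (d     ∷ out) (false , l) = trans (signed-push out (false , d ∷ l)) (cong (unrollℤ out) (fromDigits-∷ℤ d l))

  clip : Bool × List Bool → List Bool
  clip (m , l) = if m then [] else l

  -- The pass leaves 0, 1 or more of the subtrahend. The first two cases give the start values 0 and
  -- -1. In the last one, marked by the empty list, the difference is negative and is cut off to 0.
  borrowStart : List Bool → List (Bool × List Bool)
  borrowStart []          = (false , []) ∷ []
  borrowStart (true  ∷ []) = (true , []) ∷ []
  borrowStart _           = []

  subDigits : List Bool → List Bool → List Bool
  subDigits ds l = let (r , out) = Sub.pass (l , []) ds in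
    caseList (borrowStart r) [] (λ (s , _) → clip (foldl pushStep s out))

  clip-signed : ∀ s {m n} → signed s ≡ + m ℤ.- + n → fromDigits (clip s) ≡ m ∸ n
  clip-signed (true , l) {m} {n} eq = sym (m≤n⇒m∸n≡0 (≮⇒≥ λ n<m → contradiction
    (trans (sym (ℤ.⊖-≥ {m} {n} (<⇒≤ n<m))) (trans (sym (ℤ.m-n≡m⊖n m n)) (sym eq))) λ ()))
  clip-signed (false , l) {m} {n} eq with n ≤? m
  ... | yes n≤m = ℤ.+-injective (trans eq (trans (ℤ.m-n≡m⊖n m n) (ℤ.⊖-≥ {m} {n} n≤m)))
  ... | no  n≰m = contradiction (trans eq (trans (ℤ.m-n≡m⊖n m n) (ℤ.⊖-< {m} {n} (≰⇒> n≰m)))) (pos≢neg (m<n⇒0<n∸m (≰⇒> n≰m)))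
    where
    pos≢neg : ∀ {a b} → 0 < b → + a ≢ ℤ.- + b
    pos≢neg {b = suc b} _ ()

  -- The larger digit fixes -2, since 2 + 2 (-2) = -2, so a value of at most -2 never rises above
  -- it.
  unrollℤ-negative : ∀ out i → i ℤ.≤ -[1+ 1 ] → unrollℤ out i ℤ.≤ -[1+ 1 ]
  unrollℤ-negative []        i i≤ = i≤
  unrollℤ-negative (d ∷ out) i i≤ = unrollℤ-negative out _
    (ℤ.≤-trans (ℤ.+-mono-≤ (ℤ.+≤+ (digit≤2 d)) (ℤ.*-monoˡ-≤-nonNeg (+ 2) i≤)) ℤ.≤-refl)

  fromDigits-subDigits : ∀ ds l → fromDigits (subDigits ds l) ≡ fromDigits ds ∸ fromDigits l
  fromDigits-subDigits ds l = finish (Sub.pass (l , []) ds) (fromDigits-sub ds l [])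
    where
    negative : ∀ n out → 2 ≤ n → unrollℤ out (ℤ.- + n) ≡ + fromDigits ds ℤ.- + fromDigits l → 0 ≡ fromDigits ds ∸ fromDigits l
    negative n out 2≤n eq = sym (m≤n⇒m∸n≡0 (≮⇒≥ λ l<d → contradiction
      (subst (ℤ._≤ -[1+ 1 ]) (trans eq (trans (ℤ.m-n≡m⊖n (fromDigits ds) (fromDigits l)) (ℤ.⊖-≥ {fromDigits ds} {fromDigits l} (<⇒≤ l<d))))
        (unrollℤ-negative out _ (ℤ.neg-mono-≤ (ℤ.+≤+ 2≤n)))) λ ()))
    finish : ∀ s → unrollℤ (proj₂ s) (ℤ.- + fromDigits (proj₁ s)) ≡ + fromDigits ds ℤ.- + fromDigits l →
             fromDigits (caseList (borrowStart (proj₁ s)) [] (λ (b , _) → clip (foldl pushStep b (proj₂ s)))) ≡ fromDigits ds ∸ fromDigits l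
    finish ([]               , out) eq = clip-signed (foldl pushStep (false , []) out) {fromDigits ds} {fromDigits l} (trans (signed-push out _) eq)
    finish (true ∷ []        , out) eq = clip-signed (foldl pushStep (true , []) out) {fromDigits ds} {fromDigits l} (trans (signed-push out _) eq)
    finish (false ∷ r        , out) eq = negative (fromDigits (false ∷ r)) out
      (≤-trans (m≤m+n 2 _) (≤-reflexive (sym (fromDigits-∷ false r)))) eq
    finish (true ∷ d ∷ r     , out) eq = negative (fromDigits (true ∷ d ∷ r)) out
      (s≤s (≤-trans (m≤n⇒m≤n+o (2 * fromDigits r) (1≤digit d)) (≤-trans (≤-reflexive (sym (fromDigits-∷ d r))) (m≤m+n _ _)))) eq

  borrowStartP : PolyTime (list bool) (list (bool ⊗ list bool)) borrowStart
  borrowStartP = ext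
    (match identity (constant ((false , []) ∷ []))
      (cond (snd ▷ fst) (match (snd ▷ snd) (constant ((true , []) ∷ [])) nilP) nilP))
    λ { [] → refl ; (true ∷ []) → refl ; (true ∷ _ ∷ _) → refl ; (false ∷ _) → refl }

  pushStepP : PolyTime (bool ⊗ (bool ⊗ list bool)) (bool ⊗ list bool) (λ (d , s) → pushStep s d)
  pushStepP = cond (snd ▷ fst) ⟨ fst , nilP ⟩ ⟨ constant false , ⟨ fst , snd ▷ snd ⟩ ▷ consP ⟩

  pushP : PolyTime ((bool ⊗ list bool) ⊗ list bool) (bool ⊗ list bool) (λ (s , out) → foldl pushStep s out)
  pushP = ⟨ ⟨ constant {τ = tree} nil , snd ⟩ , fst ⟩ ▷
    foldGrowing (λ _ → pushStep) (⟨ fst ▷ snd , snd ⟩ ▷ pushStepP) (con 10) (λ _ (m , l) d → grow m l d)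
    where
    grow : ∀ m l d → size (enc (bool ⊗ list bool) (pushStep (m , l) d)) ≤ size (enc (bool ⊗ list bool) (m , l)) + 10
    grow true  l d = ≤-trans (s≤s (+-monoˡ-≤ 1 (bit≤3 d))) (≤-trans (m≤n+m 5 5) (m≤n+m 10 (size (enc (bool ⊗ list bool) (true , l)))))
    grow false l d = ≤-trans (s≤s (s≤s (size-∷-digit d l))) (≤-trans (≤-reflexive (sym (+-assoc 2 (size (enc (list bool) l)) 4)))
                             (+-monoʳ-≤ (2 + size (enc (list bool) l)) (m≤m+n 4 6)))

  monusP : PolyTime (num ⊗ num) num (uncurry _∸_)
  monusP = ext
    (⟨ fst ▷ digitsP , snd ▷ digitsP ⟩ ▷ Sub.passP subCombineP ▷
     match (fst ▷ borrowStartP) nilP (⟨ snd ▷ fst , fst ▷ snd ⟩ ▷ pushP ▷ cond fst nilP snd) ▷ fromDigitsP)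
    λ (m , n) → trans (fromDigits-subDigits (digits m) (digits n)) (cong₂ _∸_ (fromDigits-digits m) (fromDigits-digits n))

  ≤ᵇ-∸ : ∀ m n → (m ∸ n ≡ᵇ 0) ≡ (m ≤ᵇ n)
  ≤ᵇ-∸ zero    n       = cong (_≡ᵇ 0) (0∸n≡0 n)
  ≤ᵇ-∸ (suc m) zero    = refl
  ≤ᵇ-∸ (suc zero) (suc n) = cong (_≡ᵇ 0) (0∸n≡0 n)
  ≤ᵇ-∸ (suc (suc m)) (suc n) = ≤ᵇ-∸ (suc m) n

  leqP : PolyTime (num ⊗ num) bool (uncurry _≤ᵇ_)
  leqP = ext (monusP ▷ isZeroP) λ (m , n) → ≤ᵇ-∸ m n

  ltP : PolyTime (num ⊗ num) bool (uncurry _<ᵇ_)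
  ltP = ⟨ fst ▷ sucP , snd ⟩ ▷ leqP

  ≡ᵇ-∧ : ∀ m n → (m ≤ᵇ n) ∧ (n ≤ᵇ m) ≡ (m ≡ᵇ n)
  ≡ᵇ-∧ zero          zero          = refl
  ≡ᵇ-∧ zero          (suc n)       = refl
  ≡ᵇ-∧ (suc m)       zero          = refl
  ≡ᵇ-∧ (suc zero)    (suc zero)    = refl
  ≡ᵇ-∧ (suc zero)    (suc (suc n)) = refl
  ≡ᵇ-∧ (suc (suc m)) (suc zero)    = refl
  ≡ᵇ-∧ (suc (suc m)) (suc (suc n)) = ≡ᵇ-∧ (suc m) (suc n)

  eqP : PolyTime (num ⊗ num) bool (uncurry _≡ᵇ_)
  eqP = ext (⟨ leqP , ⟨ snd , fst ⟩ ▷ leqP ⟩ ▷ andP) λ (m , n) → ≡ᵇ-∧ m n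

  -- Horner's scheme.

  mulStep : ℕ → ℕ → Bool → ℕ
  mulStep n a d = (if d then n else n + n) + (a + a)

  mulP : PolyTime (num ⊗ num) num (uncurry _*_)
  mulP = ext
    -- The scheme reads the digits from the most significant one, hence the reversal.
    (⟨ ⟨ snd , fst ▷ digitsP ▷ reverseP ⟩ , constant 0 ⟩ ▷
     foldNum mulStep
       (⟨ cond (fst ▷ snd) (fst ▷ fst) (⟨ fst ▷ fst , fst ▷ fst ⟩ ▷ addP) , ⟨ snd , snd ⟩ ▷ addP ⟩ ▷ addP)
       (con 2 ⊕ var) grow)
    λ (m , n) → trans (reverse-foldl (mulStep n) 0 (digits m))
                      (trans (horner n (digits m)) (cong (_* n) (fromDigits-digits m)))
    where
    open ≤-Reasoning
    double : ∀ x → 2 * x ≡ x + x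
    double x = cong (λ z → x + z) (+-identityʳ x)
    grow : ∀ n a d k → 1 ≤ k → a < 2 ^ k → mulStep n a d < 2 ^ (k + (2 + (size (natural n) + size (bit d))))
    grow n a d k 1≤k a< = begin-strict
      mulStep n a d                           ≤⟨ +-monoˡ-≤ _ (summand d) ⟩
      (n + n) + (a + a)                       ≡⟨ sym (cong₂ _+_ (double n) (double a)) ⟩
      2 * n + 2 * a                           <⟨ +-mono-≤-< (*-monoʳ-≤ 2 (<⇒≤ (natural-upper n))) (*-monoʳ-< 2 a<) ⟩
      2 ^ suc (size (natural n)) + 2 ^ suc k  ≤⟨ 2^+2^ {suc (size (natural n))} {suc k} (s≤s z≤n) (s≤s z≤n) ⟩
      2 ^ (suc (size (natural n)) + suc k)    ≤⟨ ^-monoʳ-≤ 2 (≤-trans (≤-reflexive (lemma (size (natural n)) k)) (+-monoʳ-≤ k (+-monoʳ-≤ 2 (m≤m+n _ _)))) ⟩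
      2 ^ (k + (2 + (size (natural n) + size (bit d)))) ∎
      where
      summand : ∀ d → (if d then n else n + n) ≤ n + n
      summand true  = m≤m+n n n
      summand false = ≤-refl
      lemma : ∀ s k → suc s + suc k ≡ k + (2 + s)
      lemma = solve-∀
    horner : ∀ n l → foldr (λ d a → mulStep n a d) 0 l ≡ fromDigits l * n
    horner n []      = refl
    horner n (d ∷ l) = trans (trans (cong (λ a → mulStep n a d) (horner n l)) (step d)) (cong (_* n) (sym (fromDigits-∷ d l)))
      where
      step : ∀ d → mulStep n (fromDigits l * n) d ≡ (digit d + 2 * fromDigits l) * n
      step true  = lemma n (fromDigits l)
        where
        lemma : ∀ n v → n + (v * n + v * n) ≡ (1 + 2 * v) * n
        lemma = solve-∀
      step false = lemma n (fromDigits l)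
        where
        lemma : ∀ n v → (n + n) + (v * n + v * n) ≡ (2 + 2 * v) * n
        lemma = solve-∀

  sumP : ∀ {f} → PolyTime (Γ ⊗ τ) num f → PolyTime (Γ ⊗ list τ) num (λ (γ , xs) → sum (map (λ x → f (γ , x)) xs))
  sumP {Γ} {τ} {f} F = ext
    (⟨ ⟨ fst , snd ▷ reverseP ⟩ , constant 0 ⟩ ▷
     foldNum (λ γ a x → f (γ , x) + a) (⟨ fst ▷ F , snd ⟩ ▷ addP) (bound F ⟪ con 1 ⊕ var ⟫)
       λ γ a x k 1≤k a< → subst₂ (λ s e → s < 2 ^ e) (+-comm a (f (γ , x))) (cong (λ z → k + z) (sym (⟦⟧-⟪⟫ (bound F) (con 1 ⊕ var) _)))
         (sum<2^ 1≤k (≤-trans (size≥1 _) (output≤ F (γ , x))) a<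
           (≤-trans (natural-upper (f (γ , x))) (^-monoʳ-≤ 2 (output≤ F (γ , x))))))
    λ (γ , xs) → trans (reverse-foldl (λ a x → f (γ , x) + a) 0 xs) (eq γ xs)
    where
    eq : ∀ γ xs → foldr (λ x a → f (γ , x) + a) 0 xs ≡ sum (map (λ x → f (γ , x)) xs)
    eq γ []       = refl
    eq γ (x ∷ xs) = cong (λ z → f (γ , x) + z) (eq γ xs)

  productP : ∀ {f} → PolyTime (Γ ⊗ τ) num f →
             PolyTime (Γ ⊗ list τ) num (λ (γ , xs) → product (map (λ x → f (γ , x)) xs))
  productP {Γ} {τ} {f} F = ext
    (⟨ ⟨ fst , snd ▷ reverseP ⟩ , constant 1 ⟩ ▷
     foldNum (λ γ a x → f (γ , x) * a) (⟨ fst ▷ F , snd ⟩ ▷ mulP) (bound F ⟪ con 1 ⊕ var ⟫)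
       λ γ a x k 1≤k a< → subst₂ (λ s e → s < 2 ^ e) (*-comm a (f (γ , x))) (cong (λ z → k + z) (sym (⟦⟧-⟪⟫ (bound F) (con 1 ⊕ var) _)))
         (product<2^ {a} {f (γ , x)} {k} a< (≤-trans (natural-upper (f (γ , x))) (^-monoʳ-≤ 2 (output≤ F (γ , x))))))
    λ (γ , xs) → trans (reverse-foldl (λ a x → f (γ , x) * a) 1 xs) (eq γ xs)
    where
    eq : ∀ γ xs → foldr (λ x a → f (γ , x) * a) 1 xs ≡ product (map (λ x → f (γ , x)) xs)
    eq γ []       = refl
    eq γ (x ∷ xs) = cong (f (γ , x) *_) (eq γ xs)

  isNegative : ℤ → Bool
  isNegative (+ _)    = false
  isNegative -[1+ _ ] = true

  isNegativeP : PolyTime int bool isNegative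
  isNegativeP = record { program = head ; bound = var ; run = λ { (+ _) → _ , head-cons , ≤-refl ; -[1+ _ ] → _ , head-cons , ≤-refl } }

  absP : PolyTime int num ∣_∣
  absP = record { program = tail ; bound = var ; run = λ { (+ _) → _ , tail-cons , ≤-refl ; -[1+ _ ] → _ , tail-cons , ≤-refl } }

  positiveP : PolyTime num int (λ n → + n)
  positiveP = fromTree (⟨ constant {τ = bool} false , identity ⟩ ▷ toTree)

  negate : ℕ → ℤ
  negate n = ℤ.- + n

  -- 0 is encoded with the positive sign only, so it is a case of its own.
  negateP : PolyTime num int negate
  negateP = fromTree (ext (cond isZeroP (constant (enc int (+ 0))) (⟨ constant {τ = bool} true , identity ⟩ ▷ toTree))
    λ { zero → refl ; (suc n) → refl })

  differenceP : PolyTime (num ⊗ num) int (uncurry _⊖_)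
  differenceP = ext (cond (⟨ snd , fst ⟩ ▷ leqP) (monusP ▷ positiveP) (⟨ snd , fst ⟩ ▷ monusP ▷ negateP)) λ (m , n) → eq m n
    where
    eq : ∀ m n → (if n ≤ᵇ m then + (m ∸ n) else negate (n ∸ m)) ≡ m ⊖ n
    eq m n with n ≤ᵇ m in b
    ... | true  = sym (ℤ.⊖-≥ {m} {n} (≤ᵇ⇒≤ n m (Equivalence.from T-≡ b)))
    ... | false = sym (ℤ.⊖-< {m} {n} (≰⇒> λ n≤m → subst T b (≤⇒≤ᵇ n≤m)))

  -- A sum of integers is the difference of the sum of the positive parts and the sum of the
  -- negative parts.
  plus minus : ℤ → ℕ
  plus i  = if isNegative i then 0 else ∣ i ∣
  minus i = if isNegative i then ∣ i ∣ else 0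

  plusP : PolyTime int num plus
  plusP = cond isNegativeP (constant 0) absP

  minusP : PolyTime int num minus
  minusP = cond isNegativeP absP (constant 0)

  addℤP : PolyTime (int ⊗ int) int (uncurry ℤ._+_)
  addℤP = ext (⟨ ⟨ fst ▷ plusP , snd ▷ plusP ⟩ ▷ addP , ⟨ fst ▷ minusP , snd ▷ minusP ⟩ ▷ addP ⟩ ▷ differenceP)
    λ { (+ m , + n)           → ℤ.⊖-≥ z≤n
      ; (+ m , -[1+ n ])      → cong (_⊖ suc n) (+-identityʳ m)
      ; (-[1+ m ] , + n)      → cong (n ⊖_) (+-identityʳ (suc m))
      ; (-[1+ m ] , -[1+ n ]) → cong -[1+_] (+-suc m n) }

  mulℤP : PolyTime (int ⊗ int) int (uncurry ℤ._*_)
  mulℤP = ext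
    (cond (⟨ fst ▷ isNegativeP , snd ▷ isNegativeP ⟩ ▷ xorP)
          (⟨ fst ▷ absP , snd ▷ absP ⟩ ▷ mulP ▷ negateP) (⟨ fst ▷ absP , snd ▷ absP ⟩ ▷ mulP ▷ positiveP))
    λ { (+ m , + n)           → ℤ.pos-* m n
      ; (+ m , -[1+ n ])      → sym (ℤ.-◃n≡-n (m * suc n))
      ; (-[1+ m ] , + n)      → sym (ℤ.-◃n≡-n (suc m * n))
      ; (-[1+ m ] , -[1+ n ]) → refl }
    where
    xorP : PolyTime (bool ⊗ bool) bool (uncurry _xor_)
    xorP = ext (cond fst (snd ▷ notP) snd) λ { (true , _) → refl ; (false , _) → refl }

  negℤP : PolyTime int int (λ i → ℤ.- i)
  negℤP = ext (cond isNegativeP (absP ▷ positiveP) (absP ▷ negateP)) λ { (+ _) → refl ; -[1+ _ ] → refl }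

-- Vertices of a system of linear inequalities, and the gap for approximate solutions.

module LinearProgram where

  open Complexity
  open Arithmetic
  open import Data.Bool.Base using (Bool; true; false; if_then_else_; not; _∧_)
  open import Data.Integer.Base using (ℤ; +_; -[1+_]; 0ℤ; 1ℤ; _+_; _*_; -_; _-_; _≤_; _<_; +≤+; +<+; ∣_∣; positive; nonNegative)
  open import Data.Integer.Properties
  open import Data.Integer.Tactic.RingSolver using (solve-∀)
  open import Data.List.Base as List using (List; []; _∷_; concatMap; map)
  open import Data.List.Membership.Propositional using (_∈_; lose)
  open import Data.List.Membership.Propositional.Properties using (∈-map⁺; ∈-concatMap⁺)
  open import Data.List.Relation.Unary.All as All using (All; []; _∷_)
  import Data.List.Relation.Unary.All.Properties as All
  open import Data.List.Relation.Unary.Any using (here; there)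
  open import Data.Nat.Base as ℕ using (ℕ; zero; suc)
  open import Data.Nat.ListAction using (sum)
  import Data.Nat.Properties as ℕ
  open import Data.Product using (∃; _×_; _,_; proj₁; proj₂; uncurry)
  open import Data.Sum.Base using (_⊎_; inj₁; inj₂)
  open import Data.Vec.Base as Vec using (Vec; []; _∷_)
  open import Data.Vec.Relation.Unary.All using ([]; _∷_) renaming (All to VAll)
  open import Function.Base using (_∘_)
  open import Relation.Binary.PropositionalEquality
  open import Relation.Nullary using (contradiction; yes; no)

  dot : ∀ {n} → Vec ℤ n → Vec ℤ n → ℤ
  dot []      []      = 0ℤ
  dot (x ∷ u) (y ∷ v) = x * y + dot u v

  -- The combination of a row with r from which the first variable is
  -- eliminated, and the extension of a point on which r is tight.

  eliminate : ∀ {n} → Vec ℤ (suc n) → Vec ℤ (suc n) → Vec ℤ n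
  eliminate (a ∷ r) (b ∷ row) = Vec.zipWith (λ x y → a * x - b * y) row r

  extend : ∀ {n} → Vec ℤ (suc n) → Vec ℤ n → Vec ℤ (suc n)
  extend (a ∷ r) w = - dot r w ∷ Vec.map (a *_) w

  -- The constraint that the first unknown is non-negative. As its first coefficient is positive,
  -- every elimination finds at least one row that can be made tight.
  unit : ∀ n → Vec ℤ (suc n)
  unit n = 1ℤ ∷ Vec.replicate n 0ℤ

  isPositive : ℤ → Bool
  isPositive i = isNegative (- i)

  -- A system of homogeneous inequalities 0 ≤ dot row (x , z) in d
  -- non-negative unknowns x and the scale z.  If it has a solution with
  -- positive scale, then it has one on which some row with a positive
  -- first coefficient is tight.

  candidates : ∀ d → List (Vec ℤ (suc d)) → List (Vec ℤ (suc d))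
  candidates zero    rows = (1ℤ ∷ []) ∷ []
  candidates (suc d) rows = concatMap
    (λ r → if isPositive (Vec.head r)
           then map (extend r) (candidates d (map (eliminate r) (unit (suc d) ∷ rows)))
           else [])
    (unit (suc d) ∷ rows)

  Feasible : ∀ {n} → List (Vec ℤ n) → Vec ℤ n → Set
  Feasible rows x = All (λ row → 0ℤ ≤ dot row x) rows

  isPositive⇒ : ∀ {i} → isPositive i ≡ true → 0ℤ < i
  isPositive⇒ {+ suc n} _ = +<+ (ℕ.s≤s ℕ.z≤n)

  ⇒isPositive : ∀ {i} → 0ℤ < i → isPositive i ≡ true
  ⇒isPositive {+ suc n} _             = refl
  ⇒isPositive {+ zero}  (+<+ ())

  dot-combination : ∀ {n} a b (u v w : Vec ℤ n) →
    dot (Vec.zipWith (λ x y → a * x - b * y) u v) w ≡ a * dot u w - b * dot v w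
  dot-combination a b []      []      []      = lemma a b
    where
    lemma : ∀ a b → 0ℤ ≡ a * 0ℤ - b * 0ℤ
    lemma = solve-∀
  dot-combination a b (x ∷ u) (y ∷ v) (z ∷ w) =
    trans (cong (λ s → (a * x - b * y) * z + s) (dot-combination a b u v w)) (lemma a b x y z (dot u w) (dot v w))
    where
    lemma : ∀ a b x y z s t → (a * x - b * y) * z + (a * s - b * t) ≡ a * (x * z + s) - b * (y * z + t)
    lemma = solve-∀

  dot-scale : ∀ {n} a (u w : Vec ℤ n) → dot u (Vec.map (a *_) w) ≡ a * dot u w
  dot-scale a []      []      = sym (*-zeroʳ a)
  dot-scale a (x ∷ u) (y ∷ w) = trans (cong (λ s → x * (a * y) + s) (dot-scale a u w)) (lemma a x y (dot u w))
    where
    lemma : ∀ a x y s → x * (a * y) + a * s ≡ a * (x * y + s)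
    lemma = solve-∀

  dot-zero : ∀ {n} (w : Vec ℤ n) → dot (Vec.replicate n 0ℤ) w ≡ 0ℤ
  dot-zero []      = refl
  dot-zero (x ∷ w) = trans (cong₂ _+_ (*-zeroˡ x) (dot-zero w)) refl

  dot-unit : ∀ {n} x (w : Vec ℤ n) → dot (unit n) (x ∷ w) ≡ x
  dot-unit x w = trans (cong₂ _+_ (*-identityˡ x) (dot-zero w)) (+-identityʳ x)

  -- `extend` solves the equation of the tight row `r` for the first unknown. To avoid a division by
  -- its head `a`, the other coordinates are multiplied by `a`.
  dot-extend : ∀ {n} (r row : Vec ℤ (suc n)) w → dot row (extend r w) ≡ dot (eliminate r row) w
  dot-extend (a ∷ r) (b ∷ row) w = begin
    b * - dot r w + dot row (Vec.map (a *_) w) ≡⟨ cong (λ s → b * - dot r w + s) (dot-scale a row w) ⟩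
    b * - dot r w + a * dot row w              ≡⟨ lemma a b (dot row w) (dot r w) ⟩
    a * dot row w - b * dot r w                ≡⟨ sym (dot-combination a b row r w) ⟩
    dot (eliminate (a ∷ r) (b ∷ row)) w        ∎
    where
    open ≡-Reasoning
    lemma : ∀ a b s t → b * - t + a * s ≡ a * s - b * t
    lemma = solve-∀

  last-map : ∀ {n} a (w : Vec ℤ (suc n)) → Vec.last (Vec.map (a *_) w) ≡ a * Vec.last w
  last-map a (x ∷ [])    = refl
  last-map a (x ∷ y ∷ w) = last-map a (y ∷ w)

  0<* : ∀ {a b} → 0ℤ < a → 0ℤ < b → 0ℤ < a * b
  0<* {+ suc a} {+ suc b} _ _ = +<+ (ℕ.s≤s ℕ.z≤n)
  0<* {+ suc a} {+ zero}  _ (+<+ ())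
  0<* {+ zero} (+<+ ())

  0≤* : ∀ {a b} → 0ℤ ≤ a → 0ℤ ≤ b → 0ℤ ≤ a * b
  0≤* {+ a} {+ b} _ _ = subst (0ℤ ≤_) (pos-* a b) (+≤+ ℕ.z≤n)

  candidates-scale : ∀ d rows → All (λ w → 0ℤ < Vec.last w) (candidates d rows)
  candidates-scale zero    rows = +<+ (ℕ.s≤s ℕ.z≤n) ∷ []
  candidates-scale (suc d) rows = All.concat⁺ (All.map⁺ (All.universal each (unit (suc d) ∷ rows)))
    where
    each : ∀ r → All (λ w → 0ℤ < Vec.last w)
             (if isPositive (Vec.head r) then map (extend r) (candidates d (map (eliminate r) (unit (suc d) ∷ rows))) else [])
    each r@(a ∷ _) with isPositive a in pos
    ... | false = []
    ... | true  = All.map⁺ (All.map (λ { {x ∷ w} 0<w → subst (0ℤ <_) (sym (last-map a (x ∷ w))) (0<* (isPositive⇒ pos) 0<w) })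
                                    (candidates-scale d _))

  -- A row with head a > 0 and tail r bounds the first unknown from below by -(dot r w) / a. With
  -- the denominators cleared, the first row gives the larger bound at `w`.
  Beats : ∀ {n} → Vec ℤ n → Vec ℤ (suc n) → Vec ℤ (suc n) → Set
  Beats w (a ∷ r) (b ∷ s) = b * dot r w ≤ a * dot s w

  Beats-refl : ∀ {n} (w : Vec ℤ n) r → Beats w r r
  Beats-refl w (a ∷ r) = ≤-refl

  Beats-trans : ∀ {n} (w : Vec ℤ n) q r s → 0ℤ < Vec.head q → 0ℤ < Vec.head r → 0ℤ < Vec.head s →
                Beats w q r → Beats w r s → Beats w q s
  Beats-trans w (c ∷ q) (a ∷ r) (b ∷ s) 0<c 0<a 0<b q≥r r≥s =
    *-cancelˡ-≤-pos _ _ a {{positive 0<a}} (begin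
      a * (b * dot q w) ≡⟨ swap a b (dot q w) ⟩
      b * (a * dot q w) ≤⟨ *-monoˡ-≤-nonNeg b {{nonNegative (<⇒≤ 0<b)}} q≥r ⟩
      b * (c * dot r w) ≡⟨ swap b c (dot r w) ⟩
      c * (b * dot r w) ≤⟨ *-monoˡ-≤-nonNeg c {{nonNegative (<⇒≤ 0<c)}} r≥s ⟩
      c * (a * dot s w) ≡⟨ swap c a (dot s w) ⟩
      a * (c * dot s w) ∎)
    where
    open ≤-Reasoning
    swap : ∀ x y z → x * (y * z) ≡ y * (x * z)
    swap = solve-∀

  Beats-total : ∀ {n} (w : Vec ℤ n) r s → Beats w r s ⊎ Beats w s r
  Beats-total w (a ∷ r) (b ∷ s) = ≤-total (b * dot r w) (a * dot s w)

  skip-second : ∀ {A : Set} {x y z : A} {xs} → x ∈ y ∷ xs → x ∈ y ∷ z ∷ xs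
  skip-second (here eq) = here eq
  skip-second (there i) = there (there i)

  -- Making this row tight lowers the first unknown as far as the lower bounds at `w` permit.
  best : ∀ {n} (w : Vec ℤ n) r rows → 0ℤ < Vec.head r →
         ∃ λ q → q ∈ r ∷ rows × 0ℤ < Vec.head q ×
                 All (λ s → 0ℤ < Vec.head s → Beats w q s) (r ∷ rows)
  best w r []         0<r = r , here refl , 0<r , (λ _ → Beats-refl w r) ∷ []
  best w r (s ∷ rows) 0<r with best w r rows 0<r
  ... | q , q∈ , 0<q , q≥r ∷ q≥ with 0ℤ <? Vec.head s | Beats-total w q s
  ... | no  0≮s | _        = q , skip-second q∈ , 0<q , q≥r ∷ (λ 0<s → contradiction 0<s 0≮s) ∷ q≥
  ... | yes 0<s | inj₁ q≥s = q , skip-second q∈ , 0<q , q≥r ∷ (λ _ → q≥s) ∷ q≥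
  ... | yes 0<s | inj₂ s≥q = s , there (here refl) , 0<s ,
    (λ 0<t → Beats-trans w s q r 0<s 0<q 0<t s≥q (q≥r 0<t)) ∷ (λ _ → Beats-refl w s) ∷
    All.map (λ {t} q≥t 0<t → Beats-trans w s q t 0<s 0<q 0<t s≥q (q≥t 0<t)) q≥

  ∈⇒≤sum : ∀ {A : Set} (f : A → ℕ) {x xs} → x ∈ xs → f x ℕ.≤ sum (map f xs)
  ∈⇒≤sum f {xs = _ ∷ xs} (here refl) = ℕ.m≤m+n _ _
  ∈⇒≤sum f {xs = y ∷ _}  (there x∈)  = ℕ.m≤n⇒m≤o+n (f y) (∈⇒≤sum f x∈)

  -- The rows hold up to an error of z / K.  As their entries are integers,
  -- some candidate satisfies them exactly once K is large enough.

  Almost : ∀ {n} → ℕ → List (Vec ℤ (suc n)) → Vec ℤ (suc n) → Set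
  Almost K rows x = All (λ row → - Vec.last x ≤ + K * dot row x) rows

  -- The two errors of z / K are multiplied by a and b, and their sum is at most z / k.
  combine-almost : ∀ K k a b {R S z} → k ℕ.* (a ℕ.+ b) ℕ.≤ K → 0ℤ < + K → 0ℤ ≤ z →
    - z ≤ + K * R → - z ≤ + K * S → - z ≤ + k * (+ a * R + + b * S)
  combine-almost K k a b {R} {S} {z} small 0<K 0≤z R≥ S≥ =
    *-cancelˡ-≤-pos _ _ (+ K) {{positive 0<K}} (begin
      + K * - z                                        ≡⟨ sym (neg-distribʳ-* (+ K) z) ⟩
      - (+ K * z)                                      ≤⟨ neg-mono-≤ (*-monoʳ-≤-nonNeg z {{nonNegative 0≤z}} (+≤+ small)) ⟩
      - (+ (k ℕ.* (a ℕ.+ b)) * z)                      ≡⟨ cong (λ i → - (i * z)) (pos-* k (a ℕ.+ b)) ⟩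
      - (+ k * (+ a + + b) * z)                        ≡⟨ lemma₁ (+ k) (+ a) (+ b) z ⟩
      + k * (+ a * - z + + b * - z)                    ≤⟨ *-monoˡ-≤-nonNeg (+ k) (+-mono-≤ (*-monoˡ-≤-nonNeg (+ a) R≥) (*-monoˡ-≤-nonNeg (+ b) S≥)) ⟩
      + k * (+ a * (+ K * R) + + b * (+ K * S))        ≡⟨ lemma₂ (+ k) (+ a) (+ b) (+ K) R S ⟩
      + K * (+ k * (+ a * R + + b * S))                ∎)
    where
    open ≤-Reasoning
    lemma₁ : ∀ k a b z → - (k * (a + b) * z) ≡ k * (a * - z + b * - z)
    lemma₁ = solve-∀
    lemma₂ : ∀ k a b K R S → k * (a * (K * R) + b * (K * S)) ≡ K * (k * (a * R + b * S))
    lemma₂ = solve-∀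

  -- Induction over the unknowns: without its first coordinate, the given point still almost
  -- satisfies the system from which that unknown has been eliminated with the strongest lower
  -- bound. An exact solution of the smaller system extends to one of the larger.
  gap : ∀ d rows → ∃ λ K → ∀ x → VAll (0ℤ ≤_) x → 0ℤ < Vec.last x → Almost K rows x →
        ∃ λ w → w ∈ candidates d rows × Feasible rows w
  -- A coefficient a ≤ -1 would give 2 a z ≤ -2 z < -z, so the constant 2 excludes it; by
  -- homogeneity the scale 1 is then a solution.
  gap zero    rows = 2 , λ { (z ∷ []) _ 0<z almost → 1ℤ ∷ [] , here refl , All.map (λ { {a ∷ []} → feasible a 0<z }) almost }
    where
    feasible : ∀ a {z} → 0ℤ < z → - z ≤ + 2 * (a * z + 0ℤ) → 0ℤ ≤ a * 1ℤ + 0ℤ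
    feasible (+ a)    {z} 0<z _  = subst (0ℤ ≤_) (lemma (+ a)) (+≤+ ℕ.z≤n)
      where
      lemma : ∀ a → a ≡ a * 1ℤ + 0ℤ
      lemma = solve-∀
    feasible -[1+ n ] {z} 0<z z≤ = contradiction (begin-strict
      - z                                          ≤⟨ z≤ ⟩
      + 2 * (-[1+ n ] * z + 0ℤ)                     ≡⟨ lemma (+ n) z ⟩
      - z - (z + + 2 * (+ n * z))                   <⟨ +-monoʳ-< (- z) (neg-mono-< (+-mono-<-≤ 0<z (0≤* {+ 2} (+≤+ ℕ.z≤n) (0≤* {+ n} (+≤+ ℕ.z≤n) (<⇒≤ 0<z))))) ⟩
      - z + 0ℤ                                      ≡⟨ +-identityʳ (- z) ⟩
      - z                                          ∎) (<-irrefl refl)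
      where
      open ≤-Reasoning
      lemma : ∀ n z → + 2 * (- (1ℤ + n) * z + 0ℤ) ≡ - z - (z + + 2 * (n * z))
      lemma = solve-∀
  gap (suc d) rows = K , solve
    where
    rows⁺ = unit (suc d) ∷ rows
    gaps : ∀ r → ∃ λ K → ∀ x → VAll (0ℤ ≤_) x → 0ℤ < Vec.last x → Almost K (map (eliminate r) rows⁺) x →
           ∃ λ w → w ∈ candidates d (map (eliminate r) rows⁺) × Feasible (map (eliminate r) rows⁺) w
    gaps r = gap d (map (eliminate r) rows⁺)
    magnitude : Vec ℤ (2 ℕ.+ d) → ℕ
    magnitude row = ∣ Vec.head row ∣
    k A K : ℕ
    k = sum (map (proj₁ ∘ gaps) rows⁺)
    A = sum (map magnitude rows⁺)
    -- k dominates the constants of all reduced systems and A all first coefficients, so that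
    -- `combine-almost` applies to every pair of rows; `suc` makes K positive.
    K = suc (k ℕ.* (A ℕ.+ A))

    module _ {x₀ : ℤ} {w : Vec ℤ (suc d)} (0≤z : 0ℤ ≤ Vec.last w) where

      z = Vec.last w

      nonpositive : ∀ a b r row → (+ a ∷ r) ∈ rows⁺ → (- + b ∷ row) ∈ rows⁺ →
        - z ≤ + K * dot (+ a ∷ r) (x₀ ∷ w) → - z ≤ + K * dot (- + b ∷ row) (x₀ ∷ w) →
        - z ≤ + proj₁ (gaps (+ a ∷ r)) * dot (eliminate (+ a ∷ r) (- + b ∷ row)) w
      nonpositive a b r row r∈ row∈ r≥ row≥ = ≤-trans
        (combine-almost K (proj₁ (gaps (+ a ∷ r))) a b
          (ℕ.m≤n⇒m≤1+n (ℕ.*-mono-≤ (∈⇒≤sum (proj₁ ∘ gaps) r∈) (ℕ.+-mono-≤ (∈⇒≤sum magnitude r∈)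
            (subst (ℕ._≤ A) (∣-i∣≡∣i∣ (+ b)) (∈⇒≤sum magnitude row∈)))))
          (+<+ (ℕ.s≤s ℕ.z≤n)) 0≤z row≥ r≥)
        (≤-reflexive (cong (λ i → + proj₁ (gaps (+ a ∷ r)) * i)
          (trans (lemma (+ a) (+ b) x₀ (dot row w) (dot r w)) (sym (dot-combination (+ a) (- + b) row r w)))))
        where
        lemma : ∀ a b x s t → a * (- b * x + s) + b * (a * x + t) ≡ a * s - - b * t
        lemma = solve-∀

      -- A row with positive head is another lower bound, and its reduced form holds exactly because
      -- `r` beats it. A row with head -b, b ≥ 0, is combined with `r` as in Fourier-Motzkin
      -- elimination, at the price of a larger error.
      reduced : ∀ r row → r ∈ rows⁺ → row ∈ rows⁺ → 0ℤ < Vec.head r → (0ℤ < Vec.head row → Beats w r row) →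
        - z ≤ + K * dot r (x₀ ∷ w) → - z ≤ + K * dot row (x₀ ∷ w) →
        - z ≤ + proj₁ (gaps r) * dot (eliminate r row) w
      reduced (+ 0     ∷ r) row              r∈ row∈ (+<+ ()) beats r≥ row≥
      reduced (+ suc a ∷ r) (+ suc b  ∷ row) r∈ row∈ 0<a beats r≥ row≥ =
        ≤-trans (neg-mono-≤ 0≤z) (0≤* {+ proj₁ (gaps (+ suc a ∷ r))} (+≤+ ℕ.z≤n)
          (subst (0ℤ ≤_) (sym (dot-combination (+ suc a) (+ suc b) row r w)) (i≤j⇒0≤j-i (beats (+<+ (ℕ.s≤s ℕ.z≤n))))))
      reduced (+ suc a ∷ r) (+ 0      ∷ row) r∈ row∈ 0<a beats r≥ row≥ = nonpositive (suc a) 0 r row r∈ row∈ r≥ row≥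
      reduced (+ suc a ∷ r) (-[1+ b ] ∷ row) r∈ row∈ 0<a beats r≥ row≥ = nonpositive (suc a) (suc b) r row r∈ row∈ r≥ row≥

    extended : ∀ r w → r ∈ rows⁺ → 0ℤ < Vec.head r → w ∈ candidates d (map (eliminate r) rows⁺) →
               extend r w ∈ candidates (suc d) rows
    extended r w r∈ 0<r w∈ = ∈-concatMap⁺ _ (lose r∈ (subst (λ b → extend r w ∈ (if b then map (extend r) (candidates d (map (eliminate r) rows⁺)) else []))
      (sym (⇒isPositive 0<r)) (∈-map⁺ (extend r) w∈)))

    almost⁺ : ∀ {x₀ x₁} {w : Vec ℤ d} → 0ℤ ≤ x₀ → 0ℤ < Vec.last (x₁ ∷ w) →
              Almost K rows (x₀ ∷ x₁ ∷ w) → Almost K rows⁺ (x₀ ∷ x₁ ∷ w)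
    almost⁺ {x₀} {x₁} {w} 0≤x₀ 0<z almost = ≤-trans (neg-mono-≤ (<⇒≤ 0<z))
      (0≤* {+ K} (+≤+ ℕ.z≤n) (subst (0ℤ ≤_) (sym (dot-unit x₀ (x₁ ∷ w))) 0≤x₀)) ∷ almost

    solve : ∀ x → VAll (0ℤ ≤_) x → 0ℤ < Vec.last x → Almost K rows x → ∃ λ w → w ∈ candidates (suc d) rows × Feasible rows w
    solve (x₀ ∷ w@(_ ∷ _)) (0≤x₀ ∷ 0≤w) 0<z almost with best w (unit (suc d)) rows (+<+ (ℕ.s≤s ℕ.z≤n)) | almost⁺ 0≤x₀ 0<z almost
    ... | r , r∈ , 0<r , beats | almost′
      with v , v∈ , feasible ← proj₂ (gaps r) w 0≤w 0<z (All.map⁺ (All.tabulate λ {row} row∈ →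
             reduced (<⇒≤ 0<z) r row r∈ row∈ 0<r (All.lookup beats row∈) (All.lookup almost′ r∈) (All.lookup almost′ row∈)))
      = extend r v , extended r v r∈ 0<r v∈ ,
        All.map (λ {row} 0≤ → subst (0ℤ ≤_) (sym (dot-extend r row v)) 0≤) (All.tail (All.map⁻ feasible))

  -- Programs for the elimination and for testing the candidates.

  dotP : ∀ n → PolyTime (vec int n ⊗ vec int n) int (uncurry dot)
  dotP zero    = ext (constant 0ℤ) λ { ([] , []) → refl }
  dotP (suc n) = ext (⟨ ⟨ fst ▷ vhead , snd ▷ vhead ⟩ ▷ mulℤP , ⟨ fst ▷ vtail , snd ▷ vtail ⟩ ▷ dotP n ⟩ ▷ addℤP)
                     λ { (_ ∷ _ , _ ∷ _) → refl }

  scaleP : ∀ n → PolyTime (int ⊗ vec int n) (vec int n) (λ (a , w) → Vec.map (a *_) w)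
  scaleP n = vmapP n mulℤP

  subtractP : ∀ n → PolyTime (vec int n ⊗ vec int n) (vec int n) (λ (u , v) → Vec.zipWith _-_ u v)
  subtractP n = vzipWithP n (⟨ fst , snd ▷ negℤP ⟩ ▷ addℤP)

  eliminateP : ∀ n → PolyTime (vec int (suc n) ⊗ vec int (suc n)) (vec int n) (uncurry eliminate)
  eliminateP n = ext
    (⟨ ⟨ fst ▷ vhead , snd ▷ vtail ⟩ ▷ scaleP n , ⟨ snd ▷ vhead , fst ▷ vtail ⟩ ▷ scaleP n ⟩ ▷ subtractP n)
    λ { (a ∷ r , b ∷ row) → eq a b row r }
    where
    eq : ∀ {n} a b (u v : Vec ℤ n) →
         Vec.zipWith _-_ (Vec.map (a *_) u) (Vec.map (b *_) v) ≡ Vec.zipWith (λ x y → a * x - b * y) u v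
    eq a b []      []      = refl
    eq a b (x ∷ u) (y ∷ v) = cong (a * x - b * y ∷_) (eq a b u v)

  extendP : ∀ n → PolyTime (vec int (suc n) ⊗ vec int n) (vec int (suc n)) (uncurry extend)
  extendP n = ext (⟨ ⟨ fst ▷ vtail , snd ⟩ ▷ dotP n ▷ negℤP , ⟨ fst ▷ vhead , snd ⟩ ▷ scaleP n ⟩ ▷ vcons)
                  λ { (a ∷ r , w) → refl }

  isPositiveP : PolyTime int bool isPositive
  isPositiveP = negℤP ▷ isNegativeP

  -- The recursion over the unknowns is unfolded in the program. For each d the bound is a fixed
  -- composition of polynomials, whose degree depends on d.
  candidatesP : ∀ d → PolyTime (list (vec int (suc d))) (list (vec int (suc d))) (candidates d)
  candidatesP zero    = constant _
  candidatesP (suc d) =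
    ⟨ rows⁺ , rows⁺ ⟩ ▷ concatMapP
      (cond (snd ▷ vhead ▷ isPositiveP)
        (⟨ snd , ⟨ snd , fst ⟩ ▷ mapP (eliminateP (suc d)) ▷ candidatesP d ⟩ ▷ mapP (extendP (suc d)))
        nilP)
    where
    rows⁺ : PolyTime (list (vec int (2 ℕ.+ d))) (list (vec int (2 ℕ.+ d))) (unit (suc d) ∷_)
    rows⁺ = ⟨ constant (unit (suc d)) , identity ⟩ ▷ consP

  feasibleᵇ : ∀ {n} → List (Vec ℤ n) → Vec ℤ n → Bool
  feasibleᵇ rows x = List.foldl (λ b row → b ∧ not (isNegative (dot row x))) true rows

  feasibleᵇP : ∀ n → PolyTime (vec int n ⊗ list (vec int n)) bool (λ (x , rows) → feasibleᵇ rows x)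
  feasibleᵇP n = allP (⟨ snd , fst ⟩ ▷ dotP n ▷ isNegativeP ▷ notP)

  isNegative-false⇒ : ∀ i → not (isNegative i) ≡ true → 0ℤ ≤ i
  isNegative-false⇒ (+ n) _ = +≤+ ℕ.z≤n

  feasibleᵇ⇒ : ∀ {n} rows (x : Vec ℤ n) → feasibleᵇ rows x ≡ true → Feasible rows x
  feasibleᵇ⇒ rows x eq = proj₂ (go true rows eq)
    where
    go : ∀ b rows → List.foldl (λ b row → b ∧ not (isNegative (dot row x))) b rows ≡ true → b ≡ true × Feasible rows x
    go b []           eq = eq , []
    go b (row ∷ rows) eq with go _ rows eq
    ... | b∧ , all with b | not (isNegative (dot row x)) in nonneg
    ... | true | true = refl , isNegative-false⇒ _ nonneg ∷ all

  ⇒feasibleᵇ : ∀ {n} rows (x : Vec ℤ n) → Feasible rows x → feasibleᵇ rows x ≡ true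
  ⇒feasibleᵇ []           x []          = refl
  ⇒feasibleᵇ (row ∷ rows) x (0≤ ∷ rest) with dot row x | 0≤
  ... | + _ | +≤+ _ = ⇒feasibleᵇ rows x rest

-- The traversal of a cycle.

module CycleOrder where

  open import Defs using (Graph; IsCycle; Next; Side; left; right)
  open import Data.Bool.Base using (Bool; true; false)
  open import Data.Fin.Base as Fin using (Fin; zero; suc; toℕ; fromℕ<; opposite; punchOut)
  open import Data.Fin.Permutation as Perm using (Permutation′; _⟨$⟩ʳ_; _⟨$⟩ˡ_; _∘ₚ_; reverse)
  open import Data.Fin.Properties using (toℕ-injective; toℕ-fromℕ<; toℕ<n; opposite-prop; any?; _≟_; injective⇒≤; punchOut-injective; opposite-involutive)
  import Data.Fin.Properties as Fin
  open import Data.Nat.Base using (ℕ; zero; suc; _+_; _*_; _∸_; _≤_; _<_; z≤n; s≤s; NonZero; >-nonZero; _%_; _/_)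
  open import Data.Nat.DivMod
  open import Data.Nat.Properties hiding (_≟_)
  open import Data.Product using (∃; _×_; _,_; proj₁; proj₂)
  open import Data.Sum.Base using (_⊎_; inj₁; inj₂; [_,_]′; swap)
  open import Function.Base using (_∘_)
  open import Function.Bundles using (_⇔_; Equivalence; mk⇔)
  open import Relation.Binary.PropositionalEquality
  open import Relation.Nullary using (contradiction; yes; no)

  -- By the pigeonhole principle: a missed value could be punched out, leaving an injection into a
  -- smaller set.
  injective⇒surjective : ∀ {n} (f : Fin n → Fin n) → (∀ i j → f i ≡ f j → i ≡ j) → ∀ y → ∃ λ x → f x ≡ y
  injective⇒surjective {n} f inj y with any? (λ x → f x ≟ y)
  ... | yes found = found
  injective⇒surjective {suc n} f inj y | no missed = contradiction
    (injective⇒≤ {f = λ x → punchOut (λ eq → missed (x , sym eq))}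
      (λ {i} {j} eq → inj i j (punchOut-injective (λ e → missed (i , sym e)) (λ e → missed (j , sym e)) eq)))
    1+n≰n

  %-period : ∀ a d N .{{_ : NonZero N}} → d < N → (a + d) % N ≡ a % N → d ≡ 0
  %-period a d N d<N eq = [ low , high ]′ (≤-<-connex ((a + d) / N) (a / N))
    where
    same : a / N * N + d ≡ (a + d) / N * N
    same = +-cancelˡ-≡ (a % N) _ _ (begin
      a % N + (a / N * N + d)            ≡⟨ sym (+-assoc (a % N) _ d) ⟩
      a % N + a / N * N + d              ≡⟨ cong (_+ d) (sym (m≡m%n+[m/n]*n a N)) ⟩
      a + d                              ≡⟨ m≡m%n+[m/n]*n (a + d) N ⟩
      (a + d) % N + (a + d) / N * N      ≡⟨ cong (_+ ((a + d) / N * N)) eq ⟩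
      a % N + (a + d) / N * N            ∎)
      where open ≡-Reasoning
    low : (a + d) / N ≤ a / N → d ≡ 0
    low q≤ = n≤0⇒n≡0 (+-cancelˡ-≤ (a / N * N) d 0
      (subst₂ _≤_ (sym same) (sym (+-identityʳ _)) (*-monoˡ-≤ N q≤)))
    high : a / N < (a + d) / N → d ≡ 0
    high q< = contradiction d<N (≤⇒≯ (+-cancelˡ-≤ (a / N * N) N d
      (subst₂ _≤_ (+-comm N _) (sym same) (*-monoˡ-≤ N q<))))

  %-injective : ∀ a {i j} N .{{_ : NonZero N}} → i < N → j < N → (a + i) % N ≡ (a + j) % N → i ≡ j
  %-injective a {i} {j} N i<N j<N eq with ≤-total i j
  ... | inj₁ i≤j = ≤-antisym i≤j (m∸n≡0⇒m≤n (%-period (a + i) (j ∸ i) N (≤-<-trans (m∸n≤m j i) j<N)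
    (trans (cong (_% N) (trans (+-assoc a i _) (cong (a +_) (m+[n∸m]≡n i≤j)))) (sym eq))))
  ... | inj₂ j≤i = ≤-antisym (m∸n≡0⇒m≤n (%-period (a + j) (i ∸ j) N (≤-<-trans (m∸n≤m i j) i<N)
    (trans (cong (_% N) (trans (+-assoc a j _) (cong (a +_) (m+[n∸m]≡n j≤i)))) eq))) j≤i

  next-functional : ∀ {n} {i j k : Fin n} → Next i j → Next i k → j ≡ k
  next-functional (inj₁ p)       (inj₁ q)       = toℕ-injective (trans p (sym q))
  next-functional (inj₁ p)       (inj₂ (q , _)) = contradiction (trans p q) (<⇒≢ (toℕ<n _))
  next-functional (inj₂ (p , _)) (inj₁ q)       = contradiction (trans q p) (<⇒≢ (toℕ<n _))
  next-functional (inj₂ (_ , p)) (inj₂ (_ , q)) = toℕ-injective (trans p (sym q))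

  next-injective : ∀ {n} {i j k : Fin n} → Next i k → Next j k → i ≡ j
  next-injective (inj₁ p)       (inj₁ q)       = toℕ-injective (suc-injective (trans (sym p) q))
  next-injective (inj₁ p)       (inj₂ (_ , q)) with () ← trans (sym p) q
  next-injective (inj₂ (_ , p)) (inj₁ q)       with () ← trans (sym q) p
  next-injective (inj₂ (p , _)) (inj₂ (q , _)) = toℕ-injective (suc-injective (trans p (sym q)))

  suc-% : ∀ n x .{{_ : NonZero n}} → suc x % n ≡ suc (x % n) % n
  suc-% n x = begin
    suc x % n                          ≡⟨ cong (λ y → suc y % n) (m≡m%n+[m/n]*n x n) ⟩
    (suc (x % n) + x / n * n) % n      ≡⟨ [m+kn]%n≡m%n (suc (x % n)) (x / n) n ⟩
    suc (x % n) % n                    ∎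
    where open ≡-Reasoning

  next-% : ∀ n x .{{_ : NonZero n}} → Next (x mod n) (suc x mod n)
  next-% n x with m≤n⇒m<n∨m≡n (m%n<n x n)
  ... | inj₁ lt = inj₁ (trans (toℕ-fromℕ< (m%n<n (suc x) n)) (trans (suc-% n x)
                    (trans (m<n⇒m%n≡m lt) (cong suc (sym (toℕ-fromℕ< (m%n<n x n)))))))
  ... | inj₂ eq = inj₂ (trans (cong suc (toℕ-fromℕ< (m%n<n x n))) eq ,
                        trans (toℕ-fromℕ< (m%n<n (suc x) n)) (trans (suc-% n x) (trans (cong (_% n) eq) (n%n≡0 n))))

  next-opposite : ∀ {n} {i j : Fin n} → Next i j → Next (opposite j) (opposite i)
  next-opposite {n} {i} {j} (inj₁ p) = inj₁ (begin
    toℕ (opposite i)                 ≡⟨ opposite-prop i ⟩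
    n ∸ suc (toℕ i)                  ≡⟨ cong (n ∸_) (sym p) ⟩
    n ∸ toℕ j                        ≡⟨ +-∸-assoc 1 (toℕ<n j) ⟩
    suc (n ∸ suc (toℕ j))            ≡⟨ cong suc (sym (opposite-prop j)) ⟩
    suc (toℕ (opposite j))           ∎)
    where open ≡-Reasoning
  next-opposite {suc n} {i} {j} (inj₂ (p , q)) = inj₂
    (cong suc (trans (opposite-prop j) (cong (n ∸_) q)) ,
     trans (opposite-prop i) (trans (cong (suc n ∸_) p) (n∸n≡0 (suc n))))

  other : Side → Side
  other left  = right
  other right = left

  start finish : Bool → Side
  start false = left
  start true  = right
  finish b = other (start b)

  -- The edges and vertices of a cycle in cyclic order, beginning with the
  -- edge number 0 traversed from left to right.  The flag of an edge says
  -- whether it is traversed from right to left.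

  record CyclicOrder (G : Graph) : Set where
    open Graph G
    field
      2≤#E       : 2 ≤ #E
      edge       : ℕ → E
      vertex     : ℕ → V
      reversed   : ℕ → Bool
      first      : toℕ (edge 0) ≡ 0 × reversed 0 ≡ false
      starts     : ∀ k → endpoint (edge k) (start (reversed k)) ≡ vertex k
      finishes   : ∀ k → endpoint (edge k) (finish (reversed k)) ≡ vertex (suc k)
      closed     : vertex #E ≡ vertex 0
      distinctᵛ  : ∀ {i j} → i < #E → j < #E → vertex i ≡ vertex j → i ≡ j
      distinctᵉ  : ∀ {i j} → i < #E → j < #E → edge i ≡ edge j → i ≡ j
      position   : ∀ e → ∃ λ k → k < #E × edge k ≡ e
      incident   : ∀ e s k → endpoint e s ≡ vertex (suc k) → e ≡ edge k ⊎ e ≡ edge (suc k)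

  module _ (G : Graph) where
    open Graph G

    Joins : V → V → E → Set
    Joins u v e = (endpoint e left ≡ u × endpoint e right ≡ v) ⊎ (endpoint e left ≡ v × endpoint e right ≡ u)

    joins-unique : ∀ {u v d e} → Joins u v d → Joins u v e → d ≡ e
    joins-unique {d = d} {e} (inj₁ (p , q)) (inj₁ (r , s)) = simple λ { left → trans p (sym r) ; right → trans q (sym s) }
    joins-unique {d = d} {e} (inj₂ (p , q)) (inj₂ (r , s)) = simple λ { left → trans p (sym r) ; right → trans q (sym s) }
    joins-unique {d = d} {e} (inj₁ (p , q)) (inj₂ (r , s)) =
      contradiction (subst₂ Fin._<_ p q (ordered d)) (Fin.<-asym (subst₂ Fin._<_ r s (ordered e)))
    joins-unique {d = d} {e} (inj₂ (p , q)) (inj₁ (r , s)) =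
      contradiction (subst₂ Fin._<_ p q (ordered d)) (Fin.<-asym (subst₂ Fin._<_ r s (ordered e)))

    joins-other : ∀ e s → Joins (endpoint e s) (endpoint e (other s)) e
    joins-other e left  = inj₁ (refl , refl)
    joins-other e right = inj₂ (refl , refl)

    Cyclic : Permutation′ #V → Set
    Cyclic σ = ∀ i j → Neighbours (σ ⟨$⟩ʳ i) (σ ⟨$⟩ʳ j) ⇔ (Next i j ⊎ Next j i)

    reverse-cyclic : ∀ σ → Cyclic σ → Cyclic (reverse ∘ₚ σ)
    reverse-cyclic σ cyc i j = mk⇔
      (λ nb → [ (λ p → inj₂ (back p)) , (λ p → inj₁ (back p)) ]′ (Equivalence.to (cyc (opposite i) (opposite j)) nb))
      (λ { (inj₁ p) → Equivalence.from (cyc (opposite i) (opposite j)) (inj₂ (next-opposite p))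
         ; (inj₂ p) → Equivalence.from (cyc (opposite i) (opposite j)) (inj₁ (next-opposite p)) })
      where
      back : ∀ {i j} → Next (opposite i) (opposite j) → Next j i
      back {i} {j} p = subst₂ Next (opposite-involutive j) (opposite-involutive i) (next-opposite p)

    -- The traversal has to begin as the walk of the algorithm does, with the edge 0 from left to
    -- right. This requires `σ` to run in that direction; if it does not, it is reversed beforehand.
    module Ordered (3≤#V : 3 ≤ #V) (σ : Permutation′ #V) (cyc : Cyclic σ)
                   (e₀ : E) (e₀≡0 : toℕ e₀ ≡ 0) (i₀ : Fin #V)
                   (leftmost : σ ⟨$⟩ʳ i₀ ≡ endpoint e₀ left)
                   (ascending : Next i₀ (σ ⟨$⟩ˡ endpoint e₀ right)) where

      instance
        #V-nonZero : NonZero #V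
        #V-nonZero = >-nonZero (≤-trans (s≤s z≤n) 3≤#V)

      index : ℕ → Fin #V
      index k = (toℕ i₀ + k) mod #V

      vertex : ℕ → V
      vertex k = σ ⟨$⟩ʳ index k

      index-next : ∀ k → Next (index k) (index (suc k))
      index-next k = subst (λ x → Next (index k) (x mod #V)) (sym (+-suc (toℕ i₀) k)) (next-% #V (toℕ i₀ + k))

      joined : ∀ k → ∃ (Joins (vertex k) (vertex (suc k)))
      joined k = Equivalence.from (cyc (index k) (index (suc k))) (inj₁ (index-next k))

      edge : ℕ → E
      edge k = proj₁ (joined k)

      reversed : ℕ → Bool
      reversed k with proj₂ (joined k)
      ... | inj₁ _ = false
      ... | inj₂ _ = true

      starts : ∀ k → endpoint (edge k) (start (reversed k)) ≡ vertex k
      starts k with proj₂ (joined k)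
      ... | inj₁ (p , _) = p
      ... | inj₂ (_ , q) = q

      finishes : ∀ k → endpoint (edge k) (finish (reversed k)) ≡ vertex (suc k)
      finishes k with proj₂ (joined k)
      ... | inj₁ (_ , q) = q
      ... | inj₂ (p , _) = p

      σ-injective : ∀ {i j} → σ ⟨$⟩ʳ i ≡ σ ⟨$⟩ʳ j → i ≡ j
      σ-injective eq = trans (sym (Perm.inverseˡ σ)) (trans (cong (σ ⟨$⟩ˡ_) eq) (Perm.inverseˡ σ))

      toℕ-index : ∀ k → toℕ (index k) ≡ (toℕ i₀ + k) % #V
      toℕ-index k = toℕ-fromℕ< (m%n<n (toℕ i₀ + k) #V)

      vertex-injective : ∀ {i j} → i < #V → j < #V → vertex i ≡ vertex j → i ≡ j
      vertex-injective i< j< eq = %-injective (toℕ i₀) #V i< j<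
        (trans (sym (toℕ-index _)) (trans (cong toℕ (σ-injective eq)) (toℕ-index _)))

      vertex-period : ∀ k → vertex (k + #V) ≡ vertex k
      vertex-period k = cong (σ ⟨$⟩ʳ_) (toℕ-injective (trans (toℕ-index (k + #V))
        (trans (trans (cong (_% #V) (sym (+-assoc (toℕ i₀) k #V))) ([m+n]%n≡m%n (toℕ i₀ + k) #V)) (sym (toℕ-index k)))))

      edge-unique : ∀ k {e} → Joins (vertex k) (vertex (suc k)) e → e ≡ edge k
      edge-unique k j = joins-unique j (proj₂ (joined k))

      -- The other end of `e` is a neighbour of the vertex and hence comes directly before or after
      -- it. As the graph is simple, this determines `e`.
      incident : ∀ e s k → endpoint e s ≡ vertex (suc k) → e ≡ edge k ⊎ e ≡ edge (suc k)
      incident e s k eq with Equivalence.to (cyc (index (suc k)) q) (e , subst₂ (λ u v → Joins u v e) eq (sym (Perm.inverseʳ σ)) (joins-other e s))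
        where q = σ ⟨$⟩ˡ endpoint e (other s)
      ... | inj₁ next = inj₂ (edge-unique (suc k) (subst₂ (λ u v → Joins u v e) eq
              (trans (sym (Perm.inverseʳ σ)) (cong (σ ⟨$⟩ʳ_) (next-functional next (index-next (suc k))))) (joins-other e s)))
      ... | inj₂ next = inj₁ (edge-unique k (swap (subst₂ (λ u v → Joins u v e) eq
              (trans (sym (Perm.inverseʳ σ)) (cong (σ ⟨$⟩ʳ_) (next-injective next (index-next k)))) (joins-other e s))))

      vertex-wrap : vertex #V ≡ vertex 0
      vertex-wrap = vertex-period 0

      -- An edge met twice in the same direction has the same first vertex both times. Met in
      -- opposite directions, it would make two vertices two steps apart coincide, which leaves at
      -- most 2 vertices.
      edge-injective : ∀ {i j} → i < #V → j < #V → edge i ≡ edge j → i ≡ j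
      edge-injective {i} {j} i< j< eq with reversed i in ri | reversed j in rj
      ... | b | c with same-or-other b c
        where
        same-or-other : ∀ b c → b ≡ c ⊎ start b ≡ finish c × finish b ≡ start c
        same-or-other false false = inj₁ refl
        same-or-other false true  = inj₂ (refl , refl)
        same-or-other true  false = inj₂ (refl , refl)
        same-or-other true  true  = inj₁ refl
      ... | inj₁ refl = vertex-injective i< j< (trans (sym (starts i))
            (trans (cong₂ endpoint eq (cong start (trans ri (sym rj)))) (starts j)))
      ... | inj₂ (p , q) = contradiction 3≤#V (<⇒≱ (s≤s (absurd (m≤n⇒m<n∨m≡n i<) (m≤n⇒m<n∨m≡n j<))))
        where
        i≈j+1 : vertex i ≡ vertex (suc j)
        i≈j+1 = trans (sym (starts i)) (trans (cong₂ endpoint eq (trans (cong start ri) (trans p (cong finish (sym rj))))) (finishes j))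
        i+1≈j : vertex (suc i) ≡ vertex j
        i+1≈j = trans (sym (finishes i)) (trans (cong₂ endpoint eq (trans (cong finish ri) (trans q (cong start (sym rj))))) (starts j))
        twice : ∀ {k} → suc k < #V → vertex (suc (suc k)) ≡ vertex k → #V ≤ 2
        twice {k} k+1< eq with m≤n⇒m<n∨m≡n k+1<
        ... | inj₁ k+2<  = contradiction (vertex-injective k+2< (<-trans (n<1+n k) k+1<) eq) (>⇒≢ (≤-trans (n<1+n k) (n≤1+n _)))
        -- Here the vertex two steps ahead is the vertex 0 again, so k = 0.
        ... | inj₂ k+2≡  = ≤-reflexive (trans (sym k+2≡) (cong (2 +_) (sym (vertex-injective (≤-trans (s≤s z≤n) 3≤#V)
                             (<-trans (n<1+n k) k+1<) (trans (sym vertex-wrap) (trans (cong vertex (sym k+2≡)) eq))))))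
        absurd : suc i < #V ⊎ suc i ≡ #V → suc j < #V ⊎ suc j ≡ #V → #V ≤ 2
        absurd _ (inj₁ j+1<) with refl ← vertex-injective i< j+1< i≈j+1 = twice j+1< i+1≈j
        absurd (inj₁ i+1<) (inj₂ _) with refl ← vertex-injective j< i+1< (sym i+1≈j) = twice i+1< (sym i≈j+1)
        absurd (inj₂ i+1≡) (inj₂ j+1≡) = contradiction
          (trans (vertex-injective i< (≤-trans (s≤s z≤n) 3≤#V) (trans i≈j+1 (trans (cong vertex j+1≡) vertex-wrap))) refl)
          λ i≡0 → <⇒≱ (≤-trans (s≤s (s≤s z≤n)) 3≤#V) (≤-reflexive (trans (sym i+1≡) (cong suc i≡0)))

      first : e₀ ≡ edge 0 × reversed 0 ≡ false
      first = eq , forward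
        where
        index₀ : index 0 ≡ i₀
        index₀ = toℕ-injective (trans (toℕ-index 0) (trans (cong (_% #V) (+-identityʳ _)) (m<n⇒m%n≡m (toℕ<n i₀))))
        start₀ : endpoint e₀ left ≡ vertex 0
        start₀ = trans (sym leftmost) (cong (σ ⟨$⟩ʳ_) (sym index₀))
        eq : e₀ ≡ edge 0
        eq = edge-unique 0 (inj₁ (start₀ ,
          trans (sym (Perm.inverseʳ σ)) (cong (σ ⟨$⟩ʳ_) (next-functional (subst (λ i → Next i _) (sym index₀) ascending) (index-next 0)))))
        forward : reversed 0 ≡ false
        forward with reversed 0 | starts 0
        ... | false | _ = refl
        ... | true  | p = contradiction (ordered e₀) (Fin.<-irrefl (trans start₀ (trans (sym p) (cong (λ e → endpoint e right) (sym eq)))))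

      -- The left end of the edge is some vertex of the order, and by `incident` the edge is the one
      -- before or the one after it.
      covered : ∀ e → ∃ λ k → k < #V × edge k ≡ e
      covered e with injective⇒surjective (λ i → vertex (toℕ i))
                       (λ i j eq → toℕ-injective (vertex-injective (toℕ<n i) (toℕ<n j) eq)) (endpoint e left)
      ... | i , eq = at (toℕ i) (toℕ<n i) eq
        where
        wrap : ∀ k → suc k ≤ #V → e ≡ edge (suc k) → ∃ λ k → k < #V × edge k ≡ e
        wrap k k< eq with m≤n⇒m<n∨m≡n k<
        ... | inj₁ k+1< = suc k , k+1< , sym eq
        ... | inj₂ k+1≡ = 0 , ≤-trans (s≤s z≤n) 3≤#V , sym (trans eq (trans (cong edge k+1≡)
                (edge-unique 0 (subst₂ (λ u v → Joins u v (edge #V)) vertex-wrap (vertex-period 1) (proj₂ (joined #V))))))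
        pick : ∀ k → k < #V → e ≡ edge k ⊎ e ≡ edge (suc k) → ∃ λ k → k < #V × edge k ≡ e
        pick k k< (inj₁ eq) = k , k< , sym eq
        pick k k< (inj₂ eq) = wrap k k< eq
        at : ∀ k → k < #V → vertex k ≡ endpoint e left → ∃ λ k → k < #V × edge k ≡ e
        at (suc k) k< eq = pick k (<-trans (n<1+n k) k<) (incident e left k (sym eq))
        -- The edge before the vertex 0 is the last one, so the position 0 is read as #V.
        at zero    k< eq = last #V 3≤#V refl
          where
          last : ∀ n → 3 ≤ n → n ≡ #V → ∃ λ k → k < #V × edge k ≡ e
          last (suc n) _ n≡ = pick n (≤-reflexive n≡)
            (incident e left n (trans (sym eq) (trans (sym vertex-wrap) (cong vertex (sym n≡)))))

      #E≡#V : #E ≡ #V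
      #E≡#V = ≤-antisym
        (injective⇒≤ {f = λ e → fromℕ< (proj₁ (proj₂ (covered e)))} λ {d} {e} eq →
          trans (sym (proj₂ (proj₂ (covered d)))) (trans (cong edge (Fin.fromℕ<-injective _ _ _ _ eq)) (proj₂ (proj₂ (covered e)))))
        (injective⇒≤ {f = edge ∘ toℕ} λ {i} {j} eq → toℕ-injective (edge-injective (toℕ<n i) (toℕ<n j) eq))

      cyclicOrder : CyclicOrder G
      cyclicOrder = record
        { 2≤#E      = subst (2 ≤_) (sym #E≡#V) (≤-trans (n≤1+n 2) 3≤#V)
        ; edge      = edge
        ; vertex    = vertex
        ; reversed  = reversed
        ; first     = trans (cong toℕ (sym (proj₁ first))) e₀≡0 , proj₂ first
        ; starts    = starts
        ; finishes  = finishes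
        ; closed    = trans (cong vertex #E≡#V) vertex-wrap
        ; distinctᵛ = λ i< j< → vertex-injective (subst (_ <_) #E≡#V i<) (subst (_ <_) #E≡#V j<)
        ; distinctᵉ = λ i< j< → edge-injective (subst (_ <_) #E≡#V i<) (subst (_ <_) #E≡#V j<)
        ; position  = λ e → let k , k< , eq = covered e in k , subst (k <_) (sym #E≡#V) k< , eq
        ; incident  = incident
        }

    cyclicOrder : IsCycle G → CyclicOrder G
    cyclicOrder (3≤#V , σ , cyc) = choose (adjacency e₀)
      where
      i₁ i₂ : Fin #V
      i₁ = fromℕ< (≤-trans (s≤s z≤n) 3≤#V)
      i₂ = fromℕ< (≤-trans (s≤s (s≤s z≤n)) 3≤#V)
      someEdge : E
      someEdge = proj₁ (Equivalence.from (cyc i₁ i₂) (inj₁ (inj₁ (trans (toℕ-fromℕ< _) (cong suc (sym (toℕ-fromℕ< _)))))))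
      e₀ : E
      e₀ = fromℕ< (≤-trans (s≤s z≤n) (toℕ<n someEdge))
      index : V → Fin #V
      index v = σ ⟨$⟩ˡ v
      adjacency : ∀ e → Next (index (endpoint e left)) (index (endpoint e right)) ⊎
                        Next (index (endpoint e right)) (index (endpoint e left))
      adjacency e = Equivalence.to (cyc _ _) (e , inj₁ (sym (Perm.inverseʳ σ) , sym (Perm.inverseʳ σ)))
      choose : Next (index (endpoint e₀ left)) (index (endpoint e₀ right)) ⊎
               Next (index (endpoint e₀ right)) (index (endpoint e₀ left)) → CyclicOrder G
      choose (inj₁ next) = Ordered.cyclicOrder 3≤#V σ cyc e₀ (toℕ-fromℕ< _) _ (Perm.inverseʳ σ) next
      choose (inj₂ next) = Ordered.cyclicOrder 3≤#V (reverse ∘ₚ σ) (reverse-cyclic σ cyc) e₀ (toℕ-fromℕ< _)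
        (opposite (index (endpoint e₀ left)))
        (trans (cong (σ ⟨$⟩ʳ_) (opposite-involutive _)) (Perm.inverseʳ σ))
        (next-opposite next)

-- Divisions of the path: the linear systems, their soundness and their solvability.

module Division where

  open Complexity
  open Arithmetic
  open LinearProgram
  open Sperner using (Labelling; rank; rank<; Near; Box; sperner)
  open CycleOrder using (injective⇒surjective; %-injective)
  open import Data.Bool.Properties using (T?; T-≡)
  open import Data.Fin.Base as Fin using (Fin; zero; suc; toℕ; inject₁)
  open import Data.Fin.Properties using (all?; toℕ-injective; toℕ<n; toℕ-fromℕ<)
  import Data.Fin.Properties as Fin
  open import Data.Integer.Base as ℤ using (ℤ; +_; 0ℤ; 1ℤ; -1ℤ; ∣_∣)
  import Data.Integer.Properties as ℤ
  import Data.Integer.Tactic.RingSolver as ℤSolver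
  open import Data.List.Base as List using (List; []; _∷_; _++_; concatMap; map; concat; filterᵇ; applyUpTo; filter)
  open import Data.List.Membership.Propositional using (_∈_; lose; find)
  open import Data.List.Membership.Propositional.Properties
  open import Data.List.Relation.Unary.All as All using (All; []; _∷_)
  import Data.List.Relation.Unary.All.Properties as All
  open import Data.List.Relation.Unary.Any using (here)
  open import Data.Nat.Base using (ℕ; zero; suc; _+_; _*_; _∸_; _⊔_; _⊓_; _≤_; _<_; z≤n; s≤s; s≤s⁻¹)
  open import Data.Nat.DivMod using (_mod_; m%n<n)
  open import Data.Nat.ListAction using (sum)
  open import Data.Nat.Properties
  open import Data.Nat.Tactic.RingSolver using (solve-∀)
  open import Data.Product using (∃; _×_; _,_; proj₁; proj₂)
  open import Data.Sum.Base using (inj₁; inj₂)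
  open import Data.Vec.Base as Vec using (Vec; []; _∷_; lookup; _∷ʳ_; tabulate)
  open import Data.Vec.Properties using (lookup-map; lookup∘tabulate; map-∷ʳ; tabulate-∘; tabulate-cong; tabulate∘lookup; last-∷ʳ)
  open import Data.Vec.Relation.Binary.Pointwise.Inductive as PW using (Pointwise; []; _∷_)
  open import Data.Vec.Relation.Unary.All as VAll using ([]; _∷_) renaming (All to VAll)
  import Data.Vec.Relation.Unary.All.Properties as VAll
  open import Function.Base using (_∘_)
  open import Function.Bundles using (Equivalence)
  open import Relation.Binary.PropositionalEquality
  open import Relation.Nullary using (Dec; contradiction)
  open import Relation.Nullary.Decidable using (_→-dec_)

  -- The measure of [0,X] when the edge i, of length z, has weight f i.

  Σ[_] : (ℕ → ℕ) → ℕ → ℕ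
  Σ[ f ] zero    = 0
  Σ[ f ] (suc n) = Σ[ f ] n + f n

  μ : (ℕ → ℕ) → (z m X : ℕ) → ℕ
  μ f z m X = Σ[ (λ i → f i * ((X ∸ i * z) ⊓ z)) ] m

  Σ-cong : ∀ {f g} n → (∀ {i} → i < n → f i ≡ g i) → Σ[ f ] n ≡ Σ[ g ] n
  Σ-cong zero    eq = refl
  Σ-cong (suc n) eq = cong₂ _+_ (Σ-cong n (eq ∘ m<n⇒m<1+n)) (eq ≤-refl)

  Σ-mono : ∀ {f g} n → (∀ i → f i ≤ g i) → Σ[ f ] n ≤ Σ[ g ] n
  Σ-mono zero    le = z≤n
  Σ-mono (suc n) le = +-mono-≤ (Σ-mono n le) (le n)

  Σ-+ : ∀ f g n → Σ[ (λ i → f i + g i) ] n ≡ Σ[ f ] n + Σ[ g ] n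
  Σ-+ f g zero    = refl
  Σ-+ f g (suc n) = trans (cong (λ s → s + (f n + g n)) (Σ-+ f g n)) (lemma (Σ[ f ] n) (Σ[ g ] n) (f n) (g n))
    where
    lemma : ∀ a b c d → a + b + (c + d) ≡ a + c + (b + d)
    lemma = solve-∀

  Σ-* : ∀ f c n → Σ[ (λ i → f i * c) ] n ≡ Σ[ f ] n * c
  Σ-* f c zero    = refl
  Σ-* f c (suc n) = trans (cong (λ s → s + f n * c) (Σ-* f c n)) (sym (*-distribʳ-+ c (Σ[ f ] n) (f n)))

  Σ-zero : ∀ {f} n → (∀ i → f i ≡ 0) → Σ[ f ] n ≡ 0
  Σ-zero zero    eq = refl
  Σ-zero (suc n) eq = cong₂ _+_ (Σ-zero n eq) (eq n)

  module Measure (f : ℕ → ℕ) (z m : ℕ) where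

    μ-mono : ∀ {X Y} → X ≤ Y → μ f z m X ≤ μ f z m Y
    μ-mono X≤Y = Σ-mono m λ i → *-monoʳ-≤ (f i) (⊓-monoˡ-≤ z (∸-monoˡ-≤ (i * z) X≤Y))

    μ-0 : μ f z m 0 ≡ 0
    μ-0 = Σ-zero m λ i → trans (cong (λ x → f i * (x ⊓ z)) (0∸n≡0 (i * z))) (*-zeroʳ (f i))

    -- No edge contributes more than its weight to the increase, so the total weight is a Lipschitz
    -- constant.
    μ-suc : ∀ X → μ f z m (suc X) ≤ μ f z m X + Σ[ f ] m
    μ-suc X = ≤-trans (Σ-mono m λ i → ≤-trans (*-monoʳ-≤ (f i) (step i)) (≤-reflexive (*-suc (f i) _)))
      (≤-reflexive (trans (Σ-cong m λ {i} _ → +-comm (f i) _) (Σ-+ (λ i → f i * ((X ∸ i * z) ⊓ z)) f m)))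
      where
      step : ∀ i → (suc X ∸ i * z) ⊓ z ≤ suc ((X ∸ i * z) ⊓ z)
      step i = ≤-trans (⊓-monoˡ-≤ z (m∸n≤1+ X (i * z))) (⊓-monoʳ-≤ (suc (X ∸ i * z)) (n≤1+n z))
        where
        m∸n≤1+ : ∀ a b → suc a ∸ b ≤ suc (a ∸ b)
        m∸n≤1+ a       zero    = ≤-refl
        m∸n≤1+ zero    (suc b) = ≤-trans (≤-reflexive (0∸n≡0 b)) z≤n
        m∸n≤1+ (suc a) (suc b) = m∸n≤1+ a b

    -- On a single edge the measure is affine in the offset; this is why fixing the edges of the
    -- cuts makes envy-freeness linear. Both ends of the edge are included.
    μ-linear : ∀ {k y} → k < m → y ≤ z → μ f z m (k * z + y) ≡ Σ[ f ] k * z + f k * y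
    μ-linear {k} {y} k<m y≤z = up-to m k<m
      where
      below : ∀ {i} → i < k → f i * ((k * z + y ∸ i * z) ⊓ z) ≡ f i * z
      below {i} i<k = cong (f i *_) (m≥n⇒m⊓n≡n (m+n≤o⇒m≤o∸n z (≤-trans (*-monoˡ-≤ z i<k) (m≤m+n (k * z) y))))
      at : f k * ((k * z + y ∸ k * z) ⊓ z) ≡ f k * y
      at = cong (f k *_) (trans (cong (_⊓ z) (m+n∸m≡n (k * z) y)) (m≤n⇒m⊓n≡m y≤z))
      above : ∀ {i} → k < i → f i * ((k * z + y ∸ i * z) ⊓ z) ≡ 0
      above {i} k<i = trans (cong (λ x → f i * (x ⊓ z)) (m≤n⇒m∸n≡0
        (≤-trans (+-monoʳ-≤ (k * z) y≤z) (≤-trans (≤-reflexive (+-comm (k * z) z)) (*-monoˡ-≤ z k<i))))) (*-zeroʳ (f i))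
      up-to : ∀ n → k < n → Σ[ (λ i → f i * ((k * z + y ∸ i * z) ⊓ z)) ] n ≡ Σ[ f ] k * z + f k * y
      up-to (suc n) k<1+n with m≤n⇒m<n∨m≡n (s≤s⁻¹ k<1+n)
      ... | inj₁ k<n  = trans (cong₂ _+_ (up-to n k<n) (above k<n)) (+-identityʳ _)
      ... | inj₂ refl = cong₂ _+_ (trans (Σ-cong k below) (Σ-* f z k)) at

    μ-total : μ f z m (m * z) ≡ Σ[ f ] m * z
    μ-total = trans (Σ-cong m λ {i} i<m → cong (f i *_) (m≥n⇒m⊓n≡n (m+n≤o⇒m≤o∸n z (*-monoˡ-≤ z i<m)))) (Σ-* f z m)

  tuples : ∀ {A : Set} n → List A → List (Vec A n)
  tuples zero    xs = [] ∷ []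
  tuples (suc n) xs = concatMap (λ v → map (_∷ v) xs) (tuples n xs)

  ∈-tuples⁺ : ∀ {A : Set} {n} {xs : List A} {v : Vec A n} → VAll (_∈ xs) v → v ∈ tuples n xs
  ∈-tuples⁺ []                      = here refl
  ∈-tuples⁺ {v = x ∷ v} (x∈ ∷ v∈) = ∈-concatMap⁺ _ (lose (∈-tuples⁺ v∈) (∈-map⁺ (_∷ v) x∈))

  ∈-tuples⁻ : ∀ {A : Set} n {xs : List A} {v : Vec A n} → v ∈ tuples n xs → VAll (_∈ xs) v
  ∈-tuples⁻ zero    {v = []} _  = []
  ∈-tuples⁻ (suc n) {xs} v∈ with u , u∈ , v∈map ← find (∈-concatMap⁻ (λ v → map (_∷ v) xs) {xs = tuples n xs} v∈)
                            with x , x∈ , refl ← ∈-map⁻ (_∷ u) v∈map = x∈ ∷ ∈-tuples⁻ n u∈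

  Injective : ∀ {n} → Vec (Fin n) n → Set
  Injective π = ∀ i j → lookup π i ≡ lookup π j → i ≡ j

  injective? : ∀ {n} (π : Vec (Fin n) n) → Dec (Injective π)
  injective? π = all? λ i → all? λ j → (lookup π i Fin.≟ lookup π j) →-dec (i Fin.≟ j)

  permutations : ∀ n → List (Vec (Fin n) n)
  permutations n = filter injective? (tuples n (List.allFin n))

  ∈-permutations : ∀ {n} (π : Vec (Fin n) n) → Injective π → π ∈ permutations n
  ∈-permutations π inj = ∈-filter⁺ injective? (∈-tuples⁺ (VAll.universal ∈-allFin π)) inj

  -- Linear forms in the offsets of the d cuts within their edges and in the
  -- length z of an edge.

  flat : ∀ d → ℤ → Vec ℤ (suc d)
  flat zero    b = b ∷ []
  flat (suc d) b = 0ℤ ∷ flat d b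

  form : ∀ {d} → Fin d → ℤ → ℤ → Vec ℤ (suc d)
  form {suc d} zero    b a = a ∷ flat d b
  form         (suc i) b a = 0ℤ ∷ form i b a

  dot-flat : ∀ d b x → dot (flat d b) x ≡ b ℤ.* Vec.last x
  dot-flat zero    b (z ∷ [])    = ℤ.+-identityʳ _
  dot-flat (suc d) b (y ∷ z ∷ x) = trans (cong₂ ℤ._+_ (ℤ.*-zeroˡ y) (dot-flat d b (z ∷ x))) (ℤ.+-identityˡ _)

  dot-form : ∀ {d} (i : Fin d) b a x → dot (form i b a) x ≡ b ℤ.* Vec.last x ℤ.+ a ℤ.* lookup x (inject₁ i)
  dot-form {suc d} zero    b a (y ∷ z ∷ x) = trans (cong (λ s → a ℤ.* y ℤ.+ s) (dot-flat d b (z ∷ x))) (ℤ.+-comm (a ℤ.* y) _)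
  dot-form         (suc i) b a (y ∷ z ∷ x) = trans (cong₂ ℤ._+_ (ℤ.*-zeroˡ y) (dot-form i b a (z ∷ x))) (ℤ.+-identityˡ _)

  _⊝_ : ∀ {n} → Vec ℤ n → Vec ℤ n → Vec ℤ n
  u ⊝ v = Vec.zipWith ℤ._-_ u v

  dot-⊝ : ∀ {n} (u v w : Vec ℤ n) → dot (u ⊝ v) w ≡ dot u w ℤ.- dot v w
  dot-⊝ []      []      []      = refl
  dot-⊝ (x ∷ u) (y ∷ v) (z ∷ w) = trans (cong (λ s → (x ℤ.- y) ℤ.* z ℤ.+ s) (dot-⊝ u v w)) (lemma x y z (dot u w) (dot v w))
    where
    lemma : ∀ x y z s t → (x ℤ.- y) ℤ.* z ℤ.+ (s ℤ.- t) ≡ (x ℤ.* z ℤ.+ s) ℤ.- (y ℤ.* z ℤ.+ t)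
    lemma = ℤSolver.solve-∀

  -- The cuts are listed in descending order, so that the piece q lies
  -- between the entries q of the two following vectors.

  rights : ∀ {A : Set} {d} → A → Vec A d → Vec A (suc d)
  rights top mids = top ∷ mids

  lefts : ∀ {A : Set} {d} → A → Vec A d → Vec A (suc d)
  lefts bottom mids = mids ∷ʳ bottom

  pieceRow : ∀ {d} → ℤ → Vec (Vec ℤ (suc d)) d → Fin (suc d) → Vec ℤ (suc d)
  pieceRow {d} top mids q = lookup (rights (flat d top) mids) q ⊝ lookup (lefts (flat d 0ℤ) mids) q

  dot-pieceRow : ∀ {d} top (mids : Vec (Vec ℤ (suc d)) d) q x →
    dot (pieceRow top mids q) x ≡
    lookup (rights (top ℤ.* Vec.last x) (Vec.map (λ r → dot r x) mids)) q ℤ.-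
    lookup (lefts 0ℤ (Vec.map (λ r → dot r x) mids)) q
  dot-pieceRow {d} top mids q x = begin
    dot (pieceRow top mids q) x
      ≡⟨ dot-⊝ (lookup (rights (flat d top) mids) q) (lookup (lefts (flat d 0ℤ) mids) q) x ⟩
    dot (lookup (rights (flat d top) mids) q) x ℤ.- dot (lookup (lefts (flat d 0ℤ) mids) q) x
      ≡⟨ cong₂ ℤ._-_ (sym (lookup-map q eval (rights (flat d top) mids))) (sym (lookup-map q eval (lefts (flat d 0ℤ) mids))) ⟩
    lookup (Vec.map eval (rights (flat d top) mids)) q ℤ.- lookup (Vec.map eval (lefts (flat d 0ℤ) mids)) q
      ≡⟨ cong₂ (λ u v → lookup u q ℤ.- lookup v q)
           (cong (_∷ Vec.map eval mids) (dot-flat d top x))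
           (trans (map-∷ʳ eval (flat d 0ℤ) mids) (cong (Vec.map eval mids ∷ʳ_) (trans (dot-flat d 0ℤ x) (ℤ.*-zeroˡ (Vec.last x))))) ⟩
    lookup (rights (top ℤ.* Vec.last x) (Vec.map eval mids)) q ℤ.- lookup (lefts 0ℤ (Vec.map eval mids)) q ∎
    where
    open ≡-Reasoning
    eval : Vec ℤ (suc d) → ℤ
    eval r = dot r x

  -- A slot is the number of an edge, together with the weight of all edges
  -- before it and its own weight for every agent.

  Slot : ℕ → Set
  Slot n = ℕ × Vec (ℕ × ℕ) n

  -- The cut number i is the maximum of the first i coordinates, which maps
  -- the cube onto the increasing sequences of cuts.

  top : ∀ {d} → Vec ℕ d → ℕ
  top []      = 0
  top (x ∷ _) = x

  maxima : ∀ {d} → Vec ℕ d → Vec ℕ d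
  maxima []      = []
  maxima (t ∷ v) = t ⊔ top (maxima v) ∷ maxima v

  top≤ : ∀ {d M} {v : Vec ℕ d} → VAll (_≤ M) v → top v ≤ M
  top≤ []      = z≤n
  top≤ (p ∷ _) = p

  maxima-box : ∀ {d M} {v : Vec ℕ d} → Box M v → VAll (_≤ M) (maxima v)
  maxima-box []                  = []
  maxima-box {v = t ∷ v} (t≤ ∷ v≤) = ⊔-lub t≤ (top≤ (maxima-box v≤)) ∷ maxima-box v≤

  Close : ℕ → ℕ → Set
  Close b x = b ≤ x × x ≤ suc b

  maxima-close : ∀ {d} {b v : Vec ℕ d} → Pointwise Close b v → Pointwise Close (maxima b) (maxima v)
  maxima-close []                = []
  maxima-close {b = s ∷ _} {t ∷ _} ((p , q) ∷ pw) =
    let p′ , q′ = tops (maxima-close pw) in (⊔-mono-≤ p p′ , ⊔-mono-≤ q q′) ∷ maxima-close pw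
    where
    tops : ∀ {d} {b v : Vec ℕ d} → Pointwise Close b v → Close (top b) (top v)
    tops []      = z≤n , z≤n
    tops (c ∷ _) = c

  maxima-ordered : ∀ {d M} (v : Vec ℕ d) → top (maxima v) ≤ M → ∀ q → lookup (lefts 0 (maxima v)) q ≤ lookup (rights M (maxima v)) q
  maxima-ordered []      _ zero    = z≤n
  maxima-ordered (t ∷ v) p zero    = p
  maxima-ordered (t ∷ v) p (suc q) = maxima-ordered v (m≤n⊔m t _) q

  -- A coordinate 0 does not raise the running maximum, so the piece between the two cuts is empty.
  -- This gives the condition on the lower faces.
  maxima-zero : ∀ {d} (v : Vec ℕ d) i → lookup v i ≡ 0 → lookup (maxima v) i ≡ lookup (lefts 0 (maxima v)) (suc i)
  maxima-zero (t ∷ [])        zero    eq = trans (⊔-identityʳ t) eq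
  maxima-zero (t ∷ v@(_ ∷ _)) zero    eq = cong (_⊔ top (maxima v)) eq
  maxima-zero (t ∷ v)         (suc i) eq = maxima-zero v i eq

  maxima-top : ∀ {d} (v : Vec ℕ d) i → lookup v i ≤ top (maxima v)
  maxima-top (t ∷ v) zero    = m≤m⊔n t _
  maxima-top (t ∷ v) (suc i) = ≤-trans (maxima-top v i) (m≤n⊔m t _)

  -- The left end of the piece q is the maximum of a range of coordinates containing i. If
  -- coordinate i is as large as possible, the piece is empty; this gives the condition on the upper
  -- faces.
  maxima-full : ∀ {d} (v : Vec ℕ d) i (q : Fin (suc d)) → rank i < rank q → lookup v i ≤ lookup (lefts 0 (maxima v)) q
  maxima-full (t ∷ v) i       zero    _  = maxima-top (t ∷ v) i
  maxima-full (t ∷ v) zero    (suc q) lt = contradiction lt (≤⇒≯ (s≤s⁻¹ (rank< q)))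
  maxima-full (t ∷ v) (suc i) (suc q) lt = maxima-full v i q lt

  rank-injective : ∀ {d} (p q : Fin d) → rank p ≡ rank q → p ≡ q
  rank-injective zero    zero    _  = refl
  rank-injective zero    (suc q) eq = contradiction (sym eq) (<⇒≢ (rank< q))
  rank-injective (suc p) zero    eq = contradiction eq (<⇒≢ (rank< p))
  rank-injective (suc p) (suc q) eq = cong suc (rank-injective p q eq)

  argmax : ∀ {k} (g : Fin (suc k) → ℕ) → ∃ λ q → ∀ p → g p ≤ g q
  argmax {zero}  g = zero , λ { zero → ≤-refl }
  argmax {suc k} g with argmax (g ∘ suc)
  ... | q , max with ≤-total (g (suc q)) (g zero)
  ... | inj₁ le = zero , λ { zero → ≤-refl ; (suc p) → ≤-trans (max p) le }
  ... | inj₂ ge = suc q , λ { zero → ge ; (suc p) → max p }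

  -- Consecutive pieces share an end, so the inequalities telescope. The contrapositive is what
  -- matters: if the whole has positive value, so has some piece.
  shrinking : ∀ {d} (g : ℕ → ℕ) M (cuts : Vec ℕ d) → (∀ q → g (lookup (rights M cuts) q) ≤ g (lookup (lefts 0 cuts) q)) → g M ≤ g 0
  shrinking g M []         le = le zero
  shrinking g M (X ∷ cuts) le = ≤-trans (le zero) (shrinking g X cuts (le ∘ suc))

  -- Division with remainder, except that the remainder may equal z: the end m z of the path still
  -- has to lie on an edge with a number below m.
  split : ∀ m z X → 0 < m → X ≤ m * z → ∃ λ k → ∃ λ y → k < m × y ≤ z × k * z + y ≡ X
  split (suc m) z X _ X≤ with ≤-total X z
  ... | inj₁ X≤z = 0 , X , s≤s z≤n , X≤z , refl
  ... | inj₂ z≤X with m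
  ... | zero   = 0 , z , s≤s z≤n , ≤-refl , ≤-antisym z≤X (≤-trans X≤ (≤-reflexive (+-identityʳ z)))
  ... | suc m′ with split (suc m′) z (X ∸ z) (s≤s z≤n) (≤-trans (∸-monoˡ-≤ z X≤) (≤-reflexive (m+n∸m≡n z _)))
  ... | k , y , k< , y≤ , eq = suc k , y , s≤s k< , y≤ , trans (+-assoc z (k * z) y) (trans (cong (λ s → z + s) eq) (m+[n∸m]≡n z≤X))

  lookup-∷ʳ : ∀ {A : Set} {d} (v : Vec A d) x i → lookup (v ∷ʳ x) (inject₁ i) ≡ lookup v i
  lookup-∷ʳ (y ∷ v) x zero    = refl
  lookup-∷ʳ (y ∷ v) x (suc i) = lookup-∷ʳ v x i

  pointwise-∷ʳ : ∀ {R : ℕ → ℕ → Set} {d} {u v : Vec ℕ d} {x y} → Pointwise R u v → R x y → Pointwise R (u ∷ʳ x) (v ∷ʳ y)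
  pointwise-∷ʳ []       r = r ∷ []
  pointwise-∷ʳ (p ∷ ps) r = p ∷ pointwise-∷ʳ ps r

  module _ {d : ℕ} where

    n = suc d

    positionForms : Vec (Slot n) d → Vec (Vec ℤ n) d
    positionForms js = tabulate λ i → form i (+ proj₁ (lookup js i)) 1ℤ

    valueForms : Fin n → Vec (Slot n) d → Vec (Vec ℤ n) d
    valueForms a js = tabulate λ i →
      form i (+ proj₁ (lookup (proj₂ (lookup js i)) a)) (+ proj₂ (lookup (proj₂ (lookup js i)) a))

    lowerRow upperRow : Fin d → Vec ℤ n
    lowerRow i = form i 0ℤ 1ℤ
    upperRow i = form i 1ℤ -1ℤ

    orderRow : ℕ → Vec (Slot n) d → Fin n → Vec ℤ n
    orderRow m js q = pieceRow (+ m) (positionForms js) q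

    envyRow : Vec ℕ n → Vec (Slot n) d → Vec (Fin n) n → Fin n → Fin n → Vec ℤ n
    envyRow T js π a q = pieceRow (+ lookup T a) (valueForms a js) (lookup π a) ⊝ pieceRow (+ lookup T a) (valueForms a js) q

    rows : Vec ℕ n → ℕ → Vec (Fin n) n → Vec (Slot n) d → List (Vec ℤ n)
    rows T m π js = List.tabulate lowerRow ++ (List.tabulate upperRow ++ (List.tabulate (orderRow m js) ++
                    concat (List.tabulate λ a → List.tabulate (envyRow T js π a))))

    solutionsAt : Vec ℕ n → ℕ → Vec (Fin n) n → Vec (Slot n) d → List (Vec ℤ n × (Vec (Slot n) d × Vec ℕ n))
    solutionsAt T m π js = map (λ x → x , js , Vec.map toℕ π)
      (filterᵇ (feasibleᵇ (rows T m π js)) (candidates d (rows T m π js)))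

    solutionsFor : Vec ℕ n → ℕ → List (Slot n) → Vec (Fin n) n → List (Vec ℤ n × (Vec (Slot n) d × Vec ℕ n))
    solutionsFor T m slots π = concatMap (solutionsAt T m π) (tuples d slots)

    search : Vec ℕ n → ℕ → List (Slot n) → List (Vec ℤ n × (Vec (Slot n) d × Vec ℕ n))
    search T m slots = concatMap (solutionsFor T m slots) (permutations n)

    cutsOf : Vec ℤ n → Vec (Slot n) d → Vec ℕ d
    cutsOf x js = tabulate λ i → proj₁ (lookup js i) * ∣ Vec.last x ∣ + ∣ lookup x (inject₁ i) ∣

    module Problem (w : Fin n → ℕ → ℕ) (m : ℕ) where

      slot : ℕ → Slot n
      slot k = k , tabulate λ a → Σ[ w a ] k , w a k

      slots : List (Slot n)
      slots = applyUpTo slot m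

      total : Fin n → ℕ
      total a = Σ[ w a ] m

      totals : Vec ℕ n
      totals = tabulate total

      right left : (z : ℕ) → Vec ℕ d → Fin n → ℕ
      right z cuts q = lookup (rights (m * z) cuts) q
      left  z cuts q = lookup (lefts 0 cuts) q

      -- Positions are multiples of 1 / z of an edge. The envy condition is written with sums on
      -- both sides, since subtraction of natural numbers is truncated.
      record Division (π : Vec (Fin n) n) (z : ℕ) (cuts : Vec ℕ d) : Set where
        field
          positive  : 0 < z
          injective : Injective π
          ordered   : ∀ q → left z cuts q ≤ right z cuts q
          envyFree  : ∀ a q → μ (w a) z m (right z cuts q) + μ (w a) z m (left z cuts (lookup π a)) ≤
                              μ (w a) z m (right z cuts (lookup π a)) + μ (w a) z m (left z cuts q)

      -- The dictionary between rows and cuts, used in both directions: a candidate yields a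
      -- division, and a point of the grid yields an approximate solution.
      module Evaluate (z : ℕ) (ks ys : Vec ℕ d) (js : Vec (Slot n) d) (x : Vec ℤ n)
                      (ks<m : ∀ i → lookup ks i < m) (ys≤z : ∀ i → lookup ys i ≤ z)
                      (js≡ : ∀ i → lookup js i ≡ slot (lookup ks i))
                      (last≡ : Vec.last x ≡ + z) (x≡ : ∀ i → lookup x (inject₁ i) ≡ + lookup ys i) where

        cuts : Vec ℕ d
        cuts = tabulate λ i → lookup ks i * z + lookup ys i

        eval : Vec ℤ n → ℤ
        eval r = dot r x

        eval-form : ∀ i b a → eval (form i (+ b) (+ a)) ≡ + (b * z + a * lookup ys i)
        eval-form i b a = begin
          dot (form i (+ b) (+ a)) x
            ≡⟨ dot-form i (+ b) (+ a) x ⟩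
          + b ℤ.* Vec.last x ℤ.+ + a ℤ.* lookup x (inject₁ i)
            ≡⟨ cong₂ (λ s t → + b ℤ.* s ℤ.+ + a ℤ.* t) last≡ (x≡ i) ⟩
          + b ℤ.* + z ℤ.+ + a ℤ.* + lookup ys i
            ≡⟨ cong₂ ℤ._+_ (sym (ℤ.pos-* b z)) (sym (ℤ.pos-* a (lookup ys i))) ⟩
          + (b * z + a * lookup ys i) ∎
          where open ≡-Reasoning

        eval-positions : Vec.map eval (positionForms js) ≡ Vec.map +_ cuts
        eval-positions = trans (sym (tabulate-∘ eval _)) (trans (tabulate-cong eq) (tabulate-∘ +_ _))
          where
          eq : ∀ i → eval (form i (+ proj₁ (lookup js i)) 1ℤ) ≡ + (lookup ks i * z + lookup ys i)
          eq i = trans (eval-form i _ 1) (cong₂ (λ k y → + (k * z + y)) (cong proj₁ (js≡ i)) (*-identityˡ (lookup ys i)))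

        eval-values : ∀ a → Vec.map eval (valueForms a js) ≡ Vec.map (λ X → + μ (w a) z m X) cuts
        eval-values a = trans (sym (tabulate-∘ eval _)) (trans (tabulate-cong eq) (tabulate-∘ (λ X → + μ (w a) z m X) _))
          where
          entry : ∀ i → lookup (proj₂ (lookup js i)) a ≡ (Σ[ w a ] (lookup ks i) , w a (lookup ks i))
          entry i = trans (cong (λ s → lookup (proj₂ s) a) (js≡ i)) (lookup∘tabulate (λ a → Σ[ w a ] (lookup ks i) , w a (lookup ks i)) a)
          eq : ∀ i → eval (form i (+ proj₁ (lookup (proj₂ (lookup js i)) a)) (+ proj₂ (lookup (proj₂ (lookup js i)) a))) ≡
                     + μ (w a) z m (lookup ks i * z + lookup ys i)
          eq i = trans (eval-form i _ _) (cong +_ (trans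
            (cong₂ (λ b c → b * z + c * lookup ys i) (cong proj₁ (entry i)) (cong proj₂ (entry i)))
            (sym (Measure.μ-linear (w a) z m (ks<m i) (ys≤z i)))))

        eval-piece : ∀ t (forms : Vec (Vec ℤ n) d) (g : ℕ → ℕ) → Vec.map eval forms ≡ Vec.map (λ X → + g X) cuts →
          t * z ≡ g (m * z) → g 0 ≡ 0 →
          ∀ q → eval (pieceRow (+ t) forms q) ≡ + g (right z cuts q) ℤ.- + g (left z cuts q)
        eval-piece t forms g eq top bottom q = begin
          eval (pieceRow (+ t) forms q)
            ≡⟨ dot-pieceRow (+ t) forms q x ⟩
          lookup (rights (+ t ℤ.* Vec.last x) (Vec.map eval forms)) q ℤ.- lookup (lefts 0ℤ (Vec.map eval forms)) q
            ≡⟨ cong₂ (λ u v → lookup u q ℤ.- lookup v q)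
                 (cong₂ _∷_ (trans (cong (+ t ℤ.*_) last≡) (trans (sym (ℤ.pos-* t z)) (cong +_ top))) eq)
                 (trans (cong₂ _∷ʳ_ eq (cong +_ (sym bottom))) (sym (map-∷ʳ (λ X → + g X) 0 cuts))) ⟩
          lookup (Vec.map (λ X → + g X) (rights (m * z) cuts)) q ℤ.- lookup (Vec.map (λ X → + g X) (lefts 0 cuts)) q
            ≡⟨ cong₂ ℤ._-_ (lookup-map q (λ X → + g X) (rights (m * z) cuts)) (lookup-map q (λ X → + g X) (lefts 0 cuts)) ⟩
          + g (right z cuts q) ℤ.- + g (left z cuts q) ∎
          where open ≡-Reasoning

        eval-lower : ∀ i → eval (lowerRow i) ≡ + lookup ys i
        eval-lower i = trans (eval-form i 0 1) (cong +_ (*-identityˡ (lookup ys i)))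

        eval-upper : ∀ i → eval (upperRow i) ≡ + z ℤ.- + lookup ys i
        eval-upper i = trans (dot-form i 1ℤ -1ℤ x) (trans (cong₂ (λ s t → 1ℤ ℤ.* s ℤ.+ -1ℤ ℤ.* t) last≡ (x≡ i))
          (lemma (+ z) (+ lookup ys i)))
          where
          lemma : ∀ s t → 1ℤ ℤ.* s ℤ.+ -1ℤ ℤ.* t ≡ s ℤ.- t
          lemma = ℤSolver.solve-∀

        eval-order : ∀ q → eval (orderRow m js q) ≡ + right z cuts q ℤ.- + left z cuts q
        eval-order = eval-piece m (positionForms js) (λ X → X) eval-positions refl refl

        eval-envy : ∀ π a q → eval (envyRow totals js π a q) ≡
          (+ μ (w a) z m (right z cuts (lookup π a)) ℤ.- + μ (w a) z m (left z cuts (lookup π a))) ℤ.-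
          (+ μ (w a) z m (right z cuts q) ℤ.- + μ (w a) z m (left z cuts q))
        eval-envy π a q = trans (dot-⊝ (pieceRow (+ lookup totals a) (valueForms a js) (lookup π a)) _ x) (cong₂ ℤ._-_ (value (lookup π a)) (value q))
          where
          value = eval-piece (lookup totals a) (valueForms a js) (μ (w a) z m) (eval-values a)
            (trans (cong (_* z) (lookup∘tabulate total a)) (sym (Measure.μ-total (w a) z m))) (Measure.μ-0 (w a) z m)

      concat-tabulate⁻ : ∀ {A : Set} {P : A → Set} {k} {f : Fin k → List A} → All P (concat (List.tabulate f)) → ∀ i → All P (f i)
      concat-tabulate⁻ {f = f} all zero    = All.++⁻ˡ (f zero) all
      concat-tabulate⁻ {f = f} all (suc i) = concat-tabulate⁻ (All.++⁻ʳ (f zero) all) i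

      0≤m-n⇒ : ∀ {a b} → 0ℤ ℤ.≤ + a ℤ.- + b → b ≤ a
      0≤m-n⇒ 0≤ = ℤ.drop‿+≤+ (ℤ.0≤i-j⇒j≤i 0≤)

      envy-arith : ∀ {a b c e} → 0ℤ ℤ.≤ (+ a ℤ.- + b) ℤ.- (+ c ℤ.- + e) → c + b ≤ a + e
      envy-arith {a} {b} {c} {e} 0≤ = 0≤m-n⇒ (subst (0ℤ ℤ.≤_) (lemma (+ a) (+ b) (+ c) (+ e)) 0≤)
        where
        lemma : ∀ a b c e → (a ℤ.- b) ℤ.- (c ℤ.- e) ≡ (a ℤ.+ e) ℤ.- (c ℤ.+ b)
        lemma = ℤSolver.solve-∀

      -- `lowerRow` and `upperRow` confine the offsets to [0, z], so that taking absolute values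
      -- changes nothing and `Evaluate` applies.
      sound-rows : ∀ π js x → Injective π → VAll (_∈ slots) js → 0ℤ ℤ.< Vec.last x → Feasible (rows totals m π js) x →
                   Division π ∣ Vec.last x ∣ (cutsOf x js)
      sound-rows π js x inj js∈ 0<z feasible = subst (Division π z) cuts≡ record
        { positive  = ℤ.drop‿+<+ (subst (0ℤ ℤ.<_) (sym last≡) 0<z)
        ; injective = inj
        ; ordered   = λ q → 0≤m-n⇒ (subst (0ℤ ℤ.≤_) (E.eval-order q) (All.tabulate⁻ {f = orderRow m js} order q))
        ; envyFree  = λ a q → envy-arith {μ (w a) z m (right z E.cuts (lookup π a))} {μ (w a) z m (left z E.cuts (lookup π a))}
                                           {μ (w a) z m (right z E.cuts q)} {μ (w a) z m (left z E.cuts q)}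
                                (subst (0ℤ ℤ.≤_) (E.eval-envy π a q)
                                (All.tabulate⁻ {f = envyRow totals js π a} (concat-tabulate⁻ {f = λ a → List.tabulate (envyRow totals js π a)} envy a) q))
        }
        where
        z = ∣ Vec.last x ∣
        ks ys : Vec ℕ d
        ks = Vec.map proj₁ js
        ys = tabulate λ i → ∣ lookup x (inject₁ i) ∣
        lower = All.++⁻ˡ (List.tabulate lowerRow) feasible
        rest₁ = All.++⁻ʳ (List.tabulate lowerRow) feasible
        upper = All.++⁻ˡ (List.tabulate upperRow) rest₁
        rest₂ = All.++⁻ʳ (List.tabulate upperRow) rest₁
        order = All.++⁻ˡ (List.tabulate (orderRow m js)) rest₂
        envy  = All.++⁻ʳ (List.tabulate (orderRow m js)) rest₂
        last≡ : + z ≡ Vec.last x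
        last≡ = ℤ.0≤i⇒+∣i∣≡i (ℤ.<⇒≤ 0<z)
        0≤y : ∀ i → 0ℤ ℤ.≤ lookup x (inject₁ i)
        0≤y i = subst (0ℤ ℤ.≤_) (trans (dot-form i 0ℤ 1ℤ x) (lemma (Vec.last x) _)) (All.tabulate⁻ lower i)
          where
          lemma : ∀ s t → 0ℤ ℤ.* s ℤ.+ 1ℤ ℤ.* t ≡ t
          lemma = ℤSolver.solve-∀
        x≡ : ∀ i → lookup x (inject₁ i) ≡ + lookup ys i
        x≡ i = trans (sym (ℤ.0≤i⇒+∣i∣≡i (0≤y i))) (cong +_ (sym (lookup∘tabulate _ i)))
        slot≡ : ∀ i → ∃ λ k → k < m × lookup js i ≡ slot k
        slot≡ i = ∈-applyUpTo⁻ slot (VAll.lookup⁺ js∈ i)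
        ks≡ : ∀ i → lookup ks i ≡ proj₁ (slot≡ i)
        ks≡ i = trans (lookup-map i proj₁ js) (cong proj₁ (proj₂ (proj₂ (slot≡ i))))
        y≤z : ∀ i → lookup ys i ≤ z
        y≤z i = 0≤m-n⇒ (subst (0ℤ ℤ.≤_) (trans (dot-form i 1ℤ -1ℤ x)
          (trans (cong₂ (λ s t → 1ℤ ℤ.* s ℤ.+ -1ℤ ℤ.* t) (sym last≡) (x≡ i)) (lemma (+ z) (+ lookup ys i)))) (All.tabulate⁻ upper i))
          where
          lemma : ∀ s t → 1ℤ ℤ.* s ℤ.+ -1ℤ ℤ.* t ≡ s ℤ.- t
          lemma = ℤSolver.solve-∀
        module E = Evaluate z ks ys js x (λ i → subst (_< m) (sym (ks≡ i)) (proj₁ (proj₂ (slot≡ i)))) y≤z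
                     (λ i → trans (proj₂ (proj₂ (slot≡ i))) (cong slot (sym (ks≡ i)))) (sym last≡) x≡
        cuts≡ : E.cuts ≡ cutsOf x js
        cuts≡ = tabulate-cong λ i → cong₂ (λ k y → k * z + y) (lookup-map i proj₁ js) (lookup∘tabulate _ i)

      Sound : Vec ℤ n × (Vec (Slot n) d × Vec ℕ n) → Set
      Sound (x , js , πs) = ∃ λ π → πs ≡ Vec.map toℕ π × Division π ∣ Vec.last x ∣ (cutsOf x js)

      sound-solution : ∀ {π js s} → π ∈ permutations n → js ∈ tuples d slots → s ∈ solutionsAt totals m π js → Sound s
      sound-solution {π} {js} π∈ js∈ found =
        let x , x∈ , eq = ∈-map⁻ (λ (x : Vec ℤ n) → x , js , Vec.map toℕ π) found
            x∈′ , feasible = ∈-filter⁻ (T? ∘ feasibleᵇ (rows totals m π js)) {xs = candidates d (rows totals m π js)} x∈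
        in subst Sound (sym eq) (π , refl ,
             sound-rows π js x (proj₂ (∈-filter⁻ injective? {xs = tuples n (List.allFin n)} π∈)) (∈-tuples⁻ d js∈)
               (All.lookup (candidates-scale d (rows totals m π js)) x∈′)
               (feasibleᵇ⇒ (rows totals m π js) x (Equivalence.to T-≡ feasible)))

      sound : ∀ {s} → s ∈ search totals m slots → Sound s
      sound found =
        let π , π∈ , found′ = find (∈-concatMap⁻ (solutionsFor totals m slots) {xs = permutations n} found)
            js , js∈ , found″ = find (∈-concatMap⁻ (solutionsAt totals m π) {xs = tuples d slots} found′)
        in sound-solution π∈ js∈ found″

      -- The divisions on a fine grid given by Sperner's lemma are nearly
      -- envy-free; by the gap lemma a candidate is exactly so.

      module Existence (0<m : 0 < m) (0<total : ∀ a → 0 < total a) where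

        gapOf : Vec (Fin n) n → Vec (Slot n) d → ℕ
        gapOf π js = proj₁ (gap d (rows totals m π js))

        -- It is not known in advance which edges and which assignment the grid will produce, so K
        -- dominates the gap constants of all of them. W is a Lipschitz constant for every agent.
        -- The envy that the grid leaves is at most 2 W, and N exceeds K times this amount.
        K W N M : ℕ
        K = sum (map (λ π → sum (map (gapOf π) (tuples d slots))) (permutations n))
        W = sum (map total (List.allFin n))
        N = suc (K * (W + W))
        M = m * N

        ν : Fin n → ℕ → ℕ
        ν a = μ (w a) N m

        gain : Fin n → Vec ℕ d → Fin n → ℕ
        gain a v q = ν a (right N (maxima v) q) ∸ ν a (left N (maxima v) q)

        favourite : Fin n → Vec ℕ d → Fin n
        favourite a v = proj₁ (argmax (gain a v))

        -- Otherwise every piece would be worthless to the agent, whereas the whole is not.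
        favourite-positive : ∀ a v → ν a (left N (maxima v) (favourite a v)) < ν a (right N (maxima v) (favourite a v))
        favourite-positive a v = ≰⇒> λ le → <⇒≱ positive (shrinking (ν a) M (maxima v) λ q →
          m∸n≡0⇒m≤n (n≤0⇒n≡0 (≤-trans (proj₂ (argmax (gain a v)) q) (≤-reflexive (m≤n⇒m∸n≡0 le)))))
          where
          positive : ν a 0 < ν a M
          positive = subst₂ _<_ (sym (Measure.μ-0 (w a) N m)) (sym (Measure.μ-total (w a) N m))
            (≤-trans (0<total a) (m≤m*n (total a) N))

        owner : Vec ℕ d → Fin n
        owner v = Vec.sum v mod n

        labelling : Labelling M d (λ v → rank (favourite (owner v) v))
        labelling = record
          { label≤ = λ v _ → s≤s⁻¹ (rank< (favourite (owner v) v))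
          -- The piece `suc i` has the same rank as the coordinate i. It is empty where this
          -- coordinate is 0, and so it is no favourite.
          ; lower  = λ v _ i eq same → let q = favourite (owner v) v in
              <⇒≢ (subst (λ q → ν (owner v) (left N (maxima v) q) < ν (owner v) (right N (maxima v) q))
                         (rank-injective q (suc i) same) (favourite-positive (owner v) v))
                  (cong (ν (owner v)) (sym (maxima-zero v i eq)))
          -- Where the coordinate i is M, all pieces of larger rank begin at the end of the path and
          -- are worthless.
          ; upper  = λ v v≤M i eq → ≮⇒≥ λ lt → let q = favourite (owner v) v in
              <⇒≱ (favourite-positive (owner v) v)
                  (Measure.μ-mono (w (owner v)) N m (≤-trans (right≤M v v≤M q)
                    (subst (_≤ left N (maxima v) q) eq (maxima-full v i q lt))))
          }
          where
          right≤M : ∀ v → Box M v → ∀ q → right N (maxima v) q ≤ M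
          right≤M v v≤M zero    = ≤-refl
          right≤M v v≤M (suc q) = VAll.lookup⁺ (maxima-box v≤M) q

        module Cell {base : Vec ℕ d} {start : ℕ} (vertex : Fin n → Vec ℕ d)
                    (sums : ∀ i → Vec.sum (vertex i) ≡ start + toℕ i)
                    (near : ∀ i → Near M base (vertex i))
                    (distinct : ∀ i j → rank (favourite (owner (vertex i)) (vertex i)) ≡ rank (favourite (owner (vertex j)) (vertex j)) → i ≡ j)
                    where

          -- The owner of the vertex number i; since the coordinate sums are consecutive, every
          -- agent owns exactly one vertex.
          rotate : Fin n → Fin n
          rotate i = (start + toℕ i) mod n

          owned : ∀ a → ∃ λ i → rotate i ≡ a
          owned = injective⇒surjective rotate λ i j eq → toℕ-injective (%-injective start n (toℕ<n i) (toℕ<n j)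
            (trans (sym (toℕ-fromℕ< (m%n<n (start + toℕ i) n))) (trans (cong toℕ eq) (toℕ-fromℕ< (m%n<n (start + toℕ j) n)))))

          corner : Fin n → Vec ℕ d
          corner a = vertex (proj₁ (owned a))

          owner-corner : ∀ a → owner (corner a) ≡ a
          owner-corner a = trans (cong (_mod n) (sums (proj₁ (owned a)))) (proj₂ (owned a))

          choice : Fin n → Fin n
          choice a = favourite a (corner a)

          π : Vec (Fin n) n
          π = tabulate choice

          π-injective : Injective π
          π-injective a b eq = trans (sym (proj₂ (owned a))) (trans (cong rotate (distinct _ _
            (cong rank (trans (cong (λ o → favourite o (corner a)) (owner-corner a))
              (trans (trans (sym (lookup∘tabulate choice a)) (trans eq (lookup∘tabulate choice b)))
                     (cong (λ o → favourite o (corner b)) (sym (owner-corner b)))))))) (proj₂ (owned b)))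

          -- Each agent has chosen a favourite at a corner of its own, but a single division has to
          -- serve all of them. Every cut of any corner is that of `Y` or one grid step further.
          Y : Vec ℕ d
          Y = maxima base

          Y≤M : VAll (_≤ M) Y
          Y≤M = VAll.lookup⁻ λ i → ≤-trans (proj₁ (PW.lookup (maxima-close (proj₂ (near zero))) i)) (VAll.lookup⁺ (maxima-box (proj₁ (near zero))) i)

          parts : ∀ i → ∃ λ k → ∃ λ y → k < m × y ≤ N × k * N + y ≡ lookup Y i
          parts i = split m N (lookup Y i) 0<m (VAll.lookup⁺ Y≤M i)

          ks ys : Vec ℕ d
          ks = tabulate (λ i → proj₁ (parts i))
          ys = tabulate (λ i → proj₁ (proj₂ (parts i)))

          js : Vec (Slot n) d
          js = tabulate (slot ∘ proj₁ ∘ parts)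

          x : Vec ℤ n
          x = Vec.map +_ (ys ∷ʳ N)

          last-x : Vec.last x ≡ + N
          last-x = trans (cong Vec.last (map-∷ʳ +_ N ys)) (last-∷ʳ (+ N) (Vec.map +_ ys))

          module E = Evaluate N ks ys js x
            (λ i → subst (_< m) (sym (lookup∘tabulate _ i)) (proj₁ (proj₂ (proj₂ (parts i)))))
            (λ i → subst (_≤ N) (sym (lookup∘tabulate _ i)) (proj₁ (proj₂ (proj₂ (proj₂ (parts i))))))
            (λ i → trans (lookup∘tabulate _ i) (cong slot (sym (lookup∘tabulate _ i))))
            last-x
            (λ i → trans (lookup-map (inject₁ i) +_ (ys ∷ʳ N)) (cong +_ (lookup-∷ʳ ys N i)))

          cuts≡Y : E.cuts ≡ Y
          cuts≡Y = trans (tabulate-cong λ i → trans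
            (cong₂ (λ k y → k * N + y) (lookup∘tabulate _ i) (lookup∘tabulate _ i)) (proj₂ (proj₂ (proj₂ (proj₂ (parts i))))))
            (tabulate∘lookup Y)

          R L : Fin n → ℕ
          R = right N Y
          L = left N Y

          near-right : ∀ i q → Close (R q) (right N (maxima (vertex i)) q)
          near-right i = PW.lookup ((≤-refl , n≤1+n M) ∷ maxima-close (proj₂ (near i)))

          near-left : ∀ i q → Close (L q) (left N (maxima (vertex i)) q)
          near-left i = PW.lookup (pointwise-∷ʳ (maxima-close (proj₂ (near i))) (z≤n , z≤n))

          -- The agent's choice is optimal at its own corner. On passing to that corner two of the
          -- four terms can only grow; on returning to `Y` the other two cost at most W each.
          nearly : ∀ a q → ν a (R q) + ν a (L (choice a)) ≤ ν a (R (choice a)) + ν a (L q) + (W + W)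
          nearly a q = begin
            ν a (R q) + ν a (L p)
              ≤⟨ +-mono-≤ (mono (proj₁ (near-right i q))) (mono (proj₁ (near-left i p))) ⟩
            ν a R′q + ν a L′p
              ≤⟨ m∸n≤o∸k (mono (ordered q)) (mono (ordered p)) (proj₂ (argmax (gain a (corner a))) q) ⟩
            ν a R′p + ν a L′q
              ≤⟨ +-mono-≤ (lipschitz (proj₂ (near-right i p))) (lipschitz (proj₂ (near-left i q))) ⟩
            (ν a (R p) + W) + (ν a (L q) + W)
              ≡⟨ lemma (ν a (R p)) (ν a (L q)) W ⟩
            ν a (R p) + ν a (L q) + (W + W) ∎
            where
            open ≤-Reasoning
            i = proj₁ (owned a)
            p = choice a
            R′q = right N (maxima (corner a)) q
            L′q = left N (maxima (corner a)) q
            R′p = right N (maxima (corner a)) p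
            L′p = left N (maxima (corner a)) p
            mono : ∀ {X Y} → X ≤ Y → ν a X ≤ ν a Y
            mono = Measure.μ-mono (w a) N m
            ordered = maxima-ordered (corner a) (top≤ (maxima-box (proj₁ (near i))))
            lipschitz : ∀ {X Y} → Y ≤ suc X → ν a Y ≤ ν a X + W
            lipschitz {X} le = ≤-trans (mono le) (≤-trans (Measure.μ-suc (w a) N m X)
              (+-monoʳ-≤ (ν a X) (∈⇒≤sum total (∈-allFin a))))
            m∸n≤o∸k : ∀ {r l r′ l′} → l ≤ r → l′ ≤ r′ → r ∸ l ≤ r′ ∸ l′ → r + l′ ≤ r′ + l
            m∸n≤o∸k {r} {l} {r′} {l′} l≤r l′≤r′ le = begin
              r + l′              ≡⟨ cong (_+ l′) (sym (m∸n+n≡m l≤r)) ⟩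
              r ∸ l + l + l′      ≤⟨ +-monoˡ-≤ l′ (+-monoˡ-≤ l le) ⟩
              r′ ∸ l′ + l + l′    ≡⟨ swap (r′ ∸ l′) l l′ ⟩
              r′ ∸ l′ + l′ + l    ≡⟨ cong (_+ l) (m∸n+n≡m l′≤r′) ⟩
              r′ + l              ∎
              where
              swap : ∀ a b c → a + b + c ≡ a + c + b
              swap = solve-∀
            lemma : ∀ a b w → (a + w) + (b + w) ≡ a + b + (w + w)
            lemma = solve-∀

          π∈ : π ∈ permutations n
          π∈ = ∈-permutations π π-injective

          js∈ : js ∈ tuples d slots
          js∈ = ∈-tuples⁺ (VAll.lookup⁻ λ i → subst (_∈ slots) (sym (lookup∘tabulate _ i))
            (∈-applyUpTo⁺ slot (proj₁ (proj₂ (proj₂ (parts i))))))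

          k : ℕ
          k = gapOf π js

          k≤K : k ≤ K
          k≤K = ≤-trans (∈⇒≤sum (gapOf π) js∈) (∈⇒≤sum (λ π → sum (map (gapOf π) (tuples d slots))) π∈)

          harmless : ∀ {e} → 0ℤ ℤ.≤ e → ℤ.- + N ℤ.≤ + k ℤ.* e
          harmless 0≤e = ℤ.≤-trans (ℤ.neg-mono-≤ (ℤ.+≤+ (z≤n {N}))) (0≤* {+ k} (ℤ.+≤+ z≤n) 0≤e)

          difference≥0 : ∀ {a b} → b ≤ a → 0ℤ ℤ.≤ + a ℤ.- + b
          difference≥0 b≤a = ℤ.i≤j⇒0≤j-i (ℤ.+≤+ b≤a)

          envious : ∀ {a b c e} → c + b ≤ a + e + (W + W) → ℤ.- + N ℤ.≤ + k ℤ.* ((+ a ℤ.- + b) ℤ.- (+ c ℤ.- + e))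
          envious {a} {b} {c} {e} le = begin
            ℤ.- + N                                 ≤⟨ ℤ.neg-mono-≤ (ℤ.+≤+ (≤-trans (*-monoˡ-≤ (W + W) k≤K) (n≤1+n _))) ⟩
            ℤ.- + (k * (W + W))                     ≡⟨ cong ℤ.-_ (ℤ.pos-* k (W + W)) ⟩
            ℤ.- (+ k ℤ.* + (W + W))                 ≡⟨ ℤ.neg-distribʳ-* (+ k) (+ (W + W)) ⟩
            + k ℤ.* (ℤ.- + (W + W))                 ≤⟨ ℤ.*-monoˡ-≤-nonNeg (+ k) shortfall ⟩
            + k ℤ.* ((+ a ℤ.- + b) ℤ.- (+ c ℤ.- + e)) ∎
            where
            open ℤ.≤-Reasoning
            lemma₁ : ∀ s w → ℤ.- w ≡ s ℤ.- (s ℤ.+ w)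
            lemma₁ = ℤSolver.solve-∀
            lemma₂ : ∀ a b c e → (a ℤ.+ e) ℤ.- (c ℤ.+ b) ≡ (a ℤ.- b) ℤ.- (c ℤ.- e)
            lemma₂ = ℤSolver.solve-∀
            shortfall : ℤ.- + (W + W) ℤ.≤ (+ a ℤ.- + b) ℤ.- (+ c ℤ.- + e)
            shortfall = begin
              ℤ.- + (W + W)                                   ≡⟨ lemma₁ (+ (a + e)) (+ (W + W)) ⟩
              + (a + e) ℤ.- + (a + e + (W + W))               ≤⟨ ℤ.+-monoʳ-≤ (+ (a + e)) (ℤ.neg-mono-≤ (ℤ.+≤+ le)) ⟩
              + (a + e) ℤ.- + (c + b)                         ≡⟨ lemma₂ (+ a) (+ b) (+ c) (+ e) ⟩
              (+ a ℤ.- + b) ℤ.- (+ c ℤ.- + e)                 ∎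

          -- The bounds and the order hold exactly at a grid point; only the envy rows need the
          -- tolerance.
          almost : Almost k (rows totals m π js) x
          almost = subst (λ z → All (λ row → ℤ.- z ℤ.≤ + k ℤ.* dot row x) (rows totals m π js)) (sym last-x)
            (All.++⁺ (All.tabulate⁺ {f = lowerRow} λ i → harmless (subst (0ℤ ℤ.≤_) (sym (E.eval-lower i)) (ℤ.+≤+ z≤n)))
            (All.++⁺ (All.tabulate⁺ {f = upperRow} λ i → harmless (subst (0ℤ ℤ.≤_) (sym (E.eval-upper i))
                       (difference≥0 (subst (_≤ N) (sym (lookup∘tabulate _ i)) (proj₁ (proj₂ (proj₂ (proj₂ (parts i)))))))))
            (All.++⁺ (All.tabulate⁺ {f = orderRow m js} λ q → harmless (subst (0ℤ ℤ.≤_) (sym (E.eval-order q))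
                       (difference≥0 (subst (λ c → left N c q ≤ right N c q) (sym cuts≡Y)
                         (maxima-ordered base (top≤ Y≤M) q)))))
            (All.concat⁺ (All.tabulate⁺ {f = λ a → List.tabulate (envyRow totals js π a)} λ a → All.tabulate⁺ {f = envyRow totals js π a} λ q →
              subst (λ e → ℤ.- + N ℤ.≤ + k ℤ.* e) (sym (E.eval-envy π a q)) (envious
                {ν a (right N E.cuts (lookup π a))} {ν a (left N E.cuts (lookup π a))} {ν a (right N E.cuts q)} {ν a (left N E.cuts q)}
                (subst₂ (λ c p → ν a (right N c q) + ν a (left N c p) ≤ ν a (right N c p) + ν a (left N c q) + (W + W))
                        (sym cuts≡Y) (sym (lookup∘tabulate choice a)) (nearly a q))))))))

          found : ∃ λ s → s ∈ search totals m slots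
          found = let v , v∈ , feasible = solution in
            (v , js , Vec.map toℕ π) , ∈-concatMap⁺ (solutionsFor totals m slots) {xs = permutations n} (lose π∈
                  (∈-concatMap⁺ (solutionsAt totals m π) {xs = tuples d slots} (lose js∈ (∈-map⁺ (λ (x : Vec ℤ n) → x , js , Vec.map toℕ π)
                    (∈-filter⁺ (T? ∘ feasibleᵇ (rows totals m π js)) v∈
                      (Equivalence.from (T-≡ {x = feasibleᵇ (rows totals m π js) v}) (⇒feasibleᵇ (rows totals m π js) v feasible)))))))
            where
            solution : ∃ λ v → v ∈ candidates d (rows totals m π js) × Feasible (rows totals m π js) v
            solution = proj₂ (gap d (rows totals m π js)) x
              (VAll.map⁺ (VAll.universal (λ _ → ℤ.+≤+ z≤n) (ys ∷ʳ N)))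
              (subst (0ℤ ℤ.<_) (sym last-x) (ℤ.+<+ (s≤s z≤n))) almost

        exists : ∃ λ s → s ∈ search totals m slots
        exists = let base , start , vertex , sums , near , distinct = sperner M d labelling
                 in Cell.found vertex sums near distinct

-- Half-open stretches of the path as intervals on the edges.

module Intervals where

  open import Defs using (ℝ; fromℚ; Interval; point; segment; ∣_∣ᴵ; _∈ᴵ_; InUnitInterval)
  open import Data.Bool.Base using (Bool; true; false; T; if_then_else_)
  open import Data.Bool.Properties using (T?; T-≡)
  open import Data.Integer.Base as ℤ using (+_)
  import Data.Integer.Properties as ℤ
  import Data.Integer.Tactic.RingSolver as ℤSolver
  open import Data.List.Base using (List; []; _∷_)
  open import Data.List.Membership.Propositional using (_∈_)
  open import Data.List.Relation.Unary.Any using (here)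
  open import Data.Nat.Base as ℕ using (ℕ; suc; z≤n)
  import Data.Nat.Properties as ℕ
  open import Data.Product using (∃; _×_; _,_)
  open import Data.Rational.Base using (ℚ; 0ℚ; 1ℚ; _+_; _-_; _*_; -_; _≤_; _<_; fromℚᵘ; toℚᵘ)
  open import Data.Rational.Properties
  open import Data.Rational.Solver using (module +-*-Solver)
  open +-*-Solver using (solve; con; _:-_; _:=_)
  open import Data.Rational.Unnormalised.Base as ℚᵘ using (mkℚᵘ; *≡*; *≤*; *<*)
  import Data.Rational.Unnormalised.Properties as ℚᵘ
  open import Data.Sum.Base using (_⊎_; inj₁; inj₂)
  open import Function.Base using (_∘_)
  open import Function.Bundles using (Equivalence)
  open import Relation.Binary.PropositionalEquality
  open import Relation.Nullary using (¬_; Dec; contradiction; yes; no)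
  open import Relation.Nullary.Decidable using (toWitness; fromWitness)

  <⇒≱ : ∀ {p q} → p < q → ¬ q ≤ p
  <⇒≱ p<q q≤p = <-irrefl refl (<-≤-trans p<q q≤p)

  -- The denominator is suc z.

  opaque
    frac : ℕ → ℕ → ℚ
    frac z a = fromℚᵘ (mkℚᵘ (+ a) z)

  opaque
    unfolding frac

    frac-def : ∀ z a → fromℚᵘ (mkℚᵘ (+ a) z) ≡ frac z a
    frac-def z a = refl

  module _ (z : ℕ) where

    opaque
      unfolding frac

      frac-mono : ∀ {a b} → a ℕ.≤ b → frac z a ≤ frac z b
      frac-mono {a} {b} a≤b = toℚᵘ-cancel-≤ (ℚᵘ.≤-respˡ-≃ (ℚᵘ.≃-sym (toℚᵘ-fromℚᵘ (mkℚᵘ (+ a) z)))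
        (ℚᵘ.≤-respʳ-≃ (ℚᵘ.≃-sym (toℚᵘ-fromℚᵘ (mkℚᵘ (+ b) z))) (*≤* (ℤ.*-monoʳ-≤-nonNeg (+ suc z) (ℤ.+≤+ a≤b)))))

      frac-mono-< : ∀ {a b} → a ℕ.< b → frac z a < frac z b
      frac-mono-< {a} {b} a<b = toℚᵘ-cancel-< (ℚᵘ.<-respˡ-≃ (ℚᵘ.≃-sym (toℚᵘ-fromℚᵘ (mkℚᵘ (+ a) z)))
        (ℚᵘ.<-respʳ-≃ (ℚᵘ.≃-sym (toℚᵘ-fromℚᵘ (mkℚᵘ (+ b) z))) (*<* (ℤ.*-monoʳ-<-pos (+ suc z) (ℤ.+<+ a<b)))))

      frac-0 : frac z 0 ≡ 0ℚ
      frac-0 = fromℚᵘ-cong {mkℚᵘ (+ 0) z} {mkℚᵘ (+ 0) 0} (*≡* refl)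

      frac-1 : frac z (suc z) ≡ 1ℚ
      frac-1 = fromℚᵘ-cong {mkℚᵘ (+ suc z) z} {mkℚᵘ (+ 1) 0} (*≡* (ℤ.*-comm (+ suc z) (+ 1)))

      frac-+ : ∀ a b → frac z (a ℕ.+ b) ≡ frac z a + frac z b
      frac-+ a b = toℚᵘ-injective (begin
        toℚᵘ (frac z (a ℕ.+ b))                    ≈⟨ toℚᵘ-fromℚᵘ (mkℚᵘ (+ (a ℕ.+ b)) z) ⟩
        mkℚᵘ (+ (a ℕ.+ b)) z                       ≈⟨ *≡* (lemma (+ a) (+ b) (+ suc z)) ⟩
        mkℚᵘ (+ a) z ℚᵘ.+ mkℚᵘ (+ b) z             ≈⟨ ℚᵘ.≃-sym (ℚᵘ.+-cong (toℚᵘ-fromℚᵘ (mkℚᵘ (+ a) z)) (toℚᵘ-fromℚᵘ (mkℚᵘ (+ b) z))) ⟩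
        toℚᵘ (frac z a) ℚᵘ.+ toℚᵘ (frac z b)       ≈⟨ ℚᵘ.≃-sym (toℚᵘ-homo-+ (frac z a) (frac z b)) ⟩
        toℚᵘ (frac z a + frac z b)                 ∎)
        where
        open ℚᵘ.≃-Reasoning
        lemma : ∀ a b c → (a ℤ.+ b) ℤ.* (c ℤ.* c) ≡ (a ℤ.* c ℤ.+ b ℤ.* c) ℤ.* c
        lemma = ℤSolver.solve-∀

    frac-∸ : ∀ {a b} → a ℕ.≤ b → frac z (b ℕ.∸ a) ≡ frac z b - frac z a
    frac-∸ {a} {b} a≤b = begin
      frac z (b ℕ.∸ a)                              ≡⟨ sym (+-identityʳ _) ⟩
      frac z (b ℕ.∸ a) + 0ℚ                         ≡⟨ cong (λ s → frac z (b ℕ.∸ a) + s) (sym (+-inverseʳ (frac z a))) ⟩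
      frac z (b ℕ.∸ a) + (frac z a - frac z a)      ≡⟨ sym (+-assoc (frac z (b ℕ.∸ a)) (frac z a) _) ⟩
      frac z (b ℕ.∸ a) + frac z a - frac z a        ≡⟨ cong (λ s → s - frac z a) (sym (frac-+ (b ℕ.∸ a) a)) ⟩
      frac z (b ℕ.∸ a ℕ.+ a) - frac z a             ≡⟨ cong (λ c → frac z c - frac z a) (ℕ.m∸n+n≡m a≤b) ⟩
      frac z b - frac z a                           ∎
      where open ≡-Reasoning

  opaque
    unfolding frac

    frac-* : ∀ y z a b → frac y a * frac z b ≡ frac (z ℕ.+ y ℕ.* suc z) (a ℕ.* b)
    frac-* y z a b = toℚᵘ-injective (begin
      toℚᵘ (frac y a * frac z b)                       ≈⟨ toℚᵘ-homo-* (frac y a) (frac z b) ⟩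
      toℚᵘ (frac y a) ℚᵘ.* toℚᵘ (frac z b)             ≈⟨ ℚᵘ.*-cong (toℚᵘ-fromℚᵘ (mkℚᵘ (+ a) y)) (toℚᵘ-fromℚᵘ (mkℚᵘ (+ b) z)) ⟩
      mkℚᵘ (+ a) y ℚᵘ.* mkℚᵘ (+ b) z                   ≈⟨ *≡* (cong (ℤ._* + (suc y ℕ.* suc z)) (sym (ℤ.pos-* a b))) ⟩
      mkℚᵘ (+ (a ℕ.* b)) (z ℕ.+ y ℕ.* suc z)           ≈⟨ ℚᵘ.≃-sym (toℚᵘ-fromℚᵘ (mkℚᵘ (+ (a ℕ.* b)) (z ℕ.+ y ℕ.* suc z))) ⟩
      toℚᵘ (frac (z ℕ.+ y ℕ.* suc z) (a ℕ.* b))        ∎)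
      where open ℚᵘ.≃-Reasoning

  above-mono : ∀ α {q r} → q ≤ r → T (ℝ.above α q) → T (ℝ.above α r)
  above-mono α {q} {r} q≤r up = let s , s<q , up′ = Equivalence.to (ℝ.above-rounded α q) up
                                in Equivalence.from (ℝ.above-rounded α r) (s , <-≤-trans s<q q≤r , up′)

  below-mono : ∀ α {q r} → q ≤ r → T (ℝ.below α r) → T (ℝ.below α q)
  below-mono α {q} {r} q≤r down = let s , r<s , down′ = Equivalence.to (ℝ.below-rounded α r) down
                                  in Equivalence.from (ℝ.below-rounded α q) (s , ≤-<-trans q≤r r<s , down′)

  -- An edge is divided into suc z equal parts; its points are numbered in
  -- the direction of travel.

  module Grid (z′ : ℕ) where

    z = suc z′

    coord : Bool → ℕ → ℚ
    coord false a = frac z′ a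
    coord true  a = 1ℚ - frac z′ a

    coord-true : ∀ {a} → a ℕ.≤ z → coord true a ≡ frac z′ (z ℕ.∸ a)
    coord-true {a} a≤z = trans (cong (_- frac z′ a) (sym (frac-1 z′))) (sym (frac-∸ z′ a≤z))

    flip-mono-≤ : ∀ {a b} → a ℕ.≤ b → coord true b ≤ coord true a
    flip-mono-≤ a≤b = +-monoʳ-≤ 1ℚ (neg-antimono-≤ (frac-mono z′ a≤b))

    flip-mono-< : ∀ {a b} → a ℕ.< b → coord true b < coord true a
    flip-mono-< a<b = +-monoʳ-< 1ℚ (neg-antimono-< (frac-mono-< z′ a<b))

    coord-0 : ∀ rev → coord rev 0 ≡ (if rev then 1ℚ else 0ℚ)
    coord-0 false = frac-0 z′
    coord-0 true  = cong (λ q → 1ℚ - q) (frac-0 z′)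

    coord-1 : ∀ rev → coord rev z ≡ (if rev then 0ℚ else 1ℚ)
    coord-1 false = frac-1 z′
    coord-1 true  = cong (λ q → 1ℚ - q) (frac-1 z′)

    0≤coord : ∀ rev {a} → a ℕ.≤ z → 0ℚ ≤ coord rev a
    0≤coord false {a} a≤z = subst (_≤ frac z′ a) (frac-0 z′) (frac-mono z′ z≤n)
    0≤coord true  {a} a≤z = subst (_≤ coord true a) (coord-1 true) (flip-mono-≤ a≤z)

    coord≤1 : ∀ rev {a} → a ℕ.≤ z → coord rev a ≤ 1ℚ
    coord≤1 false {a} a≤z = subst (frac z′ a ≤_) (frac-1 z′) (frac-mono z′ a≤z)
    coord≤1 true  {a} a≤z = subst (coord true a ≤_) (coord-0 true) (flip-mono-≤ {0} {a} z≤n)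

    -- Before rev α a: in the direction of travel, α comes before the point
    -- number a.

    Before After : Bool → ℝ → ℕ → Set
    Before false α a = T (ℝ.above α (coord false a))
    Before true  α a = T (ℝ.below α (coord true a))
    After  false α a = T (ℝ.below α (coord false a))
    After  true  α a = T (ℝ.above α (coord true a))

    before? : ∀ rev α a → Dec (Before rev α a)
    before? false α a = T? _
    before? true  α a = T? _

    before-mono : ∀ rev α {a b} → a ℕ.≤ b → Before rev α a → Before rev α b
    before-mono false α a≤b = above-mono α (frac-mono z′ a≤b)
    before-mono true  α a≤b = below-mono α (flip-mono-≤ a≤b)

    not-before-0 : ∀ rev α → InUnitInterval α → ¬ Before rev α 0
    not-before-0 false α (0≤α , _) = 0≤α ∘ subst (λ q → T (ℝ.above α q)) (coord-0 false)
    not-before-0 true  α (_ , α≤1) = α≤1 ∘ subst (λ q → T (ℝ.below α q)) (coord-0 true)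

    not-after-1 : ∀ rev α → InUnitInterval α → ¬ After rev α z
    not-after-1 false α (_ , α≤1) = α≤1 ∘ subst (λ q → T (ℝ.below α q)) (coord-1 false)
    not-after-1 true  α (0≤α , _) = 0≤α ∘ subst (λ q → T (ℝ.above α q)) (coord-1 true)

    -- A point with a number above z lies strictly outside the unit interval, so locatedness can be
    -- applied between it and the end. The other outcome would put α itself outside.
    before-beyond : ∀ rev α {a} → InUnitInterval α → z ℕ.< a → Before rev α a
    before-beyond false α {a} (_ , α≤1) z<a with ℝ.located α (subst (_< coord false a) (coord-1 false) (frac-mono-< z′ z<a))
    ... | inj₁ 1<α = contradiction 1<α α≤1
    ... | inj₂ α<a = α<a
    before-beyond true  α {a} (0≤α , _) z<a with ℝ.located α (subst (coord true a <_) (coord-1 true) (flip-mono-< z<a))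
    ... | inj₁ α<a = α<a
    ... | inj₂ α<0 = contradiction α<0 0≤α

    -- The intersection of the stretch from a (included) to b (excluded) with
    -- an edge of length z.

    part : Bool → ℕ → ℕ → List Interval
    part rev a b with a ℕ.<? b ℕ.⊓ z | a ℕ.≟ z
    part false a b | yes a<e | _       = segment (coord false a) (coord false (b ℕ.⊓ z)) true (z ℕ.<ᵇ b)
      (0≤coord false (ℕ.≤-trans (ℕ.<⇒≤ a<e) (ℕ.m⊓n≤n b z))) (frac-mono-< z′ a<e) (coord≤1 false (ℕ.m⊓n≤n b z)) ∷ []
    part true  a b | yes a<e | _       = segment (coord true (b ℕ.⊓ z)) (coord true a) (z ℕ.<ᵇ b) true
      (0≤coord true (ℕ.m⊓n≤n b z)) (flip-mono-< a<e) (coord≤1 true (ℕ.≤-trans (ℕ.<⇒≤ a<e) (ℕ.m⊓n≤n b z))) ∷ []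
    part rev   a b | no _    | yes a≡z = point (coord rev z) (0≤coord rev ℕ.≤-refl) (coord≤1 rev ℕ.≤-refl) ∷ []
    part rev   a b | no _    | no _    = []

    beyond : ∀ {b} → (z ℕ.<ᵇ b) ≡ true → z ℕ.< b
    beyond {b} eq = ℕ.<ᵇ⇒< z b (Equivalence.from T-≡ eq)

    within : ∀ {b} → (z ℕ.<ᵇ b) ≡ false → b ℕ.≤ z
    within {b} eq = ℕ.≮⇒≥ λ z<b → subst T eq (ℕ.<⇒<ᵇ z<b)

    -- The ends arise by truncated subtraction of the position of the edge. Either both become 0,
    -- because the stretch ends before anything of the edge is reached, or they remain distinct.
    Proper : ℕ → ℕ → Set
    Proper a b = (a ≡ 0 × b ≡ 0) ⊎ a ℕ.< b

    Inside : Bool → ℝ → ℕ → ℕ → Set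
    Inside rev α a b = ¬ Before rev α a × Before rev α b

    part-unique : ∀ rev a b {I J} → I ∈ part rev a b → J ∈ part rev a b → I ≡ J
    part-unique rev a b p q with a ℕ.<? b ℕ.⊓ z | a ℕ.≟ z
    part-unique false a b (here refl) (here refl) | yes _ | _     = refl
    part-unique true  a b (here refl) (here refl) | yes _ | _     = refl
    part-unique false a b (here refl) (here refl) | no _  | yes _ = refl
    part-unique true  a b (here refl) (here refl) | no _  | yes _ = refl

    part-short : ∀ rev a b → part rev a b ≡ [] ⊎ ∃ λ I → part rev a b ≡ I ∷ []
    part-short rev a b with a ℕ.<? b ℕ.⊓ z | a ℕ.≟ z
    part-short false a b | yes _ | _     = inj₂ (_ , refl)
    part-short true  a b | yes _ | _     = inj₂ (_ , refl)
    part-short rev   a b | no _  | yes _ = inj₂ (_ , refl)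
    part-short rev   a b | no _  | no _  = inj₁ refl

    module _ (α : ℝ) (unit : InUnitInterval α) where

      -- The far end is closed if the stretch goes on beyond the edge, and then every point of the
      -- edge comes before b. Otherwise the far end is b itself, which is excluded.
      part-sound : ∀ rev {a b I} → Proper a b → I ∈ part rev a b → α ∈ᴵ I → Inside rev α a b
      part-sound rev {a} {b} proper I∈ α∈ with a ℕ.<? b ℕ.⊓ z | a ℕ.≟ z
      part-sound false {a} {b} proper (here refl) (≥a , ≤e) | yes a<e | _ with z ℕ.<ᵇ b in eq
      ... | true  = ≥a , before-beyond false α unit (beyond {b} eq)
      ... | false = ≥a , subst (Before false α) (ℕ.m≤n⇒m⊓n≡m (within {b} eq)) ≤e
      part-sound true  {a} {b} proper (here refl) (≤e , ≥a) | yes a<e | _ with z ℕ.<ᵇ b in eq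
      ... | true  = ≥a , before-beyond true α unit (beyond {b} eq)
      ... | false = ≥a , subst (Before true α) (ℕ.m≤n⇒m⊓n≡m (within {b} eq)) ≤e
      part-sound false {b = b} (inj₂ z<b) (here refl) (≥z , _) | no _ | yes refl = ≥z , before-beyond false α unit z<b
      part-sound true  {b = b} (inj₂ z<b) (here refl) (_ , ≥z) | no _ | yes refl = ≥z , before-beyond true α unit z<b

      part-complete : ∀ rev {a b I} → I ∈ part rev a b → Inside rev α a b → α ∈ᴵ I
      part-complete rev {a} {b} I∈ inside with a ℕ.<? b ℕ.⊓ z | a ℕ.≟ z
      part-complete false {a} {b} (here refl) (≥a , <b) | yes a<e | _ with z ℕ.<ᵇ b in eq
      ... | true  = ≥a , not-after-1 false α unit ∘ subst (After false α) (ℕ.m≥n⇒m⊓n≡n (ℕ.<⇒≤ (beyond {b} eq)))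
      ... | false = ≥a , subst (Before false α) (sym (ℕ.m≤n⇒m⊓n≡m (within {b} eq))) <b
      part-complete true  {a} {b} (here refl) (≥a , <b) | yes a<e | _ with z ℕ.<ᵇ b in eq
      ... | true  = not-after-1 true α unit ∘ subst (After true α) (ℕ.m≥n⇒m⊓n≡n (ℕ.<⇒≤ (beyond {b} eq))) , ≥a
      ... | false = subst (Before true α) (sym (ℕ.m≤n⇒m⊓n≡m (within {b} eq))) <b , ≥a
      part-complete false (here refl) (≥z , _) | no _ | yes refl = ≥z , not-after-1 false α unit
      part-complete true  (here refl) (≥z , _) | no _ | yes refl = not-after-1 true α unit , ≥z

    part-inhabited : ∀ rev {a b} → a ℕ.≤ z → a ℕ.< b → ∃ (_∈ part rev a b)
    part-inhabited rev {a} {b} a≤z a<b with a ℕ.<? b ℕ.⊓ z | a ℕ.≟ z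
    part-inhabited false a≤z a<b | yes _   | _      = _ , here refl
    part-inhabited true  a≤z a<b | yes _   | _      = _ , here refl
    part-inhabited rev   a≤z a<b | no _    | yes _  = _ , here refl
    part-inhabited rev   a≤z a<b | no  a≮e | no a≢z = contradiction (ℕ.⊓-glb a<b (ℕ.≤∧≢⇒< a≤z a≢z)) a≮e

    part-bounds : ∀ rev {a b I} → Proper a b → I ∈ part rev a b → a ℕ.≤ z × a ℕ.< b
    part-bounds rev {a} {b} proper I∈ with a ℕ.<? b ℕ.⊓ z | a ℕ.≟ z
    part-bounds rev {a} {b} proper      I∈ | yes a<e | _        = ℕ.≤-trans (ℕ.<⇒≤ a<e) (ℕ.m⊓n≤n b z) , ℕ.≤-trans a<e (ℕ.m⊓n≤m b z)
    part-bounds rev {a} {b} (inj₂ a<b)  I∈ | no _    | yes refl = ℕ.≤-refl , a<b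

    part-length : ∀ rev {a b I} → Proper a b → I ∈ part rev a b → ∣ I ∣ᴵ ≡ frac z′ (b ℕ.⊓ z ℕ.∸ a ℕ.⊓ z)
    part-length rev {a} {b} proper I∈ with a ℕ.<? b ℕ.⊓ z | a ℕ.≟ z
    part-length false {a} {b} proper (here refl) | yes a<e | _ = trans (sym (frac-∸ z′ (ℕ.<⇒≤ a<e)))
      (cong (λ c → frac z′ (b ℕ.⊓ z ℕ.∸ c)) (sym (ℕ.m≤n⇒m⊓n≡m (ℕ.≤-trans (ℕ.<⇒≤ a<e) (ℕ.m⊓n≤n b z)))))
    part-length true  {a} {b} proper (here refl) | yes a<e | _ = trans (reflect (frac z′ a) (frac z′ (b ℕ.⊓ z)))
      (trans (sym (frac-∸ z′ (ℕ.<⇒≤ a<e)))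
      (cong (λ c → frac z′ (b ℕ.⊓ z ℕ.∸ c)) (sym (ℕ.m≤n⇒m⊓n≡m (ℕ.≤-trans (ℕ.<⇒≤ a<e) (ℕ.m⊓n≤n b z))))))
      where
      reflect : ∀ p q → (1ℚ - p) - (1ℚ - q) ≡ q - p
      reflect = solve 2 (λ p q → (con 1ℚ :- p) :- (con 1ℚ :- q) := q :- p) refl
    part-length rev {a} {b} (inj₂ z<b) (here refl) | no _ | yes refl = trans (sym (frac-0 z′))
      (cong (frac z′) (sym (trans (cong₂ ℕ._∸_ (ℕ.m≥n⇒m⊓n≡n (ℕ.<⇒≤ z<b)) (ℕ.⊓-idem z)) (ℕ.n∸n≡0 z))))

    part-empty : ∀ rev {a b} → part rev a b ≡ [] → frac z′ (b ℕ.⊓ z ℕ.∸ a ℕ.⊓ z) ≡ 0ℚ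
    part-empty rev {a} {b} eq with a ℕ.<? b ℕ.⊓ z | a ℕ.≟ z
    part-empty false () | yes _ | _
    part-empty true  () | yes _ | _
    part-empty rev {a} {b} eq | no a≮e | no _ = trans (cong (frac z′) (ℕ.m≤n⇒m∸n≡0 (ℕ.⊓-glb (ℕ.≮⇒≥ a≮e) (ℕ.m⊓n≤n b z)))) (frac-0 z′)

    gridPoint : Bool → ℕ → ℝ
    gridPoint rev c = fromℚ (coord rev c)

    gridPoint-unit : ∀ rev {c} → c ℕ.≤ z → InUnitInterval (gridPoint rev c)
    gridPoint-unit rev c≤z = (λ lt → <⇒≱ (toWitness lt) (0≤coord rev c≤z)) , λ lt → <⇒≱ (toWitness lt) (coord≤1 rev c≤z)

    before-grid⁺ : ∀ rev {a c} → c ℕ.< a → Before rev (gridPoint rev c) a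
    before-grid⁺ false c<a = fromWitness (frac-mono-< z′ c<a)
    before-grid⁺ true  c<a = fromWitness (flip-mono-< c<a)

    before-grid⁻ : ∀ rev {a c} → Before rev (gridPoint rev c) a → c ℕ.< a
    before-grid⁻ false lt = ℕ.≰⇒> λ a≤c → <⇒≱ (toWitness lt) (frac-mono z′ a≤c)
    before-grid⁻ true  lt = ℕ.≰⇒> λ a≤c → <⇒≱ (toWitness lt) (flip-mono-≤ a≤c)

-- The pieces of the cycle: covering, linkedness and vertex-disjointness.

module Geometry where

  open import Defs using (ℝ; Graph; left; right; coordinate; fromℚ; Interval; _∈ᴵ_; InUnitInterval; Piece; Partition; EdgePiece; ContainsEnd; Contains; Adjacent; VertexDisjoint)
  open CycleOrder using (CyclicOrder; start; finish)
  open Intervals hiding (<⇒≱)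
  open Division using (rights; lefts; split)
  open import Data.Bool.Base using (true; false; if_then_else_)
  open import Data.Fin.Base as Fin using (Fin; zero; suc; fromℕ)
  import Data.Fin.Properties as Fin
  open import Data.List.Base using (List; []; _∷_; _++_; concatMap; map; upTo)
  open import Data.List.Membership.Propositional using (_∈_; lose; find)
  open import Data.List.Membership.Propositional.Properties
  open import Data.List.Relation.Binary.Disjoint.Propositional using (Disjoint)
  open import Data.List.Relation.Unary.All as All using (All; []; _∷_)
  import Data.List.Relation.Unary.All.Properties as All
  open import Data.List.Relation.Unary.AllPairs using (AllPairs; []; _∷_)
  import Data.List.Relation.Unary.AllPairs.Properties as AllPairs
  open import Data.List.Relation.Unary.Unique.Propositional using (Unique)
  import Data.List.Relation.Unary.Unique.Propositional.Properties as Unique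
  open import Data.Nat.Base using (ℕ; zero; suc; _+_; _*_; _∸_; _≤_; _<_; z≤n; s≤s; s≤s⁻¹)
  open import Data.Nat.Properties
  open import Data.Product using (∃; ∃₂; _×_; _,_; proj₁; proj₂)
  open import Data.Sum.Base using (_⊎_; inj₁; inj₂)
  open import Data.Vec.Base using (Vec; []; _∷_; lookup)
  open import Function.Base using (_∘_)
  open import Function.Bundles using (Equivalence)
  open import Relation.Binary.Construct.Closure.ReflexiveTransitive as Star using (Star; ε; _◅_; _◅◅_)
  open import Relation.Binary.Definitions using (tri<; tri≈; tri>)
  open import Relation.Binary.PropositionalEquality
  open import Relation.Nullary using (¬_; Dec; does; contradiction; yes; no)

  -- A discrete intermediate value argument: P fails at 0 and holds at the top, so it changes
  -- between the ends of some piece.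
  locate : ∀ {d} {P : ℕ → Set} → (∀ X → Dec (P X)) → ∀ top (cuts : Vec ℕ d) → P top → ¬ P 0 →
           ∃ λ q → P (lookup (rights top cuts) q) × ¬ P (lookup (lefts 0 cuts) q)
  locate P? top []         p ¬p₀ = zero , p , ¬p₀
  locate P? top (X ∷ cuts) p ¬p₀ with P? X
  ... | no ¬pX = zero , p , ¬pX
  ... | yes pX = let q , r = locate P? X cuts pX ¬p₀ in suc q , r

  descending : ∀ {d} top (cuts : Vec ℕ d) → (∀ q → lookup (lefts 0 cuts) q ≤ lookup (rights top cuts) q) →
               ∀ p q → p Fin.< q → lookup (rights top cuts) q ≤ lookup (lefts 0 cuts) p
  descending top (X ∷ cuts) ordered zero    (suc q) _         = below X cuts (ordered ∘ suc) q
    where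
    below : ∀ {d} top (cuts : Vec ℕ d) → (∀ q → lookup (lefts 0 cuts) q ≤ lookup (rights top cuts) q) →
            ∀ q → lookup (rights top cuts) q ≤ top
    below top cuts       ordered zero    = ≤-refl
    below top (X ∷ cuts) ordered (suc q) = ≤-trans (below X cuts (ordered ∘ suc) q) (ordered zero)
  descending top (X ∷ cuts) ordered (suc p) (suc q) (s≤s p<q) = descending X cuts (ordered ∘ suc) p q p<q

  -- A monotone P can change only once along the descending sequence of cuts.
  located-unique : ∀ {d} {P : ℕ → Set} → (∀ {X Y} → X ≤ Y → P X → P Y) → ∀ top (cuts : Vec ℕ d) →
    (∀ q → lookup (lefts 0 cuts) q ≤ lookup (rights top cuts) q) → ∀ p q →
    P (lookup (rights top cuts) p) → ¬ P (lookup (lefts 0 cuts) p) →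
    P (lookup (rights top cuts) q) → ¬ P (lookup (lefts 0 cuts) q) → p ≡ q
  located-unique mono top cuts ordered p q Pp ¬Pp Pq ¬Pq with Fin.<-cmp p q
  ... | tri< p<q _ _ = contradiction (mono (descending top cuts ordered p q p<q) Pq) ¬Pp
  ... | tri≈ _ p≡q _ = p≡q
  ... | tri> _ _ q<p = contradiction (mono (descending top cuts ordered q p q<p) Pp) ¬Pq

  module Arcs {G : Graph} (O : CyclicOrder G) (z′ : ℕ) {d : ℕ} (cuts : Vec ℕ d) where
    open Graph G
    open CyclicOrder O
    open Grid z′ public

    m : ℕ
    m = #E

    -- Every point of the circle but the last one lies in one of the arcs
    -- between consecutive cuts; the arc number 0 consists of the last point,
    -- which the circle identifies with the first one.

    A B : Fin (2 + d) → ℕ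
    A r = lookup (lefts 0 (m * z ∷ cuts)) r
    B r = lookup (rights (suc (m * z)) (m * z ∷ cuts)) r

    -- Pieces are numbered from the end of the path, so `fromℕ d` is the one that begins at 0, the
    -- point with which the last one is identified.
    owner : Fin (2 + d) → Fin (suc d)
    owner zero    = fromℕ d
    owner (suc q) = q

    partAt : ℕ → Fin (2 + d) → List Interval
    partAt k r = part (reversed k) (A r ∸ k * z) (B r ∸ k * z)

    arcMembers : Fin (2 + d) → List (EdgePiece G)
    arcMembers r = concatMap (λ k → map (edge k ,_) (partAt k r)) (upTo m)

    pieceMembers : Fin (suc d) → List (EdgePiece G)
    pieceMembers q = arcMembers (suc q) ++ (if does (q Fin.≟ fromℕ d) then arcMembers zero else [])

    module Strict (strict : ∀ q → lookup (lefts 0 cuts) q < lookup (rights (m * z) cuts) q) where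

      strictArc : ∀ r → A r < B r
      strictArc zero    = n<1+n (m * z)
      strictArc (suc q) = strict q

      proper : ∀ k r → Proper (A r ∸ k * z) (B r ∸ k * z)
      proper k r with ≤-<-connex (B r) (k * z)
      ... | inj₁ B≤ = inj₁ (m≤n⇒m∸n≡0 (≤-trans (<⇒≤ (strictArc r)) B≤) , m≤n⇒m∸n≡0 B≤)
      ... | inj₂ <B with ≤-total (A r) (k * z)
      ... | inj₁ A≤ = inj₂ (subst (_< B r ∸ k * z) (sym (m≤n⇒m∸n≡0 A≤)) (m<n⇒0<n∸m <B))
      ... | inj₂ ≤A = inj₂ (∸-monoˡ-< (strictArc r) ≤A)

      arc∈⁺ : ∀ {k r I} → k < m → I ∈ partAt k r → (edge k , I) ∈ arcMembers r
      arc∈⁺ k<m I∈ = ∈-concatMap⁺ _ (lose (∈-upTo⁺ k<m) (∈-map⁺ _ I∈))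

      InArc : Fin (2 + d) → EdgePiece G → Set
      InArc r x = ∃₂ λ k I → k < m × I ∈ partAt k r × x ≡ (edge k , I)

      arc∈⁻ : ∀ {x} r → x ∈ arcMembers r → InArc r x
      arc∈⁻ {x} r x∈ =
        let k , k∈ , x∈′ = find (∈-concatMap⁻ (λ k → map (edge k ,_) (partAt k r)) {xs = upTo m} x∈)
            I , I∈ , eq  = ∈-map⁻ (edge k ,_) x∈′
        in k , I , ∈-upTo⁻ k∈ , I∈ , eq

      piece∈⁺ : ∀ r {x} → x ∈ arcMembers r → x ∈ pieceMembers (owner r)
      piece∈⁺ zero    x∈ with fromℕ d Fin.≟ fromℕ d
      ... | yes _  = ∈-++⁺ʳ (arcMembers (suc (fromℕ d))) x∈
      ... | no neq = contradiction refl neq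
      piece∈⁺ (suc q) x∈ = ∈-++⁺ˡ x∈

      InPiece : Fin (suc d) → EdgePiece G → Set
      InPiece q x = ∃ λ r → owner r ≡ q × InArc r x

      piece∈⁻ : ∀ q {x} → x ∈ pieceMembers q → InPiece q x
      piece∈⁻ q x∈ with ∈-++⁻ (arcMembers (suc q)) x∈
      ... | inj₁ x∈′ = suc q , refl , arc∈⁻ (suc q) x∈′
      ... | inj₂ x∈′ with q Fin.≟ fromℕ d
      ... | yes eq = zero , sym eq , arc∈⁻ zero x∈′

      coordinate-start : ∀ rev → coordinate (start rev) ≡ coord rev 0
      coordinate-start false = sym (coord-0 false)
      coordinate-start true  = sym (coord-0 true)

      coordinate-finish : ∀ rev → coordinate (finish rev) ≡ coord rev z
      coordinate-finish false = sym (coord-1 false)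
      coordinate-finish true  = sym (coord-1 true)

      extent : ∀ {k r I} → I ∈ partAt k r → A r ≤ suc k * z × k * z < B r
      extent {k} {r} I∈ = let a≤z , a<b = part-bounds (reversed k) (proper k r) I∈ in
        ≤-trans (m≤n+m∸n (A r) (k * z)) (≤-trans (+-monoʳ-≤ (k * z) a≤z) (≤-reflexive (+-comm (k * z) z))) ,
        m<n⇒0<n∸m⁻ (≤-<-trans z≤n a<b)
        where
        m<n⇒0<n∸m⁻ : ∀ {a b} → 0 < b ∸ a → a < b
        m<n⇒0<n∸m⁻ {a} {b} lt = ≰⇒> λ b≤a → <⇒≱ lt (≤-reflexive (m≤n⇒m∸n≡0 b≤a))

      existing : ∀ {k r} → A r ≤ suc k * z → k * z < B r → ∃ λ I → I ∈ partAt k r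
      existing {k} {r} A≤ <B with proper k r
      ... | inj₂ a<b     = part-inhabited (reversed k) (m≤n+o⇒m∸n≤o (A r) (k * z) (≤-trans A≤ (≤-reflexive (+-comm z (k * z))))) a<b
      ... | inj₁ (_ , b≡0) = contradiction b≡0 (≢-sym (<⇒≢ (m<n⇒0<n∸m <B)))

      at-start : ∀ {k r I} → I ∈ partAt k r → A r ≤ k * z → ContainsEnd G (edge k , I) (start (reversed k))
      at-start {k} {r} {I} I∈ A≤ = subst (λ q → fromℚ q ∈ᴵ I) (sym (coordinate-start (reversed k)))
        (part-complete (gridPoint (reversed k) 0) (gridPoint-unit (reversed k) z≤n) (reversed k) I∈
          ((λ bf → <⇒≱ (before-grid⁻ (reversed k) bf) (≤-reflexive (m≤n⇒m∸n≡0 A≤))) ,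
           before-grid⁺ (reversed k) (m<n⇒0<n∸m (proj₂ (extent {k} {r} I∈)))))

      at-finish : ∀ {k r I} → I ∈ partAt k r → suc k * z < B r → ContainsEnd G (edge k , I) (finish (reversed k))
      at-finish {k} {r} {I} I∈ <B = subst (λ q → fromℚ q ∈ᴵ I) (sym (coordinate-finish (reversed k)))
        (part-complete (gridPoint (reversed k) z) (gridPoint-unit (reversed k) ≤-refl) (reversed k) I∈
          ((λ bf → <⇒≱ (before-grid⁻ (reversed k) bf) (proj₁ (part-bounds (reversed k) (proper k r) I∈))) ,
           before-grid⁺ (reversed k) (m+n≤o⇒m≤o∸n (suc z) <B)))

      start-at : ∀ {k r I} → I ∈ partAt k r → ContainsEnd G (edge k , I) (start (reversed k)) → A r ≤ k * z × k * z < B r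
      start-at {k} {r} {I} I∈ end =
        let ¬bf , bf = part-sound (gridPoint (reversed k) 0) (gridPoint-unit (reversed k) z≤n) (reversed k) (proper k r) I∈
                         (subst (λ q → fromℚ q ∈ᴵ I) (coordinate-start (reversed k)) end)
        in m∸n≡0⇒m≤n (n≤0⇒n≡0 (≮⇒≥ (¬bf ∘ before-grid⁺ (reversed k)))) , proj₂ (extent {k} {r} I∈)

      finish-at : ∀ {k r I} → I ∈ partAt k r → ContainsEnd G (edge k , I) (finish (reversed k)) → A r ≤ suc k * z × suc k * z < B r
      finish-at {k} {r} {I} I∈ end =
        let ¬bf , bf = part-sound (gridPoint (reversed k) z) (gridPoint-unit (reversed k) ≤-refl) (reversed k) (proper k r) I∈
                         (subst (λ q → fromℚ q ∈ᴵ I) (coordinate-finish (reversed k)) end)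
        in proj₁ (extent {k} {r} I∈) , ≰⇒> λ B≤ → <⇒≱ (before-grid⁻ (reversed k) bf)
             (m≤n+o⇒m∸n≤o (B r) (k * z) (≤-trans B≤ (≤-reflexive (+-comm z (k * z)))))

      Linked : Fin (suc d) → EdgePiece G → EdgePiece G → Set
      Linked q = Star (λ x y → x ∈ pieceMembers q × y ∈ pieceMembers q × Adjacent G x y)

      linked-sym : ∀ {q x y} → Linked q x y → Linked q y x
      linked-sym = Star.reverse λ { (x∈ , y∈ , x≢y , v , xv , yv) → y∈ , x∈ , ≢-sym x≢y , v , yv , xv }

      -- Where an arc reaches beyond a vertex, its parts on the two edges both contain that vertex,
      -- so they are adjacent.
      along : ∀ r n k {I J} → k + n < m → I ∈ partAt k r → J ∈ partAt (k + n) r →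
              Linked (owner r) (edge k , I) (edge (k + n) , J)
      along r zero    k k< I∈ J∈ rewrite +-identityʳ k | part-unique (reversed k) (A r ∸ k * z) (B r ∸ k * z) I∈ J∈ = ε
      along r (suc n) k {I} {J} k< I∈ J∈ rewrite +-suc k n =
        (member (≤-<-trans (m≤m+n k (suc n)) (subst (_< m) (sym (+-suc k n)) k<)) I∈ , member k+1<m (proj₂ next) ,
         (λ eq → <⇒≢ (n<1+n k) (distinctᵉ (<-trans (n<1+n k) k+1<m) k+1<m eq)) ,
         vertex (suc k) , (_ , finishes k , at-finish {k} {r} I∈ reach) , (_ , starts (suc k) , at-start {suc k} {r} (proj₂ next) (proj₁ (extent {k} {r} I∈)))) ◅
        along r n (suc k) k< (proj₂ next) J∈
        where
        member : ∀ {k I} → k < m → I ∈ partAt k r → (edge k , I) ∈ pieceMembers (owner r)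
        member {k} k< I∈ = piece∈⁺ r (arc∈⁺ {k} {r} k< I∈)
        k+1<m : suc k < m
        k+1<m = ≤-<-trans (m≤m+n (suc k) n) k<
        reach : suc k * z < B r
        reach = ≤-<-trans (*-monoˡ-≤ z (m≤m+n (suc k) n)) (proj₂ (extent {suc (k + n)} {r} J∈))
        next : ∃ λ I → I ∈ partAt (suc k) r
        next = existing {suc k} {r} (≤-trans (proj₁ (extent {k} {r} I∈)) (m≤n+m (suc k * z) z)) reach

      within-arc : ∀ r {k l I J} → k < m → l < m → I ∈ partAt k r → J ∈ partAt l r → Linked (owner r) (edge k , I) (edge l , J)
      within-arc r {k} {l} k< l< I∈ J∈ with ≤-total k l
      ... | inj₁ k≤l with n , refl ← m≤n⇒∃[o]m+o≡n k≤l = along r n k l< I∈ J∈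
      ... | inj₂ l≤k with n , refl ← m≤n⇒∃[o]m+o≡n l≤k = linked-sym (along r n l k< J∈ I∈)

      lefts-last : ∀ {d} (cuts : Vec ℕ d) → lookup (lefts 0 cuts) (fromℕ d) ≡ 0
      lefts-last []         = refl
      lefts-last (X ∷ cuts) = lefts-last cuts

      first-arc : A (suc (fromℕ d)) ≡ 0
      first-arc = lefts-last cuts

      0<m : 0 < m
      0<m = ≤-trans (s≤s z≤n) 2≤#E

      -- The piece that owns the last point also contains the beginning of the edge 0; its two arcs
      -- are linked through this member.
      hub : ∃ λ I → I ∈ partAt 0 (suc (fromℕ d))
      hub = existing {0} {suc (fromℕ d)} (subst (_≤ 1 * z) (sym first-arc) z≤n) (≤-<-trans z≤n (strictArc (suc (fromℕ d))))

      -- The last point of the circle is adjacent to the beginning of the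
      -- first edge.

      wrap-hub : ∀ {k I} → k < m → I ∈ partAt k zero → Linked (fromℕ d) (edge k , I) (edge 0 , proj₁ hub)
      wrap-hub {k} {I} k< I∈ =
        (piece∈⁺ zero (arc∈⁺ {k} {zero} k< I∈) , piece∈⁺ (suc (fromℕ d)) (arc∈⁺ {0} {suc (fromℕ d)} 0<m (proj₂ hub)) ,
         (λ eq → <⇒≢ (s≤s⁻¹ (≤-trans 2≤#E (≤-reflexive (sym k+1≡m)))) (sym (distinctᵉ k< 0<m eq))) ,
         vertex (suc k) , (_ , finishes k , at-finish {k} {zero} I∈ (s≤s (≤-reflexive (cong (_* z) k+1≡m)))) ,
         (_ , trans (starts 0) (sym (trans (cong vertex k+1≡m) closed)) , at-start {0} {suc (fromℕ d)} (proj₂ hub) (≤-reflexive first-arc))) ◅ ε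
        where
        k+1≡m : suc k ≡ m
        k+1≡m = ≤-antisym k< (*-cancelʳ-≤ m (suc k) z (proj₁ (extent {k} {zero} I∈)))

      linked-arcs : ∀ r s {k l I J} → owner s ≡ owner r → k < m → l < m → I ∈ partAt k r → J ∈ partAt l s →
                    Linked (owner r) (edge k , I) (edge l , J)
      linked-arcs (suc q) (suc q) refl k< l< I∈ J∈ = within-arc (suc q) k< l< I∈ J∈
      linked-arcs zero    zero    refl k< l< I∈ J∈ = wrap-hub k< I∈ ◅◅ linked-sym (wrap-hub l< J∈)
      linked-arcs (suc q) zero    refl k< l< I∈ J∈ = within-arc (suc q) k< 0<m I∈ (proj₂ hub) ◅◅ linked-sym (wrap-hub l< J∈)
      linked-arcs zero    (suc q) refl k< l< I∈ J∈ = wrap-hub k< I∈ ◅◅ within-arc (suc q) 0<m l< (proj₂ hub) J∈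

      linked-members : ∀ {q x y} → InPiece q x → InPiece q y → Linked q x y
      linked-members (r , refl , k , I , k< , I∈ , refl) (s , eq , l , J , l< , J∈ , refl) = linked-arcs r s eq k< l< I∈ J∈

      linked : ∀ q {x y} → x ∈ pieceMembers q → y ∈ pieceMembers q → Linked q x y
      linked q x∈ y∈ = linked-members (piece∈⁻ q x∈) (piece∈⁻ q y∈)

      module _ {α} (unit : InUnitInterval α) (k : ℕ) where

        P : ℕ → Set
        P X = Before (reversed k) α (X ∸ k * z)

        P-mono : ∀ {X Y} → X ≤ Y → P X → P Y
        P-mono X≤Y = before-mono (reversed k) α (∸-monoˡ-≤ (k * z) X≤Y)

        -- `P X` says that α comes before the point X of the path; the arc of α is the one along
        -- which this becomes true.
        holder : k < m → ∃ λ r → P (B r) × ¬ P (A r)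
        holder k< = locate (λ X → before? (reversed k) α (X ∸ k * z)) (suc (m * z)) (m * z ∷ cuts)
          (before-beyond (reversed k) α unit (m+n≤o⇒m≤o∸n (suc z) (s≤s (*-monoˡ-≤ z k<))))
          (not-before-0 (reversed k) α unit ∘ subst (Before (reversed k) α) (0∸n≡0 (k * z)))

        holder-unique : ∀ r s → P (B r) → ¬ P (A r) → P (B s) → ¬ P (A s) → r ≡ s
        holder-unique = located-unique P-mono (suc (m * z)) (m * z ∷ cuts) (<⇒≤ ∘ strictArc)

        held : ∀ {r} → P (B r) → ¬ P (A r) → ∃ λ I → I ∈ partAt k r × α ∈ᴵ I
        held {r} pB ¬pA with proper k r
        ... | inj₁ (_ , b≡0) = contradiction (subst (Before (reversed k) α) b≡0 pB) (not-before-0 (reversed k) α unit)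
        ... | inj₂ a<b =
          let I , I∈ = part-inhabited (reversed k) (≮⇒≥ (¬pA ∘ before-beyond (reversed k) α unit)) a<b
          in I , I∈ , part-complete α unit (reversed k) I∈ (¬pA , pB)

        meet : ∀ {r s I J} → I ∈ partAt k r → α ∈ᴵ I → J ∈ partAt k s → α ∈ᴵ J → r ≡ s
        meet {r} {s} I∈ αI J∈ αJ =
          let ¬pA , pB = part-sound α unit (reversed k) (proper k r) I∈ αI
              ¬pA′ , pB′ = part-sound α unit (reversed k) (proper k s) J∈ αJ
          in holder-unique r s pB ¬pA pB′ ¬pA′

      same-edge : ∀ {k l} {I J : Interval} → k < m → l < m → (edge k , I) ≡ (edge l , J) → k ≡ l × I ≡ J
      same-edge k< l< eq = distinctᵉ k< l< (cong proj₁ eq) , cong proj₂ eq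

      Covered : E → ℝ → Set
      Covered e α = ∃ λ ((q , I) : Fin (suc d) × Interval) →
        ((e , I) ∈ pieceMembers q × α ∈ᴵ I) ×
        (∀ {y} → (e , proj₂ y) ∈ pieceMembers (proj₁ y) × α ∈ᴵ proj₂ y → (q , I) ≡ y)

      covered : ∀ {k} → k < m → ∀ α → InUnitInterval α → Covered (edge k) α
      covered {k} k< α unit =
        let r , pB , ¬pA = holder unit k k<
            I , I∈ , αI  = held unit k {r} pB ¬pA
        in (owner r , I) , (piece∈⁺ r (arc∈⁺ {k} {r} k< I∈) , αI) ,
           λ {y} (y∈ , αJ) → unique′ r I∈ αI (piece∈⁻ (proj₁ y) y∈) αJ
        where
        unique″ : ∀ {r s l I J} → I ∈ partAt k r → α ∈ᴵ I → J ∈ partAt l s → α ∈ᴵ J → k ≡ l → r ≡ s → (owner r , I) ≡ (owner s , J)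
        unique″ {r} I∈ αI J∈ αJ refl refl = cong (owner r ,_) (part-unique (reversed k) (A r ∸ k * z) (B r ∸ k * z) I∈ J∈)
        unique′ : ∀ r {q I J} → I ∈ partAt k r → α ∈ᴵ I → InPiece q (edge k , J) → α ∈ᴵ J → (owner r , I) ≡ (q , J)
        unique′ r {I = I} {J} I∈ αI (s , refl , l , J′ , l< , J∈ , eq) αJ =
          let k≡l , J≡ = same-edge k< l< eq
              J∈′ = subst₂ (λ l J → J ∈ partAt l s) (sym k≡l) (sym J≡) J∈
          in unique″ {r} {s} I∈ αI J∈′ αJ refl (meet unit k {r} {s} I∈ αI J∈′ αJ)

      covers : ∀ e α → InUnitInterval α → Covered e α
      covers e α unit = let k , k< , eq = position e in subst (λ e → Covered e α) eq (covered k< α unit)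

      -- A listed interval contains its first point in the direction of travel. Being inhabited, it
      -- cannot occur in two arcs without contradicting the uniqueness of the arc of a point.
      witness : ∀ {k r I} → I ∈ partAt k r → ∃ λ α → InUnitInterval α × α ∈ᴵ I
      witness {k} {r} I∈ = let a≤z , a<b = part-bounds (reversed k) (proper k r) I∈
                               unit = gridPoint-unit (reversed k) a≤z in
        gridPoint (reversed k) (A r ∸ k * z) , unit ,
        part-complete (gridPoint (reversed k) (A r ∸ k * z)) unit (reversed k) I∈
          ((λ bf → <⇒≢ (before-grid⁻ (reversed k) bf) refl) , before-grid⁺ (reversed k) a<b)

      disjoint-arcs : ∀ r s {x} → InArc r x → InArc s x → r ≡ s
      disjoint-arcs r s (k , I , k< , I∈ , refl) (l , J , l< , J∈ , eq) =
        let k≡l , I≡J = same-edge k< l< eq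
            α , unit , αI = witness {k} {r} I∈
        in meet unit k {r} {s} I∈ αI (subst₂ (λ l J → J ∈ partAt l s) (sym k≡l) (sym I≡J) J∈) αI

      part-Unique : ∀ k r → Unique (partAt k r)
      part-Unique k r = unique (part-unique (reversed k) (A r ∸ k * z) (B r ∸ k * z)) (part-short (reversed k) (A r ∸ k * z) (B r ∸ k * z))
        where
        unique : ∀ {xs : List Interval} → (∀ {I J} → I ∈ xs → J ∈ xs → I ≡ J) → xs ≡ [] ⊎ (∃ λ I → xs ≡ I ∷ []) → Unique xs
        unique _ (inj₁ refl)       = []
        unique _ (inj₂ (_ , refl)) = [] ∷ []

      arc-Unique : ∀ r → Unique (arcMembers r)
      arc-Unique r = Unique.concat⁺
        (All.map⁺ (All.universal (λ k → Unique.map⁺ (cong proj₂) (part-Unique k r)) (upTo m)))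
        (AllPairs.map⁺ (disjoint (upTo m) (Unique.upTo⁺ m) (All.tabulate ∈-upTo⁻)))
        where
        disjoint : ∀ ks → Unique ks → All (_< m) ks →
          AllPairs (λ k l → Disjoint (map (edge k ,_) (partAt k r)) (map (edge l ,_) (partAt l r))) ks
        disjoint []       []       []         = []
        disjoint (k ∷ ks) (k∉ ∷ u) (k< ∷ ks<) =
          All.zipWith (λ { (k≢l , l<) (x∈ , y∈) → k≢l (apart k< l< x∈ y∈) }) (k∉ , ks<) ∷ disjoint ks u ks<
          where
          apart : ∀ {k l x} → k < m → l < m → x ∈ map (edge k ,_) (partAt k r) → x ∈ map (edge l ,_) (partAt l r) → k ≡ l
          apart {k} {l} k< l< x∈ y∈ with I , _ , refl ← ∈-map⁻ (edge k ,_) x∈ with J , _ , eq ← ∈-map⁻ (edge l ,_) y∈ =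
            distinctᵉ k< l< (cong proj₁ eq)

      piece-Unique : ∀ q → Unique (pieceMembers q)
      piece-Unique q with q Fin.≟ fromℕ d
      ... | yes _ = Unique.++⁺ (arc-Unique (suc q)) (arc-Unique zero) λ { (x∈ , y∈) → contradiction (disjoint-arcs (suc q) zero (arc∈⁻ (suc q) x∈) (arc∈⁻ zero y∈)) λ () }
      ... | no _  = Unique.++⁺ (arc-Unique (suc q)) [] λ { (_ , ()) }

      piece-member : ∀ q → ∃₂ λ e I → (e , I) ∈ pieceMembers q × ∃ λ α → InUnitInterval α × α ∈ᴵ I
      piece-member q with split m z (A (suc q)) 0<m (≤-trans (<⇒≤ (strict q)) (right≤ q))
        where
        right≤ : ∀ q → B (suc q) ≤ m * z
        right≤ q = descending (suc (m * z)) (m * z ∷ cuts) (<⇒≤ ∘ strictArc) zero (suc q) (s≤s z≤n)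
      ... | k , y , k< , y≤z , eq with existing {k} {suc q}
              (≤-trans (≤-reflexive (sym eq)) (≤-trans (+-monoʳ-≤ (k * z) y≤z) (≤-reflexive (+-comm (k * z) z))))
              (≤-<-trans (≤-trans (m≤m+n (k * z) y) (≤-reflexive eq)) (strict q))
      ... | I , I∈ = edge k , I , piece∈⁺ (suc q) (arc∈⁺ {k} {suc q} k< I∈) , witness {k} {suc q} I∈

      piece : Fin (suc d) → Piece G
      piece q = record { members = pieceMembers q ; unique = piece-Unique q ; linked = linked q }

      partition : Partition G
      partition = record
        { #pieces  = suc d
        ; piece    = piece
        ; distinct = λ {i} {j} same →
            let e , I , ∈i , α , unit , α∈ = piece-member i
                _ , _ , uniq = covers e α unit
            in cong proj₁ (trans (sym (uniq {i , I} (∈i , α∈))) (uniq {j , I} (Equivalence.to same ∈i , α∈)))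
        ; covers   = covers
        }

      vertex-at : ∀ {v k r I} → k < m → I ∈ partAt k r → Contains G (edge k , I) v →
                  ∃ λ p → p ≤ m × vertex p ≡ v × A r ≤ p * z × p * z < B r
      vertex-at {v} {k} {r} {I} k< I∈ (s , s≡v , end) with which s (reversed k)
        where
        which : ∀ s rev → s ≡ start rev ⊎ s ≡ finish rev
        which left  false = inj₁ refl
        which left  true  = inj₂ refl
        which right false = inj₂ refl
        which right true  = inj₁ refl
      ... | inj₁ refl = k , <⇒≤ k< , trans (sym (starts k)) s≡v , start-at {k} {r} I∈ end
      ... | inj₂ refl = suc k , k< , trans (sym (finishes k)) s≡v , finish-at {k} {r} I∈ end

      arc-at-unique : ∀ {p r s} → A r ≤ p → p < B r → A s ≤ p → p < B s → r ≡ s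
      arc-at-unique {p} {r} {s} Ar Br As Bs = located-unique {P = p <_} (λ X≤Y p<X → ≤-trans p<X X≤Y)
        (suc (m * z)) (m * z ∷ cuts) (<⇒≤ ∘ strictArc) r s Br (≤⇒≯ Ar) Bs (≤⇒≯ As)

      owner-last : ∀ r → A r ≤ m * z → m * z < B r → owner r ≡ fromℕ d
      owner-last r Ar Br = cong owner (arc-at-unique {m * z} {r} {zero} Ar Br ≤-refl (n<1+n _))

      owner-first : ∀ r → A r ≤ 0 → 0 < B r → owner r ≡ fromℕ d
      owner-first r Ar Br = cong owner (arc-at-unique {0} {r} {suc (fromℕ d)} Ar Br
        (≤-reflexive first-arc) (≤-<-trans z≤n (strictArc (suc (fromℕ d)))))

      -- Different positions belong to the same vertex only if they are 0 and m, and both of these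
      -- are owned by the piece that begins at 0.
      owner-at : ∀ r s {p q} → A r ≤ p * z → p * z < B r → A s ≤ q * z → q * z < B s → vertex p ≡ vertex q →
                 p < m ⊎ p ≡ m → q < m ⊎ q ≡ m → owner r ≡ owner s
      owner-at r s Ar Br As Bs eq (inj₁ p<)   (inj₁ q<)   with refl ← distinctᵛ p< q< eq = cong owner (arc-at-unique {_} {r} {s} Ar Br As Bs)
      owner-at r s Ar Br As Bs eq (inj₂ refl) (inj₂ refl) = cong owner (arc-at-unique {m * z} {r} {s} Ar Br As Bs)
      owner-at r s Ar Br As Bs eq (inj₁ p<)   (inj₂ refl) with refl ← distinctᵛ p< 0<m (trans eq closed) =
        trans (owner-first r Ar Br) (sym (owner-last s As Bs))
      owner-at r s Ar Br As Bs eq (inj₂ refl) (inj₁ q<)   with refl ← distinctᵛ q< 0<m (trans (sym eq) closed) =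
        trans (owner-last r Ar Br) (sym (owner-first s As Bs))

      vertexDisjoint : VertexDisjoint G partition
      vertexDisjoint v {i} {j} x∈ xv y∈ yv = go (piece∈⁻ i x∈) (piece∈⁻ j y∈) xv yv
        where
        go : ∀ {i j x y} → InPiece i x → InPiece j y → Contains G x v → Contains G y v → i ≡ j
        go (r , refl , k , I , k< , I∈ , refl) (s , refl , l , J , l< , J∈ , refl) xv yv =
          let p , p≤m , p≡v , Ar , Br = vertex-at {v} {k} {r} k< I∈ xv
              q , q≤m , q≡v , As , Bs = vertex-at {v} {l} {s} l< J∈ yv
          in owner-at r s Ar Br As Bs (trans p≡v (sym q≡v)) (m≤n⇒m<n∨m≡n p≤m) (m≤n⇒m<n∨m≡n q≤m)

-- The utility of a piece in terms of the measure.

module Valuation where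

  open import Defs using (Graph; ∣_∣ᴵ; EdgePiece)
  open CycleOrder using (CyclicOrder)
  open Intervals using (frac; frac-0; frac-+; frac-*; frac-mono)
  open Geometry using (module Arcs)
  open Division using (Σ[_]; μ; Σ-cong; Σ-+; Σ-zero; rights; lefts)
  open import Data.Bool.Base using (if_then_else_)
  open import Data.Fin.Base as Fin using (Fin; zero; suc; fromℕ)
  import Data.Fin.Properties as Fin
  open import Data.List.Base using (List; []; _∷_; _++_; concatMap; map; foldr; upTo; applyUpTo)
  open import Data.List.Relation.Unary.All as All using (All; []; _∷_)
  open import Data.List.Relation.Unary.Any using (here)
  open import Data.List.Membership.Propositional using (_∈_)
  open import Data.List.Membership.Propositional.Properties using (∈-upTo⁻)
  open import Data.Nat.Base as ℕ using (ℕ; zero; suc; _∸_; _⊓_)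
  open import Data.Nat.ListAction using (sum)
  import Data.Nat.Properties as ℕ
  open import Data.Nat.Tactic.RingSolver using (solve-∀)
  open import Data.Product using (_,_; proj₁; proj₂)
  open import Data.Rational.Base using (ℚ; 0ℚ; _+_; _*_; _≤_)
  open import Data.Rational.Properties using (+-identityˡ; +-identityʳ; +-assoc; *-zeroˡ)
  open import Data.Sum.Base using (inj₁; inj₂)
  open import Data.Vec.Base using (Vec; lookup)
  open import Function.Base using (_∘_; id)
  open import Relation.Binary.PropositionalEquality
  open import Relation.Nullary using (does; yes; no)

  Σ-front : ∀ f n → Σ[ f ] (suc n) ≡ f 0 ℕ.+ Σ[ f ∘ suc ] n
  Σ-front f zero    = sym (ℕ.+-identityʳ (f 0))
  Σ-front f (suc n) = trans (cong (ℕ._+ f (suc n)) (Σ-front f n)) (ℕ.+-assoc (f 0) _ _)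

  sum-applyUpTo : ∀ {A : Set} (g : A → ℕ) f n → sum (map g (applyUpTo f n)) ≡ Σ[ g ∘ f ] n
  sum-applyUpTo g f zero    = refl
  sum-applyUpTo g f (suc n) = trans (cong (g (f 0) ℕ.+_) (sum-applyUpTo g (f ∘ suc) n)) (sym (Σ-front (g ∘ f) n))

  module Worth {G : Graph} (O : CyclicOrder G) (z′ D′ : ℕ) {d : ℕ} (cuts : Vec ℕ d)
    (strict : ∀ q → lookup (lefts 0 cuts) q ℕ.< lookup (rights (Graph.#E G ℕ.* suc z′) cuts) q)
    (u : Graph.E G → ℚ) (f : ℕ → ℕ) where

    open Graph G
    open CyclicOrder O
    open Arcs O z′ cuts
    open Strict strict

    worth : List (EdgePiece G) → ℚ
    worth xs = foldr _+_ 0ℚ (map (λ (e , I) → ∣ I ∣ᴵ * u e) xs)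

    worth-++ : ∀ xs ys → worth (xs ++ ys) ≡ worth xs + worth ys
    worth-++ []       ys = sym (+-identityˡ _)
    worth-++ (x ∷ xs) ys = trans (cong (λ s → ∣ proj₂ x ∣ᴵ * u (proj₁ x) + s) (worth-++ xs ys)) (sym (+-assoc (∣ proj₂ x ∣ᴵ * u (proj₁ x)) _ _))

    -- The common denominator of all values, minus one.

    c : ℕ
    c = D′ ℕ.+ z′ ℕ.* suc D′

    len : Fin (2 ℕ.+ d) → ℕ → ℕ
    len r k = (B r ∸ k ℕ.* z) ⊓ z ∸ (A r ∸ k ℕ.* z) ⊓ z

    gain : Fin (2 ℕ.+ d) → ℕ
    gain r = Σ[ (λ k → f k ℕ.* len r k) ] m

    gain-μ : ∀ r → gain r ℕ.+ μ f z m (A r) ≡ μ f z m (B r)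
    gain-μ r = trans (sym (Σ-+ _ _ m)) (Σ-cong m λ {k} _ → trans (sym (ℕ.*-distribˡ-+ (f k) (len r k) _))
      (cong (f k ℕ.*_) (ℕ.m∸n+n≡m (ℕ.⊓-monoˡ-≤ z (ℕ.∸-monoˡ-≤ (k ℕ.* z) (ℕ.<⇒≤ (strictArc r)))))))

    -- This arc is a single point, so handing it to the piece that begins at 0 does not change any
    -- utility.
    gain-wrap : gain zero ≡ 0
    gain-wrap = trans (Σ-cong m λ {k} k< → trans (cong (f k ℕ.*_) (ℕ.m≤n⇒m∸n≡0 (ℕ.≤-trans (ℕ.m⊓n≤n (B zero ∸ k ℕ.* z) z)
        (ℕ.≤-reflexive (sym (ℕ.m≥n⇒m⊓n≡n (ℕ.m+n≤o⇒m≤o∸n z (ℕ.*-monoˡ-≤ z k<)))))))) (ℕ.*-zeroʳ (f k)))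
      (Σ-zero m λ _ → refl)

    module _ (u≡ : ∀ k → k ℕ.< m → u (edge k) ≡ frac D′ (f k)) where

      worth-part : ∀ r k → k ℕ.< m → worth (map (edge k ,_) (partAt k r)) ≡ frac c (f k ℕ.* len r k)
      worth-part r k k< = trans (single (partAt k r) refl) (trans (cong (frac z′ (len r k) *_) (u≡ k k<))
        (trans (frac-* z′ D′ (len r k) (f k)) (cong (frac c) (ℕ.*-comm (len r k) (f k)))))
        where
        single : ∀ Is → Is ≡ partAt k r → worth (map (edge k ,_) Is) ≡ frac z′ (len r k) * u (edge k)
        single Is Is≡ with part-short (reversed k) (A r ∸ k ℕ.* z) (B r ∸ k ℕ.* z)
        ... | inj₁ eq rewrite trans Is≡ eq = sym (trans (cong (_* u (edge k)) (part-empty (reversed k) eq)) (*-zeroˡ (u (edge k))))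
        ... | inj₂ (I , eq) rewrite trans Is≡ eq = trans (+-identityʳ _)
                (cong (_* u (edge k)) (part-length (reversed k) (proper k r) (subst (I ∈_) (sym eq) (here refl))))

      worth-arc : ∀ r → worth (arcMembers r) ≡ frac c (gain r)
      worth-arc r = trans (collect (upTo m) (All.tabulate ∈-upTo⁻)) (cong (frac c) (sum-applyUpTo _ id m))
        where
        collect : ∀ ks → All (ℕ._< m) ks →
          worth (concatMap (λ k → map (edge k ,_) (partAt k r)) ks) ≡ frac c (sum (map (λ k → f k ℕ.* len r k) ks))
        collect []       []         = sym (frac-0 c)
        collect (k ∷ ks) (k< ∷ ks<) = trans (worth-++ (map (edge k ,_) (partAt k r)) _)
          (trans (cong₂ _+_ (worth-part r k k<) (collect ks ks<)) (sym (frac-+ c _ _)))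

      worth-piece : ∀ q → worth (pieceMembers q) ≡ frac c (gain (suc q))
      worth-piece q = trans (worth-++ (arcMembers (suc q)) _) (trans (cong₂ _+_ (worth-arc (suc q)) rest) (+-identityʳ _))
        where
        rest : worth (if does (q Fin.≟ fromℕ d) then arcMembers zero else []) ≡ 0ℚ
        rest with q Fin.≟ fromℕ d
        ... | yes _ = trans (worth-arc zero) (trans (cong (frac c) gain-wrap) (frac-0 c))
        ... | no  _ = refl

      -- Adding the measures up to both left ends turns the gains into the sums of the hypothesis,
      -- so that no truncated subtraction occurs.
      worth-mono : ∀ p q → μ f z m (lookup (rights (m ℕ.* z) cuts) p) ℕ.+ μ f z m (lookup (lefts 0 cuts) q) ℕ.≤
                           μ f z m (lookup (rights (m ℕ.* z) cuts) q) ℕ.+ μ f z m (lookup (lefts 0 cuts) p) →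
                   worth (pieceMembers p) ≤ worth (pieceMembers q)
      worth-mono p q le = subst₂ _≤_ (sym (worth-piece p)) (sym (worth-piece q)) (frac-mono c
        (ℕ.+-cancelʳ-≤ (μ f z m (A (suc p)) ℕ.+ μ f z m (A (suc q))) _ _ (begin
          gain (suc p) ℕ.+ (μ f z m (A (suc p)) ℕ.+ μ f z m (A (suc q)))  ≡⟨ sym (ℕ.+-assoc (gain (suc p)) _ _) ⟩
          gain (suc p) ℕ.+ μ f z m (A (suc p)) ℕ.+ μ f z m (A (suc q))    ≡⟨ cong (ℕ._+ μ f z m (A (suc q))) (gain-μ (suc p)) ⟩
          μ f z m (B (suc p)) ℕ.+ μ f z m (A (suc q))                     ≤⟨ le ⟩
          μ f z m (B (suc q)) ℕ.+ μ f z m (A (suc p))                     ≡⟨ cong (ℕ._+ μ f z m (A (suc p))) (sym (gain-μ (suc q))) ⟩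
          gain (suc q) ℕ.+ μ f z m (A (suc q)) ℕ.+ μ f z m (A (suc p))    ≡⟨ lemma (gain (suc q)) (μ f z m (A (suc q))) (μ f z m (A (suc p))) ⟩
          gain (suc q) ℕ.+ (μ f z m (A (suc p)) ℕ.+ μ f z m (A (suc q)))  ∎)))
        where
        open ℕ.≤-Reasoning
        lemma : ∀ a b c → a ℕ.+ b ℕ.+ c ≡ a ℕ.+ (c ℕ.+ b)
        lemma = solve-∀

-- The algorithm as a polynomial-time program.

module Algorithm where

  open import Defs using (Tree; nil; cons; size; bit; natural)
  open Complexity
  open Arithmetic
  open LinearProgram
  open Division using (Slot; tuples; permutations; flat; form; rights; lefts; pieceRow; positionForms; valueForms; lowerRow; upperRow; envyRow; rows; search; solutionsAt; cutsOf)
  open import Data.Bool.Base using (Bool; true; false; if_then_else_; _∧_; _∨_; not; T)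
  open import Data.Bool.Properties using (T-≡)
  open import Data.Fin.Base as Fin using (Fin; zero; suc; toℕ; inject₁; fromℕ)
  import Data.Fin.Properties as Fin
  open import Data.Integer.Base as ℤ using (ℤ; ∣_∣; 0ℤ; 1ℤ)
  open import Data.List.Base as List using (List; []; _∷_; _++_; concatMap; concat; map; filterᵇ; foldl; reverse)
  open import Data.List.Properties using (ʳ++-defn; ++-identityʳ; reverse-involutive)
  open import Data.Nat.Base using (ℕ; zero; suc; _+_; _*_; _∸_; _⊓_; _^_; _≤_; _<_; _≤ᵇ_; _<ᵇ_; _≡ᵇ_; z≤n; s≤s)
  open import Data.Nat.ListAction using (sum; product)
  open import Data.Nat.Properties
  open import Data.Nat.Tactic.RingSolver using (solve-∀)
  open import Data.Product using (_×_; _,_; proj₁; proj₂; uncurry)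
  open import Data.Vec.Base as Vec using (Vec; []; _∷_; lookup; _∷ʳ_; tabulate)
  open import Function.Base using (_∘_; const)
  open import Function.Bundles using (Equivalence)
  open import Relation.Binary.PropositionalEquality
  open import Relation.Nullary using (does)

  private variable
    σ τ ρ Γ : Ty

  -- The index is known when the program is built, so every component may have a program of its own.
  vtabulateP : ∀ n {f : Fin n → El Γ → El τ} → (∀ i → PolyTime Γ τ (f i)) →
               PolyTime Γ (vec τ n) (λ γ → tabulate (λ i → f i γ))
  vtabulateP zero    F = vnil
  vtabulateP (suc n) F = ⟨ F zero , vtabulateP n (λ i → F (suc i)) ⟩ ▷ vcons

  ltabulateP : ∀ n {f : Fin n → El Γ → El τ} → (∀ i → PolyTime Γ τ (f i)) →
               PolyTime Γ (list τ) (λ γ → List.tabulate (λ i → f i γ))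
  ltabulateP zero    F = nilP
  ltabulateP (suc n) F = ⟨ F zero , ltabulateP n (λ i → F (suc i)) ⟩ ▷ consP

  concatTabulateP : ∀ n {f : Fin n → El Γ → List (El τ)} → (∀ i → PolyTime Γ (list τ) (f i)) →
                    PolyTime Γ (list τ) (λ γ → concat (List.tabulate (λ i → f i γ)))
  concatTabulateP zero    F = nilP
  concatTabulateP (suc n) F = ⟨ F zero , concatTabulateP n (λ i → F (suc i)) ⟩ ▷ appendP

  -- The list is not part of the data: the program contains a copy for each element. It is used for
  -- the assignments of the pieces, whose number depends only on n.
  concatConstantP : ∀ {A : Set} (xs : List A) {f : A → El Γ → List (El τ)} → (∀ x → PolyTime Γ (list τ) (f x)) →
                    PolyTime Γ (list τ) (λ γ → concatMap (λ x → f x γ) xs)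
  concatConstantP []       F = nilP
  concatConstantP (x ∷ xs) F = ⟨ F x , concatConstantP xs F ⟩ ▷ appendP

  vlookupP : ∀ {n} (i : Fin n) → PolyTime (vec τ n) τ (λ v → lookup v i)
  vlookupP zero    = ext vhead λ { (_ ∷ _) → refl }
  vlookupP (suc i) = ext (vtail ▷ vlookupP i) λ { (_ ∷ _) → refl }

  snocP : ∀ n → PolyTime (vec τ n ⊗ τ) (vec τ (suc n)) (λ (v , x) → v ∷ʳ x)
  snocP zero    = ext (⟨ snd , vnil ⟩ ▷ vcons) λ { ([] , _) → refl }
  snocP (suc n) = ext (⟨ fst ▷ vhead , ⟨ fst ▷ vtail , snd ⟩ ▷ snocP n ⟩ ▷ vcons) λ { (_ ∷ _ , _) → refl }

  minP : PolyTime (num ⊗ num) num (uncurry _⊓_)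
  minP = ext (cond leqP fst snd) λ (m , n) → eq m n
    where
    eq : ∀ m n → (if m ≤ᵇ n then m else n) ≡ m ⊓ n
    eq m n with m ≤ᵇ n in le
    ... | true  = sym (m≤n⇒m⊓n≡m (≤ᵇ⇒≤ m n (Equivalence.from T-≡ le)))
    ... | false = sym (m≥n⇒m⊓n≡n (<⇒≤ (≰⇒> λ m≤n → subst T le (≤⇒≤ᵇ m≤n))))

  orP : PolyTime (bool ⊗ bool) bool (uncurry _∨_)
  orP = ext (cond fst (constant true) snd) λ { (true , _) → refl ; (false , _) → refl }

  slotTy : ℕ → Ty
  slotTy n = num ⊗ vec (num ⊗ num) n

  flatP : ∀ d → PolyTime int (vec int (suc d)) (flat d)
  flatP zero    = ⟨ identity , vnil ⟩ ▷ vcons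
  flatP (suc d) = ⟨ constant 0ℤ , flatP d ⟩ ▷ vcons

  formP : ∀ {d} (i : Fin d) → PolyTime (int ⊗ int) (vec int (suc d)) (λ (b , a) → form i b a)
  formP {suc d} zero    = ⟨ snd , fst ▷ flatP d ⟩ ▷ vcons
  formP         (suc i) = ⟨ constant 0ℤ , formP i ⟩ ▷ vcons

  leftsP : ∀ {d} {bottom} → PolyTime Γ τ bottom → ∀ {mids} → PolyTime Γ (vec τ d) mids →
           PolyTime Γ (vec τ (suc d)) (λ γ → lefts (bottom γ) (mids γ))
  leftsP {d = d} bottomP midsP = ⟨ midsP , bottomP ⟩ ▷ snocP d

  rightsP : ∀ {d} {top} → PolyTime Γ τ top → ∀ {mids} → PolyTime Γ (vec τ d) mids →
            PolyTime Γ (vec τ (suc d)) (λ γ → rights (top γ) (mids γ))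
  rightsP topP midsP = ⟨ topP , midsP ⟩ ▷ vcons

  pieceRowP : ∀ {d} (q : Fin (suc d)) → PolyTime (int ⊗ vec (vec int (suc d)) d) (vec int (suc d)) (λ (t , mids) → pieceRow t mids q)
  pieceRowP {d} q = ⟨ rightsP (fst ▷ flatP d) snd ▷ vlookupP q , leftsP (constant (flat d 0ℤ)) snd ▷ vlookupP q ⟩ ▷ subtractP (suc d)

  module _ (d : ℕ) where

    private n = suc d

    positionFormsP : PolyTime (vec (slotTy n) d) (vec (vec int n) d) positionForms
    positionFormsP = vtabulateP d λ i → ⟨ vlookupP i ▷ fst ▷ positiveP , constant 1ℤ ⟩ ▷ formP i

    valueFormsP : ∀ a → PolyTime (vec (slotTy n) d) (vec (vec int n) d) (valueForms a)
    valueFormsP a = vtabulateP d λ i →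
      ⟨ vlookupP i ▷ snd ▷ vlookupP a ▷ fst ▷ positiveP , vlookupP i ▷ snd ▷ vlookupP a ▷ snd ▷ positiveP ⟩ ▷ formP i

    problemTy : Ty
    problemTy = (vec num n ⊗ num) ⊗ vec (slotTy n) d

    envyRowP : ∀ π a q → PolyTime problemTy (vec int n) (λ ((T , _) , js) → envyRow T js π a q)
    envyRowP π a q = ⟨ piece (lookup π a) , piece q ⟩ ▷ subtractP n
      where
      piece : ∀ q → PolyTime problemTy (vec int n) _
      piece q = ⟨ fst ▷ fst ▷ vlookupP a ▷ positiveP , snd ▷ valueFormsP a ⟩ ▷ pieceRowP q

    rowsP : ∀ π → PolyTime problemTy (list (vec int n)) (λ ((T , m) , js) → rows T m π js)
    rowsP π =
      ⟨ ltabulateP d (λ i → constant (lowerRow i)) , ⟨ ltabulateP d (λ i → constant (upperRow i)) ,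
      ⟨ ltabulateP n (λ q → ⟨ fst ▷ snd ▷ positiveP , snd ▷ positionFormsP ⟩ ▷ pieceRowP q) ,
        concatTabulateP n (λ a → ltabulateP n (envyRowP π a)) ⟩ ▷ appendP ⟩ ▷ appendP ⟩ ▷ appendP

    solutionTy : Ty
    solutionTy = vec int n ⊗ (vec (slotTy n) d ⊗ vec num n)

    solutionsAtP : ∀ π → PolyTime problemTy (list solutionTy) (λ ((T , m) , js) → solutionsAt T m π js)
    solutionsAtP π =
      ⟨ snd , ⟨ rowsP π , rowsP π ▷ candidatesP d ⟩ ▷ filterP (⟨ snd , fst ⟩ ▷ feasibleᵇP n) ⟩ ▷
      mapP ⟨ snd , ⟨ fst , constant (Vec.map toℕ π) ⟩ ⟩

    tuplesP : ∀ k → PolyTime (list τ) (list (vec τ k)) (tuples k)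
    tuplesP zero    = constant ([] ∷ [])
    tuplesP (suc k) = ⟨ identity , tuplesP k ⟩ ▷ concatMapP (⟨ snd , fst ⟩ ▷ mapP (⟨ snd , fst ⟩ ▷ vcons))

    searchP : PolyTime ((vec num n ⊗ num) ⊗ list (slotTy n)) (list solutionTy) (λ ((T , m) , slots) → search T m slots)
    searchP = concatConstantP (permutations n) λ π → ⟨ fst , snd ▷ tuplesP d ⟩ ▷ concatMapP (solutionsAtP π)

    lastP : ∀ k → PolyTime (vec τ (suc k)) τ Vec.last
    lastP zero    = ext vhead λ { (_ ∷ []) → refl }
    lastP (suc k) = ext (vtail ▷ lastP k) λ { (_ ∷ _ ∷ _) → refl }

    cutsOfP : PolyTime (vec int n ⊗ vec (slotTy n) d) (vec num d) (uncurry cutsOf)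
    cutsOfP = vtabulateP d λ i →
      ⟨ ⟨ snd ▷ vlookupP i ▷ fst , fst ▷ lastP d ▷ absP ⟩ ▷ mulP , fst ▷ vlookupP (inject₁ i) ▷ absP ⟩ ▷ addP

  indexFrom : ∀ {A : Set} → ℕ → List A → List (ℕ × A)
  indexFrom k []       = []
  indexFrom k (x ∷ xs) = (k , x) ∷ indexFrom (suc k) xs

  index : ∀ {A : Set} → List A → List (ℕ × A)
  index = indexFrom 0

  indexStep : ∀ {A : Set} → ℕ × List (ℕ × A) → A → ℕ × List (ℕ × A)
  indexStep (k , out) x = suc k , (k , x) ∷ out

  index-steps : ∀ {A : Set} (xs : List A) k out →
                foldl indexStep (k , out) xs ≡ (List.length xs + k , indexFrom k xs List.ʳ++ out)
  index-steps []       k out = refl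
  index-steps (x ∷ xs) k out = trans (index-steps xs (suc k) ((k , x) ∷ out))
    (cong (_, indexFrom k (x ∷ xs) List.ʳ++ out) (+-suc (List.length xs) k))

  n<2^1+n : ∀ n → n < 2 ^ suc n
  n<2^1+n zero    = s≤s z≤n
  n<2^1+n (suc n) = ≤-trans (+-mono-≤ (m^n>0 2 (suc n)) (n<2^1+n n)) (≤-reflexive (cong (2 ^ suc n +_) (sym (+-identityʳ _))))

  -- 2^S exceeds all indices. An entry adds two `cons` nodes and a number of size at most 4 S + 1 to
  -- the size of its element.
  index-size : ∀ τ (xs : List (El τ)) k out S → k + List.length xs < 2 ^ S →
    size (enc (list (num ⊗ τ)) (indexFrom k xs List.ʳ++ out)) ≤
    size (enc (list (num ⊗ τ)) out) + List.length xs * (4 * S + 3) + size (enc (list τ) xs)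
  index-size τ []       k out S lt = ≤-trans (m≤m+n _ 0) (m≤m+n _ 1)
  index-size τ (x ∷ xs) k out S lt = ≤-trans (index-size τ xs (suc k) ((k , x) ∷ out) S (subst (_< 2 ^ S) (+-suc k _) lt))
    (≤-trans (+-monoˡ-≤ _ (+-monoˡ-≤ _ (+-monoˡ-≤ O (s≤s (s≤s (+-monoˡ-≤ X (natural-size S (≤-<-trans (m≤m+n k _) lt))))))))
             (≤-trans (≤-reflexive (lemma O (List.length xs) S X (size (enc (list τ) xs)))) (+-monoʳ-≤ (O + suc (List.length xs) * (4 * S + 3)) (n≤1+n _))))
    where
    O = size (enc (list (num ⊗ τ)) out)
    X = size (enc τ x)
    lemma : ∀ o l s x xs → suc (suc (4 * s + 1 + x)) + o + l * (4 * s + 3) + xs ≡ o + suc l * (4 * s + 3) + (x + xs)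
    lemma = solve-∀

  indexP : PolyTime (list τ) (list (num ⊗ τ)) index
  indexP {τ} = ext
    (⟨ ⟨ constant {τ = tree} nil , identity ⟩ , constant (0 , []) ⟩ ▷
     fold (λ _ → indexStep) (⟨ snd ▷ fst ▷ sucP , ⟨ ⟨ snd ▷ fst , fst ▷ snd ⟩ , snd ▷ snd ⟩ ▷ consP ⟩)
       (con 1 ⊕ (con 4 ⊛ (con 2 ⊛ var ⊕ con 1) ⊕ con 1) ⊕ (var ⊕ var ⊛ (con 4 ⊛ (con 2 ⊛ var ⊕ con 1) ⊕ con 3) ⊕ var))
       bounded ▷
     snd ▷ reverseP)
    λ xs → trans (cong (reverse ∘ proj₂) (index-steps xs 0 []))
      (trans (cong reverse (ʳ++-defn (index xs))) (trans (cong reverse (++-identityʳ (reverse (index xs)))) (reverse-involutive (index xs))))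
    where
    bounded : ∀ (γ : Tree) xs ((k , out) : ℕ × List (ℕ × El τ)) → size (enc (num ⊗ list (num ⊗ τ)) (foldl indexStep (k , out) xs)) ≤ _
    bounded γ xs (k , out) rewrite index-steps xs k out = s≤s (+-mono-≤
      (≤-trans (natural-size S (≤-<-trans (≤-reflexive (+-comm L k)) k+L<)) (+-monoˡ-≤ 1 (*-monoʳ-≤ 4 S≤)))
      (≤-trans (index-size τ xs k out S k+L<)
        (+-mono-≤ (+-mono-≤ O≤ (*-mono-≤ L≤ (+-monoˡ-≤ 3 (*-monoʳ-≤ 4 S≤)))) X≤)))
      where
      L = List.length xs
      s = size (natural k)
      S = s + suc L
      N = size (enc ((tree ⊗ list τ) ⊗ (num ⊗ list (num ⊗ τ))) ((γ , xs) , (k , out)))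
      k+L< : k + L < 2 ^ S
      k+L< = sum<2^ {a = s} (size≥1 (natural k)) (s≤s z≤n) (natural-upper k) (n<2^1+n L)
      X≤ : size (enc (list τ) xs) ≤ N
      X≤ = m≤n⇒m≤1+n (m≤n⇒m≤n+o (size (enc (num ⊗ list (num ⊗ τ)) (k , out))) (m≤n⇒m≤1+n (m≤n+m _ (size γ))))
      L≤ : L ≤ N
      L≤ = ≤-trans (n≤1+n L) (≤-trans (length≤ τ xs) X≤)
      s≤ : s ≤ N
      s≤ = m≤n⇒m≤1+n (m≤n⇒m≤o+n (size (enc (tree ⊗ list τ) (γ , xs))) (m≤n⇒m≤1+n (m≤m+n s _)))
      O≤ : size (enc (list (num ⊗ τ)) out) ≤ N
      O≤ = m≤n⇒m≤1+n (m≤n⇒m≤o+n (size (enc (tree ⊗ list τ) (γ , xs))) (m≤n⇒m≤1+n (m≤n+m _ s)))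
      S≤ : S ≤ 2 * N + 1
      S≤ = ≤-trans (+-mono-≤ s≤ (s≤s L≤)) (≤-reflexive (lemma N))
        where
        lemma : ∀ n → n + suc n ≡ 2 * n + 1
        lemma = solve-∀

  lengthP : PolyTime (list τ) num (λ xs → sum (map (const 1) xs))
  lengthP = ⟨ constant {τ = tree} nil , identity ⟩ ▷ sumP (constant 1)

  -- The edges in cyclic order, each with the direction of travel.  The state
  -- of the walk is the current edge, its end, and the edges passed so far.

  edgeTy walkTy orderTy : Ty
  edgeTy  = num ⊗ (num ⊗ num)
  walkTy  = (num ⊗ num) ⊗ list (num ⊗ bool)
  orderTy = list (num ⊗ (num ⊗ bool))

  -- On a cycle exactly one edge passes this test.
  continues : ℕ × ℕ → ℕ × (ℕ × ℕ) → Bool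
  continues (i , v) (j , (l , r)) = not (j ≡ᵇ i) ∧ ((l ≡ᵇ v) ∨ (r ≡ᵇ v))

  nextEdges : List (ℕ × (ℕ × ℕ)) → ℕ × ℕ → List (ℕ × (ℕ × ℕ))
  nextEdges es here = filterᵇ (continues here) es

  advance : El walkTy → (ℕ × (ℕ × ℕ)) × List (ℕ × (ℕ × ℕ)) → El walkTy
  advance ((i , v) , out) ((j , (l , r)) , _) = if l ≡ᵇ v then ((j , r) , (j , false) ∷ out) else ((j , l) , (j , true) ∷ out)

  -- The edges over which the walk is folded act as a counter: there is one step for every edge but
  -- the first.
  walkStep : List (ℕ × (ℕ × ℕ)) → El walkTy → ℕ × (ℕ × ℕ) → El walkTy
  walkStep es s _ = caseList (nextEdges es (proj₁ s)) s (advance s)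

  setOff : (ℕ × (ℕ × ℕ)) → El walkTy
  setOff (i , (l , r)) = (i , r) , (i , false) ∷ []

  cycleOrder : List (ℕ × (ℕ × ℕ)) → List (ℕ × Bool)
  cycleOrder es = caseList es [] λ (e , rest) → reverse (proj₂ (foldl (walkStep es) (setOff e) rest))

  nextEdgesP : PolyTime (list edgeTy ⊗ (num ⊗ num)) (list edgeTy) (uncurry nextEdges)
  nextEdgesP = ⟨ snd , fst ⟩ ▷ filterP
    (⟨ ⟨ snd ▷ fst , fst ▷ fst ⟩ ▷ eqP ▷ notP ,
       ⟨ ⟨ snd ▷ snd ▷ fst , fst ▷ snd ⟩ ▷ eqP , ⟨ snd ▷ snd ▷ snd , fst ▷ snd ⟩ ▷ eqP ⟩ ▷ orP ⟩ ▷ andP)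

  walkStepP : PolyTime ((list edgeTy ⊗ edgeTy) ⊗ walkTy) walkTy (λ ((es , e) , s) → walkStep es s e)
  walkStepP = match (⟨ fst ▷ fst , snd ▷ fst ⟩ ▷ nextEdgesP) snd
    (cond (⟨ edge ▷ snd ▷ fst , fst ▷ snd ▷ fst ▷ snd ⟩ ▷ eqP)
      ⟨ ⟨ edge ▷ fst , edge ▷ snd ▷ snd ⟩ , ⟨ ⟨ edge ▷ fst , constant false ⟩ , fst ▷ snd ▷ snd ⟩ ▷ consP ⟩
      ⟨ ⟨ edge ▷ fst , edge ▷ snd ▷ fst ⟩ , ⟨ ⟨ edge ▷ fst , constant true ⟩ , fst ▷ snd ▷ snd ⟩ ▷ consP ⟩)
    where
    edge : PolyTime (((list edgeTy ⊗ edgeTy) ⊗ walkTy) ⊗ (edgeTy ⊗ list edgeTy)) edgeTy (proj₁ ∘ proj₂)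
    edge = snd ▷ fst

  filter-head : ∀ τ (p : El τ → Bool) xs {y ys} → filterᵇ p xs ≡ y ∷ ys → size (enc τ y) ≤ size (enc (list τ) xs)
  filter-head τ p (x ∷ xs) eq with p x
  filter-head τ p (x ∷ xs) refl | true  = m≤n⇒m≤1+n (m≤m+n _ _)
  filter-head τ p (x ∷ xs) eq   | false = ≤-trans (filter-head τ p xs eq) (m≤n⇒m≤1+n (m≤n+m _ (size (enc τ x))))

  walk-grows : ∀ es s e → size (enc walkTy (walkStep es s e)) ≤ size (enc walkTy s) + (2 * size (enc (list edgeTy) es) + 6)
  walk-grows es s@((i , v) , out) e with nextEdges es (i , v) in eq
  ... | [] = m≤m+n _ _
  ... | (j , (l , r)) ∷ rest = advanced (l ≡ᵇ v)
    where
    E = size (enc (list edgeTy) es)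
    N = size (natural j)
    O = size (enc (list (num ⊗ bool)) out)
    I = size (enc (num ⊗ num) (i , v))
    fits : suc (N + suc (size (natural l) + size (natural r))) ≤ E
    fits = filter-head edgeTy (continues (i , v)) es eq
    step : ∀ w b → N + w ≤ E → size (bit b) ≤ 3 →
           suc (suc (N + w) + suc (suc (N + size (bit b)) + O)) ≤ suc (I + O) + (2 * E + 6)
    step w b Jw≤ b≤ = ≤-trans (s≤s (+-mono-≤ (s≤s Jw≤) (s≤s (+-monoˡ-≤ O (s≤s (+-mono-≤ (≤-trans (m≤m+n N w) Jw≤) b≤))))))
      (≤-trans (≤-reflexive (lemma E O)) (+-monoˡ-≤ (2 * E + 6) (s≤s (m≤n+m O I))))
      where
      lemma : ∀ e o → suc (suc e + suc (suc (e + 3) + o)) ≡ suc o + (2 * e + 6)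
      lemma = solve-∀
    advanced : ∀ b → size (enc walkTy (if b then ((j , r) , (j , false) ∷ out) else ((j , l) , (j , true) ∷ out))) ≤ suc (I + O) + (2 * E + 6)
    advanced true  = step (size (natural r)) false (≤-trans (≤-trans (+-monoʳ-≤ N (m≤n⇒m≤1+n (m≤n+m _ (size (natural l))))) (n≤1+n _)) fits) (bit≤3 false)
    advanced false = step (size (natural l)) true (≤-trans (≤-trans (+-monoʳ-≤ N (m≤n⇒m≤1+n (m≤m+n _ (size (natural r))))) (n≤1+n _)) fits) (bit≤3 true)

  cycleOrderP : PolyTime (list edgeTy) (list (num ⊗ bool)) cycleOrder
  cycleOrderP = match identity nilP
    (⟨ ⟨ fst , snd ▷ snd ⟩ , snd ▷ fst ▷ ⟨ ⟨ fst , snd ▷ snd ⟩ , ⟨ ⟨ fst , constant false ⟩ , nilP ⟩ ▷ consP ⟩ ⟩ ▷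
     foldGrowing walkStep walkStepP (con 2 ⊛ var ⊕ con 6) (λ es s e → ≤-trans (walk-grows es s e)
       (+-monoʳ-≤ (size (enc walkTy s)) (+-monoˡ-≤ 6 (*-monoʳ-≤ 2 (m≤m+n (size (enc (list edgeTy) es)) (size (enc edgeTy e))))))) ▷
     snd ▷ reverseP)

  -- The weight of an edge for an agent: all values multiplied by the product
  -- of all denominators.

  utilitiesTy : Ty
  utilitiesTy = list (num ⊗ (int ⊗ num))

  weight : El utilitiesTy → ℕ → ℕ
  weight us e = product (map (λ (i , (p , q)) → if i ≡ᵇ e then ∣ p ∣ else q) us)

  weightP : PolyTime (num ⊗ utilitiesTy) num (λ (e , us) → weight us e)
  weightP = productP (cond (⟨ snd ▷ fst , fst ⟩ ▷ eqP) (snd ▷ snd ▷ fst ▷ absP) (snd ▷ snd ▷ snd))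

  totalWeight : El orderTy → El utilitiesTy → ℕ
  totalWeight order us = sum (map (λ (_ , (e , _)) → weight us e) order)

  totalWeightP : PolyTime (orderTy ⊗ utilitiesTy) num (uncurry totalWeight)
  totalWeightP = ⟨ snd , fst ⟩ ▷ sumP (⟨ snd ▷ snd ▷ fst , fst ⟩ ▷ weightP)

  weightBefore : El orderTy → El utilitiesTy → ℕ → ℕ
  weightBefore order us k = sum (map (λ (i , (e , _)) → if i <ᵇ k then weight us e else 0) order)

  weightBeforeP : PolyTime ((orderTy ⊗ utilitiesTy) ⊗ num) num (λ ((order , us) , k) → weightBefore order us k)
  weightBeforeP = ⟨ ⟨ fst ▷ snd , snd ⟩ , fst ▷ fst ⟩ ▷
    sumP (cond (⟨ snd ▷ fst , fst ▷ snd ⟩ ▷ ltP) (⟨ snd ▷ snd ▷ fst , fst ▷ fst ⟩ ▷ weightP) (constant 0))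

  slotsOf : ∀ {n} → El orderTy → Vec (El utilitiesTy) n → List (Slot n)
  slotsOf order agents = map (λ (k , (e , _)) → k , Vec.map (λ us → weightBefore order us k , weight us e) agents) order

  slotsOfP : ∀ n → PolyTime (orderTy ⊗ vec utilitiesTy n) (list (slotTy n)) (uncurry slotsOf)
  slotsOfP n = ⟨ identity , fst ⟩ ▷ mapP
    ⟨ snd ▷ fst , ⟨ ⟨ fst ▷ fst , snd ⟩ , fst ▷ snd ⟩ ▷
      vmapP n ⟨ ⟨ ⟨ fst ▷ fst , snd ⟩ , fst ▷ snd ▷ fst ⟩ ▷ weightBeforeP , ⟨ fst ▷ snd ▷ snd ▷ fst , snd ⟩ ▷ weightP ⟩ ⟩

  fractionTree : ℕ × ℕ → Tree
  fractionTree (z , a) = enc (int ⊗ num) (ℤ.+ a , z)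

  fractionTreeP : PolyTime (num ⊗ num) tree fractionTree
  fractionTreeP = ⟨ snd ▷ positiveP , fst ⟩ ▷ toTree

  segmentTree : (Bool × Bool) × (Tree × Tree) → Tree
  segmentTree = enc ((bool ⊗ bool) ⊗ (tree ⊗ tree))

  stretchTy : Ty
  stretchTy = (bool ⊗ num) ⊗ (num ⊗ num)

  -- Follows `part` case by case; the coordinate 1 - a / z on a reversed edge becomes the fraction
  -- (z - a) / z.
  partTrees : El stretchTy → List Tree
  partTrees ((rev , z) , (a , b)) =
    if a <ᵇ b ⊓ z
    then (if rev then segmentTree (((z <ᵇ b) , true) , (fractionTree (z , z ∸ (b ⊓ z)) , fractionTree (z , z ∸ a)))
                 else segmentTree ((true , (z <ᵇ b)) , (fractionTree (z , a) , fractionTree (z , b ⊓ z)))) ∷ []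
    else (if a ≡ᵇ z then cons nil (fractionTree (z , (if rev then 0 else z))) ∷ [] else [])

  partTreesP : PolyTime stretchTy (list tree) partTrees
  partTreesP = cond (⟨ a , ⟨ b , z ⟩ ▷ minP ⟩ ▷ ltP)
    (cond rev
      (⟨ ⟨ ⟨ z , b ⟩ ▷ ltP , constant true ⟩ , ⟨ ⟨ z , ⟨ z , ⟨ b , z ⟩ ▷ minP ⟩ ▷ monusP ⟩ ▷ fractionTreeP , ⟨ z , ⟨ z , a ⟩ ▷ monusP ⟩ ▷ fractionTreeP ⟩ ⟩ ▷ toTree)
      (⟨ ⟨ constant true , ⟨ z , b ⟩ ▷ ltP ⟩ , ⟨ ⟨ z , a ⟩ ▷ fractionTreeP , ⟨ z , ⟨ b , z ⟩ ▷ minP ⟩ ▷ fractionTreeP ⟩ ⟩ ▷ toTree) ▷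
     singleton)
    (cond (⟨ a , z ⟩ ▷ eqP) (⟨ constant {τ = tree} nil , ⟨ z , cond rev (constant 0) z ⟩ ▷ fractionTreeP ⟩ ▷ toTree ▷ singleton) nilP)
    where
    rev : PolyTime stretchTy bool _
    rev = fst ▷ fst
    z : PolyTime stretchTy num _
    z = fst ▷ snd
    a : PolyTime stretchTy num _
    a = snd ▷ fst
    b : PolyTime stretchTy num _
    b = snd ▷ snd

  arcTrees : El orderTy → ℕ → ℕ → ℕ → List (ℕ × Tree)
  arcTrees order z A B = concatMap (λ (k , (e , rev)) → map (e ,_) (partTrees ((rev , z) , (A ∸ k * z , B ∸ k * z)))) order

  arcTreesP : PolyTime ((orderTy ⊗ num) ⊗ (num ⊗ num)) (list (num ⊗ tree)) (λ ((order , z) , (A , B)) → arcTrees order z A B)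
  arcTreesP = ⟨ ⟨ fst ▷ snd , snd ⟩ , fst ▷ fst ⟩ ▷ concatMapP
    (⟨ snd ▷ snd ▷ fst , ⟨ ⟨ snd ▷ snd ▷ snd , fst ▷ fst ⟩ , ⟨ ⟨ fst ▷ snd ▷ fst , offset ⟩ ▷ monusP , ⟨ fst ▷ snd ▷ snd , offset ⟩ ▷ monusP ⟩ ⟩ ▷ partTreesP ⟩ ▷
     mapP identity)
    where
    offset : PolyTime ((num ⊗ (num ⊗ num)) ⊗ (num ⊗ (num ⊗ bool))) num _
    offset = ⟨ snd ▷ fst , fst ▷ fst ⟩ ▷ mulP

  takeVec : ∀ {A : Set} k → A → List A → Vec A k
  takeVec zero    x₀ xs = []
  takeVec (suc k) x₀ xs = caseList xs x₀ proj₁ ∷ takeVec k x₀ (caseList xs [] proj₂)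

  takeVecP : ∀ k x₀ → PolyTime (list τ) (vec τ k) (takeVec k x₀)
  takeVecP zero    x₀ = vnil
  takeVecP (suc k) x₀ = ⟨ match identity (constant x₀) (snd ▷ fst) , match identity nilP (snd ▷ snd) ▷ takeVecP k x₀ ⟩ ▷ vcons

  module _ (d : ℕ) where

    private n = suc d

    pieceTrees : El orderTy → ℕ → ℕ → Vec ℕ d → Fin n → List (ℕ × Tree)
    pieceTrees order m z cuts q = arc (suc q) ++ (if does (q Fin.≟ fromℕ d) then arc zero else [])
      where
      arc : Fin (suc n) → List (ℕ × Tree)
      arc r = arcTrees order z (lookup (lefts 0 (m * z ∷ cuts)) r) (lookup (rights (suc (m * z)) (m * z ∷ cuts)) r)

    cuttingTy : Ty
    cuttingTy = (orderTy ⊗ num) ⊗ (num ⊗ vec num d)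

    pieceTreesP : ∀ q → PolyTime cuttingTy (list (num ⊗ tree)) (λ ((order , m) , (z , cuts)) → pieceTrees order m z cuts q)
    pieceTreesP q = ⟨ arc (suc q) , extra (does (q Fin.≟ fromℕ d)) ⟩ ▷ appendP
      where
      circumference : PolyTime cuttingTy num (λ ((order , m) , (z , cuts)) → m * z)
      circumference = ⟨ fst ▷ snd , snd ▷ fst ⟩ ▷ mulP
      all : PolyTime cuttingTy (vec num (suc d)) (λ ((order , m) , (z , cuts)) → m * z ∷ cuts)
      all = ⟨ circumference , snd ▷ snd ⟩ ▷ vcons
      arc : ∀ r → PolyTime cuttingTy (list (num ⊗ tree)) (λ ((order , m) , (z , cuts)) →
            arcTrees order z (lookup (lefts 0 (m * z ∷ cuts)) r) (lookup (rights (suc (m * z)) (m * z ∷ cuts)) r))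
      arc r = ⟨ ⟨ fst ▷ fst , snd ▷ fst ⟩ , ⟨ leftsP (constant 0) all ▷ vlookupP r , rightsP (circumference ▷ sucP) all ▷ vlookupP r ⟩ ⟩ ▷ arcTreesP
      extra : ∀ b → PolyTime cuttingTy (list (num ⊗ tree)) (λ ((order , m) , (z , cuts)) →
              if b then arcTrees order z (lookup (lefts 0 (m * z ∷ cuts)) zero) (lookup (rights (suc (m * z)) (m * z ∷ cuts)) zero) else [])
      extra true  = arc zero
      extra false = nilP

    answerTy : Ty
    answerTy = tree ⊗ (vec (list (num ⊗ tree)) n ⊗ vec num n)

    answer : (El orderTy × ℕ) × El (solutionTy d) → Tree
    answer ((order , m) , (x , (js , πs))) = enc answerTy (nil , (tabulate (pieceTrees order m ∣ Vec.last x ∣ (cutsOf x js)) , πs))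

    answerP : PolyTime ((orderTy ⊗ num) ⊗ solutionTy d) tree answer
    answerP = ⟨ constant {τ = tree} nil , ⟨
        ⟨ fst , ⟨ snd ▷ fst ▷ lastP d d ▷ absP , ⟨ snd ▷ fst , snd ▷ snd ▷ fst ⟩ ▷ cutsOfP d ⟩ ⟩ ▷ vtabulateP n pieceTreesP
      , snd ▷ snd ▷ snd ⟩ ⟩ ▷ toTree

  inputTy : Ty
  inputTy = (num ⊗ list (num ⊗ num)) ⊗ list (list (int ⊗ num))

  preparedTy : Ty
  preparedTy = (orderTy ⊗ num) ⊗ list utilitiesTy

  prepare : El inputTy → El preparedTy
  prepare ((_ , es) , uss) = (index (cycleOrder (index es)) , sum (map (const 1) es)) , map index uss

  prepareP : PolyTime inputTy preparedTy prepare
  prepareP = ⟨ ⟨ fst ▷ snd ▷ indexP ▷ cycleOrderP ▷ indexP , fst ▷ snd ▷ lengthP ⟩ ,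
               ⟨ constant {τ = tree} nil , snd ⟩ ▷ mapP (snd ▷ indexP) ⟩

  solutions : ∀ d → (El orderTy × ℕ) × Vec (El utilitiesTy) (suc d) → List (El (solutionTy d))
  solutions d ((order , m) , agents) = search (Vec.map (totalWeight order) agents) m (slotsOf order agents)

  solutionsP : ∀ d → PolyTime ((orderTy ⊗ num) ⊗ vec utilitiesTy (suc d)) (list (solutionTy d)) (solutions d)
  solutionsP d = ⟨ ⟨ ⟨ fst ▷ fst , snd ⟩ ▷ vmapP (suc d) totalWeightP , fst ▷ snd ⟩ , ⟨ fst ▷ fst , snd ⟩ ▷ slotsOfP (suc d) ⟩ ▷ searchP d

  -- After an empty search `nil` would be the answer no; on a cycle with d + 1 agents the search
  -- always finds something.
  solve : ∀ d → El preparedTy → Tree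
  solve d (om , agents) = caseList (solutions d (om , takeVec (suc d) [] agents)) nil (λ (s , _) → answer d (om , s))

  solveP : ∀ d → PolyTime preparedTy tree (solve d)
  solveP d = match (⟨ fst , snd ▷ takeVecP (suc d) [] ⟩ ▷ solutionsP d) (constant nil) (⟨ fst ▷ fst , snd ▷ fst ⟩ ▷ answerP d)

  -- The number of agents fixes the number of unknowns, so each number needs a program of its own.
  -- The length of the list of utilities selects it.
  solveUpTo : ℕ → El preparedTy → Tree
  solveUpTo zero    _ = nil
  solveUpTo (suc d) p = if sum (map (const 1) (proj₂ p)) ≡ᵇ suc d then solve d p else solveUpTo d p

  solveUpToP : ∀ c → PolyTime preparedTy tree (solveUpTo c)
  solveUpToP zero    = constant nil
  solveUpToP (suc d) = cond (⟨ snd ▷ lengthP , constant (suc d) ⟩ ▷ eqP) (solveP d) (solveUpToP d)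

  algorithm : ℕ → El inputTy → Tree
  algorithm c = solveUpTo c ∘ prepare

  algorithmP : ∀ c → PolyTime inputTy tree (algorithm c)
  algorithmP c = prepareP ▷ solveUpToP c

-- Correctness of the algorithm and of its output.

module Correctness where

  open import Defs hiding (empty; value; yes; no)
  open Complexity
  open Algorithm
  open CycleOrder using (CyclicOrder; cyclicOrder; start; finish; injective⇒surjective)
  open Division using (Σ[_]; Slot; μ; search; cutsOf; Σ-cong; shrinking; module Problem; module Measure)
  open Geometry using (module Arcs)
  open Intervals using (frac; frac-def; frac-0; frac-mono-<; module Grid)
  open Sperner using (≡ᵇ-refl; ≡ᵇ-false)
  open Valuation using (sum-applyUpTo; module Worth)
  open import Data.Bool.Base using (Bool; true; false; if_then_else_; not; _∧_; _∨_; T)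
  open import Data.Bool.Properties using (T-≡; T-∧; T-∨; ∨-zeroʳ)
  open import Data.Fin.Base as Fin using (Fin; zero; suc; toℕ; fromℕ)
  import Data.Fin.Properties as Fin
  open import Data.Integer.Base as ℤ using (ℤ; +_; ∣_∣)
  import Data.Integer.Properties as ℤ
  open import Data.List.Base as List using (List; []; _∷_; _++_; map; foldl; reverse; filterᵇ; concatMap; applyUpTo; applyDownFrom; upTo)
  open import Data.List.Properties using (map-tabulate; map-applyUpTo; reverse-applyDownFrom; tabulate-cong; length-tabulate)
  open import Data.List.Membership.Propositional using (_∈_)
  open import Data.List.Membership.Propositional.Properties using (∈-tabulate⁺; ∈-tabulate⁻)
  open import Data.List.Relation.Unary.Any using (here; there)
  open import Data.Nat.Base as ℕ using (ℕ; zero; suc; _∸_; _⊓_; _<ᵇ_; _≡ᵇ_; z≤n; s≤s; pred)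
  open import Data.Nat.ListAction using (product) renaming (sum to sumℕ)
  import Data.Nat.Properties as ℕ
  open import Data.Nat.Tactic.RingSolver using (solve-∀)
  open import Data.Product using (∃; _×_; _,_; proj₁; proj₂)
  open import Data.Rational.Base using (ℚ; 0ℚ; 1ℚ; _≤_; fromℚᵘ; toℚᵘ)
  open import Data.Rational.Properties using (fromℚᵘ-cong; toℚᵘ-fromℚᵘ; toℚᵘ-mono-≤; +-0-commutativeMonoid)
  open import Algebra.Properties.CommutativeMonoid.Sum +-0-commutativeMonoid using (sum; sum-cong-≗; sum-replicate-zero)
  open import Data.Rational.Unnormalised.Base as ℚᵘ using (ℚᵘ; mkℚᵘ; *≡*; *≤*; ↥_; ↧ₙ_)
  import Data.Rational.Unnormalised.Properties as ℚᵘ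
  open import Data.Sum.Base using (_⊎_; inj₁; inj₂)
  open import Data.Vec.Base as Vec using (Vec; []; _∷_; lookup)
  import Data.Vec.Properties as Vec
  open import Function.Base using (_∘_; id; const)
  open import Function.Bundles using (Equivalence; Bijection; mk⤖)
  open import Relation.Binary.PropositionalEquality
  open import Relation.Nullary using (¬_; does; contradiction; yes; no)

  ≮⇒<ᵇ : ∀ {m n} → ¬ m ℕ.< n → (m <ᵇ n) ≡ false
  ≮⇒<ᵇ {m} {n} m≮n with m <ᵇ n in eq
  ... | true  = contradiction (ℕ.<ᵇ⇒< m n (Equivalence.from T-≡ eq)) m≮n
  ... | false = refl

  ≡ᵇ⇒≡ : ∀ {n} {i j : Fin n} → T (toℕ i ≡ᵇ toℕ j) → i ≡ j
  ≡ᵇ⇒≡ {i = i} {j} t = Fin.toℕ-injective (ℕ.≡ᵇ⇒≡ (toℕ i) (toℕ j) t)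

  indexFrom-tabulate : ∀ {A : Set} {n} (f : Fin n → A) k →
                       indexFrom k (List.tabulate f) ≡ List.tabulate (λ i → k ℕ.+ toℕ i , f i)
  indexFrom-tabulate {n = zero}  f k = refl
  indexFrom-tabulate {n = suc n} f k = cong₂ _∷_ (cong (_, f zero) (sym (ℕ.+-identityʳ k)))
    (trans (indexFrom-tabulate (f ∘ suc) (suc k)) (tabulate-cong λ i → cong (_, f (suc i)) (sym (ℕ.+-suc k (toℕ i)))))

  applyUpTo-cong : ∀ {A : Set} {f g : ℕ → A} n → (∀ {k} → k ℕ.< n → f k ≡ g k) → applyUpTo f n ≡ applyUpTo g n
  applyUpTo-cong zero    eq = refl
  applyUpTo-cong (suc n) eq = cong₂ _∷_ (eq (s≤s z≤n)) (applyUpTo-cong n (eq ∘ s≤s))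

  indexFrom-applyUpTo : ∀ {A : Set} (f : ℕ → A) n k → indexFrom k (applyUpTo f n) ≡ applyUpTo (λ i → k ℕ.+ i , f i) n
  indexFrom-applyUpTo f zero    k = refl
  indexFrom-applyUpTo f (suc n) k = cong₂ _∷_ (cong (_, f 0) (sym (ℕ.+-identityʳ k)))
    (trans (indexFrom-applyUpTo (f ∘ suc) n (suc k)) (applyUpTo-cong n λ {i} _ → cong (_, f (suc i)) (sym (ℕ.+-suc k i))))

  filter-single : ∀ {A : Set} (p : A → Bool) xs {y} → y ∈ xs → p y ≡ true → (∀ x → x ∈ xs → p x ≡ true → x ≡ y) →
                  ∃ λ ys → filterᵇ p xs ≡ y ∷ ys
  filter-single p (x ∷ xs) y∈ py only with p x in px
  ... | true  = _ , cong (_∷ _) (only x (here refl) px)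
  filter-single p (x ∷ xs) (here refl) py only | false with () ← trans (sym px) py
  filter-single p (x ∷ xs) (there y∈)  py only | false = filter-single p xs y∈ py (λ x → only x ∘ there)

  tabulate-head : ∀ {A : Set} {n} (f : Fin n → A) i → toℕ i ≡ 0 → ∃ λ rest → List.tabulate f ≡ f i ∷ rest × suc (List.length rest) ≡ n
  tabulate-head {n = suc n} f zero _ = List.tabulate (f ∘ suc) , refl , cong suc (length-tabulate (f ∘ suc))

  module Walk {G : Graph} (O : CyclicOrder G) where
    open Graph G
    open CyclicOrder O

    entry : E → ℕ × (ℕ × ℕ)
    entry e = toℕ e , (toℕ (endpoint e left) , toℕ (endpoint e right))

    entries : List (ℕ × (ℕ × ℕ))
    entries = List.tabulate entry

    passed : ℕ → ℕ × Bool
    passed k = toℕ (edge k) , reversed k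

    state : ℕ → El walkTy
    state k = (toℕ (edge k) , toℕ (vertex (suc k))) , applyDownFrom passed (suc k)

    touches : ∀ e s v → endpoint e s ≡ v → ((toℕ (endpoint e left) ≡ᵇ toℕ v) ∨ (toℕ (endpoint e right) ≡ᵇ toℕ v)) ≡ true
    touches e left  v refl rewrite ≡ᵇ-refl (toℕ v) = refl
    touches e right v refl rewrite ≡ᵇ-refl (toℕ v) = ∨-zeroʳ _

    continues⇒ : ∀ i v e → continues (toℕ i , toℕ v) (entry e) ≡ true → e ≢ i × ∃ λ s → endpoint e s ≡ v
    continues⇒ i v e eq = let t , t′ = Equivalence.to (T-∧ {not (toℕ e ≡ᵇ toℕ i)}) (Equivalence.from T-≡ eq) in
      apart t , end (Equivalence.to (T-∨ {toℕ (endpoint e left) ≡ᵇ toℕ v}) t′)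
      where
      apart : T (not (toℕ e ≡ᵇ toℕ i)) → e ≢ i
      apart t refl = subst (T ∘ not) (≡ᵇ-refl (toℕ e)) t
      end : T (toℕ (endpoint e left) ≡ᵇ toℕ v) ⊎ T (toℕ (endpoint e right) ≡ᵇ toℕ v) → ∃ λ s → endpoint e s ≡ v
      end (inj₁ p) = left , ≡ᵇ⇒≡ p
      end (inj₂ p) = right , ≡ᵇ⇒≡ p

    -- By `incident` only two edges meet at the vertex, and the test excludes the one just passed.
    next-entry : ∀ k → suc k ℕ.< #E → ∃ λ ys → nextEdges entries (toℕ (edge k) , toℕ (vertex (suc k))) ≡ entry (edge (suc k)) ∷ ys
    next-entry k k+1< = filter-single _ entries (∈-tabulate⁺ (edge (suc k)))
      (cong₂ _∧_ (cong not (≡ᵇ-false λ eq → ℕ.<⇒≢ (ℕ.n<1+n k) (sym (distinctᵉ k+1< (ℕ.<-trans (ℕ.n<1+n k) k+1<) (Fin.toℕ-injective eq)))))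
                 (touches (edge (suc k)) (start (reversed (suc k))) (vertex (suc k)) (starts (suc k))))
      only
      where
      only : ∀ x → x ∈ entries → continues (toℕ (edge k) , toℕ (vertex (suc k))) x ≡ true → x ≡ entry (edge (suc k))
      only x x∈ cont with e , refl ← ∈-tabulate⁻ x∈ with continues⇒ (edge k) (vertex (suc k)) e cont
      ... | e≢ , s , eq with incident e s k eq
      ... | inj₁ same = contradiction same e≢
      ... | inj₂ same = cong entry same

    advance-entry : ∀ e rev {v w} i out ys → endpoint e (start rev) ≡ v → endpoint e (finish rev) ≡ w →
                    advance ((i , toℕ v) , out) (entry e , ys) ≡ ((toℕ e , toℕ w) , (toℕ e , rev) ∷ out)
    advance-entry e false i out ys refl refl rewrite ≡ᵇ-refl (toℕ (endpoint e left)) = refl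
    -- A reversed edge is entered at its right end; the comparison with its left end fails because
    -- the left end is smaller.
    advance-entry e true  i out ys refl refl rewrite ≡ᵇ-false (ℕ.<⇒≢ (ordered e)) = refl

    walk-step : ∀ k x → suc k ℕ.< #E → walkStep entries (state k) x ≡ state (suc k)
    walk-step k x k+1< = let ys , eq = next-entry k k+1< in
      trans (cong (λ l → caseList l (state k) (advance (state k))) eq)
            (advance-entry (edge (suc k)) (reversed (suc k)) (toℕ (edge k)) _ ys (starts (suc k)) (finishes (suc k)))

    walk-steps : ∀ xs k → List.length xs ℕ.+ k ℕ.< #E → foldl (walkStep entries) (state k) xs ≡ state (List.length xs ℕ.+ k)
    walk-steps []       k _  = refl
    walk-steps (x ∷ xs) k lt = trans (cong (λ s → foldl (walkStep entries) s xs) (walk-step k x (ℕ.≤-trans (s≤s (s≤s (ℕ.m≤n+m k _))) lt)))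
      (trans (walk-steps xs (suc k) (subst (ℕ._< #E) (sym (ℕ.+-suc _ k)) lt)) (cong state (ℕ.+-suc _ k)))

    set-off : setOff (entry (edge 0)) ≡ state 0
    set-off = cong₂ (λ w b → (toℕ (edge 0) , w) , (toℕ (edge 0) , b) ∷ [])
      (cong toℕ (subst (λ b → endpoint (edge 0) (finish b) ≡ vertex 1) (proj₂ first) (finishes 0))) (sym (proj₂ first))

    cycleOrder-correct : cycleOrder entries ≡ applyUpTo passed #E
    cycleOrder-correct = let rest , eq , len = tabulate-head entry (edge 0) (proj₁ first) in begin
      cycleOrder entries
        ≡⟨ cong (λ l → caseList l [] λ (e , rest) → reverse (proj₂ (foldl (walkStep entries) (setOff e) rest))) eq ⟩
      reverse (proj₂ (foldl (walkStep entries) (setOff (entry (edge 0))) rest))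
        ≡⟨ cong (λ s → reverse (proj₂ (foldl (walkStep entries) s rest))) set-off ⟩
      reverse (proj₂ (foldl (walkStep entries) (state 0) rest))
        ≡⟨ cong (reverse ∘ proj₂) (walk-steps rest 0 (subst (ℕ._≤ #E) (cong suc (sym (ℕ.+-identityʳ _))) (ℕ.≤-reflexive len))) ⟩
      reverse (applyDownFrom passed (suc (List.length rest ℕ.+ 0)))
        ≡⟨ cong (λ k → reverse (applyDownFrom passed k)) (trans (cong suc (ℕ.+-identityʳ _)) len) ⟩
      reverse (applyDownFrom passed #E)
        ≡⟨ reverse-applyDownFrom passed #E ⟩
      applyUpTo passed #E ∎
      where open ≡-Reasoning

    order : El orderTy
    order = applyUpTo (λ k → k , passed k) #E

    order-correct : index (cycleOrder (index (List.tabulate λ e → toℕ (endpoint e left) , toℕ (endpoint e right)))) ≡ order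
    order-correct = trans (cong (index ∘ cycleOrder) (indexFrom-tabulate (λ e → toℕ (endpoint e left) , toℕ (endpoint e right)) 0))
      (trans (cong index cycleOrder-correct) (indexFrom-applyUpTo passed #E 0))

  length-sum : ∀ {A : Set} {n} (f : Fin n → A) → sumℕ (map (const 1) (List.tabulate f)) ≡ n
  length-sum {n = zero}  f = refl
  length-sum {n = suc n} f = cong suc (length-sum (f ∘ suc))

  module Utilities {n} (p : Fin n → ℚᵘ) where

    utilities : El utilitiesTy
    utilities = List.tabulate λ e → toℕ e , (↥ p e , ↧ₙ p e)

    denominators : List ℕ
    denominators = List.tabulate (↧ₙ_ ∘ p)

    -- The weight is the numerator for `e` times the denominators for all other edges; the factor
    -- completes the product.
    weight-denominator : ∀ e → weight utilities (toℕ e) ℕ.* ↧ₙ p e ≡ ∣ ↥ p e ∣ ℕ.* product denominators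
    weight-denominator e = trans (cong (λ l → product l ℕ.* ↧ₙ p e) (map-tabulate (λ i → toℕ i , (↥ p i , ↧ₙ p i)) (λ (i , (a , b)) → if i ≡ᵇ toℕ e then ∣ a ∣ else b))) (go (∣_∣ ∘ ↥_ ∘ p) (↧ₙ_ ∘ p) e)
      where
      go : ∀ {n} (above below : Fin n → ℕ) e →
           product (List.tabulate (λ i → if toℕ i ≡ᵇ toℕ e then above i else below i)) ℕ.* below e ≡ above e ℕ.* product (List.tabulate below)
      go above below zero    = lemma (above zero) (product (List.tabulate (below ∘ suc))) (below zero)
        where
        lemma : ∀ a b c → a ℕ.* b ℕ.* c ≡ a ℕ.* (c ℕ.* b)
        lemma = solve-∀
      go above below (suc e) = trans (ℕ.*-assoc (below zero) _ _) (trans (cong (below zero ℕ.*_) (go (above ∘ suc) (below ∘ suc) e))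
        (lemma (below zero) (above (suc e)) (product (List.tabulate (below ∘ suc)))))
        where
        lemma : ∀ a b c → a ℕ.* (b ℕ.* c) ≡ b ℕ.* (a ℕ.* c)
        lemma = solve-∀

    D′ : ℕ
    D′ = pred (product denominators)

    product-positive : ∀ {n} (p : Fin n → ℚᵘ) → 0 ℕ.< product (List.tabulate (↧ₙ_ ∘ p))
    product-positive {zero}  p = s≤s z≤n
    product-positive {suc n} p = ℕ.*-mono-< {0} {↧ₙ p zero} (s≤s z≤n) (product-positive (p ∘ suc))

    D≡ : suc D′ ≡ product denominators
    D≡ = ℕ.suc-pred (product denominators) {{ℕ.>-nonZero (product-positive p)}}

    weight-utility : ∀ e → 0ℚ ≤ fromℚᵘ (p e) → fromℚᵘ (p e) ≡ frac D′ (weight utilities (toℕ e))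
    weight-utility e 0≤ = trans (fromℚᵘ-cong {p e} {mkℚᵘ (+ weight utilities (toℕ e)) D′} (*≡* eq)) (frac-def D′ _)
      where
      numerator : + ∣ ↥ p e ∣ ≡ ↥ p e
      numerator = ℤ.0≤i⇒+∣i∣≡i (drop (ℚᵘ.≤-respʳ-≃ (toℚᵘ-fromℚᵘ (p e)) (toℚᵘ-mono-≤ 0≤)))
        where
        drop : ∀ {q} → toℚᵘ 0ℚ ℚᵘ.≤ q → ℤ.0ℤ ℤ.≤ ↥ q
        drop {mkℚᵘ a b} (*≤* le) = subst₂ ℤ._≤_ (ℤ.*-zeroˡ (+ suc b)) (ℤ.*-identityʳ a) le
      eq : ↥ p e ℤ.* + suc D′ ≡ + weight utilities (toℕ e) ℤ.* + ↧ₙ p e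
      eq = begin
        ↥ p e ℤ.* + suc D′                             ≡⟨ cong₂ (λ a b → a ℤ.* + b) (sym numerator) D≡ ⟩
        + ∣ ↥ p e ∣ ℤ.* + product denominators          ≡⟨ sym (ℤ.pos-* ∣ ↥ p e ∣ _) ⟩
        + (∣ ↥ p e ∣ ℕ.* product denominators)          ≡⟨ cong +_ (sym (weight-denominator e)) ⟩
        + (weight utilities (toℕ e) ℕ.* ↧ₙ p e)         ≡⟨ ℤ.pos-* (weight utilities (toℕ e)) (↧ₙ p e) ⟩
        + weight utilities (toℕ e) ℤ.* + ↧ₙ p e         ∎
        where open ≡-Reasoning

  Σ-restrict : ∀ (f : ℕ → ℕ) k n → k ℕ.≤ n → Σ[ (λ i → if i <ᵇ k then f i else 0) ] n ≡ Σ[ f ] k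
  Σ-restrict f k n k≤n = go n k≤n
    where
    inside : ∀ {i} → i ℕ.< k → (if i <ᵇ k then f i else 0) ≡ f i
    inside {i} i<k rewrite Equivalence.to T-≡ (ℕ.<⇒<ᵇ i<k) = refl
    outside : ∀ {i} → k ℕ.≤ i → (if i <ᵇ k then f i else 0) ≡ 0
    outside {i} k≤i with i <ᵇ k in eq
    ... | true  = contradiction k≤i (ℕ.<⇒≱ (ℕ.<ᵇ⇒< i k (Equivalence.from T-≡ eq)))
    ... | false = refl
    go : ∀ n → k ℕ.≤ n → Σ[ (λ i → if i <ᵇ k then f i else 0) ] n ≡ Σ[ f ] k
    go n k≤n with ℕ.m≤n⇒m<n∨m≡n k≤n
    ... | inj₂ refl = Σ-cong k inside
    go (suc n) _ | inj₁ (s≤s k≤n) = trans (cong₂ ℕ._+_ (go n k≤n) (outside k≤n)) (ℕ.+-identityʳ _)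

  map-lookup : ∀ {A B : Set} {n} (g : A → B) (v : Vec A n) → Vec.map g v ≡ Vec.tabulate (g ∘ lookup v)
  map-lookup g v = trans (cong (Vec.map g) (sym (Vec.tabulate∘lookup v))) (sym (Vec.tabulate-∘ g (lookup v)))

  takeVec-tabulate : ∀ {A : Set} k (x₀ : A) (f : Fin k → A) → takeVec k x₀ (List.tabulate f) ≡ Vec.tabulate f
  takeVec-tabulate zero    x₀ f = refl
  takeVec-tabulate (suc k) x₀ f = cong (f zero ∷_) (takeVec-tabulate k x₀ (f ∘ suc))

  module _ {A : Set} {R : Encoding A} {τ : Ty} where

    -- A rational number may be encoded by any fraction, so the data in the tree are not determined
    -- by the family. They are extracted from the encoding, and `Q` records how they represent the
    -- family.
    decodeFamily : ∀ {Q : A → El τ → Set} → (∀ {a s} → R a s → ∃ λ y → Q a y × s ≡ enc τ y) →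
      ∀ {n} (f : Fin n → A) {t} → familyᴱ R f t → ∃ λ (g : Fin n → El τ) → (∀ i → Q (f i) (g i)) × t ≡ enc (list τ) (List.tabulate g)
    decodeFamily dec {zero}  f []       = (λ ()) , (λ ()) , refl
    decodeFamily dec {suc n} f (r ∷ rs) =
      let y , q , eq = dec r ; g , qs , eqs = decodeFamily dec (f ∘ suc) rs in
      (λ { zero → y ; (suc i) → g i }) , (λ { zero → q ; (suc i) → qs i }) , cong₂ cons eq eqs

    encode-++ : ∀ {xs ys} us vs → listᴱ R xs (enc (list τ) us) → listᴱ R ys (enc (list τ) vs) →
                listᴱ R (xs ++ ys) (enc (list τ) (us ++ vs))
    encode-++ []       vs []       q = q
    encode-++ (_ ∷ us) vs (r ∷ rs) q = r ∷ encode-++ us vs rs q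

    encode-concatMap : ∀ {f : ℕ → List A} {g : ℕ → List (El τ)} n (h : ℕ → ℕ) →
      (∀ k → listᴱ R (f k) (enc (list τ) (g k))) →
      listᴱ R (concatMap f (applyUpTo h n)) (enc (list τ) (concatMap g (applyUpTo h n)))
    encode-concatMap         zero    h enc = []
    encode-concatMap {g = g} (suc n) h enc =
      encode-++ (g (h 0)) (concatMap g (applyUpTo (h ∘ suc) n)) (enc (h 0)) (encode-concatMap {g = g} n (h ∘ suc) enc)

    encode-family : ∀ {n} (f : Fin n → A) (g : Fin n → El τ) → (∀ i → R (f i) (enc τ (g i))) →
                    familyᴱ R f (enc (vec τ n) (Vec.tabulate g))
    encode-family {zero}  f g enc = []
    encode-family {suc n} f g enc = enc zero ∷ encode-family (f ∘ suc) (g ∘ suc) (enc ∘ suc)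

  module _ (z′ : ℕ) where
    open Grid z′

    encode-coord : ∀ rev a → a ℕ.≤ z → rationalᴱ (coord rev a) (fractionTree (z , (if rev then z ∸ a else a)))
    encode-coord false a a≤z = mkℚᵘ (+ a) z′ , frac-def z′ a , refl
    encode-coord true  a a≤z = mkℚᵘ (+ (z ∸ a)) z′ , trans (frac-def z′ (z ∸ a)) (sym (coord-true a≤z)) , refl

    encode-part : ∀ rev a b → listᴱ intervalᴱ (part rev a b) (enc (list tree) (partTrees ((rev , z) , (a , b))))
    encode-part rev a b with a ℕ.<? b ⊓ z | a ℕ.≟ z
    encode-part false a b | yes a<e | _ rewrite Equivalence.to T-≡ (ℕ.<⇒<ᵇ a<e) =
      segment {0≤l = 0≤coord false (ℕ.≤-trans (ℕ.<⇒≤ a<e) (ℕ.m⊓n≤n b z))} {l<r = frac-mono-< z′ a<e} {r≤1 = coord≤1 false (ℕ.m⊓n≤n b z)}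
        (encode-coord false a (ℕ.≤-trans (ℕ.<⇒≤ a<e) (ℕ.m⊓n≤n b z))) (encode-coord false (b ⊓ z) (ℕ.m⊓n≤n b z)) ∷ []
    encode-part true  a b | yes a<e | _ rewrite Equivalence.to T-≡ (ℕ.<⇒<ᵇ a<e) =
      segment {0≤l = 0≤coord true (ℕ.m⊓n≤n b z)} {l<r = flip-mono-< a<e} {r≤1 = coord≤1 true (ℕ.≤-trans (ℕ.<⇒≤ a<e) (ℕ.m⊓n≤n b z))}
        (encode-coord true (b ⊓ z) (ℕ.m⊓n≤n b z)) (encode-coord true a (ℕ.≤-trans (ℕ.<⇒≤ a<e) (ℕ.m⊓n≤n b z))) ∷ []
    encode-part rev a b | no a≮e | yes refl rewrite ≮⇒<ᵇ a≮e | ≡ᵇ-refl z′ = point {0≤q = 0≤coord rev ℕ.≤-refl} {q≤1 = coord≤1 rev ℕ.≤-refl} (end rev) ∷ []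
      where
      end : ∀ rev → rationalᴱ (coord rev z) (fractionTree (z , (if rev then 0 else z)))
      end false = encode-coord false z ℕ.≤-refl
      end true  = subst (λ c → rationalᴱ (coord true z) (fractionTree (z , c))) (ℕ.n∸n≡0 z) (encode-coord true z ℕ.≤-refl)
    encode-part rev a b | no a≮e | no a≢z rewrite ≮⇒<ᵇ a≮e | ≡ᵇ-false a≢z = []

  Σ≡0⇒ : ∀ f n {k} → k ℕ.< n → Σ[ f ] n ≡ 0 → f k ≡ 0
  Σ≡0⇒ f (suc n) k<1+n eq with ℕ.m≤n⇒m<n∨m≡n (ℕ.s≤s⁻¹ k<1+n)
  ... | inj₁ k<n  = Σ≡0⇒ f n k<n (ℕ.m+n≡0⇒m≡0 _ eq)
  ... | inj₂ refl = ℕ.m+n≡0⇒n≡0 (Σ[ f ] n) eq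

  encode-labelled : ∀ {A : Set} {R : Encoding A} {n} (e : Fin n) xs ts → listᴱ R xs (enc (list tree) ts) →
                    listᴱ (pairᴱ finᴱ R) (map (e ,_) xs) (enc (list (num ⊗ tree)) (map (toℕ e ,_) ts))
  encode-labelled e []       []       []       = []
  encode-labelled e (x ∷ xs) (t ∷ ts) (r ∷ rs) = cons refl r ∷ encode-labelled e xs ts rs

  module Solve (G : Graph) (cycle : IsCycle G) (d : ℕ)
    (utility : Fin (suc d) → Graph.E G → ℚ) (nonNegative : ∀ a e → 0ℚ ≤ utility a e) (normalized : ∀ a → sum (utility a) ≡ 1ℚ)
    (p : Fin (suc d) → Graph.E G → ℚᵘ) (p≡ : ∀ a e → fromℚᵘ (p a e) ≡ utility a e) where

    X : Instance
    X = record { #agents = suc d ; graph = G ; utility = utility ; nonNegative = nonNegative ; normalized = normalized }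

    open Graph G
    O = cyclicOrder G cycle
    open CyclicOrder O
    open Walk O using (order; passed; order-correct)

    m : ℕ
    m = #E

    module U a = Utilities (p a)

    w : Fin (suc d) → ℕ → ℕ
    w a k = weight (U.utilities a) (toℕ (edge k))

    module P = Problem w m

    agents : Vec (El utilitiesTy) (suc d)
    agents = Vec.tabulate U.utilities

    worth≡ : ∀ a k → utility a (edge k) ≡ frac (U.D′ a) (w a k)
    worth≡ a k = trans (sym (p≡ a (edge k))) (U.weight-utility a (edge k) (subst (0ℚ ≤_) (sym (p≡ a (edge k))) (nonNegative a (edge k))))

    totals≡ : Vec.map (totalWeight order) agents ≡ P.totals
    totals≡ = trans (sym (Vec.tabulate-∘ (totalWeight order) U.utilities))
      (Vec.tabulate-cong λ a → sum-applyUpTo (λ (_ , (e , _)) → weight (U.utilities a) e) (λ k → k , passed k) m)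

    slots≡ : slotsOf order agents ≡ P.slots
    slots≡ = trans (map-applyUpTo (λ k → k , passed k) _ m) (applyUpTo-cong m λ {k} k<m →
      cong (k ,_) (trans (sym (Vec.tabulate-∘ _ U.utilities)) (Vec.tabulate-cong λ a → cong (_, w a k) (before a k k<m))))
      where
      before : ∀ a k → k ℕ.< m → weightBefore order (U.utilities a) k ≡ Σ[ w a ] k
      before a k k<m = trans (sum-applyUpTo (λ (i , (e , _)) → if i <ᵇ k then weight (U.utilities a) e else 0) (λ k → k , passed k) m)
        (Σ-restrict (w a) k m (ℕ.<⇒≤ k<m))

    0<m : 0 ℕ.< m
    0<m = ℕ.≤-trans (s≤s z≤n) 2≤#E

    -- Weights with sum 0 are all 0, which contradicts the normalization.
    0<total : ∀ a → 0 ℕ.< P.total a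
    0<total a = ℕ.n≢0⇒n>0 λ total≡0 → contradiction
      (trans (sym (normalized a)) (trans (sum-cong-≗ (worthless total≡0)) (sum-replicate-zero #E))) λ ()
      where
      worthless : P.total a ≡ 0 → ∀ e → utility a e ≡ 0ℚ
      worthless total≡0 e with k , k< , refl ← position e =
        trans (worth≡ a k) (trans (cong (frac (U.D′ a)) (Σ≡0⇒ (w a) m k< total≡0)) (frac-0 (U.D′ a)))

    module _ {π : Vec (Fin (suc d)) (suc d)} {z : ℕ} {cuts : Vec ℕ d} (D : P.Division π z cuts) where
      open P.Division D

      assigned : ∀ q → ∃ λ a → lookup π a ≡ q
      assigned = injective⇒surjective (lookup π) injective

      -- The owner of an empty piece would value it at 0 without envying anybody. Then every piece
      -- would be worth 0 to this agent, although the whole is not.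
      strict : ∀ q → P.left z cuts q ℕ.< P.right z cuts q
      strict q with a , refl ← assigned q = ℕ.≰⇒> λ R≤L → ℕ.<⇒≱ whole (shrinking (μ (w a) z m) (m ℕ.* z) cuts λ p →
        ℕ.+-cancelʳ-≤ (μ (w a) z m (P.left z cuts (lookup π a))) _ _ (ℕ.≤-trans (envyFree a p)
          (ℕ.≤-trans (ℕ.+-monoˡ-≤ _ (Measure.μ-mono (w a) z m R≤L)) (ℕ.≤-reflexive (ℕ.+-comm (μ (w a) z m (P.left z cuts (lookup π a))) _)))))
        where
        whole : μ (w a) z m 0 ℕ.< μ (w a) z m (m ℕ.* z)
        whole = subst₂ ℕ._<_ (sym (Measure.μ-0 (w a) z m)) (sym (Measure.μ-total (w a) z m)) (ℕ.*-mono-< {0} {P.total a} {0} {z} (0<total a) positive)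

    Solved : Tree → Set
    Solved o = ∃ λ (C : EnvyFreeCutting X) → VertexDisjoint G (EnvyFreeCutting.partition C) × ∃ λ t → cuttingᴱ C t × o ≡ cons nil t

    module Output {π : Vec (Fin (suc d)) (suc d)} {z′ : ℕ} {cuts : Vec ℕ d} (D : P.Division π (suc z′) cuts) where

      module A = Arcs O z′ cuts
      module S = A.Strict (strict D)

      cutting : EnvyFreeCutting X
      cutting = record
        { partition  = S.partition
        ; assignment = mk⤖ {to = lookup π} ((λ {i} {j} → P.Division.injective D i j) ,
                         λ q → let a , eq = assigned D q in a , λ { refl → eq })
        ; envyFree   = λ a a′ → Worth.worth-mono O z′ (U.D′ a) cuts (strict D) (utility a) (w a) (λ k _ → worth≡ a k)
                         (lookup π a′) (lookup π a) (P.Division.envyFree D a (lookup π a′))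
        }

      arcs : ∀ r → listᴱ (pairᴱ finᴱ intervalᴱ) (A.arcMembers r) (enc (list (num ⊗ tree)) (arcTrees order (suc z′) (A.A r) (A.B r)))
      arcs r = subst (λ ts → listᴱ (pairᴱ finᴱ intervalᴱ) (A.arcMembers r) (enc (list (num ⊗ tree)) ts)) (sym flatten)
        (encode-concatMap {τ = num ⊗ tree} {g = trees} m id λ k →
          encode-labelled (edge k) (A.partAt k r)
            (partTrees ((reversed k , suc z′) , (A.A r ∸ k ℕ.* suc z′ , A.B r ∸ k ℕ.* suc z′))) (encode-part z′ (reversed k) (A.A r ∸ k ℕ.* suc z′) (A.B r ∸ k ℕ.* suc z′)))
        where
        trees : ℕ → List (ℕ × Tree)
        trees k = map (toℕ (edge k) ,_) (partTrees ((reversed k , suc z′) , (A.A r ∸ k ℕ.* suc z′ , A.B r ∸ k ℕ.* suc z′)))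
        flatten : arcTrees order (suc z′) (A.A r) (A.B r) ≡ concatMap trees (upTo m)
        flatten = cong List.concat (trans (map-applyUpTo (λ k → k , passed k) _ m) (sym (map-applyUpTo id trees m)))

      pieces : ∀ q → pieceᴱ (S.piece q) (enc (list (num ⊗ tree)) (pieceTrees d order m (suc z′) cuts q))
      pieces q = encode-++ (arcTrees order (suc z′) (A.A (suc q)) (A.B (suc q)))
                           (if does (q Fin.≟ fromℕ d) then arcTrees order (suc z′) (A.A zero) (A.B zero) else [])
                           (arcs (suc q)) (extra (does (q Fin.≟ fromℕ d)))
        where
        extra : ∀ b → listᴱ (pairᴱ finᴱ intervalᴱ) (if b then A.arcMembers zero else [])
                  (enc (list (num ⊗ tree)) (if b then arcTrees order (suc z′) (A.A zero) (A.B zero) else []))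
        extra true  = arcs zero
        extra false = []

      solved : Solved (enc (answerTy d) (nil , (Vec.tabulate (pieceTrees d order m (suc z′) cuts) , Vec.map toℕ π)))
      solved = cutting , S.vertexDisjoint , _ ,
        cons (encode-family S.piece (pieceTrees d order m (suc z′) cuts) pieces)
             (subst (λ v → familyᴱ finᴱ (lookup π) (enc (vec num (suc d)) v)) (sym (map-lookup toℕ π))
               (encode-family (lookup π) (toℕ ∘ lookup π) (λ _ → refl))) , refl

    solved-division : ∀ {π cuts} z → P.Division π z cuts →
      Solved (enc (answerTy d) (nil , (Vec.tabulate (pieceTrees d order m z cuts) , Vec.map toℕ π)))
    solved-division zero    D with () ← P.Division.positive D
    solved-division (suc z) D = Output.solved D

    solved-solution : ∀ {x : Vec ℤ (suc d)} {js : Vec (Slot (suc d)) d} {πs} →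
      (∃ λ π → πs ≡ Vec.map toℕ π × P.Division π ∣ Vec.last x ∣ (cutsOf x js)) → Solved (answer d ((order , m) , (x , (js , πs))))
    solved-solution {x} (π , refl , D) = solved-division ∣ Vec.last x ∣ D

    solved-search : ∀ sols → (∀ {s} → s ∈ sols → s ∈ search P.totals m P.slots) → (∃ λ s → s ∈ sols) →
      Solved (caseList sols nil (λ (s , _) → answer d ((order , m) , s)))
    solved-search []                  valid (_ , ())
    solved-search ((x , js , πs) ∷ _) valid _ = solved-solution {x} {js} {πs} (P.sound (valid (here refl)))

    solve-correct : Solved (solve d ((order , m) , List.tabulate U.utilities))
    solve-correct = subst (λ v → Solved (caseList (solutions d ((order , m) , v)) nil (λ (s , _) → answer d ((order , m) , s))))
      (sym (takeVec-tabulate (suc d) [] U.utilities))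
      (subst₂ (λ T slots → Solved (caseList (search T m slots) nil (λ (s , _) → answer d ((order , m) , s))))
        (sym totals≡) (sym slots≡)
        (solved-search (search P.totals m P.slots) id (P.Existence.exists 0<m 0<total)))

  solveUpTo-step : ∀ c p {b} → (sumℕ (map (const 1) (proj₂ p)) ≡ᵇ suc c) ≡ b → solveUpTo (suc c) p ≡ (if b then solve c p else solveUpTo c p)
  solveUpTo-step c p = cong (λ b → if b then solve c p else solveUpTo c p)

  solveUpTo-agents : ∀ c d p → suc d ℕ.≤ c → sumℕ (map (const 1) (proj₂ p)) ≡ suc d → solveUpTo c p ≡ solve d p
  solveUpTo-agents (suc c) d p (s≤s d≤c) eq with d ℕ.≟ c
  ... | yes refl = solveUpTo-step d p (trans (cong (_≡ᵇ suc d) eq) (≡ᵇ-refl d))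
  ... | no  d≢c  = trans (solveUpTo-step c p (trans (cong (_≡ᵇ suc c) eq) (≡ᵇ-false d≢c)))
                         (solveUpTo-agents c d p (ℕ.≤∧≢⇒< d≤c d≢c) eq)

  solveUpTo-none : ∀ c p → sumℕ (map (const 1) (proj₂ p)) ≡ 0 → solveUpTo c p ≡ nil
  solveUpTo-none zero    p eq = refl
  solveUpTo-none (suc c) p eq = trans (solveUpTo-step c p (cong (_≡ᵇ suc c) eq)) (solveUpTo-none c p eq)

  -- One outcome answers both problems: a positive answer is vertex-disjoint, and a negative one
  -- excludes any cutting at all.
  data Outcome (X : Instance) : Tree → Set where
    unsolvable : ¬ EnvyFreeCutting X → Outcome X nil
    solved     : (C : EnvyFreeCutting X) → VertexDisjoint (Instance.graph X) (EnvyFreeCutting.partition C) →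
                 ∀ {t} → cuttingᴱ C t → Outcome X (cons nil t)

  -- A partition covers the point 0 of an edge and hence has a piece, which would have to be
  -- assigned to some agent.
  no-agents : ∀ X → Instance.#agents X ≡ 0 → IsCycle (Instance.graph X) → ¬ EnvyFreeCutting X
  no-agents X none cycle C = empty (subst Fin none (proj₁ (Bijection.surjective assignment (proj₁ (proj₁ covered)))))
    where
    open EnvyFreeCutting C
    empty : ¬ Fin 0
    empty ()
    covered = Partition.covers partition (CyclicOrder.edge (cyclicOrder (Instance.graph X) cycle) 0) (fromℚ 0ℚ)
      ((λ ()) , λ ())

  rational-decode : ∀ {q t} → rationalᴱ q t → ∃ λ (y : El (int ⊗ num)) → (∃ λ r → fromℚᵘ r ≡ q × y ≡ (↥ r , ↧ₙ r)) × t ≡ enc (int ⊗ num) y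
  rational-decode (mkℚᵘ a b , eq , refl) = (a , suc b) , (mkℚᵘ a b , eq , refl) , refl

  module _ (G : Graph) where
    open Graph G

    inputOf : ∀ {n} → (Fin n → E → ℚᵘ) → El inputTy
    inputOf p = (#V , List.tabulate λ e → toℕ (endpoint e left) , toℕ (endpoint e right)) ,
                List.tabulate λ a → List.tabulate λ e → ↥ p a e , ↧ₙ p a e

    prepare-correct : ∀ (cycle : IsCycle G) {n} (p : Fin n → E → ℚᵘ) →
      prepare (inputOf p) ≡ ((Walk.order (cyclicOrder G cycle) , #E) , List.tabulate λ a → Utilities.utilities (p a))
    prepare-correct cycle p = cong₂ _,_
      (cong₂ _,_ (Walk.order-correct (cyclicOrder G cycle)) (length-sum λ e → toℕ (endpoint e left) , toℕ (endpoint e right)))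
      (trans (map-tabulate (λ a → List.tabulate λ e → ↥ p a e , ↧ₙ p a e) index)
             (tabulate-cong λ a → indexFrom-tabulate (λ e → ↥ p a e , ↧ₙ p a e) 0))

    outcome : ∀ c {n} → n ℕ.≤ c → IsCycle G → ∀ utility nonNegative normalized (p : Fin n → E → ℚᵘ) →
      (∀ a e → fromℚᵘ (p a e) ≡ utility a e) →
      Outcome (record { #agents = n ; graph = G ; utility = utility ; nonNegative = nonNegative ; normalized = normalized })
              (algorithm c (inputOf p))
    outcome c {zero}  n≤c cycle utility nonNegative normalized p p≡ = subst (Outcome _)
      (sym (solveUpTo-none c (prepare (inputOf p)) refl)) (unsolvable (no-agents _ refl cycle))
    outcome c {suc d} n≤c cycle utility nonNegative normalized p p≡ = subst (Outcome X)
      (sym (trans (cong (solveUpTo c) (prepare-correct cycle p)) (solveUpTo-agents c d _ n≤c (length-sum λ a → Utilities.utilities (p a)))))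
      (found solve-correct)
      where
      open Solve G cycle d utility nonNegative normalized p p≡
      found : ∀ {o} → Solved o → Outcome X o
      found (C , vd , _ , enc , refl) = solved C vd enc

  -- The fractions found in the tree are arbitrary representatives of the utilities, so they are
  -- passed on as a family `p`, for which `outcome` holds in general.
  algorithm-correct : ∀ c X → CycleWithAtMost c X → ∀ {i} → instanceᴱ X i →
                      ∃ λ input → i ≡ enc inputTy input × Outcome X (algorithm c input)
  algorithm-correct c X (n≤c , cycle) (cons (cons refl edges) agents)
    with g , g≡ , refl ← decodeFamily {τ = num ⊗ num} {Q = λ (u , v) y → y ≡ (toℕ u , toℕ v)}
           (λ { (cons refl refl) → _ , refl , refl }) _ edges
    with h , h≡ , refl ← decodeFamily {τ = list (int ⊗ num)}
           {Q = λ u ys → ∃ λ (p : Instance.E X → ℚᵘ) → (∀ e → fromℚᵘ (p e) ≡ u e) × ys ≡ List.tabulate (λ e → ↥ p e , ↧ₙ p e)}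
           (λ {u} r → let k , k≡ , eq = decodeFamily {τ = int ⊗ num} rational-decode u r in
              _ , ((λ e → proj₁ (k≡ e)) , (λ e → proj₁ (proj₂ (k≡ e))) , tabulate-cong (λ e → proj₂ (proj₂ (k≡ e)))) , eq) _ agents
    = inputOf graph p ,
      cong₂ (λ es us → enc inputTy ((#V , es) , us)) (tabulate-cong g≡) (tabulate-cong λ a → proj₂ (proj₂ (h≡ a))) ,
      outcome graph c n≤c cycle utility nonNegative normalized p (λ a → proj₁ (proj₂ (h≡ a)))
    where
    open Instance X
    p : Agent → E → ℚᵘ
    p a = proj₁ (h≡ a)

  -- Shared by both problems, which run the same program; the symbolic bound is converted into a
  -- list of coefficients here.
  polynomialTime : ∀ (Problem : SearchProblem) → let open SearchProblem Problem in
    ∀ {f} → PolyTime inputTy tree f →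
    (∀ x {i} → inputEncoding x i → ∃ λ input → i ≡ enc inputTy input × Answers (solutionEncoding x) (f input)) →
    PolynomialTimeSolvable Problem
  polynomialTime Problem {f} F correct = program F , coefficients (bound F) , λ x encoded →
    let input , eq , answers = correct x encoded
        t , d , t≤ = run F input
    in _ , t , subst (λ i → program F ⊢ i ⇓ f input ⟨ t ⟩) (sym eq) d ,
       subst (λ i → t ℕ.≤ polynomial (coefficients (bound F)) (size i)) (sym eq)
         (ℕ.≤-trans t≤ (ℕ.≤-reflexive (sym (coefficients-correct (bound F) _)))) , answers

open import Defs
open Algorithm using (algorithmP)
open Correctness
open import Data.Nat.Base using (ℕ)
open import Data.Product using (_×_; _,_; proj₁)
open import Function.Base using (_∘_)

theorem9 : (c : ℕ) →
    PolynomialTimeSolvable (restrict EF-GC (CycleWithAtMost c)) ×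
    PolynomialTimeSolvable (restrict EF-VDGC (CycleWithAtMost c))
theorem9 c =
  polynomialTime (restrict EF-GC (CycleWithAtMost c)) (algorithmP c)
    (λ (X , few) encoded → let input , eq , result = algorithm-correct c X few encoded in input , eq , plain result) ,
  polynomialTime (restrict EF-VDGC (CycleWithAtMost c)) (algorithmP c)
    (λ (X , few) encoded → let input , eq , result = algorithm-correct c X few encoded in input , eq , vertexDisjoint result)
  where
  plain : ∀ {X o} → Outcome X o → Answers cuttingᴱ o
  plain (unsolvable none)  = Answers.no none
  plain (solved C _ enc)   = Answers.yes C enc
  vertexDisjoint : ∀ {X o} → Outcome X o → Answers {S = EnvyFreeVertexDisjointCutting X} (λ (C , _) → cuttingᴱ C) o
  vertexDisjoint (unsolvable none) = Answers.no (none ∘ proj₁)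
  vertexDisjoint (solved C vd enc) = Answers.yes (C , vd) enc
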